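{- For every $k\ge 1$ and $\ell\ge 1$, Fair $k$-Division Under Conflicts is solvable in time $\mathcal{O}(n^2(n+(Q+1)^{2k}))$ for conflict graphs $G$ with $n$ vertices and treewidth at most $\ell$, where $Q=\max_{1\le j\le k}p_j(V(G))$ and the constant hidden in the $\mathcal{O}$-notation depends on $k$ and $\ell$.
   Context: A tree decomposition of a graph $G$ is a pair $(T,\{B_t\}_{t\in V(T)})$ where $T$ is a tree and each $B_t\subseteq V(G)$, such that every vertex of $G$ lies in some bag, every edge of $G$ has both endpoints in some bag, and for every vertex $u$ the nodes $t$ with $u\in B_t$ induce a connected subtree of $T$. Its width is $\max_t|B_t|-1$, and the treewidth of $G$ is the minimum width of a tree decomposition of $G$. A partial $k$-coloring of $G$ is a sequence $(X_1,\dots,X_k)$ of $k$ pairwise disjoint independent sets of $G$. Given profit functions $p_1,\dots,p_k:V(G)\to\mathbb{Z}_+$, write $p_j(X)=\sum_{v\in X}p_j(v)$; the satisfaction level of $(X_1,\dots,X_k)$ is $\min_j p_j(X_j)$. Fair $k$-Division Under Conflicts: given $G$ and $p_1,\dots,p_k$, compute a partial $k$-coloring of $G$ with maximum satisfaction level. -}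

module Defs where

open import Data.Bool.Base using (Bool; true; false; T; if_then_else_; _∧_)
open import Data.Fin.Base using (Fin; zero; suc; toℕ; fromℕ; fromℕ<; inject₁; combine; remQuot)
open import Data.Fin.Subset using (Subset; _∈_; _∩_; Empty; ⊤; ∣_∣)
open import Data.Fin.Subset.Properties using (_∈?_)
open import Data.Integer.Base as ℤ using (ℤ; +_)
open import Data.List.Base using (map; filter; allFin; tabulate)
open import Data.List.Extrema.Nat using (min; max)
open import Data.Nat.Base using (ℕ; zero; suc; _+_; _*_; _∸_; _≤_; _≡ᵇ_; _<ᵇ_; NonZero)
open import Data.Nat.ListAction using (sum)
open import Data.Nat.Properties using (_<?_)
open import Data.Product.Base using (Σ-syntax; _×_; uncurry)
import Data.Vec.Base as Vec
open import Function.Base using (_∘_)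
open import Function.Definitions using (Injective)
open import Relation.Binary.Construct.Closure.ReflexiveTransitive using (Star)
open import Relation.Binary.PropositionalEquality.Core using (_≡_; _≢_)
open import Relation.Nullary using (¬_; yes; no)

record Graph (n : ℕ) : Set where
  field
    adj    : Fin n → Fin n → Bool
    sym    : ∀ u v → adj u v ≡ adj v u
    irrefl : ∀ u → adj u u ≡ false

  Adj : Fin n → Fin n → Set
  Adj u v = T (adj u v)

open Graph public using (adj; Adj)

-- The subgraph of G induced by P is connected (or empty).
ConnectedOn : ∀ {n} → Graph n → (Fin n → Set) → Set
ConnectedOn G P = ∀ u v → P u → P v → Star (λ x y → P x × P y × Adj G x y) u v

Connected : ∀ {n} → Graph n → Set
Connected G = ∀ u v → Star (Adj G) u v

record Cycle {n : ℕ} (G : Graph n) : Set where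
  field
    extra    : ℕ
    vertex   : Fin (3 + extra) → Fin n
    distinct : Injective _≡_ _≡_ vertex
    step     : ∀ i → Adj G (vertex (inject₁ i)) (vertex (suc i))
    close    : Adj G (vertex (fromℕ (2 + extra))) (vertex zero)

record IsTree {m : ℕ} (G : Graph m) : Set where
  field
    nonempty  : NonZero m
    connected : Connected G
    acyclic   : ¬ Cycle G

record TreeDecomposition {n : ℕ} (G : Graph n) : Set where
  field
    nodes    : ℕ
    tree     : Graph nodes
    isTree   : IsTree tree
    bag      : Fin nodes → Subset n
    vertices : ∀ u → Σ[ t ∈ Fin nodes ] u ∈ bag t
    edges    : ∀ u v → Adj G u v → Σ[ t ∈ Fin nodes ] (u ∈ bag t × v ∈ bag t)
    subtrees : ∀ u → ConnectedOn tree (λ t → u ∈ bag t)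

-- An integer, since the graph without vertices has width -1.
width : ∀ {n} {G : Graph n} → TreeDecomposition G → ℤ
width D = + max 0 (tabulate (∣_∣ ∘ bag)) ℤ.- + 1
  where open TreeDecomposition D

record IsTreewidth {n : ℕ} (G : Graph n) (w : ℤ) : Set where
  field
    attained : Σ[ D ∈ TreeDecomposition G ] width D ≡ w
    minimum  : ∀ (D : TreeDecomposition G) → w ℤ.≤ width D

TreewidthAtMost : ∀ {n} → Graph n → ℕ → Set
TreewidthAtMost G ℓ = Σ[ w ∈ ℤ ] (IsTreewidth G w × w ℤ.≤ + ℓ)

Profits : ℕ → ℕ → Set
Profits k n = Fin k → Fin n → ℕ

profit : ∀ {n} → (Fin n → ℕ) → Subset n → ℕ
profit {n} f X = sum (map f (filter (_∈? X) (allFin n)))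

Independent : ∀ {n} → Graph n → Subset n → Set
Independent G X = ∀ u v → u ∈ X → v ∈ X → ¬ Adj G u v

record IsPartialColoring {k n : ℕ} (G : Graph n) (X : Fin k → Subset n) : Set where
  field
    independent : ∀ j → Independent G (X j)
    disjoint    : ∀ i j → i ≢ j → Empty (X i ∩ X j)

satisfaction : ∀ {k n} .{{_ : NonZero k}} → Profits k n → (Fin k → Subset n) → ℕ
satisfaction {suc k} p X = min (level zero) (tabulate (level ∘ suc))
  where
  level : Fin (suc k) → ℕ
  level j = profit (p j) (X j)

record IsOptimal {k n : ℕ} .{{_ : NonZero k}} (G : Graph n) (p : Profits k n)
                 (X : Fin k → Subset n) : Set where
  field
    coloring : IsPartialColoring G X
    maximal  : ∀ Y → IsPartialColoring G Y → satisfaction p Y ≤ satisfaction p X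

maxTotalProfit : ∀ {k n} → Profits k n → ℕ
maxTotalProfit p = max 0 (tabulate (λ j → profit (p j) ⊤))

-- A uniform-cost RAM over ℕ with addition and truncated subtraction (but no
-- multiplication), presented by structured programs.  The memory is divided
-- into arrays indexed by ℕ.  A program mentions finitely many of them, say
-- those with names below b, so placing cell i of array a at address b * i + a
-- gives a RAM with a single memory and constant-factor overhead.

Store : Set
Store = ℕ → ℕ → ℕ

infixl 6 _⊕_ _⊖_
infix  8 _[_]

data Expr : Set where
  const   : ℕ → Expr
  _[_]    : ℕ → Expr → Expr
  _⊕_ _⊖_ : Expr → Expr → Expr

⟦_⟧ : Expr → Store → ℕ
⟦ const c ⟧ s = c
⟦ a [ e ] ⟧ s = s a (⟦ e ⟧ s)
⟦ e ⊕ f   ⟧ s = ⟦ e ⟧ s + ⟦ f ⟧ s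
⟦ e ⊖ f   ⟧ s = ⟦ e ⟧ s ∸ ⟦ f ⟧ s

cost : Expr → ℕ
cost (const c) = 1
cost (a [ e ]) = 1 + cost e
cost (e ⊕ f)   = 1 + cost e + cost f
cost (e ⊖ f)   = 1 + cost e + cost f

infixr 4 _︔_
infix  5 _[_]≔_

data Program : Set where
  skip            : Program
  _[_]≔_          : ℕ → Expr → Expr → Program
  _︔_             : Program → Program → Program
  ifnz_then_else_ : Expr → Program → Program → Program
  whilenz_loop_   : Expr → Program → Program

update : Store → ℕ → ℕ → ℕ → Store
update s a i x b j = if (a ≡ᵇ b) ∧ (i ≡ᵇ j) then x else s b j

-- ⟨ c , s ⟩⇓⟨ s′ , t ⟩: started in s, c halts in s′ after t elementary steps.
data ⟨_,_⟩⇓⟨_,_⟩ : Program → Store → Store → ℕ → Set where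

  skip : ∀ {s} → ⟨ skip , s ⟩⇓⟨ s , 1 ⟩

  assign : ∀ {a e f s} →
    ⟨ a [ e ]≔ f , s ⟩⇓⟨ update s a (⟦ e ⟧ s) (⟦ f ⟧ s) , 1 + cost e + cost f ⟩

  seq : ∀ {c d s s′ s″ t t′} →
    ⟨ c , s ⟩⇓⟨ s′ , t ⟩ → ⟨ d , s′ ⟩⇓⟨ s″ , t′ ⟩ →
    ⟨ c ︔ d , s ⟩⇓⟨ s″ , t + t′ ⟩

  if-nonzero : ∀ {e c d s s′ t} →
    ⟦ e ⟧ s ≢ 0 → ⟨ c , s ⟩⇓⟨ s′ , t ⟩ →
    ⟨ ifnz e then c else d , s ⟩⇓⟨ s′ , 1 + cost e + t ⟩

  if-zero : ∀ {e c d s s′ t} →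
    ⟦ e ⟧ s ≡ 0 → ⟨ d , s ⟩⇓⟨ s′ , t ⟩ →
    ⟨ ifnz e then c else d , s ⟩⇓⟨ s′ , 1 + cost e + t ⟩

  while-zero : ∀ {e c s} →
    ⟦ e ⟧ s ≡ 0 →
    ⟨ whilenz e loop c , s ⟩⇓⟨ s , 1 + cost e ⟩

  while-nonzero : ∀ {e c s s′ s″ t t′} →
    ⟦ e ⟧ s ≢ 0 → ⟨ c , s ⟩⇓⟨ s′ , t ⟩ → ⟨ whilenz e loop c , s′ ⟩⇓⟨ s″ , t′ ⟩ →
    ⟨ whilenz e loop c , s ⟩⇓⟨ s″ , 1 + cost e + t + t′ ⟩

array : ∀ {m} → (Fin m → ℕ) → ℕ → ℕ
array {m} f i with i <? m
... | yes i<m = f (fromℕ< i<m)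
... | no  _   = 0

-- Row-major: entry (i , j) is in cell n * toℕ i + toℕ j.
matrix : ∀ {m n} → (Fin m → Fin n → ℕ) → ℕ → ℕ
matrix {n = n} f = array (uncurry f ∘ remQuot n)

-- Array 0 holds n in cell 0, array 1 the adjacency matrix, array 2 the k × n
-- profit matrix; all other cells are 0.
input : ∀ {k n} → Graph n → Profits k n → Store
input {n = n} G p 0 0 = n
input         G p 1 i = matrix (λ u v → if adj G u v then 1 else 0) i
input         G p 2 i = matrix p i
input         G p _ _ = 0

-- Array 3 holds the k × n matrix whose nonzero entries (j , v) are the v ∈ X j.
output : ∀ {k n} → Store → Fin k → Subset n
output s j = Vec.tabulate (λ v → 0 <ᵇ s 3 (toℕ (combine j v)))

{-# OPTIONS --safe #-}
-- No tree decomposition is given, so one of width O(ℓ) is computed by iterative compression: the vertices are added one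
-- at a time, the new vertex is put into every bag of the current decomposition, and the result is rebuilt with small bags by
-- recursive splitting: a boundary W of at most 3s + 1 vertices, s = ℓ + 1, has a separator of size at most s leaving at most
-- 2s vertices of W on either side, since treewidth at most ℓ provides one.
-- Finding such a separator and solving the fair division are the same problem: label the vertices so that certain
-- labels do not meet along edges, with control over a sum of vertex weights.  One dynamic program over the decomposition
-- solves both; it stores for each labelling of a bag and each attainable weight the code of a labelling attaining it.
-- Vectors (of profits, or of the sizes of the separator and its sides) and labellings are packed into single numbers, so
-- that combining two table entries is one addition.  Each run needs O(n) table joins, quadratic in the number of weights:
-- constantly many for separators, and at most (kQ + 1)^k for profits.
module Submission where

open import Defs
open import Data.Nat.Base using (ℕ; _+_; _*_; _^_; _≤_; _≥_; NonZero)
open import Data.Product.Base using (Σ-syntax; _×_)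
open import Data.Bool.Base using (Bool; true; false; T; not; if_then_else_; _∧_; _∨_)
open import Data.Bool.Properties using (T?)
open import Data.Empty using (⊥)
open import Data.Fin.Base as Fin using (Fin; zero; suc; toℕ; fromℕ<; combine; remQuot)
open import Data.Fin.Properties as Fin using (any?; all?; pigeonhole; toℕ-injective; toℕ<n; toℕ-inject₁; toℕ-fromℕ; fromℕ<-toℕ; toℕ-fromℕ<; toℕ-combine; remQuot-combine)
open import Data.Fin.Subset using (Subset; _∈_; ⊤; ∣_∣)
open import Data.Fin.Subset.Properties using (_∈?_; ∈⊤; x∈p∩q⁺; x∈p∩q⁻)
open import Data.Integer.Base as ℤ using (ℤ)
import Data.Integer.Properties as ℤ
open import Data.List.Base using (tabulate; map; filter)
import Data.List.Extrema.Nat as Extrema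
import Data.List.Relation.Unary.All.Properties as All
import Data.List.Relation.Unary.Any.Properties as Any
open import Data.Nat.Base using (zero; suc; _∸_; _<_; _⊓_; z≤n; s≤s; z<s; s≤s⁻¹; _≡ᵇ_; _<ᵇ_; nonZero)
open import Data.Nat.DivMod using (_/_; _%_; m%n<n; [m+kn]%n≡m%n; m<n⇒m%n≡m; +-distrib-/-∣ʳ; m<n⇒m/n≡0; m*n/n≡m; m≡m%n+[m/n]*n; m<n*o⇒m/o<n)
open import Data.Nat.Divisibility using (n∣m*n)
open import Data.Nat.ListAction using (sum)
open import Data.Nat.Properties
open import Data.Nat.Tactic.RingSolver using (solve-∀)
open import Data.Product.Base using (∃-syntax; _,_; proj₁; proj₂; _,′_; uncurry)
open import Data.Sum.Base using (_⊎_; inj₁; inj₂; [_,_]′)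
open import Data.Unit.Base using (tt) renaming (⊤ to Unit)
import Data.Vec.Base as Vec
open import Data.Vec.Properties using ([]=⇒lookup; lookup⇒[]=; lookup∘tabulate)
open import Function.Base using (_∘_; case_of_)
open import Relation.Binary.Construct.Closure.ReflexiveTransitive using (Star; ε; _◅_)
import Relation.Binary.Construct.Closure.ReflexiveTransitive as Star
open import Relation.Binary.Definitions using (tri<; tri≈; tri>)
open import Relation.Binary.PropositionalEquality using (_≡_; _≢_; refl; sym; trans; cong; cong₂; subst; subst₂)
open import Relation.Nullary using (¬_; Dec; yes; no; contradiction)
open import Relation.Nullary.Decidable using (⌊_⌋; ¬?; _×-dec_; _→-dec_; decidable-stable)

-- Timed execution

-- Cost: a stage examines at most `1 + 2n` nodes, and each split searches the whole current graph in
-- time O(n), which makes O(n^3) over all stages. Splitting always progresses because one vertex not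
-- yet in any bag joins the boundary before the split; it takes the boundary from `3s` to `3s + 1`
-- vertices and pays for the two nodes that the split creates.
--
-- Tables keep admissible weights only, so a labelling is sure to be found only if all of its
-- partial weights are admissible. A separation is therefore described by upper bounds alone, which
-- vertex subsets inherit: at most `s` vertices in the separator, and at most `3s` in the separator
-- and one marked side together.
--
-- Packed vectors must add without carries. For profits the base `B` is one more than the sum of all
-- profits, hence at most `(k + 1) * (Q + 1)`; the `B ^ k` weights, squared in a join, give
-- `(Q + 1) ^ (2 * k)` up to a factor depending on `k`.
--
-- The machine does not multiply: powers and products are repeated additions, and the offsets
-- `n * u` of matrix rows are tabulated once.

V : ℕ → Expr
V a = a [ const 0 ]

keeps : Program → ℕ → Bool
keeps skip                      a = true
keeps (b [ e ]≔ f)              a = not (b ≡ᵇ a)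
keeps (c ︔ d)                   a = keeps c a ∧ keeps d a
keeps (ifnz e then c else d)    a = keeps c a ∧ keeps d a
keeps (whilenz e loop c)        a = keeps c a

keepsAll : Program → Expr → Bool
keepsAll c (const _) = true
keepsAll c (a [ e ]) = keeps c a ∧ keepsAll c e
keepsAll c (e ⊕ f)   = keepsAll c e ∧ keepsAll c f
keepsAll c (e ⊖ f)   = keepsAll c e ∧ keepsAll c f

T-∧₁ : ∀ {x y} → T (x ∧ y) → T x
T-∧₁ {true} _ = tt

T-∧₂ : ∀ {x y} → T (x ∧ y) → T y
T-∧₂ {true} p = p

T-∧ : ∀ {x y} → T x → T y → T (x ∧ y)
T-∧ {true} _ q = q

infix 4 _≈[_]_

-- The frame of a program: arrays that `c` never assigns to are unchanged. `keeps` is a Boolean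
-- function of the syntax, so for concrete `c` and `a` the implicit argument has the unit type and
-- is filled in without a proof.
_≈[_]_ : Store → Program → Store → Set
s′ ≈[ c ] s = ∀ a {_ : T (keeps c a)} i → s′ a i ≡ s a i

execution-keeps : ∀ {c s s′ t} → ⟨ c , s ⟩⇓⟨ s′ , t ⟩ → s′ ≈[ c ] s
execution-keeps skip a i = refl
execution-keeps (assign {a = b}) a {k} i with b ≡ᵇ a
... | false = refl
execution-keeps (seq {c} {d} p q) a {k} i =
  trans (execution-keeps q a {T-∧₂ {keeps c a} k} i) (execution-keeps p a {T-∧₁ k} i)
execution-keeps (if-nonzero _ p) a {k} i = execution-keeps p a {T-∧₁ k} i
execution-keeps (if-zero {c = c} _ p) a {k} i = execution-keeps p a {T-∧₂ {keeps c a} k} i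
execution-keeps (while-zero _) a i = refl
execution-keeps (while-nonzero _ p q) a {k} i =
  trans (execution-keeps q a {k} i) (execution-keeps p a {k} i)

⟦⟧-kept : ∀ {s s′} c e → T (keepsAll c e) → s′ ≈[ c ] s → ⟦ e ⟧ s′ ≡ ⟦ e ⟧ s
⟦⟧-kept c (const _) k f = refl
⟦⟧-kept {s} {s′} c (a [ e ]) k f =
  trans (f a {T-∧₁ k} _) (cong (s a) (⟦⟧-kept c e (T-∧₂ {keeps c a} k) f))
⟦⟧-kept c (e ⊕ e′) k f = cong₂ _+_ (⟦⟧-kept c e (T-∧₁ k) f) (⟦⟧-kept c e′ (T-∧₂ {keepsAll c e} k) f)
⟦⟧-kept c (e ⊖ e′) k f = cong₂ _∸_ (⟦⟧-kept c e (T-∧₁ k) f) (⟦⟧-kept c e′ (T-∧₂ {keepsAll c e} k) f)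

≡ᵇ-refl : ∀ i → (i ≡ᵇ i) ≡ true
≡ᵇ-refl zero    = refl
≡ᵇ-refl (suc i) = ≡ᵇ-refl i

≢⇒≡ᵇ : ∀ {i j} → i ≢ j → (i ≡ᵇ j) ≡ false
≢⇒≡ᵇ {zero}  {zero}  p = contradiction refl p
≢⇒≡ᵇ {zero}  {suc j} p = refl
≢⇒≡ᵇ {suc i} {zero}  p = refl
≢⇒≡ᵇ {suc i} {suc j} p = ≢⇒≡ᵇ (p ∘ cong suc)

update-same : ∀ s a i x → update s a i x a i ≡ x
update-same s a i x rewrite ≡ᵇ-refl a | ≡ᵇ-refl i = refl

-- For a literal array name `a`, `update s a i x a` unfolds to `set (s a) i x`, so a single array
-- can be treated as a function, apart from the store.
set : (ℕ → ℕ) → ℕ → ℕ → ℕ → ℕ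
set h i x j = if i ≡ᵇ j then x else h j

set-same : ∀ h i x → set h i x i ≡ x
set-same h i x rewrite ≡ᵇ-refl i = refl

set-other : ∀ h {i j} x → i ≢ j → set h i x j ≡ h j
set-other h x i≢j rewrite ≢⇒≡ᵇ i≢j = refl

-- The factor 1 + x is the size-dependent part of the running time, K the constant.
record Run (c : Program) (s : Store) (Q : Store → Set) (K x : ℕ) : Set where
  constructor run
  field
    {final} : Store
    {steps} : ℕ
    exec    : ⟨ c , s ⟩⇓⟨ final , steps ⟩
    post    : Q final
    bound   : steps ≤ K * suc x

K≤K* : ∀ K x → K ≤ K * suc x
K≤K* K x = m≤m*n K (suc x)

run-skip : ∀ {s Q x} → Q s → Run skip s Q 1 x
run-skip {x = x} q = run skip q (K≤K* 1 x)

run-assign : ∀ {a e f s Q x} → Q (update s a (⟦ e ⟧ s) (⟦ f ⟧ s)) → Run (a [ e ]≔ f) s Q (1 + cost e + cost f) x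
run-assign {e = e} {f} {x = x} q = run assign q (K≤K* (1 + cost e + cost f) x)

-- Constants add up while the size `x` is shared; parts of smaller size are raised to `x` by
-- `run-size` beforehand. The continuation receives the frame of `c` next to the postcondition, so
-- postconditions list only what has changed.
run-seq : ∀ {c d s Q R K K′ x} → Run c s Q K x → (∀ s′ → Q s′ → s′ ≈[ c ] s → Run d s′ R K′ x) →
          Run (c ︔ d) s R (K + K′) x
run-seq {K = K} {K′} {x} (run e q b) f with f _ q (execution-keeps e)
... | run e′ q′ b′ = run (seq e e′) q′ (≤-trans (+-mono-≤ b b′) (≤-reflexive (sym (*-distribʳ-+ (suc x) K K′))))

-- The store after an assignment is passed on as a term; the contents of its cells are then found by
-- computation.
run-assign-seq : ∀ {a e f d s R K x} → Run d (update s a (⟦ e ⟧ s) (⟦ f ⟧ s)) R K x →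
                 Run (a [ e ]≔ f ︔ d) s R (1 + cost e + cost f + K) x
run-assign-seq {a} {e} {f} {d} {s} {R} r =
  run-seq (run-assign {Q = λ s′ → s′ ≡ update s a (⟦ e ⟧ s) (⟦ f ⟧ s)} refl) λ { _ refl _ → r }

run-if : ∀ {e c d s Q K K′ x} → (⟦ e ⟧ s ≢ 0 → Run c s Q K x) → (⟦ e ⟧ s ≡ 0 → Run d s Q K′ x) →
         Run (ifnz e then c else d) s Q (1 + cost e + (K + K′)) x
run-if {e} {s = s} {K = K} {K′} {x} f g with ⟦ e ⟧ s in eq
... | zero with run p q b ← g refl = run (if-zero eq p) q
        (≤-trans (+-mono-≤ (K≤K* (1 + cost e) x) (≤-trans b (*-monoˡ-≤ (suc x) (m≤n+m K′ K))))
                 (≤-reflexive (sym (*-distribʳ-+ (suc x) (1 + cost e) (K + K′)))))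
... | suc _ with run p q b ← f (λ ()) = run (if-nonzero (λ eq′ → case trans (sym eq) eq′ of λ ()) p) q
        (≤-trans (+-mono-≤ (K≤K* (1 + cost e) x) (≤-trans b (*-monoˡ-≤ (suc x) (m≤m+n K K′))))
                 (≤-reflexive (sym (*-distribʳ-+ (suc x) (1 + cost e) (K + K′)))))

run-mono : ∀ {c s Q Q′ K x y} → (∀ s′ → Q s′ → s′ ≈[ c ] s → Q′ s′) → x ≤ y → Run c s Q K x → Run c s Q′ K y
run-mono {K = K} f x≤y (run e q b) = run e (f _ q (execution-keeps e)) (≤-trans b (*-monoʳ-≤ K (s≤s x≤y)))

run-post : ∀ {c s Q Q′ K x} → (∀ s′ → Q s′ → s′ ≈[ c ] s → Q′ s′) → Run c s Q K x → Run c s Q′ K x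
run-post f = run-mono f ≤-refl

run-size : ∀ {c s Q K x y} → x ≤ y → Run c s Q K x → Run c s Q K y
run-size = run-mono (λ _ q _ → q)

increment : ℕ → Program
increment x = x [ const 0 ]≔ V x ⊕ const 1

for : ℕ → Expr → Program → Program
for x e c = x [ const 0 ]≔ const 0 ︔ whilenz e ⊖ V x loop (c ︔ increment x)

-- 1 + (n ⊛ y) = (1 + n) * (1 + y)
infixr 7 _⊛_
_⊛_ : ℕ → ℕ → ℕ
n ⊛ y = y + n * suc y

*-swap : ∀ x y z → x * (y * z) ≡ y * (x * z)
*-swap x y z = trans (sym (*-assoc x y z)) (trans (cong (_* z) (*-comm x y)) (*-assoc y x z))

loop-bound : ∀ n K D d f y → d ≤ D → f ≤ D → f + n * (K * suc y + d) ≤ (K + D) * (suc n * suc y)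
loop-bound n K D d f y d≤D f≤D = ≤-trans
  (+-mono-≤ (≤-trans f≤D (m≤n+m D (K * suc y))) (*-monoʳ-≤ n (+-monoʳ-≤ (K * suc y) d≤D)))
  (≤-trans (*-monoʳ-≤ (suc n) (+-monoʳ-≤ (K * suc y) (K≤K* D y)))
  (≤-reflexive (trans (cong (suc n *_) (sym (*-distribʳ-+ (suc y) K D))) (*-swap (suc n) (K + D) (suc y)))))

for-bound : ∀ n K y c → 3 + (n * (K * suc y + (10 + c)) + (4 + c)) ≤ (K + (17 + 2 * c)) * (suc n * suc y)
for-bound n K y c = ≤-trans (≤-reflexive (cong (3 +_) (+-comm (n * (K * suc y + (10 + c))) (4 + c))))
  (loop-bound n K (17 + 2 * c) (10 + c) (7 + c) y
    (+-mono-≤ {10} {17} {c} {2 * c} (m≤m+n 10 7) (m≤m+n c _)) (+-mono-≤ {7} {17} {c} {2 * c} (m≤m+n 7 10) (m≤m+n c _)))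

-- The rule for counted loops. The test evaluates `e` anew in every round, hence `keep-e`. By
-- `frozen` the invariant survives changes of the counter, whose value reaches the body as the index
-- `i`.
module _ {x : ℕ} {e : Expr} {c : Program} {s : Store} (I : ℕ → Store → Set) (n : ℕ) {K y : ℕ}
  (keep-x : T (keeps c x)) (keep-e : T (keepsAll (c ︔ increment x) e))
  (frozen : ∀ (i : ℕ) (s : Store) (v : ℕ) → I i s → I i (update s x 0 v))
  (body : ∀ (i : ℕ) (s₁ : Store) → i < n → s₁ x 0 ≡ i → s₁ ≈[ for x e c ] s → I i s₁ → Run c s₁ (I (suc i)) K y)
  where

  private
    loop = whilenz e ⊖ V x loop (c ︔ increment x)

    keeps-inc : ∀ a → T (keeps (for x e c) a) → T (keeps (c ︔ increment x) a)
    keeps-inc a k = T-∧₂ {not (x ≡ᵇ a)} k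

    keepsAll-for : ∀ e′ → T (keepsAll (c ︔ increment x) e′) → T (keepsAll (for x e c) e′)
    keepsAll-for (const _) k = tt
    keepsAll-for (a [ e′ ]) k = T-∧ (T-∧ (T-∧₂ {keeps c a} (T-∧₁ k)) (T-∧₁ k)) (keepsAll-for e′ (T-∧₂ {keeps (c ︔ increment x) a} k))
    keepsAll-for (f ⊕ g) k = T-∧ (keepsAll-for f (T-∧₁ k)) (keepsAll-for g (T-∧₂ {keepsAll (c ︔ increment x) f} k))
    keepsAll-for (f ⊖ g) k = T-∧ (keepsAll-for f (T-∧₁ k)) (keepsAll-for g (T-∧₂ {keepsAll (c ︔ increment x) f} k))

    step : ℕ
    step = K * suc y + (10 + cost e)

    -- Induction on the number `r` of rounds left. Besides its body, a round pays `4 + cost e` for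
    -- the test and 6 for the increment; the last `4 + cost e` is the failing test.
    iterations : ∀ r i s₁ → i + r ≡ n → s₁ x 0 ≡ i → ⟦ e ⟧ s ≡ n → s₁ ≈[ for x e c ] s → I i s₁ →
      Σ[ s₂ ∈ Store ] Σ[ t ∈ ℕ ] (⟨ loop , s₁ ⟩⇓⟨ s₂ , t ⟩ × I n s₂ × t ≤ r * step + (4 + cost e))
    iterations r i s₁ ir six es fr inv with trans (⟦⟧-kept (for x e c) e (keepsAll-for e keep-e) fr) es
    iterations zero i s₁ ir six es fr inv | es₁ =
      s₁ , _ , while-zero (trans (cong₂ _∸_ es₁ six) (trans (cong (_∸ i) (sym (trans (sym (+-identityʳ i)) ir))) (n∸n≡0 i)))
      , subst (λ j → I j s₁) (trans (sym (+-identityʳ i)) ir) inv , ≤-reflexive (cong (2 +_) (+-comm (cost e) 2))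
    iterations (suc r) i s₁ ir six es fr inv | es₁
      with run {s₂} p q b ← body i s₁ (≤-trans (s≤s (m≤m+n i r)) (≤-reflexive (trans (sym (+-suc i r)) ir))) six fr inv
      with s₃ , t , p₃ , q₃ , b₃ ← iterations r (suc i) (update s₂ x 0 (s₂ x 0 + 1)) (trans (sym (+-suc i r)) ir)
             (trans (update-same s₂ x 0 _) (trans (+-comm _ 1) (cong suc (trans (execution-keeps p x {keep-x} 0) six)))) es
             (λ a {k} j → trans (execution-keeps (seq p (assign {x} {const 0} {V x ⊕ const 1})) a {keeps-inc a k} j) (fr a {k} j))
             (frozen _ _ _ q)
      = s₃ , _ , while-nonzero (λ eq → m<n⇒n∸m≢0 i<n (trans (sym (cong₂ _∸_ es₁ six)) eq)) (seq p assign) p₃ , q₃ ,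
        ≤-trans (+-monoʳ-≤ _ b₃) (≤-trans (+-monoˡ-≤ (r * step + (4 + cost e)) (+-monoʳ-≤ (1 + (1 + cost e + 2)) (+-monoˡ-≤ 6 b)))
          (≤-reflexive (lemma (cost e) (K * suc y) (r * step))))
      where
      i<n : i < n
      i<n = ≤-trans (s≤s (m≤m+n i r)) (≤-reflexive (trans (sym (+-suc i r)) ir))
      m<n⇒n∸m≢0 : ∀ {a b} → a < b → b ∸ a ≢ 0
      m<n⇒n∸m≢0 a<b eq = <⇒≱ a<b (m∸n≡0⇒m≤n eq)
      lemma : ∀ c b z → 1 + (1 + c + 2) + (b + 6) + (z + (4 + c)) ≡ b + (10 + c) + z + (4 + c)
      lemma c b z = trans (sym (+-assoc (1 + (1 + c + 2) + (b + 6)) z (4 + c))) (cong (λ h → h + z + (4 + c)) head)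
        where
        head : 1 + (1 + c + 2) + (b + 6) ≡ b + (10 + c)
        head = trans (cong (λ h → 2 + h + (b + 6)) (+-comm c 2)) (trans (cong (4 +_) (trans (sym (+-assoc c b 6)) (trans (+-comm (c + b) 6) (cong (6 +_) (+-comm c b)))))
               (trans (cong (10 +_) refl) (trans (+-comm 10 (b + c)) (trans (+-assoc b c 10) (cong (b +_) (+-comm c 10))))))

  run-for : ⟦ e ⟧ s ≡ n → I 0 s → Run (for x e c) s (I n) (K + (17 + 2 * cost e)) (n ⊛ y)
  run-for es inv =
    let _ , _ , p , q , b = iterations n 0 (update s x 0 0) refl (update-same s x 0 0) es
                        (λ a {k} i → execution-keeps (assign {x} {const 0} {const 0} {s}) a {T-∧₁ k} i) (frozen _ _ _ inv)
    in run (seq assign p) q (≤-trans (+-monoʳ-≤ 3 b) (for-bound n K y (cost e)))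

  -- For loops whose number of rounds is bounded by a constant `C`: the rounds are absorbed by the
  -- constant, and the size stays that of the body.
  run-forᶜ : ∀ C → n ≤ C → ⟦ e ⟧ s ≡ n → I 0 s → Run (for x e c) s (I n) ((K + (17 + 2 * cost e)) * suc C) y
  run-forᶜ C n≤C es inv = let run p q b = run-for es inv in
    run p q (≤-trans b (≤-trans (≤-reflexive (sym (*-assoc (K + (17 + 2 * cost e)) (suc n) (suc y))))
      (*-monoˡ-≤ (suc y) (*-monoʳ-≤ (K + (17 + 2 * cost e)) (s≤s n≤C)))))

-- Finite sums and constant-size expressions

∑ : ℕ → (ℕ → ℕ) → ℕ
∑ zero    f = 0
∑ (suc n) f = ∑ n f + f n

∑-cong : ∀ n {f g} → (∀ i → i < n → f i ≡ g i) → ∑ n f ≡ ∑ n g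
∑-cong zero    p = refl
∑-cong (suc n) p = cong₂ _+_ (∑-cong n (λ i i<n → p i (m<n⇒m<1+n i<n))) (p n ≤-refl)

∑-mono : ∀ n {f g} → (∀ i → i < n → f i ≤ g i) → ∑ n f ≤ ∑ n g
∑-mono zero    p = z≤n
∑-mono (suc n) p = +-mono-≤ (∑-mono n (λ i i<n → p i (m<n⇒m<1+n i<n))) (p n ≤-refl)

∑-extend : ∀ {m n} f → m ≤ n → ∑ m f ≤ ∑ n f
∑-extend {m} {zero}  f z≤n = z≤n
∑-extend {m} {suc n} f m≤1+n with m≤n⇒m<n∨m≡n m≤1+n
... | inj₁ (s≤s m≤n) = ≤-trans (∑-extend f m≤n) (m≤m+n _ _)
... | inj₂ refl      = ≤-refl

∑-zero : ∀ n {f} → (∀ i → i < n → f i ≡ 0) → ∑ n f ≡ 0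
∑-zero zero    p = refl
∑-zero (suc n) p = cong₂ _+_ (∑-zero n (λ i i<n → p i (m<n⇒m<1+n i<n))) (p n ≤-refl)

∑≡0⇒ : ∀ n {f} → ∑ n f ≡ 0 → ∀ i → i < n → f i ≡ 0
∑≡0⇒ (suc n) {f} p i i<1+n with m≤n⇒m<n∨m≡n (s≤s⁻¹ i<1+n)
... | inj₁ i<n  = ∑≡0⇒ n (m+n≡0⇒m≡0 (∑ n f) p) i i<n
... | inj₂ refl = m+n≡0⇒n≡0 (∑ n f) p

+-interchange : ∀ a b c d → (a + b) + (c + d) ≡ (a + c) + (b + d)
+-interchange a b c d = trans (+-assoc a b (c + d)) (trans (cong (a +_)
  (trans (sym (+-assoc b c d)) (trans (cong (_+ d) (+-comm b c)) (+-assoc c b d)))) (sym (+-assoc a c (b + d))))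

∑-+ : ∀ n f g → ∑ n (λ i → f i + g i) ≡ ∑ n f + ∑ n g
∑-+ zero    f g = refl
∑-+ (suc n) f g = trans (cong (_+ (f n + g n)) (∑-+ n f g)) (+-interchange (∑ n f) (∑ n g) (f n) (g n))

∑-* : ∀ n c f → ∑ n (λ i → c * f i) ≡ c * ∑ n f
∑-* zero    c f = sym (*-zeroʳ c)
∑-* (suc n) c f = trans (cong (_+ c * f n) (∑-* n c f)) (sym (*-distribˡ-+ c (∑ n f) (f n)))

∑-*ʳ : ∀ n f c → ∑ n (λ i → f i * c) ≡ ∑ n f * c
∑-*ʳ n f c = trans (∑-cong n (λ i _ → *-comm (f i) c)) (trans (∑-* n c f) (*-comm c (∑ n f)))

∑-swap : ∀ m n (f : ℕ → ℕ → ℕ) → ∑ m (λ i → ∑ n (f i)) ≡ ∑ n (λ j → ∑ m (λ i → f i j))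
∑-swap zero    n f = sym (∑-zero n (λ _ _ → refl))
∑-swap (suc m) n f = trans (cong (_+ ∑ n (f m)) (∑-swap m n f)) (sym (∑-+ n (λ j → ∑ m (λ i → f i j)) (f m)))

when : Bool → ℕ → ℕ
when true  x = x
when false x = 0

when≤ : ∀ c x → when c x ≤ x
when≤ true  x = ≤-refl
when≤ false x = z≤n

≡ᵇ-true : ∀ {i j} → i ≡ j → (i ≡ᵇ j) ≡ true
≡ᵇ-true {i} refl = ≡ᵇ-refl i

≡ᵇ-sound : ∀ i j → (i ≡ᵇ j) ≡ true → i ≡ j
≡ᵇ-sound zero    zero    _ = refl
≡ᵇ-sound (suc i) (suc j) p = cong suc (≡ᵇ-sound i j p)

∑-delta : ∀ n j (f : ℕ → ℕ) → j < n → ∑ n (λ i → when (i ≡ᵇ j) (f i)) ≡ f j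
∑-delta (suc n) j f j<1+n with j ≟ n
... | yes refl rewrite ≡ᵇ-refl j = cong (_+ f j) (∑-zero j (λ i i<j → cong (λ c → when c (f i)) (≢⇒≡ᵇ (<⇒≢ i<j))))
... | no j≢n rewrite ≢⇒≡ᵇ {n} {j} (j≢n ∘ sym) = trans (+-identityʳ _) (∑-delta n j f (≤∧≢⇒< (s≤s⁻¹ j<1+n) j≢n))

∑-member : ∀ n f i → i < n → f i ≤ ∑ n f
∑-member (suc n) f i i<1+n with i ≟ n
... | yes refl = m≤n+m _ _
... | no i≢n = ≤-trans (∑-member n f i (≤∧≢⇒< (s≤s⁻¹ i<1+n) i≢n)) (m≤m+n _ _)

-- In place of multiplication: a fixed multiple is an addition of fixed length.
times : ℕ → Expr → Expr
times zero    e = const 0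
times (suc c) e = e ⊕ times c e

⟦times⟧ : ∀ c e s → ⟦ times c e ⟧ s ≡ c * ⟦ e ⟧ s
⟦times⟧ zero    e s = refl
⟦times⟧ (suc c) e s = cong (⟦ e ⟧ s +_) (⟦times⟧ c e s)

sumE : ℕ → (ℕ → Expr) → Expr
sumE zero    f = const 0
sumE (suc n) f = sumE n f ⊕ f n

⟦sumE⟧ : ∀ n f s → ⟦ sumE n f ⟧ s ≡ ∑ n (λ i → ⟦ f i ⟧ s)
⟦sumE⟧ zero    f s = refl
⟦sumE⟧ (suc n) f s = cong (_+ ⟦ f n ⟧ s) (⟦sumE⟧ n f s)

-- The Kronecker delta in terms of truncated subtraction, so that `eqE` can compute it.
δ : ℕ → ℕ → ℕ
δ x y = 1 ∸ ((x ∸ y) + (y ∸ x))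

δ-≡ : ∀ {x y} → x ≡ y → δ x y ≡ 1
δ-≡ {x} refl rewrite n∸n≡0 x = refl

δ-≢ : ∀ {x y} → x ≢ y → δ x y ≡ 0
δ-≢ {x} {y} x≢y with (x ∸ y) + (y ∸ x) in eq
... | suc k = 0∸n≡0 k
... | zero  = contradiction (≤-antisym (m∸n≡0⇒m≤n (m+n≡0⇒m≡0 (x ∸ y) eq)) (m∸n≡0⇒m≤n (m+n≡0⇒n≡0 (x ∸ y) eq))) x≢y

δ≢0⇒≡ : ∀ {x y} → δ x y ≢ 0 → x ≡ y
δ≢0⇒≡ {x} {y} p with x ≟ y
... | yes q = q
... | no  q = contradiction (δ-≢ q) p

δ≡0⇒≢ : ∀ {x y} → δ x y ≡ 0 → x ≢ y
δ≡0⇒≢ p q = case trans (sym p) (δ-≡ q) of λ ()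

eqE : Expr → Expr → Expr
eqE e f = const 1 ⊖ ((e ⊖ f) ⊕ (f ⊖ e))

-- A finite table written into the program text as a sum of deltas. It makes digits of bag codes and
-- conflict tests available in constant time, without division.
lookupE : (ℕ → ℕ) → ℕ → Expr → Expr
lookupE f n e = sumE n (λ j → times (f j) (eqE (const j) e))

⟦lookupE⟧ : ∀ f n e s → ⟦ e ⟧ s < n → ⟦ lookupE f n e ⟧ s ≡ f (⟦ e ⟧ s)
⟦lookupE⟧ f n e s x<n = trans (⟦sumE⟧ n _ s) (trans (∑-cong n term) (∑-delta n (⟦ e ⟧ s) f x<n))
  where
  term : ∀ j → j < n → ⟦ times (f j) (eqE (const j) e) ⟧ s ≡ when (j ≡ᵇ ⟦ e ⟧ s) (f j)
  term j _ with j ≟ ⟦ e ⟧ s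
  ... | yes p rewrite ≡ᵇ-true p = trans (⟦times⟧ (f j) _ s) (trans (cong (f j *_) (δ-≡ p)) (*-identityʳ (f j)))
  ... | no  p rewrite ≢⇒≡ᵇ p    = trans (⟦times⟧ (f j) _ s) (trans (cong (f j *_) (δ-≢ p)) (*-zeroʳ (f j)))

-- Rooted decompositions and the meaning of table entries

digit : (q : ℕ) .{{_ : NonZero q}} → ℕ → ℕ → ℕ
digit q x zero    = x % q
digit q x (suc a) = digit q (x / q) a

digit< : ∀ q .{{_ : NonZero q}} x a → digit q x a < q
digit< q x zero    = m%n<n x q
digit< q x (suc a) = digit< q (x / q) a

encode : ℕ → ℕ → (ℕ → ℕ) → ℕ
encode q zero    g = 0
encode q (suc b) g = g 0 + encode q b (g ∘ suc) * q

encode< : ∀ q b g → (∀ a → a < b → g a < q) → encode q b g < q ^ b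
encode< q zero    g g< = z<s
encode< q (suc b) g g< = begin-strict
  g 0 + encode q b (g ∘ suc) * q  <⟨ +-monoˡ-< _ (g< 0 z<s) ⟩
  suc (encode q b (g ∘ suc)) * q  ≤⟨ *-monoˡ-≤ q (encode< q b (g ∘ suc) (λ a a<b → g< (suc a) (s≤s a<b))) ⟩
  q ^ b * q                       ≡⟨ *-comm (q ^ b) q ⟩
  q ^ suc b                       ∎
  where open ≤-Reasoning

[m+kn]/n≡k : ∀ {n} .{{_ : NonZero n}} m k → m < n → (m + k * n) / n ≡ k
[m+kn]/n≡k {n} m k m<n = trans (+-distrib-/-∣ʳ m (n∣m*n k)) (cong₂ _+_ (m<n⇒m/n≡0 m<n) (m*n/n≡m k n))

digit-encode : ∀ q .{{_ : NonZero q}} b g → (∀ a → a < b → g a < q) → ∀ a → a < b → digit q (encode q b g) a ≡ g a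
digit-encode q (suc b) g g< zero    a<b = trans ([m+kn]%n≡m%n (g 0) (encode q b (g ∘ suc)) q) (m<n⇒m%n≡m (g< 0 z<s))
digit-encode q (suc b) g g< (suc a) (s≤s a<b) =
  trans (cong (λ x → digit q x a) ([m+kn]/n≡k (g 0) _ (g< 0 z<s)))
        (digit-encode q b (g ∘ suc) (λ a a<b → g< (suc a) (s≤s a<b)) a a<b)

-- Slot a of the bag of node i is bag (b * i + a); slots may repeat a vertex.
-- The home (hn u , hs u) of a vertex u is a slot of the topmost bag containing u.
record Rooted (b : ℕ) (E : ℕ → ℕ → Set) (nv m : ℕ) (bag par hn hs : ℕ → ℕ) : Set where
  field
    m≥1  : 1 ≤ m
    par< : ∀ i → 1 ≤ i → i < m → par i < i
    bag< : ∀ i a → i < m → a < b → bag (b * i + a) < nv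
    hn<  : ∀ u → u < nv → hn u < m
    hs<  : ∀ u → u < nv → hs u < b
    home : ∀ u → u < nv → bag (b * hn u + hs u) ≡ u
    -- Parents lead from every bag that contains a vertex to its home: this is the connectedness of
    -- the nodes containing it.
    up   : ∀ i a → i < m → a < b → hn (bag (b * i + a)) ≡ i ⊎
             (1 ≤ i × ∃[ a′ ] (a′ < b × bag (b * par i + a′) ≡ bag (b * i + a)))
    edge : ∀ u v → u < nv → v < nv → E u v →
             ∃[ i ] ∃[ a ] ∃[ a′ ] (i < m × a < b × a′ < b × bag (b * i + a) ≡ u × bag (b * i + a′) ≡ v)

merge : ℕ → ℕ → ℕ → ℕ
merge i p c = if c ≡ᵇ i then p else c

merge-≡ : ∀ {i p c} → c ≡ i → merge i p c ≡ p
merge-≡ {c = c} refl rewrite ≡ᵇ-refl c = refl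

merge-≢ : ∀ {i p c} → c ≢ i → merge i p c ≡ c
merge-≢ c≢i rewrite ≢⇒≡ᵇ c≢i = refl

-- `Conf` holds for the pairs of labels that must not meet along an edge. `W₁` gives the weights, by
-- which tables are indexed, and `W₂` the codes, which are stored in them; both are sums over
-- vertices and are treated alike.
module Semantics (b q : ℕ) (E Conf : ℕ → ℕ → Set) (nv m : ℕ) (bag par hn hs : ℕ → ℕ)
  (td : Rooted b E nv m bag par hn hs) (dg : ℕ → ℕ → ℕ) (dg< : ∀ x a → dg x a < q) (W₁ W₂ : ℕ → ℕ → ℕ) where

  open Rooted td

  -- Following `up` from a slot leads to ever smaller node numbers until the home is reached; `f`
  -- bounds the number of steps.
  home≤ : ∀ f p a → p ≤ f → p < m → a < b → hn (bag (b * p + a)) ≤ p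
  home≤ f p a p≤f p<m a<b with up p a p<m a<b
  ... | inj₁ eq = ≤-reflexive eq
  home≤ zero    (suc p) a () p<m a<b | inj₂ _
  home≤ (suc f) p a p≤f p<m a<b | inj₂ (1≤p , a′ , a′<b , eq) =
    let pp<p = par< p 1≤p p<m in
    ≤-trans (subst (λ u → hn u ≤ par p) eq (home≤ f (par p) a′ (s≤s⁻¹ (≤-trans pp<p p≤f)) (<-trans pp<p p<m) a′<b)) (<⇒≤ pp<p)

  -- After the nodes ≥ i have been merged into their parents, c j is the surviving node that absorbed j.
  record Absorbed (i : ℕ) (c : ℕ → ℕ) : Set where
    field
      below : ∀ j → j < m → c j < i
      fixed : ∀ j → j < i → c j ≡ j
      -- An entry of a bag stays visible in the bag of the absorbing node until that node has
      -- absorbed its home as well.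
      reach : ∀ j a → j < m → a < b → c j ≡ c (hn (bag (b * j + a))) ⊎
                ∃[ a′ ] (a′ < b × bag (b * c j + a′) ≡ bag (b * j + a))

  absorbed-start : Absorbed m (λ j → j)
  absorbed-start = record { below = λ j j<m → j<m ; fixed = λ j _ → refl ; reach = λ j a _ a<b → inj₂ (a , a<b , refl) }

  module Step (i : ℕ) (1≤i : 1 ≤ i) (i<m : i < m) (c : ℕ → ℕ) (ab : Absorbed (suc i) c) where
    open Absorbed ab

    p : ℕ
    p = par i

    p<i : p < i
    p<i = par< i 1≤i i<m

    p≢i : p ≢ i
    p≢i = <⇒≢ p<i

    c′ : ℕ → ℕ
    c′ j = merge i p (c j)

    absorbed-step : Absorbed i c′
    absorbed-step = record { below = below′ ; fixed = fixed′ ; reach = reach′ }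
      where
      below′ : ∀ j → j < m → c′ j < i
      below′ j j<m with c j ≟ i
      ... | yes eq rewrite merge-≡ {i} {p} eq = p<i
      ... | no  ne rewrite merge-≢ {i} {p} ne = ≤∧≢⇒< (s≤s⁻¹ (below j j<m)) ne
      fixed′ : ∀ j → j < i → c′ j ≡ j
      fixed′ j j<i rewrite fixed j (m<n⇒m<1+n j<i) = merge-≢ (<⇒≢ j<i)
      reach′ : ∀ j a → j < m → a < b → c′ j ≡ c′ (hn (bag (b * j + a))) ⊎
                 ∃[ a′ ] (a′ < b × bag (b * c′ j + a′) ≡ bag (b * j + a))
      reach′ j a j<m a<b with reach j a j<m a<b
      ... | inj₁ eq = inj₁ (cong (merge i p) eq)
      ... | inj₂ (a′ , a′<b , eq) with c j ≟ i
      ...   | no ne rewrite merge-≢ {i} {p} ne = inj₂ (a′ , a′<b , eq)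
      ...   | yes refl with up i a′ i<m a′<b
      ...     | inj₁ h = inj₁ (cong (merge i p) (sym (trans (cong c (trans (cong hn (sym eq)) h)) (fixed i ≤-refl))))
      ...     | inj₂ (_ , a″ , a″<b , eq″) = inj₂ (a″ , a″<b , trans (cong (λ k → bag (b * k + a″)) (merge-≡ {i} {p} {c j} refl)) (trans eq″ eq))

  -- A vertex is charged to the node that absorbed its home, so its occurrences in several bags
  -- count once.
  part : (ℕ → ℕ) → ℕ → (ℕ → ℕ → ℕ) → (ℕ → ℕ) → ℕ
  part c p W g = ∑ nv (λ u → when (c (hn u) ≡ᵇ p) (W u (g u)))

  ProperAt : (ℕ → ℕ) → ℕ → Set
  ProperAt g j = ∀ a a′ → a < b → a′ < b → E (bag (b * j + a)) (bag (b * j + a′)) →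
                   ¬ Conf (g (bag (b * j + a))) (g (bag (b * j + a′)))

  OnBag : (ℕ → ℕ) → ℕ → ℕ → Set
  OnBag g p x = ∀ a → a < b → g (bag (b * p + a)) ≡ dg x a

  -- g is a labelling of the part of the decomposition absorbed by p, restricting to x on the bag of p,
  -- with total weight σ and code ω.
  record Sem (c : ℕ → ℕ) (p x σ ω : ℕ) : Set where
    field
      g      : ℕ → ℕ
      g<     : ∀ u → g u < q
      on-bag : OnBag g p x
      proper : ∀ j → j < m → c j ≡ p → ProperAt g j
      sum₁   : σ ≡ part c p W₁ g
      sum₂   : ω ≡ part c p W₂ g

  -- Between a child and its parent the first condition is agreement on the common vertices. With
  -- both nodes and both codes equal, the same relation says that repeated slots carry one label and
  -- that the bag is labelled properly.
  Compatible : ℕ → ℕ → ℕ → ℕ → Set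
  Compatible i x p y = ∀ a a′ → a < b → a′ < b →
    (bag (b * i + a) ≡ bag (b * p + a′) → dg x a ≡ dg y a′) ×
    (E (bag (b * i + a)) (bag (b * p + a′)) → ¬ Conf (dg x a) (dg y a′))

  -- A program runs over slots, and a vertex may fill several of them. Comparing the slot with `hs`
  -- keeps exactly one, which exists by `home`; then the sums over slots and vertices are exchanged.
  slots-sum : ∀ i → i < m → (F : ℕ → ℕ) →
    ∑ b (λ a → when ((hn (bag (b * i + a)) ≡ᵇ i) ∧ (hs (bag (b * i + a)) ≡ᵇ a)) (F (bag (b * i + a)))) ≡
    ∑ nv (λ u → when (hn u ≡ᵇ i) (F u))
  slots-sum i i<m F = trans (∑-cong b λ a a<b → sym (∑-delta nv (bag (b * i + a)) (λ u → when ((hn u ≡ᵇ i) ∧ (hs u ≡ᵇ a)) (F u)) (bag< i a i<m a<b)))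
    (trans (∑-swap b nv _) (∑-cong nv λ u u<nv → trans (∑-cong b (eq u u<nv)) (∑-delta b (hs u) (λ _ → when (hn u ≡ᵇ i) (F u)) (hs< u u<nv))))
    where
    eq : ∀ u → u < nv → ∀ a → a < b → when (u ≡ᵇ bag (b * i + a)) (when ((hn u ≡ᵇ i) ∧ (hs u ≡ᵇ a)) (F u)) ≡
           when (a ≡ᵇ hs u) (when (hn u ≡ᵇ i) (F u))
    eq u u<nv a a<b with hs u ≟ a
    ... | no ne rewrite ≢⇒≡ᵇ ne | ≢⇒≡ᵇ (ne ∘ sym) with hn u ≡ᵇ i | u ≡ᵇ bag (b * i + a)
    ...   | true  | true  = refl
    ...   | true  | false = refl
    ...   | false | true  = refl
    ...   | false | false = refl
    eq u u<nv a a<b | yes refl rewrite ≡ᵇ-refl (hs u) with hn u ≟ i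
    ... | yes refl rewrite ≡ᵇ-refl (hn u) | home u u<nv | ≡ᵇ-refl u = refl
    ... | no ne rewrite ≢⇒≡ᵇ ne with u ≡ᵇ bag (b * i + hs u)
    ...   | true  = refl
    ...   | false = refl

  homeSum : (ℕ → ℕ → ℕ) → ℕ → ℕ → ℕ
  homeSum W i x = ∑ b (λ a → when ((hn (bag (b * i + a)) ≡ᵇ i) ∧ (hs (bag (b * i + a)) ≡ᵇ a)) (W (bag (b * i + a)) (dg x a)))

  homeSum-part : ∀ W i x g → i < m → OnBag g i x → homeSum W i x ≡ part (λ j → j) i W g
  homeSum-part W i x g i<m on = trans
    (∑-cong b λ a a<b → cong (λ l → when ((hn (bag (b * i + a)) ≡ᵇ i) ∧ (hs (bag (b * i + a)) ≡ᵇ a)) (W (bag (b * i + a)) l)) (sym (on a a<b)))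
    (slots-sum i i<m (λ u → W u (g u)))

  -- Of several slots with the same vertex the last one decides, which is immaterial for a code
  -- compatible with itself. Vertices outside the bag get a default, which enters neither the sums
  -- nor the conditions on a single node.
  labelFrom : ℕ → ℕ → ℕ → ℕ → ℕ
  labelFrom i x zero    u = dg x 0
  labelFrom i x (suc a) u = if u ≡ᵇ bag (b * i + a) then dg x a else labelFrom i x a u

  labelFrom< : ∀ i x k u → labelFrom i x k u < q
  labelFrom< i x zero    u = dg< x 0
  labelFrom< i x (suc k) u with u ≡ᵇ bag (b * i + k)
  ... | true  = dg< x k
  ... | false = labelFrom< i x k u

  labelFrom-bag : ∀ i x → Compatible i x i x → ∀ k → k ≤ b → ∀ a → a < k → labelFrom i x k (bag (b * i + a)) ≡ dg x a
  labelFrom-bag i x ok (suc k) k≤b a a<k with bag (b * i + a) ≟ bag (b * i + k)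
  ... | yes eq rewrite ≡ᵇ-true eq = sym (proj₁ (ok a k (≤-trans a<k k≤b) k≤b) eq)
  ... | no ne rewrite ≢⇒≡ᵇ ne = labelFrom-bag i x ok k (<⇒≤ k≤b) a (≤∧≢⇒< (s≤s⁻¹ a<k) λ { refl → ne refl })

  sem-init : ∀ i x → i < m → Compatible i x i x → Sem (λ j → j) i x (homeSum W₁ i x) (homeSum W₂ i x)
  sem-init i x i<m ok = record
    { g = labelFrom i x b ; g< = labelFrom< i x b ; on-bag = on
    ; proper = λ { j _ refl a a′ a<b a′<b e → subst₂ (λ l l′ → ¬ Conf l l′) (sym (on a a<b)) (sym (on a′ a′<b)) (proj₂ (ok a a′ a<b a′<b) e) }
    ; sum₁ = homeSum-part W₁ i x _ i<m on ; sum₂ = homeSum-part W₂ i x _ i<m on }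
    where
    on : OnBag (labelFrom i x b) i x
    on = labelFrom-bag i x ok b ≤-refl

  module Push (i : ℕ) (1≤i : 1 ≤ i) (i<m : i < m) (c : ℕ → ℕ) (ab : Absorbed (suc i) c) where
    open Absorbed ab
    open Step i 1≤i i<m c ab public

    -- Used with two labellings to glue partial solutions, and with a single one to split the weight
    -- of a global labelling between child and parent.
    part-merge : ∀ W g g₁ g₂ → (∀ u → c (hn u) ≡ i → g u ≡ g₂ u) → (∀ u → c (hn u) ≢ i → g u ≡ g₁ u) →
                 part c′ p W g ≡ part c p W g₁ + part c i W g₂
    part-merge W g g₁ g₂ at off = trans (∑-cong nv λ u _ → eq u) (∑-+ nv _ _)
      where
      eq : ∀ u → when (c′ (hn u) ≡ᵇ p) (W u (g u)) ≡ when (c (hn u) ≡ᵇ p) (W u (g₁ u)) + when (c (hn u) ≡ᵇ i) (W u (g₂ u))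
      eq u with c (hn u) ≟ i
      ... | yes e rewrite e | ≡ᵇ-refl i | ≡ᵇ-refl p | ≢⇒≡ᵇ (p≢i ∘ sym) = cong (W u) (at u e)
      ... | no ne rewrite ≢⇒≡ᵇ ne = trans (cong (λ l → when (c (hn u) ≡ᵇ p) (W u l)) (off u ne)) (sym (+-identityʳ _))

    private
      -- The home of an entry of the parent's bag has number at most `p < i`, and `c` still fixes
      -- such nodes.
      not-absorbed : ∀ a → a < b → c (hn (bag (b * p + a))) ≢ i
      not-absorbed a a<b eq =
        let h≤p = home≤ p p a ≤-refl (<-trans p<i i<m) a<b
            h<i = ≤-trans (s≤s h≤p) p<i
        in <⇒≢ h<i (trans (sym (fixed _ (m<n⇒m<1+n h<i))) eq)

    -- Each vertex takes the label of the side that absorbed its home. Properness is a condition on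
    -- single bags, hence on one side at a time. Care is needed only for an entry of a bag on the
    -- child's side whose home lies elsewhere: `reach` puts it into the bag of `i`, `up` into that
    -- of `p`, and compatibility makes the two labels equal.
    sem-glue : ∀ {x y σ₁ σ₂ ω₁ ω₂} → Sem c p y σ₁ ω₁ → Sem c i x σ₂ ω₂ → Compatible i x p y → Sem c′ p y (σ₁ + σ₂) (ω₁ + ω₂)
    sem-glue {x} {y} S₁ S₂ ok = record
      { g = g ; g< = g< ; on-bag = on ; proper = proper
      ; sum₁ = trans (cong₂ _+_ S₁.sum₁ S₂.sum₁) (sym (part-merge W₁ g S₁.g S₂.g at off))
      ; sum₂ = trans (cong₂ _+_ S₁.sum₂ S₂.sum₂) (sym (part-merge W₂ g S₁.g S₂.g at off)) }
      where
      module S₁ = Sem S₁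
      module S₂ = Sem S₂
      g : ℕ → ℕ
      g u = if c (hn u) ≡ᵇ i then S₂.g u else S₁.g u
      at : ∀ u → c (hn u) ≡ i → g u ≡ S₂.g u
      at u e rewrite ≡ᵇ-true e = refl
      off : ∀ u → c (hn u) ≢ i → g u ≡ S₁.g u
      off u e rewrite ≢⇒≡ᵇ e = refl
      g< : ∀ u → g u < q
      g< u with c (hn u) ≡ᵇ i
      ... | true  = S₂.g< u
      ... | false = S₁.g< u
      on : OnBag g p y
      on a a<b = trans (off _ (not-absorbed a a<b)) (S₁.on-bag a a<b)
      c≡p⇒off : ∀ j a → j < m → a < b → c j ≡ p → c (hn (bag (b * j + a))) ≢ i
      c≡p⇒off j a j<m a<b cj eq with reach j a j<m a<b
      ... | inj₁ e = p≢i (trans (sym cj) (trans e eq))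
      ... | inj₂ (a′ , a′<b , e) = not-absorbed a′ a′<b (trans (cong (λ k → c (hn k)) (trans (cong (λ k → bag (b * k + a′)) (sym cj)) e)) eq)
      agree : ∀ j a → j < m → a < b → c j ≡ i → g (bag (b * j + a)) ≡ S₂.g (bag (b * j + a))
      agree j a j<m a<b cj with c (hn (bag (b * j + a))) ≟ i
      ... | yes e = at _ e
      ... | no ne with reach j a j<m a<b
      ...   | inj₁ e = contradiction (trans (sym e) cj) ne
      ...   | inj₂ (a′ , a′<b , e) with trans (cong (λ k → bag (b * k + a′)) (sym cj)) e
      ...     | e′ with up i a′ i<m a′<b
      ...       | inj₁ h = contradiction (trans (cong c (trans (cong hn (sym e′)) h)) (fixed i ≤-refl)) ne
      ...       | inj₂ (_ , a″ , a″<b , e″) = trans (off _ ne) (trans (cong S₁.g (sym (trans e″ e′)))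
                    (trans (S₁.on-bag a″ a″<b) (trans (sym (proj₁ (ok a′ a″ a′<b a″<b) (sym e″))) (trans (sym (S₂.on-bag a′ a′<b)) (cong S₂.g e′)))))
      proper : ∀ j → j < m → c′ j ≡ p → ProperAt g j
      proper j j<m c′j a a′ a<b a′<b e with c j ≟ i
      ... | yes cj = subst₂ (λ l l′ → ¬ Conf l l′) (sym (agree j a j<m a<b cj)) (sym (agree j a′ j<m a′<b cj)) (S₂.proper j j<m cj a a′ a<b a′<b e)
      ... | no ne = subst₂ (λ l l′ → ¬ Conf l l′) (sym (off _ (c≡p⇒off j a j<m a<b cj))) (sym (off _ (c≡p⇒off j a′ j<m a′<b cj))) (S₁.proper j j<m cj a a′ a<b a′<b e)
        where
        cj : c j ≡ p
        cj = trans (sym (merge-≢ ne)) c′j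

    others : ∀ p′ → p′ ≢ p → p′ ≢ i → ∀ j → (c′ j ≡ᵇ p′) ≡ (c j ≡ᵇ p′)
    others p′ ≢p ≢i j with c j ≟ i
    ... | yes e rewrite merge-≡ {i} {p} e | e | ≢⇒≡ᵇ (≢p ∘ sym) | ≢⇒≡ᵇ (≢i ∘ sym) = refl
    ... | no ne rewrite merge-≢ {i} {p} ne = refl

    part-others : ∀ W g p′ → p′ ≢ p → p′ ≢ i → part c′ p′ W g ≡ part c p′ W g
    part-others W g p′ ≢p ≢i = ∑-cong nv λ u _ → cong (λ t → when t (W u (g u))) (others p′ ≢p ≢i (hn u))

    sem-others : ∀ {p′ x σ ω} → p′ ≢ p → p′ ≢ i → Sem c p′ x σ ω → Sem c′ p′ x σ ω
    sem-others {p′} ≢p ≢i S = record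
      { g = S₀.g ; g< = S₀.g< ; on-bag = S₀.on-bag
      ; proper = λ j j<m e → S₀.proper j j<m (≡ᵇ-sound (c j) p′ (trans (sym (others p′ ≢p ≢i j)) (≡ᵇ-true e)))
      ; sum₁ = trans S₀.sum₁ (sym (part-others W₁ S₀.g p′ ≢p ≢i))
      ; sum₂ = trans S₀.sum₂ (sym (part-others W₂ S₀.g p′ ≢p ≢i)) }
      where module S₀ = Sem S

  part-root : ∀ {c} → Absorbed 1 c → ∀ W g → part c 0 W g ≡ ∑ nv (λ u → W u (g u))
  part-root ab W g = ∑-cong nv λ u u<nv → cong (λ t → when t (W u (g u))) (≡ᵇ-true (n<1⇒n≡0 (Absorbed.below ab (hn u) (hn< u u<nv))))

  sem-root : ∀ {c x σ ω} → Absorbed 1 c → Sem c 0 x σ ω →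
    Σ[ g ∈ (ℕ → ℕ) ] ((∀ u → g u < q) × (∀ u v → u < nv → v < nv → E u v → ¬ Conf (g u) (g v)) ×
      σ ≡ ∑ nv (λ u → W₁ u (g u)) × ω ≡ ∑ nv (λ u → W₂ u (g u)))
  sem-root ab S = g , g< , pr , trans sum₁ (part-root ab W₁ g) , trans sum₂ (part-root ab W₂ g)
    where
    open Sem S
    pr : ∀ u v → u < nv → v < nv → E u v → ¬ Conf (g u) (g v)
    pr u v u<nv v<nv e with edge u v u<nv v<nv e
    ... | j , a , a′ , j<m , a<b , a′<b , refl , refl = proper j j<m (n<1⇒n≡0 (Absorbed.below ab j j<m)) a a′ a<b a′<b e

-- Joining tables

-- ROW[u] = n * u.  BAG, PAR, HN, HS, MM (and their copies ending in 2) hold a rooted decomposition of the first NV vertices.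
-- TAB[L * i + x] is the address in HEAP of the table of node i for the labelling of its bag with code x; cell σ of a table
-- is 1 + ω for some partial labelling of weight σ and code ω, and 0 if there is none.  Tables are never overwritten: FP is the
-- first unused address, beyond which HEAP is still 0.  AL marks the admissible weights and VAL ranks them; LAB is the answer.
ADJ PROF OUT ROW BAG PAR HN HS MM BAG2 PAR2 HN2 HS2 M2 OWN LEN INB LAB WT AL NN NV VAL PWR HEAP FP TAB : ℕ
CI CX CP CY A1 A2 S1 S2 DEL OME SL RR BEST DU DD BASE CNT PX UU LV ACC : ℕ
ADJ  = 1
PROF = 2
OUT  = 3
ROW  = 4
BAG  = 5
PAR  = 6
HN   = 7
HS   = 8
MM   = 9
BAG2 = 10
PAR2 = 11
HN2  = 12
HS2  = 13
M2   = 14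
OWN  = 15
LEN  = 16
INB  = 17
LAB  = 18
WT   = 19
AL   = 20
NN   = 21
NV   = 22
VAL  = 23
PWR  = 24
HEAP = 25
FP   = 26
TAB  = 27
CI   = 28
CX   = 29
CP   = 30
CY   = 31
A1   = 32
A2   = 33
S1   = 34
S2   = 35
DEL  = 36
OME  = 37
SL   = 38
RR   = 39
BEST = 40
DU   = 41
DD   = 42
BASE = 43
CNT  = 44
PX   = 45
UU   = 46
LV   = 47
ACC  = 48

infix 5 _≔_
_≔_ : ℕ → Expr → Program
a ≔ e = a [ const 0 ]≔ e

infix 5 _≔+_
_≔+_ : ℕ → Expr → Program
a ≔+ e = a ≔ V a ⊕ e

n≢0⇒suc : ∀ {n} → n ≢ 0 → ∃[ k ] n ≡ suc k
n≢0⇒suc {zero}  p = contradiction refl p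
n≢0⇒suc {suc n} p = n , refl

suc≢0 : ∀ {n k} → n ≡ suc k → n ≢ 0
suc≢0 refl ()

-- `h₀` is the heap before the join, `h` the present one, `done` the pairs of cells already treated.
-- Completeness asks only that a cell be nonzero: a later pair with the same sum may overwrite a
-- code by another one, and any will do.
record Joined (N fp : ℕ) (h₀ h : ℕ → ℕ) (al : ℕ → ℕ) (a₁ a₂ : ℕ) (S : ℕ → ℕ → Set) (done : ℕ → ℕ → Set) : Set where
  field
    outside  : ∀ x → x < fp ⊎ fp + N ≤ x → h x ≡ h₀ x
    sound    : ∀ σ ω → σ < N → h (fp + σ) ≡ suc ω → S σ ω
    grows    : ∀ x → h₀ x ≢ 0 → h x ≢ 0
    complete : ∀ σ₁ σ₂ → σ₁ < N → σ₂ < N → done σ₁ σ₂ → h₀ (a₁ + σ₁) ≢ 0 → h₀ (a₂ + σ₂) ≢ 0 →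
               al (σ₁ + σ₂) ≢ 0 → h (fp + (σ₁ + σ₂)) ≢ 0

joinP : Program
joinP = for S1 (V NN) (ifnz HEAP [ V A1 ⊕ V S1 ] then
          for S2 (V NN) (ifnz HEAP [ V A2 ⊕ V S2 ] then
            (ifnz AL [ V S1 ⊕ V S2 ] then
              -- Both cells hold one more than a code, and so must the result.
              HEAP [ V FP ⊕ (V S1 ⊕ V S2) ]≔ HEAP [ V A1 ⊕ V S1 ] ⊕ HEAP [ V A2 ⊕ V S2 ] ⊖ const 1
             else skip)
           else skip)
         else skip)

joined-skip : ∀ {N fp h₀ h al a₁ a₂ S} {done done′ : ℕ → ℕ → Set} →
  (∀ σ₁ σ₂ → σ₁ < N → σ₂ < N → done′ σ₁ σ₂ → h₀ (a₁ + σ₁) ≢ 0 → h₀ (a₂ + σ₂) ≢ 0 → al (σ₁ + σ₂) ≢ 0 → done σ₁ σ₂) →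
  Joined N fp h₀ h al a₁ a₂ S done → Joined N fp h₀ h al a₁ a₂ S done′
joined-skip f J = record { outside = outside ; sound = sound ; grows = grows
  ; complete = λ σ₁ σ₂ l₁ l₂ d p q r → complete σ₁ σ₂ l₁ l₂ (f σ₁ σ₂ l₁ l₂ d p q r) p q r }
  where open Joined J

joined-write : ∀ {N fp h₀ h al a₁ a₂ S} {done done′ : ℕ → ℕ → Set} i j ω →
  i + j < N → S (i + j) ω →
  (∀ σ₁ σ₂ → done′ σ₁ σ₂ → done σ₁ σ₂ ⊎ (σ₁ ≡ i × σ₂ ≡ j)) →
  Joined N fp h₀ h al a₁ a₂ S done → Joined N fp h₀ (set h (fp + (i + j)) (suc ω)) al a₁ a₂ S done′
joined-write {N} {fp} {h₀} {h} {S = S} i j ω ij<N s f J = record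
  { outside = λ x o → trans (set-other h {fp + (i + j)} {x} (suc ω) (λ { refl → [ <⇒≱′ , (λ le → <⇒≱ ij<N (+-cancelˡ-≤ fp _ _ le)) ]′ o })) (outside x o)
  ; sound = snd ; grows = λ x p → keep x (grows x p)
  ; complete = λ σ₁ σ₂ l₁ l₂ d p q r → [ (λ d′ → keep _ (complete σ₁ σ₂ l₁ l₂ d′ p q r))
                 , (λ { (refl , refl) → suc≢0 (set-same h _ _) }) ]′ (f σ₁ σ₂ d) }
  where
  open Joined J
  <⇒≱′ : ∀ {m n} → m + n < m → ⊥
  <⇒≱′ {m} {n} lt = <⇒≱ lt (m≤m+n m n)
  keep : ∀ x → h x ≢ 0 → set h (fp + (i + j)) (suc ω) x ≢ 0
  keep x p with fp + (i + j) ≟ x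
  ... | yes refl = suc≢0 (set-same h _ _)
  ... | no ne = λ e → p (trans (sym (set-other h _ ne)) e)
  snd : ∀ σ ω′ → σ < N → set h (fp + (i + j)) (suc ω) (fp + σ) ≡ suc ω′ → S σ ω′
  snd σ ω′ σ<N e with i + j ≟ σ
  ... | yes refl with trans (sym (set-same h (fp + (i + j)) (suc ω))) e
  ...   | refl = s
  snd σ ω′ σ<N e | no ne = sound σ ω′ σ<N (trans (sym (set-other h _ (ne ∘ +-cancelˡ-≡ fp _ _))) e)

abstract
  -- `K` is quantified before all data, so it cannot depend on the input; its value is found by
  -- unification with the constants of the rules. The target table may already hold entries, since
  -- the joins for all labels of a child accumulate in one table of the parent.
  join-run : Σ[ K ∈ ℕ ] (∀ s N fp a₁ a₂ (S : ℕ → ℕ → Set) → s NN 0 ≡ N → s FP 0 ≡ fp → s A1 0 ≡ a₁ → s A2 0 ≡ a₂ →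
    a₁ + N ≤ fp → a₂ + N ≤ fp →
    (∀ σ → s AL σ ≢ 0 → σ < N) →
    (∀ σ ω → σ < N → s HEAP (fp + σ) ≡ suc ω → S σ ω) →
    (∀ σ₁ σ₂ ω₁ ω₂ → σ₁ < N → σ₂ < N → s HEAP (a₁ + σ₁) ≡ suc ω₁ → s HEAP (a₂ + σ₂) ≡ suc ω₂ → s AL (σ₁ + σ₂) ≢ 0 → S (σ₁ + σ₂) (ω₁ + ω₂)) →
    Run joinP s (λ s′ → Joined N fp (s HEAP) (s′ HEAP) (s AL) a₁ a₂ S (λ σ₁ _ → σ₁ < N)) K (N ⊛ N ⊛ 0))
  join-run = _ , λ s N fp a₁ a₂ S N≡ fp≡ a₁≡ a₂≡ f₁ f₂ al< s₀ comb →
    let J : (ℕ → ℕ) → (ℕ → ℕ → Set) → Set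
        J h done = Joined N fp (s HEAP) h (s AL) a₁ a₂ S done
        low : ∀ {a i} → a + N ≤ fp → i < N → a + i < fp
        low {a} f i<N = ≤-trans (+-monoʳ-< a i<N) f
    in
    run-for (λ i s′ → J (s′ HEAP) (λ σ₁ _ → σ₁ < i)) N tt tt (λ _ _ _ p → p)
      (λ i s₁ i<N i≡ fr j₁ →
        let e₁ : s₁ HEAP (s₁ A1 0 + s₁ S1 0) ≡ s HEAP (a₁ + i)
            e₁ = trans (cong (s₁ HEAP) (cong₂ _+_ (trans (fr A1 0) a₁≡) i≡)) (Joined.outside j₁ _ (inj₁ (low f₁ i<N)))
        in run-if
        (λ nz → run-post (λ s′ j′ _ → joined-skip (λ σ₁ σ₂ l₁ l₂ d _ _ _ → case m<1+n⇒m<n∨m≡n d of λ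
                    { (inj₁ lt) → inj₁ lt ; (inj₂ eq) → inj₂ (eq , l₂) }) j′)
          (run-for (λ j s′ → J (s′ HEAP) (λ σ₁ σ₂ → σ₁ < i ⊎ (σ₁ ≡ i × σ₂ < j))) N tt tt (λ _ _ _ p → p)
            (λ j s₂ j<N j≡ fr₂ j₂ →
              let e₂ : s₂ HEAP (s₂ A2 0 + s₂ S2 0) ≡ s HEAP (a₂ + j)
                  e₂ = trans (cong (s₂ HEAP) (cong₂ _+_ (trans (fr₂ A2 0) (trans (fr A2 0) a₂≡)) j≡)) (Joined.outside j₂ _ (inj₁ (low f₂ j<N)))
                  e₁′ : s₂ HEAP (s₂ A1 0 + s₂ S1 0) ≡ s HEAP (a₁ + i)
                  e₁′ = trans (cong (s₂ HEAP) (cong₂ _+_ (trans (fr₂ A1 0) (trans (fr A1 0) a₁≡)) (trans (fr₂ S1 0) i≡)))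
                          (Joined.outside j₂ _ (inj₁ (low f₁ i<N)))
                  ij : s₂ S1 0 + s₂ S2 0 ≡ i + j
                  ij = cong₂ _+_ (trans (fr₂ S1 0) i≡) j≡
                  eal : s₂ AL (s₂ S1 0 + s₂ S2 0) ≡ s AL (i + j)
                  eal = trans (fr₂ AL _) (trans (fr AL _) (cong (s AL) ij))
              in run-if
              (λ nz₂ → run-if
                (λ alnz →
                  let ω₁ , q₁ = n≢0⇒suc (λ z → nz (trans e₁ z))
                      ω₂ , q₂ = n≢0⇒suc (λ z → nz₂ (trans e₂ z))
                      al≢0 : s AL (i + j) ≢ 0
                      al≢0 z = alnz (trans eal z)
                  in run-assign (subst₂ (λ x v → J (set (s₂ HEAP) x v) (λ σ₁ σ₂ → σ₁ < i ⊎ (σ₁ ≡ i × σ₂ < suc j)))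
                       (sym (cong₂ _+_ (trans (fr₂ FP 0) (trans (fr FP 0) fp≡)) ij))
                       (sym (trans (cong (_∸ 1) (cong₂ _+_ (trans e₁′ q₁) (trans e₂ q₂))) (+-suc ω₁ ω₂)))
                       (joined-write i j (ω₁ + ω₂) (al< _ al≢0) (comb i j ω₁ ω₂ i<N j<N q₁ q₂ al≢0)
                         (λ { σ₁ σ₂ (inj₁ lt) → inj₁ (inj₁ lt)
                            ; σ₁ σ₂ (inj₂ (eq , lt)) → case m<1+n⇒m<n∨m≡n lt of λ { (inj₁ lt′) → inj₁ (inj₂ (eq , lt′)) ; (inj₂ eq′) → inj₂ (eq , eq′) } })
                         j₂)))
                (λ z → run-skip (joined-skip (λ { σ₁ σ₂ _ _ (inj₁ lt) _ _ _ → inj₁ lt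
                            ; σ₁ σ₂ _ _ (inj₂ (refl , lt)) _ _ a → case m<1+n⇒m<n∨m≡n lt of λ { (inj₁ lt′) → inj₂ (refl , lt′) ; (inj₂ refl) → contradiction (trans (sym eal) z) a } }) j₂)))
              (λ z → run-skip (joined-skip (λ { σ₁ σ₂ _ _ (inj₁ lt) _ _ _ → inj₁ lt
                            ; σ₁ σ₂ _ _ (inj₂ (refl , lt)) _ b _ → case m<1+n⇒m<n∨m≡n lt of λ { (inj₁ lt′) → inj₂ (refl , lt′) ; (inj₂ refl) → contradiction (trans (sym e₂) z) b } }) j₂)))
            (trans (fr NN 0) N≡)
            (joined-skip (λ { σ₁ σ₂ _ _ (inj₁ lt) _ _ _ → lt }) j₁)))
        (λ z → run-skip (joined-skip (λ σ₁ σ₂ _ _ d a _ _ → case m<1+n⇒m<n∨m≡n d of λ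
                    { (inj₁ lt) → lt ; (inj₂ refl) → contradiction (trans (sym e₁) z) a }) j₁)))
      N≡ (record { outside = λ _ _ → refl ; sound = s₀ ; grows = λ _ p → p ; complete = λ _ _ _ _ () })

-- Powers and digits

powersP : Program
powersP = PWR [ const 0 ]≔ const 1 ︔
  for DU (V CNT) (ACC ≔ const 0 ︔ for DD (V BASE) (ACC ≔+ PWR [ V DU ]) ︔ PWR [ V DU ⊕ const 1 ]≔ V ACC)

abstract
  powers-run : Σ[ K ∈ ℕ ] (∀ s base cnt → s BASE 0 ≡ base → s CNT 0 ≡ cnt →
    Run powersP s (λ s′ → ∀ u → u ≤ cnt → s′ PWR u ≡ base ^ u) K (cnt ⊛ base ⊛ 0))
  powers-run = _ , λ s base cnt base≡ cnt≡ → run-assign-seq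
    (run-for (λ i s′ → ∀ u → u ≤ i → s′ PWR u ≡ base ^ u) cnt tt tt (λ _ _ _ p → p)
      (λ i s₁ i<n i≡ fr inv → run-assign-seq (run-seq
         (run-for (λ d s′ → s′ ACC 0 ≡ d * base ^ i) base tt tt (λ _ _ _ p → p)
           (λ d s₂ d<b d≡ fr₂ acc → run-assign (trans (cong₂ _+_ acc (trans (fr₂ PWR _) (trans (cong (s₁ PWR) (trans (fr₂ DU 0) i≡)) (inv i ≤-refl))))
              (+-comm (d * base ^ i) (base ^ i))))
           (trans (fr BASE 0) base≡) refl)
         (λ s₂ acc fr₂ → run-size z≤n (run-assign (λ u u≤1+i →
           let ix : s₂ DU 0 + 1 ≡ suc i
               ix = trans (+-comm _ 1) (cong suc (trans (fr₂ DU 0) i≡))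
           in case m≤n⇒m<n∨m≡n u≤1+i of λ
             { (inj₁ u<1+i) → trans (set-other (s₂ PWR) {s₂ DU 0 + 1} {u} _ (λ e → <⇒≢ u<1+i (trans (sym e) ix)))
                                (trans (fr₂ PWR u) (inv u (s≤s⁻¹ u<1+i)))
             ; (inj₂ refl) → trans (cong (λ x → set (s₂ PWR) x (s₂ ACC 0) (suc i)) ix) (trans (set-same (s₂ PWR) (suc i) _) acc) })))))
      cnt≡ (λ { zero z≤n → refl }))

-- In place of division, digits are peeled off from the most significant one by at most `base`
-- subtractions each. The truncated difference `PX + 1 - PWR` is nonzero exactly when the power
-- still fits.
digitsP : Program
digitsP = for DU (V CNT) (UU ≔ V CNT ⊖ (V DU ⊕ const 1) ︔ LAB [ V UU ]≔ const 0 ︔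
  for DD (V BASE) (ifnz V PX ⊕ const 1 ⊖ PWR [ V UU ] then
    (PX ≔ V PX ⊖ PWR [ V UU ] ︔ LAB [ V UU ]≔ LAB [ V UU ] ⊕ const 1) else skip))

digits-low : ∀ base (g : ℕ → ℕ) U → (∀ u → u < U → g u < base) → ∑ U (λ u → g u * base ^ u) < base ^ U
digits-low base g zero    g< = z<s
digits-low base g (suc U) g< = ≤-trans
  (+-monoˡ-≤ (g U * base ^ U) (digits-low base g U (λ u lt → g< u (m<n⇒m<1+n lt))))
  (*-monoˡ-≤ (base ^ U) (g< U ≤-refl))

-- `rest` counts the subtractions still due. Either none is, or each of the `d` rounds has made one;
-- as the digit is below the base, none is due after `base` rounds.
record Digit (gU low pw : ℕ) (d : ℕ) (lab px : ℕ) : Set where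
  constructor mkDigit
  field
    rest  : ℕ
    total : lab + rest ≡ gU
    value : px ≡ low + rest * pw
    stage : rest ≡ 0 ⊎ lab ≡ d

digit-step : ∀ {gU low pw d lab px} → px + 1 ∸ pw ≢ 0 → low < pw → Digit gU low pw d lab px → Digit gU low pw (suc d) (lab + 1) (px ∸ pw)
digit-step {low = low} {pw} nz low<pw (mkDigit zero t v st) =
  contradiction (m≤n⇒m∸n≡0 (≤-trans (≤-reflexive (trans (cong (_+ 1) (trans v (+-identityʳ low))) (+-comm low 1))) low<pw)) nz
digit-step {low = low} {pw} {lab = lab} nz low<pw (mkDigit (suc r) t v (inj₂ refl)) = mkDigit r
  (trans (+-assoc lab 1 r) t)
  (trans (cong (_∸ pw) (trans v (trans (sym (+-assoc low pw (r * pw))) (trans (cong (_+ r * pw) (+-comm low pw)) (+-assoc pw low (r * pw))))))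
    (m+n∸m≡n pw (low + r * pw))) (inj₂ (+-comm lab 1))

digit-stop : ∀ {gU low pw d lab px} → px + 1 ∸ pw ≡ 0 → Digit gU low pw d lab px → Digit gU low pw (suc d) lab px
digit-stop z (mkDigit zero t v st) = mkDigit zero t v (inj₁ refl)
digit-stop {low = low} {pw} {px = px} z (mkDigit (suc r) t v st) = contradiction (m∸n≡0⇒m≤n z)
  (<⇒≱ (≤-trans (s≤s (≤-trans (m≤m+n pw (r * pw)) (m≤n+m _ low))) (≤-reflexive (trans (cong suc (sym v)) (+-comm 1 px)))))

suc-∸ : ∀ {i n} → i < n → n ∸ i ≡ suc (n ∸ suc i)
suc-∸ {i} {suc n} (s≤s i≤n) = +-∸-assoc 1 i≤n

abstract
  digits-run : Σ[ K ∈ ℕ ] (∀ s base cnt (g : ℕ → ℕ) → s BASE 0 ≡ base → s CNT 0 ≡ cnt → (∀ u → u < cnt → s PWR u ≡ base ^ u) →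
    (∀ u → u < cnt → g u < base) → s PX 0 ≡ ∑ cnt (λ u → g u * base ^ u) →
    Run digitsP s (λ s′ → ∀ u → u < cnt → s′ LAB u ≡ g u) K (cnt ⊛ base ⊛ 0))
  digits-run = _ , λ s base cnt g base≡ cnt≡ pw≡ g< px≡ →
    run-post (λ s′ inv _ u u<n → proj₂ inv u (≤-trans (≤-reflexive (n∸n≡0 cnt)) z≤n) u<n)
    (run-for (λ i s′ → s′ PX 0 ≡ ∑ (cnt ∸ i) (λ u → g u * base ^ u) × (∀ u → cnt ∸ i ≤ u → u < cnt → s′ LAB u ≡ g u)) cnt tt tt (λ _ _ _ p → p)
      (λ i s₁ i<n i≡ fr inv →
        let U = cnt ∸ suc i
            U≡ : s₁ CNT 0 ∸ (s₁ DU 0 + 1) ≡ U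
            U≡ = cong₂ _∸_ (trans (fr CNT 0) cnt≡) (trans (+-comm _ 1) (cong suc i≡))
            1+U : cnt ∸ i ≡ suc U
            1+U = suc-∸ i<n
            U<n : U < cnt
            U<n = ≤-trans (≤-reflexive (sym 1+U)) (m∸n≤m cnt i)
            low = ∑ U (λ u → g u * base ^ u)
            low<pw = digits-low base g U (λ u lt → g< u (<-trans lt U<n))
            Inv = λ d (lab : ℕ → ℕ) px → Digit (g U) low (base ^ U) d (lab U) px × (∀ u → suc U ≤ u → u < cnt → lab u ≡ g u)
        in run-assign-seq (run-assign-seq (run-post
          (λ s′ (mkDigit r t v st , hi) _ →
            let r≡0 : r ≡ 0
                r≡0 = [ (λ e → e) , (λ e → contradiction (≤-trans (m≤m+n _ r) (≤-reflexive t)) (<⇒≱ (≤-trans (g< U U<n) (≤-reflexive (sym e))))) ]′ st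
            in trans v (trans (cong (λ r → low + r * base ^ U) r≡0) (+-identityʳ low)) ,
               λ u U≤u u<n → case m≤n⇒m<n∨m≡n U≤u of λ
                 { (inj₁ lt) → hi u lt u<n
                 ; (inj₂ refl) → trans (sym (+-identityʳ _)) (trans (cong (s′ LAB U +_) (sym r≡0)) t) })
          (run-for (λ d s′ → Inv d (s′ LAB) (s′ PX 0)) base tt tt (λ _ _ _ p → p)
            (λ d s₂ d<b d≡ fr₂ (dig , hi) →
              let u≡ : s₂ UU 0 ≡ U
                  u≡ = trans (fr₂ UU 0) U≡
                  p≡ : s₂ PWR (s₂ UU 0) ≡ base ^ U
                  p≡ = trans (fr₂ PWR _) (trans (fr PWR _) (trans (cong (s PWR) u≡) (pw≡ U U<n)))
              in run-if
                (λ nz → run-assign-seq (run-assign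
                  ( subst₂ (Digit (g U) low (base ^ U) (suc d))
                      (sym (trans (cong (λ x → set (s₂ LAB) x (s₂ LAB (s₂ UU 0) + 1) U) u≡) (trans (set-same (s₂ LAB) U _) (cong (λ x → s₂ LAB x + 1) u≡))))
                      (cong (s₂ PX 0 ∸_) (sym p≡))
                      (digit-step (λ z → nz (trans (cong (s₂ PX 0 + 1 ∸_) p≡) z)) low<pw dig)
                  , λ u lt u<n → trans (set-other (s₂ LAB) {s₂ UU 0} {u} _ (λ e → <⇒≢ lt (trans (sym u≡) e))) (hi u lt u<n))))
                (λ z → run-skip (digit-stop (trans (cong (s₂ PX 0 + 1 ∸_) (sym p≡)) z) dig , hi)))
            (trans (fr BASE 0) base≡)
            ( mkDigit (g U) (cong (_+ g U) (trans (cong (λ x → set (s₁ LAB) x 0 U) U≡) (set-same (s₁ LAB) U 0)))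
                (trans (proj₁ inv) (cong (λ k → ∑ k (λ u → g u * base ^ u)) 1+U))
                (inj₂ (trans (cong (λ x → set (s₁ LAB) x 0 U) U≡) (set-same (s₁ LAB) U 0)))
            , λ u lt u<n → trans (set-other (s₁ LAB) {s₁ CNT 0 ∸ (s₁ DU 0 + 1)} {u} 0 (λ e → <⇒≢ lt (trans (sym U≡) e)))
                (proj₂ inv u (≤-trans (≤-reflexive 1+U) lt) u<n))))))
      cnt≡ (px≡ , λ u n≤u u<n → contradiction n≤u (<⇒≱ u<n)))

-- The dynamic program

index-mono : ∀ {L i j x y} → i < j → x < L → L * i + x < L * j + y
index-mono {L} {i} {j} {x} {y} i<j x<L = ≤-trans (+-monoʳ-< (L * i) x<L) (≤-trans (≤-reflexive (trans (+-comm (L * i) L) (sym (*-suc L i))))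
  (≤-trans (*-monoʳ-≤ L i<j) (m≤m+n (L * j) y)))

index-inj : ∀ {L i j x y} → x < L → y < L → L * i + x ≡ L * j + y → i ≡ j × x ≡ y
index-inj {L} {i} {j} {x} {y} x<L y<L eq with <-cmp i j
... | tri≈ _ refl _ = refl , +-cancelˡ-≡ (L * i) x y eq
... | tri< i<j _ _ = contradiction eq (<⇒≢ (index-mono i<j x<L))
... | tri> _ _ j<i = contradiction (sym eq) (<⇒≢ (index-mono j<i y<L))

index< : ∀ {L i m x} → i < m → x < L → L * i + x < m * L
index< {L} {i} {m} {x} i<m x<L = ≤-trans (+-monoʳ-< (L * i) x<L)
  (≤-trans (≤-reflexive (trans (+-comm (L * i) L) (trans (sym (*-suc L i)) (*-comm L (suc i))))) (*-monoˡ-≤ L i<m))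

index-/ : ∀ {b} .{{_ : NonZero b}} x {a} → a < b → (b * x + a) / b ≡ x
index-/ {b} x {a} a<b = trans (cong (_/ b) (trans (+-comm (b * x) a) (cong (a +_) (*-comm b x)))) ([m+kn]/n≡k a x a<b)

index-% : ∀ {b} .{{_ : NonZero b}} x {a} → a < b → (b * x + a) % b ≡ a
index-% {b} x {a} a<b = trans (cong (_% b) (trans (+-comm (b * x) a) (cong (a +_) (*-comm b x))))
  (trans ([m+kn]%n≡m%n a x b) (m<n⇒m%n≡m a<b))

pairE : ∀ b .{{_ : NonZero b}} → (ℕ → ℕ → ℕ) → ℕ → Expr → Expr → Expr
pairE b f L X A = lookupE (λ z → f (z / b) (z % b)) (L * b) (times b X ⊕ A)

⟦pairE⟧ : ∀ b .{{_ : NonZero b}} f L X A s {x a} → ⟦ X ⟧ s ≡ x → ⟦ A ⟧ s ≡ a → x < L → a < b → ⟦ pairE b f L X A ⟧ s ≡ f x a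
⟦pairE⟧ b f L X A s refl refl x<L a<b =
  trans (⟦lookupE⟧ _ (L * b) (times b X ⊕ A) s (subst (_< L * b) (sym ix) (index< x<L a<b)))
    (trans (cong (λ z → f (z / b) (z % b)) ix) (cong₂ f (index-/ (⟦ X ⟧ s) a<b) (index-% (⟦ X ⟧ s) a<b)))
  where
  ix : ⟦ times b X ⊕ A ⟧ s ≡ b * ⟦ X ⟧ s + ⟦ A ⟧ s
  ix = cong (_+ ⟦ A ⟧ s) (⟦times⟧ b X s)

Edge : Store → ℕ → ℕ → Set
Edge s u v = s ADJ (s ROW u + v) ≢ 0

-- Each summand is an implication between truth values, written as a truncated difference: equal
-- vertices have equal labels, and adjacent ones no conflict. Subtracting twice from 1 turns every
-- nonzero entry into 1.
violation : (u u′ l l′ e c : ℕ) → ℕ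
violation u u′ l l′ e c = (δ u u′ ∸ δ l l′) + ((1 ∸ (1 ∸ e)) ∸ (1 ∸ c))

violation≡0⇒ : ∀ {u u′ l l′ e c} → violation u u′ l l′ e c ≡ 0 → (u ≡ u′ → l ≡ l′) × (e ≢ 0 → ¬ (c ≢ 0))
violation≡0⇒ {u} {u′} {l} {l′} {e} {c} z = f , g e c (m+n≡0⇒n≡0 (δ u u′ ∸ δ l l′) z)
  where
  f : u ≡ u′ → l ≡ l′
  f eq with l ≟ l′
  ... | yes p = p
  ... | no  p with trans (sym (cong₂ _∸_ (δ-≡ eq) (δ-≢ p))) (m+n≡0⇒m≡0 (δ u u′ ∸ δ l l′) z)
  ...   | ()
  g : ∀ e c → (1 ∸ (1 ∸ e)) ∸ (1 ∸ c) ≡ 0 → e ≢ 0 → ¬ (c ≢ 0)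
  g zero    c       z p q = p refl
  g (suc e) zero    z p q = q refl
  g (suc e) (suc c) z p q with trans (sym (cong₂ (λ x y → (1 ∸ x) ∸ y) (0∸n≡0 e) (0∸n≡0 c))) z
  ... | ()

⇒violation≡0 : ∀ {u u′ l l′ e c} → (u ≡ u′ → l ≡ l′) → (e ≢ 0 → ¬ (c ≢ 0)) → violation u u′ l l′ e c ≡ 0
⇒violation≡0 {u} {u′} {l} {l′} {e} {c} f g = cong₂ _+_ p (r e c g)
  where
  p : δ u u′ ∸ δ l l′ ≡ 0
  p with u ≟ u′
  ... | no ne  = trans (cong (_∸ δ l l′) (δ-≢ ne)) (0∸n≡0 (δ l l′))
  ... | yes eq = cong₂ _∸_ (δ-≡ eq) (δ-≡ (f eq))
  r : ∀ e c → (e ≢ 0 → ¬ (c ≢ 0)) → (1 ∸ (1 ∸ e)) ∸ (1 ∸ c) ≡ 0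
  r zero    c       g = 0∸n≡0 (1 ∸ c)
  r (suc e) zero    g = m≤n⇒m∸n≡0 (m∸n≤m 1 (1 ∸ suc e))
  r (suc e) (suc c) g = contradiction (λ ()) (g (λ ()))

module DP (b q : ℕ) .{{_ : NonZero b}} .{{_ : NonZero q}} (conf : ℕ → ℕ → ℕ) where

  L : ℕ
  L = q ^ b

  digE : Expr → Expr → Expr
  digE = pairE b (digit q) L

  checkE : Expr
  checkE = sumE b λ a → sumE b λ a′ →
    let u  = BAG [ times b (V CI) ⊕ const a ]
        u′ = BAG [ times b (V CP) ⊕ const a′ ]
        l  = digE (V CX) (const a)
        l′ = digE (V CY) (const a′)
    in (eqE u u′ ⊖ eqE l l′) ⊕ ((const 1 ⊖ (const 1 ⊖ ADJ [ ROW [ u ] ⊕ u′ ])) ⊖ (const 1 ⊖ pairE q conf q l l′))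

  ⟦checkE⟧ : ∀ s {i x p y} → s CI 0 ≡ i → s CX 0 ≡ x → s CP 0 ≡ p → s CY 0 ≡ y → x < L → y < L →
    ⟦ checkE ⟧ s ≡ ∑ b (λ a → ∑ b (λ a′ → violation (s BAG (b * i + a)) (s BAG (b * p + a′)) (digit q x a) (digit q y a′)
      (s ADJ (s ROW (s BAG (b * i + a)) + s BAG (b * p + a′))) (conf (digit q x a) (digit q y a′))))
  ⟦checkE⟧ s {i} {x} {p} {y} refl refl refl refl x<L y<L = trans (⟦sumE⟧ b _ s) (∑-cong b λ a a<b → trans (⟦sumE⟧ b _ s) (∑-cong b λ a′ a′<b →
    let l≡ = ⟦pairE⟧ b (digit q) L (V CX) (const a) s refl refl x<L a<b
        l′≡ = ⟦pairE⟧ b (digit q) L (V CY) (const a′) s refl refl y<L a′<b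
        u≡ = cong (λ k → s BAG (k + a)) (⟦times⟧ b (V CI) s)
        u′≡ = cong (λ k → s BAG (k + a′)) (⟦times⟧ b (V CP) s)
    in cong₂ _+_ (cong₂ _∸_ (cong₂ δ u≡ u′≡) (cong₂ δ l≡ l′≡))
         (cong₂ _∸_ (cong (λ k → 1 ∸ (1 ∸ k)) (cong (s ADJ) (cong₂ _+_ (cong (s ROW) u≡) u′≡)))
           (cong (1 ∸_) (⟦pairE⟧ q conf q _ _ s l≡ l′≡ (digit< q x a) (digit< q y a′))))))

  record Input (s : Store) : Set where
    field
      td    : Rooted b (Edge s) (s NV 0) (s MM 0) (s BAG) (s PAR) (s HN) (s HS)
      al<   : ∀ σ → s AL σ ≢ 0 → σ < s NN 0
      fresh : ∀ z → s FP 0 ≤ z → s HEAP z ≡ 0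

  record Static (s s₀ : Store) : Set where
    field
      adjˢ : ∀ i → s ADJ i ≡ s₀ ADJ i
      rowˢ : ∀ i → s ROW i ≡ s₀ ROW i
      bagˢ : ∀ i → s BAG i ≡ s₀ BAG i
      parˢ : ∀ i → s PAR i ≡ s₀ PAR i
      hnˢ  : ∀ i → s HN i ≡ s₀ HN i
      hsˢ  : ∀ i → s HS i ≡ s₀ HS i
      mmˢ  : ∀ i → s MM i ≡ s₀ MM i
      nvˢ  : ∀ i → s NV i ≡ s₀ NV i
      wtˢ  : ∀ i → s WT i ≡ s₀ WT i
      alˢ  : ∀ i → s AL i ≡ s₀ AL i
      nnˢ  : ∀ i → s NN i ≡ s₀ NN i
      valˢ : ∀ i → s VAL i ≡ s₀ VAL i

  static-refl : ∀ s → Static s s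
  static-refl s = record { adjˢ = λ _ → refl ; rowˢ = λ _ → refl ; bagˢ = λ _ → refl ; parˢ = λ _ → refl ; hnˢ = λ _ → refl ; hsˢ = λ _ → refl
    ; mmˢ = λ _ → refl ; nvˢ = λ _ → refl ; wtˢ = λ _ → refl ; alˢ = λ _ → refl ; nnˢ = λ _ → refl ; valˢ = λ _ → refl }

  keepsInput : Program → Bool
  keepsInput c = (keeps c ADJ ∧ keeps c ROW ∧ keeps c BAG ∧ keeps c PAR) ∧ (keeps c HN ∧ keeps c HS ∧ keeps c MM ∧ keeps c NV) ∧
    (keeps c WT ∧ keeps c AL ∧ keeps c NN ∧ keeps c VAL)

  static-frame : ∀ {s s₁ s₀} c {_ : T (keepsInput c)} → s₁ ≈[ c ] s → Static s s₀ → Static s₁ s₀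
  static-frame {s} {s₁} {s₀} c {k} fr st = record
    { adjˢ = go ADJ (T-∧₁ ka) adjˢ ; rowˢ = go ROW (T-∧₁ (T-∧₂ {keeps c ADJ} ka)) rowˢ
    ; bagˢ = go BAG (T-∧₁ (T-∧₂ {keeps c ROW} (T-∧₂ {keeps c ADJ} ka))) bagˢ ; parˢ = go PAR (T-∧₂ {keeps c BAG} (T-∧₂ {keeps c ROW} (T-∧₂ {keeps c ADJ} ka))) parˢ
    ; hnˢ = go HN (T-∧₁ kb) hnˢ ; hsˢ = go HS (T-∧₁ (T-∧₂ {keeps c HN} kb)) hsˢ
    ; mmˢ = go MM (T-∧₁ (T-∧₂ {keeps c HS} (T-∧₂ {keeps c HN} kb))) mmˢ ; nvˢ = go NV (T-∧₂ {keeps c MM} (T-∧₂ {keeps c HS} (T-∧₂ {keeps c HN} kb))) nvˢ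
    ; wtˢ = go WT (T-∧₁ kc) wtˢ ; alˢ = go AL (T-∧₁ (T-∧₂ {keeps c WT} kc)) alˢ
    ; nnˢ = go NN (T-∧₁ (T-∧₂ {keeps c AL} (T-∧₂ {keeps c WT} kc))) nnˢ ; valˢ = go VAL (T-∧₂ {keeps c NN} (T-∧₂ {keeps c AL} (T-∧₂ {keeps c WT} kc))) valˢ }
    where
    open Static st
    ka = T-∧₁ {keeps c ADJ ∧ keeps c ROW ∧ keeps c BAG ∧ keeps c PAR} k
    kbc = T-∧₂ {keeps c ADJ ∧ keeps c ROW ∧ keeps c BAG ∧ keeps c PAR} k
    kb = T-∧₁ {keeps c HN ∧ keeps c HS ∧ keeps c MM ∧ keeps c NV} kbc
    kc = T-∧₂ {keeps c HN ∧ keeps c HS ∧ keeps c MM ∧ keeps c NV} kbc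
    go : ∀ a → T (keeps c a) → (∀ i → s a i ≡ s₀ a i) → ∀ i → s₁ a i ≡ s₀ a i
    go a k f i = trans (fr a {k} i) (f i)

  module Spec (s₀ : Store) (inp : Input s₀) where
    open Input inp public

    nv m N : ℕ
    nv = s₀ NV 0
    m  = s₀ MM 0
    N  = s₀ NN 0

    W₁ W₂ : ℕ → ℕ → ℕ
    W₁ u l = s₀ WT (q * u + l)
    W₂ u l = l * q ^ u

    Conf : ℕ → ℕ → Set
    Conf l l′ = conf l l′ ≢ 0

    open Semantics b q (Edge s₀) Conf nv m (s₀ BAG) (s₀ PAR) (s₀ HN) (s₀ HS) td (digit q) (digit< q) W₁ W₂ public
    open Rooted td public

    -- `allowed` quantifies over all vertex sets because the parts on which the program evaluates
    -- `g` depend on the decomposition and on the stage of merging.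
    record Target (g : ℕ → ℕ) : Set where
      field
        g<      : ∀ u → g u < q
        proper  : ∀ u v → u < nv → v < nv → Edge s₀ u v → ¬ Conf (g u) (g v)
        allowed : ∀ (X : ℕ → Bool) → s₀ AL (∑ nv (λ u → when (X u) (W₁ u (g u)))) ≢ 0

    part-allowed : ∀ {g} c p → Target g → s₀ AL (part c p W₁ g) ≢ 0
    part-allowed c p t = Target.allowed t (λ u → c (s₀ HN u) ≡ᵇ p)

    target-compatible : ∀ {g i x p y} → i < m → p < m → Target g → OnBag g i x → OnBag g p y → Compatible i x p y
    target-compatible {g} i<m p<m t on on′ a a′ a<b a′<b =
      (λ eq → trans (sym (on a a<b)) (trans (cong g eq) (on′ a′ a′<b))) ,
      (λ e → subst₂ (λ l l′ → ¬ Conf l l′) (on a a<b) (on′ a′ a′<b) (Target.proper t _ _ (bag< _ a i<m a<b) (bag< _ a′ p<m a′<b) e))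

    code : (ℕ → ℕ) → ℕ → ℕ
    code g i = encode q b (λ a → g (s₀ BAG (b * i + a)))

    code< : ∀ {g} i → Target g → code g i < L
    code< i t = encode< q b _ (λ a _ → Target.g< t _)

    code-on : ∀ {g} i → Target g → OnBag g i (code g i)
    code-on i t a a<b = sym (digit-encode q b _ (λ a _ → Target.g< t _) a a<b)

    -- Soundness concerns all labellings of the absorbed part, completeness only the restrictions of
    -- labellings of the whole graph. This suffices for an optimum, and partial labellings never
    -- have to be extended.
    record Tbl (c : ℕ → ℕ) (p x : ℕ) (h : ℕ → ℕ) (fp a : ℕ) : Set where
      field
        fits     : a + N ≤ fp
        sound    : ∀ σ ω → σ < N → h (a + σ) ≡ suc ω → Sem c p x σ ω × s₀ AL σ ≢ 0
        complete : ∀ g → Target g → OnBag g p x → h (a + part c p W₁ g) ≢ 0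

    tbl-extend : ∀ {c p x h h′ fp fp′ a} → (∀ z → z < fp → h′ z ≡ h z) → fp ≤ fp′ → Tbl c p x h fp a → Tbl c p x h′ fp′ a
    tbl-extend {c} {p} {a = a} same le t = record
      { fits = ≤-trans fits le
      ; sound = λ σ ω σ<N e → sound σ ω σ<N (trans (sym (same _ (≤-trans (+-monoʳ-< a σ<N) fits))) e)
      ; complete = λ g tg on e → complete g tg on (trans (sym (same _ (≤-trans (+-monoʳ-< a (al< _ (part-allowed c p tg))) fits))) e) }
      where open Tbl t

    record New (c : ℕ → ℕ) (p x : ℕ) (D : (ℕ → ℕ) → Set) (h₀ h : ℕ → ℕ) (fp : ℕ) : Set where
      field
        below    : ∀ z → z < fp → h z ≡ h₀ z
        above    : ∀ z → fp + N ≤ z → h z ≡ 0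
        sound    : ∀ σ ω → σ < N → h (fp + σ) ≡ suc ω → Sem c p x σ ω × s₀ AL σ ≢ 0
        complete : ∀ g → Target g → OnBag g p x → D g → h (fp + part c p W₁ g) ≢ 0

    new-table : ∀ {c p x D h₀ h fp} → (∀ g → Target g → D g) → New c p x D h₀ h fp → Tbl c p x h (fp + N) fp
    new-table d n = record { fits = ≤-refl ; sound = sound ; complete = λ g t on → complete g t on (d g t) }
      where open New n

    new-empty : ∀ {c p x D h fp} → (∀ g → Target g → OnBag g p x → ¬ D g) → (∀ z → fp ≤ z → h z ≡ 0) → New c p x D h h fp
    new-empty {fp = fp} nd fr = record { below = λ _ _ → refl ; above = λ z le → fr z (≤-trans (m≤m+n fp N) le)
      ; sound = λ σ ω _ e → case trans (sym (fr _ (m≤m+n fp σ))) e of λ ()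
      ; complete = λ g t on d → contradiction d (nd g t on) }

    check-sound : ∀ s → Static s s₀ → ∀ {i x p y} → s CI 0 ≡ i → s CX 0 ≡ x → s CP 0 ≡ p → s CY 0 ≡ y → x < L → y < L →
      ⟦ checkE ⟧ s ≡ 0 → Compatible i x p y
    check-sound s st {i} {x} {p} {y} e₁ e₂ e₃ e₄ x<L y<L z a a′ a<b a′<b =
      let v = violation≡0⇒ (∑≡0⇒ b (∑≡0⇒ b (trans (sym (⟦checkE⟧ s e₁ e₂ e₃ e₄ x<L y<L)) z) a a<b) a′ a′<b)
      in (λ eq → proj₁ v (trans (bagˢ _) (trans eq (sym (bagˢ _))))) ,
         (λ e → proj₂ v (λ e′ → e (trans (sym (trans (adjˢ _) (cong (s₀ ADJ) (cong₂ _+_ (trans (rowˢ _) (cong (s₀ ROW) (bagˢ _))) (bagˢ _))))) e′)))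
      where open Static st

    check-complete : ∀ s → Static s s₀ → ∀ {i x p y} → s CI 0 ≡ i → s CX 0 ≡ x → s CP 0 ≡ p → s CY 0 ≡ y → x < L → y < L →
      Compatible i x p y → ⟦ checkE ⟧ s ≡ 0
    check-complete s st {i} {x} {p} {y} e₁ e₂ e₃ e₄ x<L y<L ok = trans (⟦checkE⟧ s e₁ e₂ e₃ e₄ x<L y<L)
      (∑-zero b λ a a<b → ∑-zero b λ a′ a′<b → ⇒violation≡0
        (λ eq → proj₁ (ok a a′ a<b a′<b) (trans (sym (bagˢ _)) (trans eq (bagˢ _))))
        (λ e → proj₂ (ok a a′ a<b a′<b) (λ e′ → e (trans (adjˢ _) (trans (cong (s₀ ADJ) (cong₂ _+_ (trans (rowˢ _) (cong (s₀ ROW) (bagˢ _))) (bagˢ _))) e′)))))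
      where open Static st

-- Tables of single nodes

both≢0⇒ : ∀ {x i y a} → δ x i ∸ (1 ∸ δ y a) ≢ 0 → x ≡ i × y ≡ a
both≢0⇒ {x} {i} {y} {a} nz with x ≟ i | y ≟ a
... | yes p | yes q = p , q
... | no  p | _     = contradiction (trans (cong (_∸ (1 ∸ δ y a)) (δ-≢ p)) (0∸n≡0 (1 ∸ δ y a))) nz
... | yes p | no  q = contradiction (cong₂ (λ e f → e ∸ (1 ∸ f)) (δ-≡ p) (δ-≢ q)) nz

both≡0⇒ : ∀ {x i y a} → δ x i ∸ (1 ∸ δ y a) ≡ 0 → ((x ≡ᵇ i) ∧ (y ≡ᵇ a)) ≡ false
both≡0⇒ {x} {i} {y} {a} z with x ≟ i | y ≟ a
... | yes p | yes q = case trans (sym (cong₂ (λ e f → e ∸ (1 ∸ f)) (δ-≡ p) (δ-≡ q))) z of λ ()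
... | no  p | _     rewrite ≢⇒≡ᵇ p = refl
... | yes p | no  q rewrite ≢⇒≡ᵇ q with x ≡ᵇ i
...   | true  = refl
...   | false = refl

module DPInit (b q : ℕ) .{{_ : NonZero b}} .{{_ : NonZero q}} (conf : ℕ → ℕ → ℕ) where
  open DP b q conf public

  slotP : Program
  slotP = UU ≔ BAG [ times b (V CI) ⊕ V SL ] ︔
    (ifnz eqE (HN [ V UU ]) (V CI) ⊖ (const 1 ⊖ eqE (HS [ V UU ]) (V SL)) then
      -- The contribution `l * q ^ u` to the code takes `l < q` additions of a tabulated power.
      (LV ≔ digE (V CX) (V SL) ︔ DEL ≔+ WT [ times q (V UU) ⊕ V LV ] ︔ for DD (V LV) (OME ≔+ PWR [ V UU ]))
     else skip)

  cellP : Program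
  cellP = DEL ≔ const 0 ︔ OME ≔ const 0 ︔ for SL (const b) slotP ︔
    (ifnz AL [ V DEL ] then HEAP [ V FP ⊕ V DEL ]≔ V OME ⊕ const 1 else skip)

  initNodeP : Program
  -- The check between two nodes is applied to a node and itself. A code that fails it receives a
  -- table all the same, an empty one, since every cell `L * i + x` must hold a valid address.
  initNodeP = for CX (const L) (TAB [ times L (V CI) ⊕ V CX ]≔ V FP ︔ CP ≔ V CI ︔ CY ≔ V CX ︔
    (ifnz checkE then skip else cellP) ︔ FP ≔+ V NN)

  initP : Program
  initP = for CI (V MM) initNodeP

  tbl-keep : ∀ s₀ (inp : Input s₀) (let open Spec s₀ inp) {c p x D h₀ h fp j y k fp′ c₂} {tab′ tab : ℕ → ℕ} → New c p x D h₀ h fp → fp′ ≡ fp + N →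
    (∀ z → tab′ z ≡ set tab k fp z) → k ≢ L * j + y →
    Tbl c₂ j y h₀ fp (tab (L * j + y)) → Tbl c₂ j y h fp′ (tab′ (L * j + y))
  tbl-keep s₀ inp {fp = fp} {k = k} {tab = tab} new refl tab≡ ne t = let open Spec s₀ inp in
    subst (Tbl _ _ _ _ _) (sym (trans (tab≡ _) (set-other tab {k} fp ne))) (tbl-extend (New.below new) (m≤m+n fp N) t)

  Powers : Store → ℕ → Set
  Powers s nv = ∀ u → u < nv → s PWR u ≡ q ^ u

  abstract
    slots-run : Σ[ K ∈ ℕ ] (∀ s₀ (inp : Input s₀) (let open Spec s₀ inp) s i x → Static s s₀ → Powers s nv → i < m → x < L →
      s CI 0 ≡ i → s CX 0 ≡ x → s DEL 0 ≡ 0 → s OME 0 ≡ 0 →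
      Run (for SL (const b) slotP) s (λ s′ → s′ DEL 0 ≡ homeSum W₁ i x × s′ OME 0 ≡ homeSum W₂ i x) K 0)
    slots-run = _ , λ s₀ inp s i x st pw i<m x<L i≡ x≡ d≡ o≡ →
      let open Spec s₀ inp
          term : (ℕ → ℕ → ℕ) → ℕ → ℕ
          term W a = when ((s₀ HN (s₀ BAG (b * i + a)) ≡ᵇ i) ∧ (s₀ HS (s₀ BAG (b * i + a)) ≡ᵇ a)) (W (s₀ BAG (b * i + a)) (digit q x a))
      in run-forᶜ (λ a s′ → s′ DEL 0 ≡ ∑ a (term W₁) × s′ OME 0 ≡ ∑ a (term W₂)) b tt tt (λ _ _ _ p → p)
        (λ a s₁ a<b a≡ fr (d₁ , o₁) →
          let st₁ = static-frame (for SL (const b) slotP) fr st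
              open Static st₁
              u = s₀ BAG (b * i + a)
              u≡ : s₁ BAG (⟦ times b (V CI) ⟧ s₁ + s₁ SL 0) ≡ u
              u≡ = trans (bagˢ _) (cong (s₀ BAG) (cong₂ _+_ (trans (⟦times⟧ b (V CI) s₁) (cong (b *_) (trans (fr CI 0) i≡))) a≡))
              s₂ = update s₁ UU 0 (s₁ BAG (⟦ times b (V CI) ⟧ s₁ + s₁ SL 0))
              h≡ : δ (s₂ HN (s₂ UU 0)) (s₂ CI 0) ∸ (1 ∸ δ (s₂ HS (s₂ UU 0)) (s₂ SL 0)) ≡ δ (s₀ HN u) i ∸ (1 ∸ δ (s₀ HS u) a)
              h≡ = cong₂ _∸_ (cong₂ δ (trans (hnˢ _) (cong (s₀ HN) u≡)) (trans (fr CI 0) i≡))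
                     (cong (1 ∸_) (cong₂ δ (trans (hsˢ _) (cong (s₀ HS) u≡)) a≡))
              l = digit q x a
              l≡ : ⟦ digE (V CX) (V SL) ⟧ s₂ ≡ l
              l≡ = ⟦pairE⟧ b (digit q) L (V CX) (V SL) s₂ (trans (fr CX 0) x≡) a≡ x<L a<b
              u<nv = bag< i a i<m a<b
          in run-assign-seq (run-if
            (λ nz →
              let hn≡ , hs≡ = both≢0⇒ {s₀ HN u} {i} {s₀ HS u} {a} (λ z → nz (trans h≡ z))
                  home : (s₀ HN u ≡ᵇ i) ∧ (s₀ HS u ≡ᵇ a) ≡ true
                  home = cong₂ _∧_ (≡ᵇ-true hn≡) (≡ᵇ-true hs≡)
                  s₃ = update s₂ LV 0 (⟦ digE (V CX) (V SL) ⟧ s₂)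
                  w≡ : s₁ DEL 0 + s₁ WT (⟦ times q (V UU) ⟧ s₃ + s₃ LV 0) ≡ ∑ (suc a) (term W₁)
                  w≡ = cong₂ _+_ d₁ (trans (wtˢ _) (trans (cong (s₀ WT) (cong₂ _+_ (trans (⟦times⟧ q (V UU) s₃) (cong (q *_) u≡)) l≡))
                         (cong (λ t → when t (W₁ u l)) (sym home))))
                  s₄ = update s₃ DEL 0 (s₁ DEL 0 + s₁ WT (⟦ times q (V UU) ⟧ s₃ + s₃ LV 0))
              in run-assign-seq (run-assign-seq
                (run-post (λ s′ o′ fr′ → trans (fr′ DEL 0) w≡ ,
                    trans o′ (cong (∑ a (term W₂) +_) (cong (λ t → when t (W₂ u l)) (sym home))))
                (run-forᶜ (λ d s′ → s′ OME 0 ≡ ∑ a (term W₂) + d * q ^ u) l tt tt (λ _ _ _ p → p)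
                  (λ d s₅ d<l d≡ fr₅ o₅ → run-assign (trans (cong₂ _+_ o₅ (trans (fr₅ PWR _) (trans (fr PWR _)
                      (trans (cong (s PWR) (trans (fr₅ UU 0) u≡)) (pw u u<nv)))))
                    (trans (+-assoc (∑ a (term W₂)) (d * q ^ u) (q ^ u)) (cong (∑ a (term W₂) +_) (+-comm (d * q ^ u) (q ^ u))))))
                  q (<⇒≤ (digit< q x a)) l≡ (trans o₁ (sym (+-identityʳ _)))))))
            (λ z → let away : (s₀ HN u ≡ᵇ i) ∧ (s₀ HS u ≡ᵇ a) ≡ false
                       away = both≡0⇒ {s₀ HN u} {i} {s₀ HS u} {a} (trans (sym h≡) z)
                   in run-skip (trans (sym (+-identityʳ _)) (cong₂ _+_ d₁ (cong (λ t → when t (W₁ u l)) (sym away))) ,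
                                trans (sym (+-identityʳ _)) (cong₂ _+_ o₁ (cong (λ t → when t (W₂ u l)) (sym away)))))))
        b ≤-refl refl (d≡ , o≡)

    cell-run : Σ[ K ∈ ℕ ] (∀ s₀ (inp : Input s₀) (let open Spec s₀ inp) s i x → Static s s₀ → Powers s nv → i < m → x < L →
      s CI 0 ≡ i → s CX 0 ≡ x → Compatible i x i x → (∀ z → s FP 0 ≤ z → s HEAP z ≡ 0) →
      Run cellP s (λ s′ → New (λ j → j) i x (λ _ → Unit) (s HEAP) (s′ HEAP) (s FP 0)) K 0)
    cell-run = _ , λ s₀ inp s i x st pw i<m x<L i≡ x≡ ok fr →
      let open Spec s₀ inp
          fp = s FP 0
          d₀ = homeSum W₁ i x
      in run-assign-seq (run-assign-seq (run-seq
        (proj₂ slots-run s₀ inp (update (update s DEL 0 0) OME 0 0) i x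
          (static-frame (DEL ≔ const 0 ︔ OME ≔ const 0) (λ { a {k} j → execution-keeps (seq (assign {DEL} {const 0} {const 0} {s}) (assign {OME} {const 0} {const 0})) a {k} j }) st)
          pw i<m x<L i≡ x≡ refl refl)
        (λ s₁ (d≡ , o≡) fr₁ →
          let h≡ : ∀ z → s₁ HEAP z ≡ s HEAP z
              h≡ z = fr₁ HEAP z
              al≡ : s₁ AL (s₁ DEL 0) ≡ s₀ AL d₀
              al≡ = trans (fr₁ AL _) (trans (Static.alˢ st _) (cong (s₀ AL) d≡))
          in run-if
          (λ nz →
            let d<N = al< d₀ (λ z → nz (trans al≡ z))
                Q : (ℕ → ℕ) → Set
                Q h = New (λ j → j) i x (λ _ → Unit) (s HEAP) h fp
            in run-assign (subst₂ (λ a v → Q (set (s₁ HEAP) a v)) (sym (cong₂ _+_ (fr₁ FP 0) d≡)) (sym (trans (cong (_+ 1) o≡) (+-comm _ 1)))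
              (record
                { below = λ z z<fp → trans (set-other (s₁ HEAP) {fp + d₀} {z} _ (λ e → <⇒≱ z<fp (≤-trans (m≤m+n fp d₀) (≤-reflexive e)))) (h≡ z)
                ; above = λ z le → trans (set-other (s₁ HEAP) {fp + d₀} {z} _ (λ e → <⇒≱ (+-monoʳ-< fp d<N) (≤-trans le (≤-reflexive (sym e)))))
                            (trans (h≡ z) (fr z (≤-trans (m≤m+n fp _) le)))
                ; sound = λ σ ω σ<N e → case d₀ ≟ σ of λ
                    { (yes refl) → subst (Sem (λ j → j) i x d₀) (suc-injective (trans (sym (set-same (s₁ HEAP) (fp + d₀) _)) e)) (sem-init i x i<m ok)
                                 , λ z → nz (trans al≡ z)
                    ; (no ne) → case trans (sym (trans (set-other (s₁ HEAP) {fp + d₀} {fp + σ} _ (ne ∘ +-cancelˡ-≡ fp _ _)) (trans (h≡ _) (fr _ (m≤m+n fp σ))))) e of λ () }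
                ; complete = λ g t on _ → suc≢0 (trans (cong (λ d → set (s₁ HEAP) (fp + d₀) (suc (homeSum W₂ i x)) (fp + d)) (sym (homeSum-part W₁ i x g i<m on)))
                               (set-same (s₁ HEAP) (fp + d₀) _)) })))
          (λ z → run-skip (record
                { below = λ z _ → h≡ z
                ; above = λ z le → trans (h≡ z) (fr z (≤-trans (m≤m+n fp _) le))
                ; sound = λ σ ω σ<N e → case trans (sym (trans (h≡ _) (fr _ (m≤m+n fp σ)))) e of λ ()
                ; complete = λ g t on _ → contradiction (trans (cong (s₀ AL) (sym (homeSum-part W₁ i x g i<m on))) (trans (sym al≡) z)) (part-allowed (λ j → j) i t) })))))

    init-run : Σ[ K ∈ ℕ ] (∀ s₀ (inp : Input s₀) (let open Spec s₀ inp) s → Static s s₀ → Powers s nv → (∀ z → s FP 0 ≤ z → s HEAP z ≡ 0) →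
      Run initP s (λ s′ → (∀ j y → j < m → y < L → Tbl (λ j → j) j y (s′ HEAP) (s′ FP 0) (s′ TAB (L * j + y))) × (∀ z → s′ FP 0 ≤ z → s′ HEAP z ≡ 0)) K (m ⊛ 0))
    init-run = _ , λ s₀ inp s st pw fresh₀ →
      let open Spec s₀ inp
          T₀ : ℕ → ℕ → (ℕ → ℕ) → ℕ → (ℕ → ℕ) → Set
          T₀ j y h fp tab = Tbl (λ j → j) j y h fp (tab (L * j + y))
      in run-for (λ i s′ → (∀ j y → j < i → y < L → T₀ j y (s′ HEAP) (s′ FP 0) (s′ TAB)) × (∀ z → s′ FP 0 ≤ z → s′ HEAP z ≡ 0)) m tt tt (λ _ _ _ p → p)
        (λ i s₁ i<m i≡ fr₁ (tb₁ , fresh₁) → run-post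
          (λ s′ (tb , fresh) _ → (λ j y j<1+i y<L → tb j y y<L ([ inj₁ , (λ e → inj₂ (e , y<L)) ]′ (m<1+n⇒m<n∨m≡n j<1+i))) , fresh)
          (run-forᶜ (λ x s′ → (∀ j y → y < L → j < i ⊎ (j ≡ i × y < x) → T₀ j y (s′ HEAP) (s′ FP 0) (s′ TAB)) × (∀ z → s′ FP 0 ≤ z → s′ HEAP z ≡ 0)) L tt tt (λ _ _ _ p → p)
            (λ x s₂ x<L x≡ fr₂ (tb₂ , fresh₂) →
              let st₂ : Static s₂ s₀
                  st₂ = static-frame initNodeP fr₂ (static-frame initP fr₁ st)
                  fp = s₂ FP 0
                  i≡₂ = trans (fr₂ CI 0) i≡
                  ix : ⟦ times L (V CI) ⟧ s₂ + s₂ CX 0 ≡ L * i + x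
                  ix = cong₂ _+_ (trans (⟦times⟧ L (V CI) s₂) (cong (L *_) i≡₂)) x≡
                  setup : Program
                  setup = TAB [ times L (V CI) ⊕ V CX ]≔ V FP ︔ CP ≔ V CI ︔ CY ≔ V CX
                  s₃ = update (update (update s₂ TAB (⟦ times L (V CI) ⟧ s₂ + s₂ CX 0) fp) CP 0 (s₂ CI 0)) CY 0 (s₂ CX 0)
                  st₃ : Static s₃ s₀
                  st₃ = static-frame setup (λ { a {k} j → execution-keeps (seq (assign {TAB} {times L (V CI) ⊕ V CX} {V FP} {s₂}) (seq (assign {CP} {const 0} {V CI}) (assign {CY} {const 0} {V CX}))) a {k} j }) st₂
              in run-assign-seq (run-assign-seq (run-assign-seq (run-seq
                {Q = λ s′ → New (λ j → j) i x (λ _ → Unit) (s₂ HEAP) (s′ HEAP) fp}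
                (run-if
                  (λ nz → run-skip (new-empty (λ g t on _ → nz (check-complete s₃ st₃ i≡₂ x≡ i≡₂ x≡ x<L x<L (target-compatible i<m i<m t on on))) fresh₂))
                  (λ z → proj₂ cell-run s₀ inp s₃ i x st₃ (λ u u<nv → trans (fr₂ PWR u) (trans (fr₁ PWR u) (pw u u<nv))) i<m x<L i≡₂ x≡
                           (check-sound s₃ st₃ i≡₂ x≡ i≡₂ x≡ x<L x<L z) fresh₂))
                (λ s₄ new fr₄ →
                  let fp≡ : s₄ FP 0 + s₄ NN 0 ≡ fp + N
                      fp≡ = cong₂ _+_ (fr₄ FP 0) (trans (fr₄ NN 0) (Static.nnˢ st₃ 0))
                      tab≡ : ∀ z → s₄ TAB z ≡ set (s₂ TAB) (L * i + x) fp z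
                      tab≡ z = trans (fr₄ TAB z) (cong (λ k → set (s₂ TAB) k fp z) ix)
                  in run-assign (
                    (λ j y y<L c → case ((j ≟ i) ,′ (y ≟ x)) of λ
                      { (yes refl , yes refl) → subst₂ (Tbl (λ j → j) i x (s₄ HEAP)) (sym fp≡) (sym (trans (tab≡ _) (set-same (s₂ TAB) (L * i + x) fp))) (new-table (λ _ _ → _) new)
                      ; (yes refl , no ne) → tbl-keep s₀ inp new fp≡ tab≡ (ne ∘ λ e → sym (proj₂ (index-inj x<L y<L e)))
                          (tb₂ j y y<L (case c of λ { (inj₁ lt) → inj₁ lt ; (inj₂ (e , lt)) → [ (λ lt′ → inj₂ (e , lt′)) , (λ e′ → contradiction e′ ne) ]′ (m<1+n⇒m<n∨m≡n lt) }))
                      ; (no ne , _) → tbl-keep s₀ inp new fp≡ tab≡ (ne ∘ λ e → sym (proj₁ (index-inj {L} {i} {j} x<L y<L e)))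
                          (tb₂ j y y<L (case c of λ { (inj₁ lt) → inj₁ lt ; (inj₂ (e , lt)) → contradiction e ne })) })
                    , λ z le → Spec.New.above new z (≤-trans (≤-reflexive (sym fp≡)) le)))))))
            L ≤-refl refl ((λ { j y y<L (inj₁ j<i) → tb₁ j y j<i y<L ; j y y<L (inj₂ (_ , ())) }) , fresh₁)))
        (Static.mmˢ st 0) ((λ { j y () }) , fresh₀)

-- Merging nodes into their parents

⊛-mono : ∀ {m n x y} → m ≤ n → x ≤ y → m ⊛ x ≤ n ⊛ y
⊛-mono p q = +-mono-≤ q (*-mono-≤ p (s≤s q))

⊛-inner : ∀ n y → y ≤ n ⊛ y
⊛-inner n y = m≤m+n y (n * suc y)

module DPPush (b q : ℕ) .{{_ : NonZero b}} .{{_ : NonZero q}} (conf : ℕ → ℕ → ℕ) where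
  open DPInit b q conf public

  pushLabelP : Program
  pushLabelP = for CX (const L) (ifnz checkE then skip else (A2 ≔ TAB [ times L (V CI) ⊕ V CX ] ︔ joinP))

  -- The old table of the parent is an operand of the joins with all codes of the child. The result
  -- therefore grows elsewhere, and `TAB` is redirected to it only at the end.
  pushNodeP : Program
  pushNodeP = for CY (const L) (A1 ≔ TAB [ times L (V CP) ⊕ V CY ] ︔ pushLabelP ︔ TAB [ times L (V CP) ⊕ V CY ]≔ V FP ︔ FP ≔+ V NN)

  -- Parents have smaller numbers, so going down from the last node, every node has received all of
  -- its children before it is merged itself. The root, node 0, remains.
  pushP : Program
  pushP = for RR (V MM ⊖ const 1) (CI ≔ V MM ⊖ (V RR ⊕ const 1) ︔ CP ≔ PAR [ V CI ] ︔ pushNodeP)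

  abstract
    -- A target labelling meets the child in the single code `code g i`, so it is accounted for once
    -- the loop has passed that code.
    pushLabel-run : Σ[ K ∈ ℕ ] (∀ s₀ (inp : Input s₀) (let open Spec s₀ inp) i 1≤i i<m c (ab : Absorbed (suc i) c) (let open Push i 1≤i i<m c ab) s y →
      Static s s₀ → y < L → s CI 0 ≡ i → s CP 0 ≡ p → s CY 0 ≡ y → Tbl c p y (s HEAP) (s FP 0) (s A1 0) →
      (∀ x → x < L → Tbl c i x (s HEAP) (s FP 0) (s TAB (L * i + x))) → (∀ z → s FP 0 ≤ z → s HEAP z ≡ 0) →
      Run pushLabelP s (λ s′ → New c′ p y (λ g → code g i < L) (s HEAP) (s′ HEAP) (s FP 0)) K (N ⊛ N ⊛ 0))
    pushLabel-run = _ , λ s₀ inp i 1≤i i<m c ab s y st y<L i≡ p≡ y≡ tp ti fresh₀ →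
      let open Spec s₀ inp
          open Push i 1≤i i<m c ab
          fp = s FP 0
          a₁ = s A1 0
      in run-forᶜ (λ x s′ → New c′ p y (λ g → code g i < x) (s HEAP) (s′ HEAP) fp) L tt tt (λ _ _ _ p → p)
        (λ x s₁ x<L x≡ fr₁ new →
          let st₁ = static-frame pushLabelP fr₁ st
              i≡₁ = trans (fr₁ CI 0) i≡
              p≡₁ = trans (fr₁ CP 0) p≡
              y≡₁ = trans (fr₁ CY 0) y≡
              p<m = <-trans p<i i<m
              fp≡ = fr₁ FP 0
              tp₁ : Tbl c p y (s₁ HEAP) fp a₁
              tp₁ = tbl-extend (New.below new) ≤-refl tp
              a₂ = s TAB (L * i + x)
              ti₁ : Tbl c i x (s₁ HEAP) fp a₂
              ti₁ = tbl-extend (New.below new) ≤-refl (ti x x<L)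
              a₂≡ : s₁ TAB (⟦ times L (V CI) ⟧ s₁ + s₁ CX 0) ≡ a₂
              a₂≡ = trans (fr₁ TAB _) (cong (s TAB) (cong₂ _+_ (trans (⟦times⟧ L (V CI) s₁) (cong (L *_) i≡₁)) x≡))
              n≡ : s₁ NN 0 ≡ N
              n≡ = Static.nnˢ st₁ 0
              al≡ : ∀ σ → s₁ AL σ ≡ s₀ AL σ
              al≡ = Static.alˢ st₁
          in run-if
          (λ nz → run-skip (record { below = New.below new ; above = New.above new ; sound = New.sound new
            ; complete = λ g t on c<1+x → case m<1+n⇒m<n∨m≡n c<1+x of λ
                { (inj₁ lt) → New.complete new g t on lt
                ; (inj₂ refl) → contradiction (check-complete s₁ st₁ i≡₁ x≡ p≡₁ y≡₁ x<L y<L (target-compatible i<m p<m t (code-on i t) on)) nz } }))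
          (λ z →
            let ok = check-sound s₁ st₁ i≡₁ x≡ p≡₁ y≡₁ x<L y<L z
                S : ℕ → ℕ → Set
                S σ ω = Sem c′ p y σ ω × s₀ AL σ ≢ 0
            in run-assign-seq (run-post
              (λ s′ J _ → record
                { below = λ z lt → trans (Joined.outside J z (inj₁ lt)) (New.below new z lt)
                ; above = λ z le → trans (Joined.outside J z (inj₂ le)) (New.above new z le)
                ; sound = Joined.sound J
                ; complete = λ g t on c<1+x →
                    let pm : part c′ p W₁ g ≡ part c p W₁ g + part c i W₁ g
                        pm = part-merge W₁ g g g (λ _ _ → refl) (λ _ _ → refl)
                    in case m<1+n⇒m<n∨m≡n c<1+x of λ
                    { (inj₁ lt) → Joined.grows J _ (New.complete new g t on lt)
                    ; (inj₂ refl) → subst (λ k → s′ HEAP (fp + k) ≢ 0) (sym pm)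
                        (Joined.complete J (part c p W₁ g) (part c i W₁ g) (al< _ (part-allowed c p t)) (al< _ (part-allowed c i t)) (al< _ (part-allowed c p t))
                          (Tbl.complete tp₁ g t on) (Tbl.complete ti₁ g t (code-on i t))
                          (λ e → part-allowed c′ p t (trans (cong (s₀ AL) pm) (trans (sym (al≡ _)) e)))) } })
              (proj₂ join-run (update s₁ A2 0 (s₁ TAB (⟦ times L (V CI) ⟧ s₁ + s₁ CX 0))) N fp a₁ a₂ S n≡ fp≡ (fr₁ A1 0) a₂≡ (Tbl.fits tp₁) (Tbl.fits ti₁)
                (λ σ e → al< σ (λ e′ → e (trans (al≡ σ) e′))) (New.sound new)
                (λ σ₁ σ₂ ω₁ ω₂ l₁ l₂ h₁ h₂ e → sem-glue (proj₁ (Tbl.sound tp₁ σ₁ ω₁ l₁ h₁)) (proj₁ (Tbl.sound ti₁ σ₂ ω₂ l₂ h₂)) ok ,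
                   (λ e′ → e (trans (al≡ _) e′)))))))
        L ≤-refl refl (new-empty (λ _ _ _ ()) fresh₀)

    pushNode-run : Σ[ K ∈ ℕ ] (∀ s₀ (inp : Input s₀) (let open Spec s₀ inp) i 1≤i i<m c (ab : Absorbed (suc i) c) (let open Push i 1≤i i<m c ab) s →
      Static s s₀ → s CI 0 ≡ i → s CP 0 ≡ p →
      (∀ p x → p < suc i → x < L → Tbl c p x (s HEAP) (s FP 0) (s TAB (L * p + x))) → (∀ z → s FP 0 ≤ z → s HEAP z ≡ 0) →
      Run pushNodeP s (λ s′ → (∀ p x → p < i → x < L → Tbl c′ p x (s′ HEAP) (s′ FP 0) (s′ TAB (L * p + x))) × (∀ z → s′ FP 0 ≤ z → s′ HEAP z ≡ 0)) K (N ⊛ N ⊛ 0))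
    pushNode-run = _ , λ s₀ inp i 1≤i i<m c ab s st i≡ p≡ tb₀ fresh₀ →
      let open Spec s₀ inp
          open Push i 1≤i i<m c ab
      in run-post
        (λ s′ (tb , tb′ , fresh) _ → (λ p′ x p′<i x<L → case p′ ≟ p of λ
             { (yes refl) → tb′ x x<L x<L
             ; (no ne) → let t = tb p′ x (m<n⇒m<1+n p′<i) x<L (inj₁ ne) ; p′≢i = <⇒≢ p′<i in record
                 { fits = Tbl.fits t
                 ; sound = λ σ ω l e → let S , a = Tbl.sound t σ ω l e in sem-others ne p′≢i S , a
                 ; complete = λ g tg on e → Tbl.complete t g tg on (trans (cong (λ k → s′ HEAP (s′ TAB (L * p′ + x) + k)) (sym (part-others W₁ g p′ ne p′≢i))) e) } }) , fresh)
        (run-forᶜ (λ y s′ → (∀ p′ x → p′ < suc i → x < L → p′ ≢ p ⊎ y ≤ x → Tbl c p′ x (s′ HEAP) (s′ FP 0) (s′ TAB (L * p′ + x))) ×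
                             (∀ x → x < L → x < y → Tbl c′ p x (s′ HEAP) (s′ FP 0) (s′ TAB (L * p + x))) ×
                             (∀ z → s′ FP 0 ≤ z → s′ HEAP z ≡ 0)) L tt tt (λ _ _ _ p → p)
          (λ y s₁ y<L y≡ fr₁ (tb , tb′ , fresh) →
            let st₁ = static-frame pushNodeP fr₁ st
                i≡₁ = trans (fr₁ CI 0) i≡
                p≡₁ = trans (fr₁ CP 0) p≡
                ix : ⟦ times L (V CP) ⟧ s₁ + s₁ CY 0 ≡ L * p + y
                ix = cong₂ _+_ (trans (⟦times⟧ L (V CP) s₁) (cong (L *_) p≡₁)) y≡
                fp = s₁ FP 0
                s₂ = update s₁ A1 0 (s₁ TAB (⟦ times L (V CP) ⟧ s₁ + s₁ CY 0))
                st₂ : Static s₂ s₀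
                st₂ = static-frame (A1 ≔ TAB [ times L (V CP) ⊕ V CY ]) (λ { a {k} j → execution-keeps (assign {A1} {const 0} {TAB [ times L (V CP) ⊕ V CY ]} {s₁}) a {k} j }) st₁
            in run-assign-seq (run-seq
              (proj₂ pushLabel-run s₀ inp i 1≤i i<m c ab s₂ y st₂ y<L i≡₁ p≡₁ y≡
                (subst (Tbl c p y (s₁ HEAP) fp) (sym (cong (s₁ TAB) ix)) (tb p y (m<n⇒m<1+n p<i) y<L (inj₂ ≤-refl)))
                (λ x x<L → tb i x ≤-refl x<L (inj₁ (p≢i ∘ sym))) fresh)
              (λ s₃ new fr₃ →
                let ix₃ : ⟦ times L (V CP) ⟧ s₃ + s₃ CY 0 ≡ L * p + y
                    ix₃ = cong₂ _+_ (trans (⟦times⟧ L (V CP) s₃) (cong (L *_) (trans (fr₃ CP 0) p≡₁))) (trans (fr₃ CY 0) y≡)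
                    fp₃ : s₃ FP 0 ≡ fp
                    fp₃ = fr₃ FP 0
                    fp≡ : s₃ FP 0 + s₃ NN 0 ≡ fp + N
                    fp≡ = cong₂ _+_ fp₃ (trans (fr₃ NN 0) (Static.nnˢ st₂ 0))
                    tab≡ : ∀ z → set (s₃ TAB) (⟦ times L (V CP) ⟧ s₃ + s₃ CY 0) (s₃ FP 0) z ≡ set (s₁ TAB) (L * p + y) fp z
                    tab≡ z = trans (cong₂ (λ k f → set (s₃ TAB) k f z) ix₃ fp₃) (cong (λ h → if (L * p + y) ≡ᵇ z then fp else h) (fr₃ TAB z))
                in run-size z≤n (run-assign-seq (run-assign
                  ( (λ p′ x p′≤i x<L d → tbl-keep s₀ inp new fp≡ tab≡
                      (λ e → let p≡p′ , y≡x = index-inj {L} {p} {p′} y<L x<L e in [ (λ ne → ne (sym p≡p′)) , (λ y<x → <⇒≢ y<x y≡x) ]′ d)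
                      (tb p′ x p′≤i x<L ([ inj₁ , (λ y<x → inj₂ (<⇒≤ y<x)) ]′ d)))
                  , (λ x x<L x<1+y → case m<1+n⇒m<n∨m≡n x<1+y of λ
                      { (inj₁ x<y) → tbl-keep s₀ inp new fp≡ tab≡ (λ e → <⇒≢ x<y (sym (proj₂ (index-inj {L} {p} {p} y<L x<L e)))) (tb′ x x<L x<y)
                      ; (inj₂ refl) → subst₂ (Tbl c′ p y (s₃ HEAP)) (sym fp≡) (sym (trans (tab≡ _) (set-same (s₁ TAB) (L * p + y) fp))) (new-table (λ g t → code< i t) new) })
                  , λ z le → New.above new z (≤-trans (≤-reflexive (sym fp≡)) le) ))))))
          L ≤-refl refl ((λ p′ x l x<L _ → tb₀ p′ x l x<L) , (λ x _ ()) , fresh₀))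

    push-run : Σ[ K ∈ ℕ ] (∀ s₀ (inp : Input s₀) (let open Spec s₀ inp) s → Static s s₀ →
      (∀ j y → j < m → y < L → Tbl (λ j → j) j y (s HEAP) (s FP 0) (s TAB (L * j + y))) → (∀ z → s FP 0 ≤ z → s HEAP z ≡ 0) →
      Run pushP s (λ s′ → (Σ[ c ∈ (ℕ → ℕ) ] (Absorbed 1 c × (∀ x → x < L → Tbl c 0 x (s′ HEAP) (s′ FP 0) (s′ TAB x)))) ×
        (∀ z → s′ FP 0 ≤ z → s′ HEAP z ≡ 0)) K (m ⊛ N ⊛ N ⊛ 0))
    push-run = _ , λ s₀ inp s st tb₀ fresh₀ →
      let open Spec s₀ inp
          State : ℕ → (ℕ → ℕ) → ℕ → (ℕ → ℕ) → Set
          State i h fp tab = Σ[ c ∈ (ℕ → ℕ) ] (Absorbed i c × (∀ p x → p < i → x < L → Tbl c p x h fp (tab (L * p + x))))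
      in run-mono
        (λ s′ ((c , ab , tb) , fresh) _ →
          let e : m ∸ (m ∸ 1) ≡ 1
              e = m∸[m∸n]≡n m≥1
          in (c , subst (λ i → Absorbed i c) e ab , λ x x<L → subst (λ k → Tbl c 0 x (s′ HEAP) (s′ FP 0) (s′ TAB (k + x))) (*-zeroʳ L)
               (tb 0 x (≤-reflexive (sym e)) x<L)) , fresh)
        (⊛-mono {m ∸ 1} {m} (m∸n≤m m 1) ≤-refl)
        (run-for (λ r s′ → State (m ∸ r) (s′ HEAP) (s′ FP 0) (s′ TAB) × (∀ z → s′ FP 0 ≤ z → s′ HEAP z ≡ 0)) (m ∸ 1) tt tt (λ _ _ _ p → p)
          (λ r s₁ r<m-1 r≡ fr₁ (S , fresh) →
            let st₁ = static-frame pushP fr₁ st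
                1+r<m : suc r < m
                1+r<m = ≤-trans (s≤s r<m-1) (≤-reflexive (m+[n∸m]≡n m≥1))
                i = m ∸ suc r
                1≤i : 1 ≤ i
                1≤i = m<n⇒0<n∸m 1+r<m
                e : m ∸ r ≡ suc i
                e = suc-∸ (<-trans (n<1+n r) 1+r<m)
                i<m : i < m
                i<m = ≤-trans (≤-reflexive (sym e)) (m∸n≤m m r)
                c , ab , tb = subst (λ i → State i (s₁ HEAP) (s₁ FP 0) (s₁ TAB)) e S
                i≡ : s₁ MM 0 ∸ (s₁ RR 0 + 1) ≡ i
                i≡ = cong₂ _∸_ (Static.mmˢ st₁ 0) (trans (+-comm _ 1) (cong suc r≡))
                s₂ = update s₁ CI 0 (s₁ MM 0 ∸ (s₁ RR 0 + 1))
                s₃ = update s₂ CP 0 (s₁ PAR (s₁ MM 0 ∸ (s₁ RR 0 + 1)))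
                st₃ : Static s₃ s₀
                st₃ = static-frame (CI ≔ V MM ⊖ (V RR ⊕ const 1) ︔ CP ≔ PAR [ V CI ])
                  (λ { a {k} j → execution-keeps (seq (assign {CI} {const 0} {V MM ⊖ (V RR ⊕ const 1)} {s₁}) (assign {CP} {const 0} {PAR [ V CI ]})) a {k} j }) st₁
            in run-assign-seq (run-assign-seq (run-post
              (λ s′ (tb′ , fresh′) _ → (_ , Step.absorbed-step i 1≤i i<m c ab , tb′) , fresh′)
              (proj₂ pushNode-run s₀ inp i 1≤i i<m c ab s₃ st₃ i≡ (trans (Static.parˢ st₁ _) (cong (s₀ PAR) i≡)) tb fresh))))
          (cong (_∸ 1) (Static.mmˢ st 0)) ((_ , absorbed-start , tb₀) , fresh₀))

-- Selection of the best entry and the complete solver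

selectP : ℕ → Program
selectP L = BEST ≔ const 0 ︔ for CX (const L) (A1 ≔ TAB [ V CX ] ︔
  for S1 (V NN) (ifnz HEAP [ V A1 ⊕ V S1 ] then
    (ifnz VAL [ V S1 ] ⊕ const 1 ⊖ V BEST then (BEST ≔ VAL [ V S1 ] ⊕ const 1 ︔ PX ≔ HEAP [ V A1 ⊕ V S1 ] ⊖ const 1) else skip)
   else skip))

-- `best` is one more than the best value so far, 0 standing for no entry. Comparing `VAL + 1` with
-- it thus treats the first entry like the others.
record Best (L N : ℕ) (h tab val : ℕ → ℕ) (done : ℕ → ℕ → Set) (best px : ℕ) : Set where
  field
    found : best ≡ 0 ⊎ ∃[ x ] ∃[ σ ] (x < L × σ < N × h (tab x + σ) ≡ suc px × best ≡ suc (val σ))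
    max   : ∀ x σ → x < L → σ < N → done x σ → h (tab x + σ) ≢ 0 → val σ < best

abstract
  select-run : ∀ L → Σ[ K ∈ ℕ ] (∀ s N → s NN 0 ≡ N →
    Run (selectP L) s (λ s′ → Best L N (s HEAP) (s TAB) (s VAL) (λ x _ → x < L) (s′ BEST 0) (s′ PX 0)) K (N ⊛ 0))
  select-run L = _ , λ s N n≡ →
    let B : (ℕ → ℕ → Set) → ℕ → ℕ → Set
        B = Best L N (s HEAP) (s TAB) (s VAL)
    in run-assign-seq (run-forᶜ (λ x s′ → B (λ x′ _ → x′ < x) (s′ BEST 0) (s′ PX 0)) L tt tt (λ _ _ _ p → p)
      (λ x s₁ x<L x≡ fr₁ b₁ →
        let a≡ : s₁ TAB (s₁ CX 0) ≡ s TAB x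
            a≡ = trans (fr₁ TAB _) (cong (s TAB) x≡)
        in run-assign-seq (run-post
        (λ s′ b _ → record { found = Best.found b ; max = λ x′ σ l₁ l₂ d → Best.max b x′ σ l₁ l₂ ([ inj₁ , (λ e → inj₂ (e , l₂)) ]′ (m<1+n⇒m<n∨m≡n d)) })
        (run-for (λ j s′ → B (λ x′ σ → x′ < x ⊎ (x′ ≡ x × σ < j)) (s′ BEST 0) (s′ PX 0)) N tt tt (λ _ _ _ p → p)
          (λ j s₂ j<N j≡ fr₂ b₂ →
            let e₂ : s₂ HEAP (s₂ A1 0 + s₂ S1 0) ≡ s HEAP (s TAB x + j)
                e₂ = trans (fr₂ HEAP _) (trans (fr₁ HEAP _) (cong (s HEAP) (cong₂ _+_ (trans (fr₂ A1 0) a≡) j≡)))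
                v₂ : s₂ VAL (s₂ S1 0) + 1 ≡ suc (s VAL j)
                v₂ = trans (cong (_+ 1) (trans (fr₂ VAL _) (trans (fr₁ VAL _) (cong (s VAL) j≡)))) (+-comm _ 1)
            in run-if
            (λ nz → run-if
              (λ better → run-assign-seq (run-assign (record
                { found = inj₂ (x , j , x<L , j<N , (let ω , e = n≢0⇒suc (λ z → nz (trans e₂ z)) in trans e (cong suc (sym (cong (_∸ 1) (trans e₂ e))))) , v₂)
                ; max = λ { x′ σ l₁ l₂ (inj₁ lt) ne → ≤-trans (<⇒≤ (s≤s (Best.max b₂ x′ σ l₁ l₂ (inj₁ lt) ne))) (improve better)
                          ; x′ σ l₁ l₂ (inj₂ (refl , lt)) ne → case m<1+n⇒m<n∨m≡n lt of λ
                              { (inj₁ lt′) → ≤-trans (<⇒≤ (s≤s (Best.max b₂ x′ σ l₁ l₂ (inj₂ (refl , lt′)) ne))) (improve better)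
                              ; (inj₂ refl) → ≤-reflexive (sym v₂) } } })))
              (λ worse → run-skip (record
                { found = Best.found b₂
                ; max = λ { x′ σ l₁ l₂ (inj₁ lt) ne → Best.max b₂ x′ σ l₁ l₂ (inj₁ lt) ne
                          ; x′ σ l₁ l₂ (inj₂ (refl , lt)) ne → case m<1+n⇒m<n∨m≡n lt of λ
                              { (inj₁ lt′) → Best.max b₂ x′ σ l₁ l₂ (inj₂ (refl , lt′)) ne
                              ; (inj₂ refl) → ≤-trans (≤-reflexive (sym v₂)) (m∸n≡0⇒m≤n worse) } } })))
            (λ z → run-skip (record
                { found = Best.found b₂
                ; max = λ { x′ σ l₁ l₂ (inj₁ lt) ne → Best.max b₂ x′ σ l₁ l₂ (inj₁ lt) ne
                          ; x′ σ l₁ l₂ (inj₂ (refl , lt)) ne → case m<1+n⇒m<n∨m≡n lt of λ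
                              { (inj₁ lt′) → Best.max b₂ x′ σ l₁ l₂ (inj₂ (refl , lt′)) ne
                              ; (inj₂ refl) → contradiction (trans (sym e₂) z) ne } } })))
          (trans (fr₁ NN 0) n≡)
          (record { found = Best.found b₁ ; max = λ { x′ σ l₁ l₂ (inj₁ lt) → Best.max b₁ x′ σ l₁ l₂ lt } }))))
      L ≤-refl refl (record { found = inj₁ refl ; max = λ _ _ _ _ () }))
    where
    improve : ∀ {new old} → new ∸ old ≢ 0 → suc old ≤ new
    improve {new} {old} p = ≰⇒> (λ le → p (m≤n⇒m∸n≡0 le))

module Solver (b q : ℕ) .{{_ : NonZero b}} .{{_ : NonZero q}} (conf : ℕ → ℕ → ℕ) where
  open DPPush b q conf public

  solveP : Program
  solveP = BASE ≔ const q ︔ CNT ≔ V NV ︔ powersP ︔ initP ︔ pushP ︔ selectP L ︔ digitsP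

  record Solved (s₀ : Store) (inp : Input s₀) (lab : ℕ → ℕ) : Set where
    open Spec s₀ inp
    field
      lab<    : ∀ u → u < nv → lab u < q
      proper  : ∀ u v → u < nv → v < nv → Edge s₀ u v → ¬ Conf (lab u) (lab v)
      allowed : s₀ AL (∑ nv (λ u → W₁ u (lab u))) ≢ 0
      optimal : ∀ g → Target g → s₀ VAL (∑ nv (λ u → W₁ u (g u))) ≤ s₀ VAL (∑ nv (λ u → W₁ u (lab u)))

  abstract
    solve-run : Σ[ K ∈ ℕ ] (∀ s₀ (inp : Input s₀) (let open Spec s₀ inp) y → nv ⊛ q ⊛ 0 ≤ y → m ⊛ N ⊛ N ⊛ 0 ≤ y → (Σ[ g ∈ (ℕ → ℕ) ] Target g) →
      Run solveP s₀ (λ s′ → Solved s₀ inp (s′ LAB) × (∀ z → s′ FP 0 ≤ z → s′ HEAP z ≡ 0)) K y)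
    solve-run = _ , λ s₀ inp y size₁ size₂ (g₀ , t₀) →
      let open Spec s₀ inp
          setup = BASE ≔ const q ︔ CNT ≔ V NV
          s₁ = update (update s₀ BASE 0 q) CNT 0 nv
          st₁ : Static s₁ s₀
          st₁ = static-frame setup (λ { a {k} j → execution-keeps (seq (assign {BASE} {const 0} {const q} {s₀}) (assign {CNT} {const 0} {V NV})) a {k} j }) (static-refl s₀)
      in run-assign-seq (run-assign-seq (run-seq (run-size size₁ (proj₂ powers-run s₁ q nv refl refl))
      (λ s₂ pw₂ fr₂ →
        let st₂ = static-frame powersP fr₂ st₁
        in run-seq (run-size (≤-trans (⊛-mono {m} ≤-refl z≤n) size₂)
          (proj₂ init-run s₀ inp s₂ st₂ (λ u u<nv → pw₂ u (<⇒≤ u<nv))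
            (λ z le → trans (fr₂ HEAP z) (fresh z (≤-trans (≤-reflexive (sym (fr₂ FP 0))) le)))))
      (λ s₃ (tb₃ , fresh₃) fr₃ →
        let st₃ = static-frame initP fr₃ st₂
        in run-seq (run-size size₂ (proj₂ push-run s₀ inp s₃ st₃ tb₃ fresh₃))
      (λ s₄ ((c , ab , tb₄) , fresh₄) fr₄ →
        let st₄ = static-frame pushP fr₄ st₃
            val≡ = Static.valˢ st₄
        in run-seq (run-size (≤-trans (≤-trans (⊛-mono {N} ≤-refl z≤n) (⊛-inner m _)) size₂) (proj₂ (select-run L) s₄ N (Static.nnˢ st₄ 0)))
      (λ s₅ best fr₅ →
        let sum≡ : ∀ g → Target g → part c 0 W₁ g ≡ ∑ nv (λ u → W₁ u (g u))
            sum≡ g t = part-root ab W₁ g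
            beats : ∀ g → Target g → s₀ VAL (∑ nv (λ u → W₁ u (g u))) < s₅ BEST 0
            beats g t = subst (λ k → s₀ VAL k < s₅ BEST 0) (sum≡ g t) (subst (_< s₅ BEST 0) (val≡ _)
              (Best.max best (code g 0) (part c 0 W₁ g) (code< 0 t) (al< _ (part-allowed c 0 t)) (code< 0 t)
                (Tbl.complete (tb₄ (code g 0) (code< 0 t)) g t (code-on 0 t))))
            -- By hypothesis there is a target labelling; its entry makes `BEST` positive.
            winner : ∃[ x ] ∃[ σ ] (x < L × σ < N × s₄ HEAP (s₄ TAB x + σ) ≡ suc (s₅ PX 0) × s₅ BEST 0 ≡ suc (s₄ VAL σ))
            winner = [ (λ e → contradiction (subst (_ <_) e (beats g₀ t₀)) (λ ())) , (λ w → w) ]′ (Best.found best)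
            x , σ , x<L , σ<N , cell , best≡ = winner
            sem , alσ = Tbl.sound (tb₄ x x<L) σ (s₅ PX 0) σ<N cell
            g , g< , proper , σ≡ , ω≡ = sem-root ab sem
            base≡ : s₅ BASE 0 ≡ q
            base≡ = trans (fr₅ BASE 0) (trans (fr₄ BASE 0) (trans (fr₃ BASE 0) (fr₂ BASE 0)))
            cnt≡ : s₅ CNT 0 ≡ nv
            cnt≡ = trans (fr₅ CNT 0) (trans (fr₄ CNT 0) (trans (fr₃ CNT 0) (fr₂ CNT 0)))
            pw≡ : ∀ u → u < nv → s₅ PWR u ≡ q ^ u
            pw≡ u u<nv = trans (fr₅ PWR u) (trans (fr₄ PWR u) (trans (fr₃ PWR u) (pw₂ u (<⇒≤ u<nv))))
        in run-post (λ s₆ lab≡ fr₆ →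
             let W≡ : ∑ nv (λ u → W₁ u (s₆ LAB u)) ≡ σ
                 W≡ = trans (∑-cong nv (λ u u<nv → cong (W₁ u) (lab≡ u u<nv))) (sym σ≡)
             in record
               { lab< = λ u u<nv → subst (_< q) (sym (lab≡ u u<nv)) (g< u)
               ; proper = λ u v u<nv v<nv e → subst₂ (λ l l′ → ¬ Conf l l′) (sym (lab≡ u u<nv)) (sym (lab≡ v v<nv)) (proper u v u<nv v<nv e)
               ; allowed = subst (λ k → s₀ AL k ≢ 0) (sym W≡) alσ
               ; optimal = λ g′ t′ → subst (λ k → s₀ VAL _ ≤ s₀ VAL k) (sym W≡)
                   (s≤s⁻¹ (≤-trans (beats g′ t′) (≤-reflexive (trans best≡ (cong suc (val≡ σ)))))) }
             , λ z le → trans (fr₆ HEAP z) (trans (fr₅ HEAP z) (fresh₄ z (≤-trans (≤-reflexive (trans (sym (fr₅ FP 0)) (sym (fr₆ FP 0)))) le))))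
           (run-size size₁ (proj₂ digits-run s₅ q nv g base≡ cnt≡ pw≡ (λ u _ → g< u) ω≡))))))))

-- Leaves of trees

𝟙 : Bool → ℕ
𝟙 c = when c 1

∑ᶠ : ∀ n → (Fin n → ℕ) → ℕ
∑ᶠ zero    f = 0
∑ᶠ (suc n) f = f zero + ∑ᶠ n (f ∘ suc)

∑ᶠ-mono : ∀ n {f g : Fin n → ℕ} → (∀ u → f u ≤ g u) → ∑ᶠ n f ≤ ∑ᶠ n g
∑ᶠ-mono zero    p = z≤n
∑ᶠ-mono (suc n) p = +-mono-≤ (p zero) (∑ᶠ-mono n (λ u → p (suc u)))

∑ᶠ-+ : ∀ n (f g : Fin n → ℕ) → ∑ᶠ n (λ u → f u + g u) ≡ ∑ᶠ n f + ∑ᶠ n g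
∑ᶠ-+ zero    f g = refl
∑ᶠ-+ (suc n) f g = trans (cong (f zero + g zero +_) (∑ᶠ-+ n (f ∘ suc) (g ∘ suc))) (+-interchange (f zero) (g zero) _ _)

# : ∀ {n} → (Fin n → Bool) → ℕ
# {n} f = ∑ᶠ n (𝟙 ∘ f)

#-mono : ∀ {n} {f g : Fin n → Bool} → (∀ u → T (f u) → T (g u)) → # f ≤ # g
#-mono {n} {f} {g} p = ∑ᶠ-mono n (λ u → le (f u) (g u) (p u))
  where
  le : ∀ x y → (T x → T y) → 𝟙 x ≤ 𝟙 y
  le false y     q = z≤n
  le true  true  q = ≤-refl
  le true  false q = contradiction (q tt) (λ ())

#-∪ : ∀ {n} {f g h : Fin n → Bool} → (∀ u → T (f u) → T (g u) ⊎ T (h u)) → # f ≤ # g + # h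
#-∪ {n} {f} {g} {h} p = ≤-trans (∑ᶠ-mono n (λ u → le (f u) (g u) (h u) (p u))) (≤-reflexive (∑ᶠ-+ n (𝟙 ∘ g) (𝟙 ∘ h)))
  where
  le : ∀ x y z → (T x → T y ⊎ T z) → 𝟙 x ≤ 𝟙 y + 𝟙 z
  le false y     z     q = z≤n
  le true  true  z     q = s≤s z≤n
  le true  false true  q = ≤-refl
  le true  false false q with q tt
  ... | inj₁ ()
  ... | inj₂ ()

#-disjoint : ∀ {n} {f g h : Fin n → Bool} → (∀ u → T (f u) → T (h u)) → (∀ u → T (g u) → T (h u)) → (∀ u → T (f u) → ¬ T (g u)) → # f + # g ≤ # h
#-disjoint {n} {f} {g} {h} p q d = ≤-trans (≤-reflexive (sym (∑ᶠ-+ n (𝟙 ∘ f) (𝟙 ∘ g)))) (∑ᶠ-mono n (λ u → le (f u) (g u) (h u) (p u) (q u) (d u)))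
  where
  le : ∀ x y z → (T x → T z) → (T y → T z) → (T x → ¬ T y) → 𝟙 x + 𝟙 y ≤ 𝟙 z
  le true  true  z     p q d = contradiction tt (d tt)
  le true  false true  p q d = ≤-refl
  le true  false false p q d = contradiction (p tt) (λ ())
  le false true  true  p q d = ≤-refl
  le false true  false p q d = contradiction (q tt) (λ ())
  le false false z     p q d = z≤n

#-positive : ∀ {n} (f : Fin n → Bool) → # f ≢ 0 → ∃[ u ] T (f u)
#-positive {zero}  f p = contradiction refl p
#-positive {suc n} f p with f zero in eq
... | true  = zero , subst T (sym eq) tt
... | false = let u , t = #-positive (f ∘ suc) p in suc u , t

T-∨₁ : ∀ {x y} → T x → T (x ∨ y)
T-∨₁ {true} _ = tt

T-∨₂ : ∀ {x y} → T y → T (x ∨ y)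
T-∨₂ {true}  _ = tt
T-∨₂ {false} p = p

T-∨ : ∀ {x y} → T (x ∨ y) → T x ⊎ T y
T-∨ {true}  _ = inj₁ tt
T-∨ {false} p = inj₂ p

T-not : ∀ {x} → T (not x) → ¬ T x
T-not {false} _ ()

not-T : ∀ {x} → ¬ T x → T (not x)
not-T {false} _ = tt
not-T {true}  p = p tt

adj-sym : ∀ {n} (G : Graph n) {u v} → Adj G u v → Adj G v u
adj-sym G {u} {v} = subst T (Graph.sym G u v)

adj-irrefl : ∀ {n} (G : Graph n) {u} → ¬ Adj G u u
adj-irrefl G {u} p = subst T (Graph.irrefl G u) p

-- A walk through `l` inside `P` enters and leaves by `x`, so this detour can be cut out. The
-- predicate makes the argument apply to the live nodes as well as to those of them whose bags
-- contain a given vertex.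
remove-leaf : ∀ {m} (G : Graph m) {P : Fin m → Set} l x → (∀ y → P y → Adj G l y → y ≡ x) → ConnectedOn G P → ConnectedOn G (λ t → P t × t ≢ l)
remove-leaf {m} G {P} l x unique conn u v (Pu , u≢l) (Pv , v≢l) = go u≢l (conn u v Pu Pv)
  where
  go : ∀ {u} → u ≢ l → Star (λ x y → P x × P y × Adj G x y) u v → Star (λ x y → (P x × x ≢ l) × (P y × y ≢ l) × Adj G x y) u v
  go u≢l ε = ε
  go u≢l (_◅_ {j = y} (Pu , Py , a) rest) with y Fin.≟ l
  ... | no y≢l = ((Pu , u≢l) , (Py , y≢l) , a) ◅ go y≢l rest
  go u≢l ((Pu , Py , a) ◅ ε) | yes refl = contradiction refl v≢l
  go {u} u≢l ((Pu , Py , a) ◅ ((_ , Pz , a′) ◅ rest)) | yes refl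
    with unique u Pu (adj-sym G a) | unique _ Pz a′
  ... | refl | refl = go u≢l rest

module _ {m : ℕ} (G : Graph m) (acyclic : ¬ Cycle G) (live : Fin m → Bool)
  (branch : ∀ l x → T (live l) → T (live x) → Adj G l x → ∃[ y ] (T (live y) × Adj G l y × y ≢ x)) where

  private
    record Path (r : ℕ) : Set where
      field
        v    : ℕ → Fin m
        on   : ∀ i → i ≤ suc r → T (live (v i))
        step : ∀ i → i ≤ r → Adj G (v i) (v (suc i))
        inj  : ∀ i j → i ≤ suc r → j ≤ suc r → v i ≡ v j → i ≡ j

    find : ∀ {r} (p : Path r) y k → (∃[ j ] (j < k × Path.v p j ≡ y)) ⊎ (∀ j → j < k → Path.v p j ≢ y)
    find p y zero    = inj₂ (λ j ())
    find p y (suc k) with Path.v p k Fin.≟ y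
    ... | yes e = inj₁ (k , ≤-refl , e)
    ... | no ne with find p y k
    ...   | inj₁ (j , j<k , e) = inj₁ (j , m<n⇒m<1+n j<k , e)
    ...   | inj₂ f = inj₂ (λ j j<1+k → [ f j , (λ { refl → ne }) ]′ (m<1+n⇒m<n∨m≡n j<1+k))

    extend : ∀ {r} (p : Path r) y → T (live y) → Adj G (Path.v p (suc r)) y → (∀ j → j < suc (suc r) → Path.v p j ≢ y) → Path (suc r)
    extend {r} p y ly a new = record { v = w ; on = on′ ; step = step′ ; inj = inj′ }
      where
      open Path p
      w : ℕ → Fin m
      w i = if i <ᵇ suc (suc r) then v i else y
      old : ∀ {i} → i < suc (suc r) → w i ≡ v i
      old {i} lt with i <ᵇ suc (suc r) | <⇒<ᵇ lt
      ... | true | _ = refl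
      last : w (suc (suc r)) ≡ y
      last with suc (suc r) <ᵇ suc (suc r) in eq
      ... | false = refl
      ... | true  = contradiction (<ᵇ⇒< (suc (suc r)) (suc (suc r)) (subst T (sym eq) tt)) (<-irrefl refl)
      split : ∀ i → i ≤ suc (suc r) → i < suc (suc r) ⊎ i ≡ suc (suc r)
      split i le = m≤n⇒m<n∨m≡n le
      on′ : ∀ i → i ≤ suc (suc r) → T (live (w i))
      on′ i le with split i le
      ... | inj₁ lt   = subst (T ∘ live) (sym (old lt)) (on i (s≤s⁻¹ lt))
      ... | inj₂ refl = subst (T ∘ live) (sym last) ly
      step′ : ∀ i → i ≤ suc r → Adj G (w i) (w (suc i))
      step′ i le with m≤n⇒m<n∨m≡n le
      ... | inj₁ lt   = subst₂ (Adj G) (sym (old (s≤s le))) (sym (old (s≤s lt))) (step i (s≤s⁻¹ lt))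
      ... | inj₂ refl = subst₂ (Adj G) (sym (old ≤-refl)) (sym last) a
      inj′ : ∀ i j → i ≤ suc (suc r) → j ≤ suc (suc r) → w i ≡ w j → i ≡ j
      inj′ i j li lj e with split i li | split j lj
      ... | inj₁ p₁   | inj₁ p₂   = inj i j (s≤s⁻¹ p₁) (s≤s⁻¹ p₂) (trans (sym (old p₁)) (trans e (old p₂)))
      ... | inj₁ p₁   | inj₂ refl = contradiction (trans (sym (old p₁)) (trans e last)) (new i p₁)
      ... | inj₂ refl | inj₁ p₂   = contradiction (trans (sym (old p₂)) (trans (sym e) last)) (new j p₂)
      ... | inj₂ refl | inj₂ refl = refl

    cycle : ∀ {r} (p : Path r) j → suc (suc j) ≤ suc r → Adj G (Path.v p (suc r)) (Path.v p j) → Cycle G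
    cycle {r} p j le a = record
      { extra = e ; vertex = λ i → v (j + toℕ i)
      ; distinct = λ {x} {y} q → toℕ-injective (+-cancelˡ-≡ j _ _ (inj _ _ (bound x) (bound y) q))
      ; step = λ i → subst₂ (λ x y → Adj G (v x) (v y)) (cong (j +_) (sym (toℕ-inject₁ i))) (sym (+-suc j (toℕ i)))
                 (step (j + toℕ i) (s≤s⁻¹ (≤-trans (≤-reflexive (sym (+-suc j (toℕ i)))) (bound (suc i)))))
      ; close = subst₂ (λ x y → Adj G (v x) (v y)) (sym (trans (cong (j +_) (toℕ-fromℕ (2 + e))) top)) (sym (+-identityʳ j)) a }
      where
      open Path p
      e : ℕ
      e = suc r ∸ suc (suc j)
      top : j + (2 + e) ≡ suc r
      top = trans (sym (+-assoc j 2 e)) (trans (cong (_+ e) (+-comm j 2)) (m+[n∸m]≡n le))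
      bound : ∀ (i : Fin (3 + e)) → j + toℕ i ≤ suc r
      bound i = ≤-trans (+-monoʳ-≤ j (s≤s⁻¹ (toℕ<n i))) (≤-reflexive top)

    walk : ∀ f r → Path r → m ≤ r + f → ⊥
    walk zero r p le with pigeonhole {m} {suc m} ≤-refl (λ i → Path.v p (toℕ i))
    ... | i , j , i<j , e = <⇒≢ i<j (Path.inj p _ _ (bound i) (bound j) e)
      where
      bound : ∀ (i : Fin (suc m)) → toℕ i ≤ suc r
      bound i = ≤-trans (s≤s⁻¹ (toℕ<n i)) (≤-trans le (≤-trans (≤-reflexive (+-identityʳ r)) (n≤1+n r)))
    walk (suc f) r p le
      with y , ly , a , ne ← branch (Path.v p (suc r)) (Path.v p r) (Path.on p _ ≤-refl) (Path.on p _ (n≤1+n r)) (adj-sym G (Path.step p r ≤-refl))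
      with find p y (suc (suc r))
    ... | inj₂ new = walk f (suc r) (extend p y ly a new) (≤-trans le (≤-reflexive (+-suc r f)))
    -- The neighbour lies on the path. It is not the end, as there are no loops, nor the vertex
    -- before it; so it is at least two steps back and closes a cycle.
    ... | inj₁ (j , j<2+r , refl) with m<1+n⇒m<n∨m≡n j<2+r
    ...   | inj₂ refl = adj-irrefl G a
    ...   | inj₁ j<1+r with m<1+n⇒m<n∨m≡n j<1+r
    ...     | inj₂ refl = ne refl
    ...     | inj₁ j<r  = acyclic (cycle p j (s≤s j<r) a)

  -- From an edge, `branch` would prolong a path of distinct live vertices forever: without cycles
  -- every prolongation is new, but there are only `m` vertices. Contrapositively, a live edge
  -- guarantees a live leaf.
  no-edge : ∀ l x → T (live l) → T (live x) → ¬ Adj G l x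
  no-edge l x ll lx a = walk m 0 (record { v = v ; on = on ; step = step ; inj = inj }) ≤-refl
    where
    v : ℕ → Fin m
    v zero    = l
    v (suc _) = x
    on : ∀ i → i ≤ 1 → T (live (v i))
    on zero    _ = ll
    on (suc i) _ = lx
    step : ∀ i → i ≤ 0 → Adj G (v i) (v (suc i))
    step zero z≤n = a
    l≢x : l ≢ x
    l≢x refl = adj-irrefl G a
    inj : ∀ i j → i ≤ 1 → j ≤ 1 → v i ≡ v j → i ≡ j
    inj zero zero _ _ _ = refl
    inj zero (suc zero) _ _ e = contradiction e l≢x
    inj (suc zero) zero _ _ e = contradiction (sym e) l≢x
    inj (suc zero) (suc zero) _ _ _ = refl
    inj (suc (suc _)) j (s≤s ()) _ _
    inj zero (suc (suc _)) _ (s≤s ()) _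
    inj (suc zero) (suc (suc _)) _ (s≤s ()) _

-- Balanced separations

_∩ᵇ_ : ∀ {n} → (Fin n → Bool) → (Fin n → Bool) → Fin n → Bool
(f ∩ᵇ g) u = f u ∧ g u

-- Labels: 0 for the separator, 1 and 2 for its two sides.
record Separation {n : ℕ} (G : Graph n) (s : ℕ) (W : Fin n → Bool) : Set where
  field
    g      : Fin n → ℕ
    g<     : ∀ u → g u < 3
    apart  : ∀ u v → Adj G u v → ¬ (g u ≡ 1 × g v ≡ 2)
    small₀ : # (λ u → g u ≡ᵇ 0) ≤ s
    small₁ : # (λ u → W u ∧ (g u ≡ᵇ 1)) ≤ s + s
    small₂ : # (λ u → W u ∧ (g u ≡ᵇ 2)) ≤ s + s

-- `B` becomes the separator, the rest of `F` one side and everything else the other. As `F` has at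
-- least `s + 1` of the `3s + 1` marked vertices, at most `2s` remain for the other side; this
-- explains the size of `W`.
separate : ∀ {n} (G : Graph n) s (W F B : Fin n → Bool) → # W ≡ suc (s + s + s) →
  (∀ u y → T (F u) → Adj G u y → T (F y) ⊎ T (B y)) → # B ≤ s → s < # (W ∩ᵇ F) → # (W ∩ᵇ F) ≤ s + s → Separation G s W
separate {n} G s W F B W≡ closed B≤ s< ≤2s = record
  { g = λ u → lab (B u) (F u) ; g< = λ u → lab< (B u) (F u)
  ; apart = λ u v a (p , q) → case closed u v (one (B u) (F u) p) a of λ
      { (inj₁ f) → proj₂ (two (B v) (F v) q) f ; (inj₂ b) → proj₁ (two (B v) (F v) q) b }
  ; small₀ = ≤-trans (#-mono (λ u → zer (B u) (F u))) B≤
  ; small₁ = ≤-trans (#-mono (λ u t → T-∧ {W u} (T-∧₁ t) (one (B u) (F u) (≡ᵇ⇒≡ _ 1 (T-∧₂ {W u} t))))) ≤2s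
  ; small₂ = +-cancelʳ-≤ (suc s) _ _ (≤-trans (+-monoʳ-≤ _ s<) (≤-trans (#-disjoint {h = W} (λ u → T-∧₁) (λ u → T-∧₁)
      (λ u t t′ → proj₂ (two (B u) (F u) (≡ᵇ⇒≡ _ 2 (T-∧₂ {W u} t))) (T-∧₂ {W u} t′))) (≤-reflexive (trans W≡ (sym (+-suc (s + s) s)))))) }
  where
  lab : Bool → Bool → ℕ
  lab true  _     = 0
  lab false true  = 1
  lab false false = 2
  lab< : ∀ x y → lab x y < 3
  lab< true  _     = s≤s z≤n
  lab< false true  = s≤s (s≤s z≤n)
  lab< false false = s≤s (s≤s (s≤s z≤n))
  zer : ∀ x y → T (lab x y ≡ᵇ 0) → T x
  zer true y _ = tt
  zer false true ()
  zer false false ()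
  one : ∀ x y → lab x y ≡ 1 → T y
  one false true _ = tt
  two : ∀ x y → lab x y ≡ 2 → ¬ T x × ¬ T y
  two false false _ = (λ ()) , (λ ())

module Peel {n m : ℕ} (G : Graph n) (tree : Graph m) (acyclic : ¬ Cycle tree) (bg : Fin m → Fin n → Bool) (s : ℕ)
  (bg≤ : ∀ t → # (bg t) ≤ s) (W : Fin n → Bool) (W≡ : # W ≡ suc (s + s + s)) where

  -- F t collects the vertices occurring only in bags of leaves peeled off into t.  If F grows beyond s marked vertices
  -- in one step it still has at most 2s of them, and then the bag of t is a balanced separator.
  record State (live : Fin m → Bool) (F : Fin m → Fin n → Bool) : Set where
    field
      connected : ConnectedOn tree (T ∘ live)
      subtree   : ∀ u → ConnectedOn tree (λ t → T (live t) × T (bg t u))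
      cover     : ∀ u → ∃[ t ] (T (live t) × (T (bg t u) ⊎ T (F t u)))
      forgotten : ∀ t t′ u → T (live t) → T (F t u) → T (live t′) → ¬ T (bg t′ u)
      closed    : ∀ t u y → T (live t) → T (F t u) → Adj G u y → T (F t y) ⊎ T (bg t y)
      edges     : ∀ u y → Adj G u y → ∃[ t ] (T (live t) × ((T (bg t u) × T (bg t y)) ⊎ (T (F t u) ⊎ T (F t y))))
      small     : ∀ t → T (live t) → # (W ∩ᵇ F t) ≤ s

  Leaf : (Fin m → Bool) → Fin m → Fin m → Set
  Leaf live l p = T (live l) × T (live p) × Adj tree l p × (∀ y → T (live y) → Adj tree l y → y ≡ p)

  leaf? : ∀ live l p → Dec (Leaf live l p)
  leaf? live l p = T? _ ×-dec T? _ ×-dec T? _ ×-dec all? (λ y → T? _ →-dec (T? _ →-dec (y Fin.≟ p)))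

  module PeelLeaf (live : Fin m → Bool) (F : Fin m → Fin n → Bool) (st : State live F) (l p : Fin m) (leaf : Leaf live l p) where
    open State st

    ll : T (live l)
    ll = proj₁ leaf

    lp : T (live p)
    lp = proj₁ (proj₂ leaf)

    unique : ∀ y → T (live y) → Adj tree l y → y ≡ p
    unique = proj₂ (proj₂ (proj₂ leaf))

    p≢l : p ≢ l
    p≢l refl = adj-irrefl tree (proj₁ (proj₂ (proj₂ leaf)))

    -- The vertices forgotten at `l` earlier, together with those that lose their last live bag with
    -- `l`.
    H : Fin n → Bool
    H u = F l u ∨ (bg l u ∧ not (bg p u))

    live′ : Fin m → Bool
    live′ t = live t ∧ not ⌊ t Fin.≟ l ⌋

    F′ : Fin m → Fin n → Bool
    F′ t u = F t u ∨ (⌊ t Fin.≟ p ⌋ ∧ H u)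

    live⁻ : ∀ {t} → T (live′ t) → T (live t) × t ≢ l
    live⁻ {t} q = T-∧₁ q , ne (T-∧₂ {live t} q)
      where
      ne : T (not ⌊ t Fin.≟ l ⌋) → t ≢ l
      ne q with t Fin.≟ l
      ... | no e = e

    live⁺ : ∀ {t} → T (live t) → t ≢ l → T (live′ t)
    live⁺ {t} q ne = T-∧ q ne′
      where
      ne′ : T (not ⌊ t Fin.≟ l ⌋)
      ne′ with t Fin.≟ l
      ... | yes e = ne e
      ... | no _  = tt

    F⁻ : ∀ {t u} → T (F′ t u) → T (F t u) ⊎ (t ≡ p × T (H u))
    F⁻ {t} {u} q with T-∨ {F t u} q
    ... | inj₁ f = inj₁ f
    ... | inj₂ h with t Fin.≟ p
    ...   | yes e = inj₂ (e , h)

    F⁺ : ∀ {u} → T (H u) → T (F′ p u)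
    F⁺ {u} h with p Fin.≟ p
    ... | yes _ = T-∨₂ {F p u} h
    ... | no ne = contradiction refl ne

    H⁻ : ∀ {u} → T (H u) → T (F l u) ⊎ (T (bg l u) × ¬ T (bg p u))
    H⁻ {u} h with T-∨ {F l u} h
    ... | inj₁ f = inj₁ f
    ... | inj₂ q = inj₂ (T-∧₁ q , T-not (T-∧₂ {bg l u} q))

    bag-or-H : ∀ {u} → T (bg l u) → T (H u) ⊎ T (bg p u)
    bag-or-H {u} q with T? (bg p u)
    ... | yes r = inj₂ r
    ... | no r  = inj₁ (T-∨₂ {F l u} (T-∧ q (not-T r)))

    -- The live bags containing `u` are connected, and the only way out of `l` leads through `p`.
    only : ∀ {u t} → T (bg l u) → ¬ T (bg p u) → T (live t) → T (bg t u) → t ≡ l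
    only {u} {t} q r lt qt with subtree u l t (ll , q) (lt , qt)
    ... | ε = refl
    ... | (_ , (ly , qy) , a) ◅ _ = contradiction (subst (λ y → T (bg y u)) (unique _ ly a) qy) r

    -- For a vertex that is just being forgotten, a live bag containing an edge at it can only be
    -- that of `l`. If instead the other end was forgotten earlier, closedness shows that this
    -- happened at `l`.
    H-closed : ∀ u y → T (H u) → Adj G u y → T (H y) ⊎ T (bg p y)
    H-closed u y h a with H⁻ h
    ... | inj₁ f with closed l u y ll f a
    ...   | inj₁ f′ = inj₁ (T-∨₁ f′)
    ...   | inj₂ q  = bag-or-H q
    H-closed u y h a | inj₂ (q , r) with edges u y a
    ... | t , lt , inj₁ (qu , qy) with only q r lt qu
    ...   | refl = bag-or-H qy
    H-closed u y h a | inj₂ (q , r) | t , lt , inj₂ (inj₁ f) = contradiction q (forgotten t l u lt f ll)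
    H-closed u y h a | inj₂ (q , r) | t , lt , inj₂ (inj₂ f) with closed t y u lt f (adj-sym G a)
    ... | inj₁ f′ = contradiction q (forgotten t l u lt f′ ll)
    ... | inj₂ qu with only q r lt qu
    ...   | refl = inj₁ (T-∨₁ f)

    U : Fin n → Bool
    U u = F p u ∨ H u

    U-closed : ∀ u y → T (U u) → Adj G u y → T (U y) ⊎ T (bg p y)
    U-closed u y t a with T-∨ {F p u} t
    ... | inj₁ f with closed p u y lp f a
    ...   | inj₁ f′ = inj₁ (T-∨₁ f′)
    ...   | inj₂ q  = inj₂ q
    U-closed u y t a | inj₂ h with H-closed u y h a
    ... | inj₁ h′ = inj₁ (T-∨₂ {F p y} h′)
    ... | inj₂ q  = inj₂ q

    H≤ : # (W ∩ᵇ H) ≤ s + s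
    H≤ = ≤-trans (#-∪ {g = W ∩ᵇ F l} {h = bg l} (λ u t → [ (λ f → inj₁ (T-∧ {W u} (T-∧₁ t) f)) , (λ q → inj₂ (proj₁ q)) ]′ (H⁻ (T-∧₂ {W u} t))))
      (+-mono-≤ (small l ll) (bg≤ l))

    U≤ : # (W ∩ᵇ H) ≤ s → # (W ∩ᵇ U) ≤ s + s
    U≤ le = ≤-trans (#-∪ {g = W ∩ᵇ F p} {h = W ∩ᵇ H} (λ u t → [ (λ f → inj₁ (T-∧ {W u} (T-∧₁ t) f)) , (λ q → inj₂ (T-∧ {W u} (T-∧₁ t) q)) ]′ (T-∨ {F p u} (T-∧₂ {W u} t))))
      (+-mono-≤ (small p lp) le)

    peel : # (W ∩ᵇ U) ≤ s → State live′ F′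
    peel U≤s = record
      { connected = λ u v pu pv → Star.map (λ ((a , b) , (c , d) , e) → live⁺ a b , live⁺ c d , e)
          (remove-leaf tree l p unique connected u v (live⁻ pu) (live⁻ pv))
      ; subtree = λ w u v (pu , qu) (pv , qv) → Star.map (λ (((a , a′) , b) , ((c , c′) , d) , e) → (live⁺ a b , a′) , (live⁺ c d , c′) , e)
          (remove-leaf tree l p (λ y (ly , _) → unique y ly) (subtree w) u v
            ((proj₁ (live⁻ pu) , qu) , proj₂ (live⁻ pu)) ((proj₁ (live⁻ pv) , qv) , proj₂ (live⁻ pv)))
      ; cover = cover′ ; forgotten = forgotten′ ; closed = closed′ ; edges = edges′ ; small = small′ }
      where
      lp′ : T (live′ p)
      lp′ = live⁺ lp p≢l
      cover′ : ∀ u → ∃[ t ] (T (live′ t) × (T (bg t u) ⊎ T (F′ t u)))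
      cover′ u with cover u
      ... | t , lt , c with t Fin.≟ l
      ...   | no ne = t , live⁺ lt ne , [ inj₁ , (λ f → inj₂ (T-∨₁ f)) ]′ c
      cover′ u | t , lt , inj₁ q | yes refl = p , lp′ , [ (λ h → inj₂ (F⁺ h)) , inj₁ ]′ (bag-or-H q)
      cover′ u | t , lt , inj₂ f | yes refl = p , lp′ , inj₂ (F⁺ (T-∨₁ f))
      forgotten′ : ∀ t t′ u → T (live′ t) → T (F′ t u) → T (live′ t′) → ¬ T (bg t′ u)
      forgotten′ t t′ u lt f lt′ q with F⁻ {t} {u} f
      ... | inj₁ f₀ = forgotten t t′ u (proj₁ (live⁻ lt)) f₀ (proj₁ (live⁻ lt′)) q
      ... | inj₂ (refl , h) with H⁻ h
      ...   | inj₁ f₀ = forgotten l t′ u ll f₀ (proj₁ (live⁻ lt′)) q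
      ...   | inj₂ (ql , qp) = proj₂ (live⁻ lt′) (only ql qp (proj₁ (live⁻ lt′)) q)
      closed′ : ∀ t u y → T (live′ t) → T (F′ t u) → Adj G u y → T (F′ t y) ⊎ T (bg t y)
      closed′ t u y lt f a with F⁻ {t} {u} f
      ... | inj₁ f₀ = [ (λ f₁ → inj₁ (T-∨₁ f₁)) , inj₂ ]′ (closed t u y (proj₁ (live⁻ lt)) f₀ a)
      ... | inj₂ (refl , h) = [ (λ h′ → inj₁ (F⁺ h′)) , inj₂ ]′ (H-closed u y h a)
      edges′ : ∀ u y → Adj G u y → ∃[ t ] (T (live′ t) × ((T (bg t u) × T (bg t y)) ⊎ (T (F′ t u) ⊎ T (F′ t y))))
      edges′ u y a with edges u y a
      ... | t , lt , c with t Fin.≟ l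
      edges′ u y a | t , lt , inj₁ q          | no ne = t , live⁺ lt ne , inj₁ q
      edges′ u y a | t , lt , inj₂ (inj₁ f)   | no ne = t , live⁺ lt ne , inj₂ (inj₁ (T-∨₁ f))
      edges′ u y a | t , lt , inj₂ (inj₂ f)   | no ne = t , live⁺ lt ne , inj₂ (inj₂ (T-∨₁ f))
      edges′ u y a | t , lt , inj₂ (inj₁ f)   | yes refl = p , lp′ , inj₂ (inj₁ (F⁺ (T-∨₁ f)))
      edges′ u y a | t , lt , inj₂ (inj₂ f)   | yes refl = p , lp′ , inj₂ (inj₂ (F⁺ (T-∨₁ f)))
      edges′ u y a | t , lt , inj₁ (qu , qy)  | yes refl with bag-or-H qu | bag-or-H qy
      ... | inj₁ h | _      = p , lp′ , inj₂ (inj₁ (F⁺ h))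
      ... | inj₂ r | inj₁ h = p , lp′ , inj₂ (inj₂ (F⁺ h))
      ... | inj₂ r | inj₂ r′ = p , lp′ , inj₁ (r , r′)
      small′ : ∀ t → T (live′ t) → # (W ∩ᵇ F′ t) ≤ s
      small′ t lt with t Fin.≟ p
      ... | yes refl = ≤-trans (#-mono (λ u q → T-∧ {W u} (T-∧₁ q) (T-∧₂ {W u} q))) U≤s
      ... | no ne    = ≤-trans (#-mono (λ u q → T-∧ {W u} (T-∧₁ q) ([ (λ f → f) , (λ ()) ]′ (T-∨ {F t u} (T-∧₂ {W u} q))))) (small t (proj₁ (live⁻ lt)))

    fewer : # live′ < # live
    fewer = ≤-trans (s≤s (#-mono {f = live′} (λ t q → T-∧ (T-∧₁ q) (T-∧₂ {live t} q))))
      (≤-trans (≤-trans (≤-reflexive (+-comm 1 (# live′))) (+-monoʳ-≤ (# live′) one))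
        (#-disjoint {f = live′} {g = λ t → ⌊ t Fin.≟ l ⌋} {h = live} (λ t q → proj₁ (live⁻ q)) (λ t q → isl t q) (λ t q r → proj₂ (live⁻ q) (is t r))))
      where
      is : ∀ t → T ⌊ t Fin.≟ l ⌋ → t ≡ l
      is t q with t Fin.≟ l
      ... | yes e = e
      isl : ∀ t → T ⌊ t Fin.≟ l ⌋ → T (live t)
      isl t q with is t q
      ... | refl = ll
      one : 1 ≤ # (λ t → ⌊ t Fin.≟ l ⌋)
      one = single l
        where
        single : ∀ {k} (l : Fin k) → 1 ≤ # (λ t → ⌊ t Fin.≟ l ⌋)
        single zero = s≤s z≤n
        single (suc l) = ≤-trans (single l) (≤-trans (#-mono (λ u q → sucT u l q)) (m≤n+m _ _))
          where
          sucT : ∀ {k} (u l : Fin k) → T ⌊ u Fin.≟ l ⌋ → T ⌊ suc u Fin.≟ suc l ⌋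
          sucT u l q with u Fin.≟ l
          ... | yes _ = tt

  -- The thresholds are tested in turn: `H` never has more than `2s` marked vertices, while for `U`
  -- this bound requires that `H` has at most `s`. Without a leaf only one live node is left, and
  -- its bag and forgotten vertices account for at most `2s` marked vertices, fewer than there are.
  separation : ∀ f live F → # live ≤ f → State live F → Separation G s W
  separation f live F le st with any? (λ l → any? (leaf? live l))
  separation f live F le st | no none = contradiction (≤-trans (≤-reflexive (sym W≡)) (≤-trans
      (#-∪ {g = W ∩ᵇ F t₀} {h = bg t₀} (λ u w → all-t₀ u w))
      (+-mono-≤ (small t₀ l₀) (bg≤ t₀)))) (<⇒≱ (s≤s (m≤m+n (s + s) s)))
    where
    open State st
    u₀ : ∃[ u ] T (W u)
    u₀ = #-positive W (λ z → case trans (sym W≡) z of λ ())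
    t₀ : Fin m
    t₀ = proj₁ (cover (proj₁ u₀))
    l₀ : T (live t₀)
    l₀ = proj₁ (proj₂ (cover (proj₁ u₀)))
    branch : ∀ l x → T (live l) → T (live x) → Adj tree l x → ∃[ y ] (T (live y) × Adj tree l y × y ≢ x)
    branch l x ll lx a with any? (λ y → T? (live y) ×-dec T? (adj tree l y) ×-dec ¬? (y Fin.≟ x))
    ... | yes r = r
    ... | no r = contradiction (l , x , ll , lx , a , λ y ly a′ → decidable-stable (y Fin.≟ x) (λ ne → r (y , ly , a′ , ne))) none
    same : ∀ t → T (live t) → t ≡ t₀
    same t lt with connected t t₀ lt l₀
    ... | ε = refl
    ... | (lt , ly , a) ◅ _ = contradiction a (no-edge tree acyclic live branch _ _ lt ly)
    all-t₀ : ∀ u → T (W u) → T ((W ∩ᵇ F t₀) u) ⊎ T (bg t₀ u)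
    all-t₀ u w with cover u
    ... | t , lt , c with same t lt
    ...   | refl = [ inj₂ , (λ f → inj₁ (T-∧ w f)) ]′ c
  separation zero live F le st | yes (l , p , leaf) = contradiction (≤-trans (PeelLeaf.fewer live F st l p leaf) le) (λ ())
  separation (suc f) live F le st | yes (l , p , leaf) with s <? # (W ∩ᵇ PeelLeaf.H live F st l p leaf)
  ... | yes s<H = separate G s W _ (bg p) W≡ (PeelLeaf.H-closed live F st l p leaf) (bg≤ p) s<H (PeelLeaf.H≤ live F st l p leaf)
  ... | no H≤s with s <? # (W ∩ᵇ PeelLeaf.U live F st l p leaf)
  ...   | yes s<U = separate G s W _ (bg p) W≡ (PeelLeaf.U-closed live F st l p leaf) (bg≤ p) s<U (PeelLeaf.U≤ live F st l p leaf (≮⇒≥ H≤s))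
  ...   | no U≤s = separation f _ _ (s≤s⁻¹ (≤-trans (PeelLeaf.fewer live F st l p leaf) le)) (PeelLeaf.peel live F st l p leaf (≮⇒≥ U≤s))

-- From bounded treewidth to splits of numbered vertices

array-toℕ : ∀ {m} (f : Fin m → ℕ) (x : Fin m) → array f (toℕ x) ≡ f x
array-toℕ {m} f x with toℕ x <? m
... | yes p = cong f (fromℕ<-toℕ x p)
... | no ¬p = contradiction (toℕ<n x) ¬p

matrix-at : ∀ {m n} (f : Fin m → Fin n → ℕ) i j → matrix f (n * toℕ i + toℕ j) ≡ f i j
matrix-at {m} {n} f i j = trans (cong (matrix f) (sym (toℕ-combine i j)))
  (trans (array-toℕ (uncurry f ∘ remQuot n) (combine i j)) (cong (uncurry f) (remQuot-combine i j)))

∑-shift : ∀ n f → ∑ (suc n) f ≡ f 0 + ∑ n (f ∘ suc)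
∑-shift zero    f = sym (+-identityʳ (f 0))
∑-shift (suc n) f = trans (cong (_+ f (suc n)) (∑-shift n f)) (+-assoc (f 0) (∑ n (f ∘ suc)) (f (suc n)))

∑-Fin : ∀ n f → ∑ n f ≡ ∑ᶠ n (f ∘ toℕ)
∑-Fin zero    f = refl
∑-Fin (suc n) f = trans (∑-shift n f) (cong (f 0 +_) (∑-Fin n (f ∘ suc)))

∣_∣≡# : ∀ {n} (p : Subset n) → ∣ p ∣ ≡ # (Vec.lookup p)
∣ Vec.[] ∣≡#           = refl
∣ true Vec.∷ p ∣≡#     = cong suc ∣ p ∣≡#
∣ false Vec.∷ p ∣≡#    = ∣ p ∣≡#

∈⇒T : ∀ {n} {p : Subset n} {u} → u ∈ p → T (Vec.lookup p u)
∈⇒T m = subst T (sym ([]=⇒lookup m)) tt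

T⇒∈ : ∀ {n} {p : Subset n} {u} → T (Vec.lookup p u) → u ∈ p
T⇒∈ {p = p} {u} t = lookup⇒[]= u p (is-true (Vec.lookup p u) t)
  where
  is-true : ∀ c → T c → c ≡ true
  is-true true _ = refl

bag-size : ∀ {n} {G : Graph n} (D : TreeDecomposition G) ℓ → width D ℤ.≤ ℤ.+ ℓ → ∀ t → # (Vec.lookup (TreeDecomposition.bag D t)) ≤ suc ℓ
bag-size D ℓ w≤ t = ≤-trans (≤-reflexive (sym ∣ bag t ∣≡#))
  (≤-trans (Extrema.v≤max⁺ 0 (tabulate (∣_∣ ∘ bag)) (inj₂ (Any.tabulate⁺ t ≤-refl))) (le _ w≤))
  where
  open TreeDecomposition D
  le : ∀ x → ℤ.+ x ℤ.- ℤ.+ 1 ℤ.≤ ℤ.+ ℓ → x ≤ suc ℓ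
  le zero    _ = z≤n
  le (suc x) p = s≤s (ℤ.drop‿+≤+ p)

treewidth-separation : ∀ {n} (G : Graph n) ℓ → TreewidthAtMost G ℓ → ∀ W → # W ≡ suc (suc ℓ + suc ℓ + suc ℓ) → Separation G (suc ℓ) W
treewidth-separation {n} G ℓ (w , tw , w≤ℓ) W W≡ = separation (# {nodes} (λ _ → true)) (λ _ → true) (λ _ _ → false) ≤-refl (record
  { connected = λ u v _ _ → Star.map (λ a → tt , tt , a) (connected u v)
  ; subtree = λ w u v (_ , p) (_ , q) → Star.map (λ (a , b , c) → (tt , ∈⇒T a) , (tt , ∈⇒T b) , c) (subtrees w u v (T⇒∈ p) (T⇒∈ q))
  ; cover = λ u → let t , m = vertices u in t , tt , inj₁ (∈⇒T m)
  ; forgotten = λ _ _ _ _ ()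
  ; closed = λ _ _ _ _ ()
  ; edges = λ u y a → let t , m , m′ = edges u y a in t , tt , inj₁ (∈⇒T m , ∈⇒T m′)
  ; small = λ t _ → ≤-trans (≤-reflexive (none W)) z≤n })
  where
  D : TreeDecomposition G
  D = proj₁ (IsTreewidth.attained tw)
  open TreeDecomposition D
  open IsTree isTree
  open Peel G tree acyclic (λ t → Vec.lookup (bag t)) (suc ℓ)
    (bag-size D ℓ (subst (ℤ._≤ ℤ.+ ℓ) (sym (proj₂ (IsTreewidth.attained tw))) w≤ℓ)) W W≡
  none : ∀ {n} (W : Fin n → Bool) → # (W ∩ᵇ (λ _ → false)) ≡ 0
  none {zero}  W = refl
  none {suc n} W with W zero
  ... | true  = none (W ∘ suc)
  ... | false = none (W ∘ suc)

count : ℕ → (ℕ → ℕ) → ℕ → (ℕ → ℕ) → ℕ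
count nv g l w = ∑ nv (λ u → when (g u ≡ᵇ l) (w u))

-- The bounds on a side are stated together with the separator because the two jointly form the
-- boundary of a child, which may have at most `3s` vertices. They follow from `2s` for the side and
-- `s` for the separator.
record Split (s nv : ℕ) (E : ℕ → ℕ → Set) (w : ℕ → ℕ) (g : ℕ → ℕ) : Set where
  field
    apart : ∀ u v → u < nv → v < nv → E u v → ¬ (g u ≡ 1 × g v ≡ 2)
    c≤    : count nv g 0 (λ _ → 1) ≤ s
    a+c≤  : count nv g 1 w + count nv g 0 (λ _ → 1) ≤ s + s + s
    b+c≤  : count nv g 2 w + count nv g 0 (λ _ → 1) ≤ s + s + s

-- With at most `3s` marked vertices all vertices can go to one side, with an empty separator.
-- Otherwise there are exactly `3s + 1`, and a separation of all of `G` is restricted to its first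
-- `nv` vertices.
split-exists : ∀ {n} (G : Graph n) ℓ → TreewidthAtMost G ℓ → ∀ nv (E : ℕ → ℕ → Set) w → nv ≤ n →
  (∀ u v → u < nv → v < nv → E u v → Σ[ u′ ∈ Fin n ] Σ[ v′ ∈ Fin n ] (toℕ u′ ≡ u × toℕ v′ ≡ v × Adj G u′ v′)) →
  (∀ u → u < nv → w u ≤ 1) → ∑ nv w ≤ suc (suc ℓ + suc ℓ + suc ℓ) →
  Σ[ g ∈ (ℕ → ℕ) ] ((∀ u → g u < 3) × Split (suc ℓ) nv E w g)
split-exists {n} G ℓ tw nv E w nv≤n edge w≤1 ∑≤ with m≤n⇒m<n∨m≡n ∑≤
... | inj₁ (s≤s le) = (λ _ → 1) , (λ _ → s≤s (s≤s z≤n)) , record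
  { apart = λ _ _ _ _ _ → λ ()
  ; c≤ = ≤-trans (≤-reflexive zer) z≤n
  ; a+c≤ = ≤-trans (≤-reflexive (trans (cong (∑ nv w +_) zer) (+-identityʳ _))) le
  ; b+c≤ = ≤-trans (≤-reflexive (cong₂ _+_ zer zer)) z≤n }
  where
  zer : ∑ nv (λ _ → 0) ≡ 0
  zer = ∑-zero nv (λ _ _ → refl)
... | inj₂ full = g , g<′ , record
  { apart = λ u v u<nv v<nv e (p , q) → case edge u v u<nv v<nv e of λ
      { (u′ , v′ , refl , refl , a) → apart u′ v′ a (trans (sym (array-toℕ gᶠ u′)) p , trans (sym (array-toℕ gᶠ v′)) q) }
  ; c≤ = c≤′
  ; a+c≤ = +-mono-≤ (≤-trans (part 1) small₁) c≤′
  ; b+c≤ = +-mono-≤ (≤-trans (part 2) small₂) c≤′ }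
  where
  one : ℕ → Bool
  one u = (u <ᵇ nv) ∧ (0 <ᵇ w u)
  W : Fin n → Bool
  W = one ∘ toℕ
  inside : ∀ u → u < nv → w u ≡ 𝟙 (one u)
  inside u lt with u <ᵇ nv | <⇒<ᵇ lt | w u | w≤1 u lt
  ... | true | _ | zero | _ = refl
  ... | true | _ | suc zero | _ = refl
  ... | true | _ | suc (suc _) | s≤s ()
  outside : ∀ u → nv ≤ u → one u ≡ false
  outside u le with u <ᵇ nv in eq
  ... | false = refl
  ... | true  = contradiction (<ᵇ⇒< u nv (subst T (sym eq) tt)) (≤⇒≯ le)
  pad : ∀ d f → (∀ u → nv ≤ u → f u ≡ 0) → ∑ (d + nv) f ≡ ∑ nv f
  pad zero    f z = refl
  pad (suc d) f z = trans (cong₂ _+_ (pad d f z) (z (d + nv) (m≤n+m nv d))) (+-identityʳ _)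
  n≡ : n ∸ nv + nv ≡ n
  n≡ = m∸n+n≡m nv≤n
  W≡ : # W ≡ suc (suc ℓ + suc ℓ + suc ℓ)
  W≡ = trans (sym (∑-Fin n (𝟙 ∘ one))) (trans (cong (λ k → ∑ k (𝟙 ∘ one)) (sym n≡))
    (trans (pad (n ∸ nv) (𝟙 ∘ one) (λ u le → cong 𝟙 (outside u le))) (trans (sym (∑-cong nv inside)) full)))
  open Separation (treewidth-separation G ℓ tw W W≡) renaming (g to gᶠ)
  g : ℕ → ℕ
  g = array gᶠ
  g<′ : ∀ u → g u < 3
  g<′ u with u <? n
  ... | yes p = g< (fromℕ< p)
  ... | no _  = z<s
  c≤′ : count nv g 0 (λ _ → 1) ≤ suc ℓ
  c≤′ = ≤-trans (∑-extend _ nv≤n) (≤-trans (≤-reflexive (∑-Fin n _))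
    (≤-trans (∑ᶠ-mono n (λ u → ≤-reflexive (cong (λ l → 𝟙 (l ≡ᵇ 0)) (array-toℕ gᶠ u)))) small₀))
  part : ∀ l → count nv g l w ≤ # (λ u → W u ∧ (gᶠ u ≡ᵇ l))
  part l = ≤-trans (∑-mono nv {g = λ u → 𝟙 (one u ∧ (g u ≡ᵇ l))} (λ u lt → ≤-reflexive (trans (cong (when (g u ≡ᵇ l)) (inside u lt)) (swap (g u ≡ᵇ l) (one u)))))
    (≤-trans (∑-extend _ nv≤n) (≤-trans (≤-reflexive (∑-Fin n _))
      (∑ᶠ-mono n (λ u → ≤-reflexive (cong (λ k → 𝟙 (W u ∧ (k ≡ᵇ l))) (array-toℕ gᶠ u))))))
    where
    swap : ∀ c d → when c (𝟙 d) ≡ 𝟙 (d ∧ c)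
    swap true  true  = refl
    swap true  false = refl
    swap false true  = refl
    swap false false = refl

-- Splitting a decomposition: invariants

In : ℕ → (ℕ → ℕ) → (ℕ → ℕ) → ℕ → ℕ → Set
In b len bag j u = ∃[ a ] (a < len j × bag (b * j + a) ≡ u)

placed : ℕ → (ℕ → ℕ) → ℕ
placed nv own = ∑ nv (λ u → when (own u ≡ᵇ 0) 1)

-- own u is 0 for a vertex u already in a bag, and 1 + j for a vertex still to be decomposed below node j.
record Queue (b nv : ℕ) (E : ℕ → ℕ → Set) (it m₂ μ : ℕ) (own len bag par hn hs : ℕ → ℕ) : Set where
  field
    m₂≥1    : 1 ≤ m₂
    parent  : ∀ j → 1 ≤ j → j < m₂ → par j < j
    -- Strict: every bag keeps a free slot for the vertex that is added after the rebuild.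
    fits    : ∀ j → j < m₂ → len j < b
    homed   : ∀ u → u < nv → own u ≡ 0 → hn u < m₂ × hs u < len (hn u) × bag (b * hn u + hs u) ≡ u
    owned   : ∀ u → u < nv → own u ≢ 0 → ∃[ j ] (own u ≡ suc j × it ≤ j × j < m₂)
    up      : ∀ j u → j < m₂ → In b len bag j u → u < nv × own u ≡ 0 × (hn u ≡ j ⊎ (1 ≤ j × In b len bag (par j) u))
    covered : ∀ u v → u < nv → v < nv → E u v → own u ≡ 0 → own v ≡ 0 → ∃[ j ] (j < m₂ × In b len bag j u × In b len bag j v)
    -- The bag of `j` separates the vertices owned by `j` from all others.
    near    : ∀ u v j → u < nv → v < nv → E u v → own u ≡ suc j → own v ≡ suc j ⊎ In b len bag j v
    -- Two nodes per placed vertex, and one for the root. `μ` is the number of nodes, or two more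
    -- between the placing of a vertex and the split that it pays for.
    count≥  : μ ≤ 1 + 2 * placed nv own

∑-set-below : ∀ nv own x → x < nv → own x ≢ 0 → suc (placed nv own) ≤ placed nv (set own x 0)
∑-set-below nv own x x<nv ne = ≤-trans
  (≤-reflexive (trans (+-comm 1 _) (trans (cong (placed nv own +_) (sym (∑-delta nv x (λ _ → 1) x<nv))) (sym (∑-+ nv _ _)))))
  (∑-mono nv le)
  where
  le : ∀ u → u < nv → when (own u ≡ᵇ 0) 1 + when (u ≡ᵇ x) 1 ≤ when (set own x 0 u ≡ᵇ 0) 1
  le u _ with u ≟ x
  ... | yes refl rewrite ≡ᵇ-refl u | ≢⇒≡ᵇ ne = ≤-refl
  ... | no u≢x rewrite ≢⇒≡ᵇ u≢x | ≢⇒≡ᵇ (u≢x ∘ sym) = ≤-reflexive (+-identityʳ _)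

module Queues (b nv : ℕ) (E : ℕ → ℕ → Set) (E-sym : ∀ u v → u < nv → v < nv → E u v → E v u) where

  -- The edges that become due are those from `x` to vertices already placed; by `near` these lie in
  -- the bag of `it`, which `x` joins. The same bag takes care of the neighbours of `x` that `it`
  -- still owns.
  place : ∀ {it m₂ μ own len bag par hn hs} x → Queue b nv E it m₂ μ own len bag par hn hs → it < m₂ →
    x < nv → own x ≡ suc it → suc (len it) < b →
    Queue b nv E it m₂ (2 + μ) (set own x 0) (set len it (suc (len it))) (set bag (b * it + len it) x) par (set hn x it) (set hs x (len it))
  place {it} {m₂} {μ} {own} {len} {bag} {par} {hn} {hs} x Q it<m₂ x<nv ox lt = record
    { m₂≥1 = m₂≥1 ; parent = parent ; fits = fits′ ; homed = homed′ ; owned = owned′ ; up = up′ ; covered = covered′ ; near = near′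
    ; count≥ = ≤-trans (+-monoʳ-≤ 2 count≥) (≤-trans (≤-reflexive (cong suc (sym (*-suc 2 (placed nv own)))))
        (s≤s (*-monoʳ-≤ 2 (∑-set-below nv own x x<nv (λ e → case trans (sym ox) e of λ ()))))) }
    where
    open Queue Q
    own′ len′ bag′ hn′ hs′ : ℕ → ℕ
    own′ = set own x 0
    len′ = set len it (suc (len it))
    bag′ = set bag (b * it + len it) x
    hn′  = set hn x it
    hs′  = set hs x (len it)
    In₀ In′ : ℕ → ℕ → Set
    In₀ = In b len bag
    In′ = In b len′ bag′
    len-it : len′ it ≡ suc (len it)
    len-it = set-same len it _
    len≤ : ∀ j → len j ≤ len′ j
    len≤ j with it ≟ j
    ... | yes refl = ≤-trans (n≤1+n _) (≤-reflexive (sym len-it))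
    ... | no ne = ≤-reflexive (sym (set-other len {it} {j} _ ne))
    slot : ∀ j a → j < m₂ → a < len j → bag′ (b * j + a) ≡ bag (b * j + a)
    slot j a j<m₂ a<len = set-other bag {b * it + len it} {b * j + a} x
      (λ e → case index-inj {b} {it} {j} (<-trans (n<1+n _) lt) (<-trans a<len (fits j j<m₂)) e of λ { (refl , refl) → <-irrefl refl a<len })
    new : In′ it x
    new = len it , ≤-reflexive (sym len-it) , set-same bag (b * it + len it) x
    In⁺ : ∀ {j u} → j < m₂ → In₀ j u → In′ j u
    In⁺ {j} j<m₂ (a , a<len , e) = a , ≤-trans a<len (len≤ j) , trans (slot j a j<m₂ a<len) e
    In⁻ : ∀ {j u} → j < m₂ → In′ j u → In₀ j u ⊎ (j ≡ it × u ≡ x)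
    In⁻ {j} {u} j<m₂ (a , a<len′ , e) with it ≟ j
    ... | no ne = let a<len = ≤-trans a<len′ (≤-reflexive (set-other len {it} {j} _ ne)) in inj₁ (a , a<len , trans (sym (slot j a j<m₂ a<len)) e)
    ... | yes refl with m<1+n⇒m<n∨m≡n (≤-trans a<len′ (≤-reflexive len-it))
    ...   | inj₁ a<len = inj₁ (a , a<len , trans (sym (slot it a j<m₂ a<len)) e)
    ...   | inj₂ refl = inj₂ (refl , trans (sym e) (set-same bag (b * it + len it) x))
    own-x : own′ x ≡ 0
    own-x = set-same own x 0
    own-≢ : ∀ {u} → x ≢ u → own′ u ≡ own u
    own-≢ {u} ne = set-other own {x} {u} 0 ne
    hn-≢ : ∀ {u} → x ≢ u → hn′ u ≡ hn u
    hn-≢ {u} ne = set-other hn {x} {u} it ne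
    0≢ : ∀ {u} → own u ≡ 0 → x ≢ u
    0≢ e refl = case trans (sym e) ox of λ ()
    fits′ : ∀ j → j < m₂ → len′ j < b
    fits′ j j<m₂ with it ≟ j
    ... | yes refl = ≤-trans (s≤s (≤-reflexive len-it)) lt
    ... | no ne = ≤-trans (s≤s (≤-reflexive (set-other len {it} {j} _ ne))) (fits j j<m₂)
    homed′ : ∀ u → u < nv → own′ u ≡ 0 → hn′ u < m₂ × hs′ u < len′ (hn′ u) × bag′ (b * hn′ u + hs′ u) ≡ u
    homed′ u u<nv ou with x ≟ u
    ... | yes refl rewrite set-same hn x it | set-same hs x (len it) = it<m₂ , ≤-reflexive (sym len-it) , set-same bag (b * it + len it) x
    ... | no ne rewrite set-other hn {x} {u} it ne | set-other hs {x} {u} (len it) ne =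
      let h , h₁ , h₂ = homed u u<nv (trans (sym (own-≢ ne)) ou) in h , ≤-trans h₁ (len≤ (hn u)) , trans (slot (hn u) (hs u) h h₁) h₂
    owned′ : ∀ u → u < nv → own′ u ≢ 0 → ∃[ j ] (own′ u ≡ suc j × it ≤ j × j < m₂)
    owned′ u u<nv ou with x ≟ u
    ... | yes refl = contradiction own-x ou
    ... | no ne = let j , e , r = owned u u<nv (λ e → ou (trans (own-≢ ne) e)) in j , trans (own-≢ ne) e , r
    up′ : ∀ j u → j < m₂ → In′ j u → u < nv × own′ u ≡ 0 × (hn′ u ≡ j ⊎ (1 ≤ j × In′ (par j) u))
    up′ j u j<m₂ i with In⁻ j<m₂ i
    ... | inj₂ (refl , refl) = x<nv , own-x , inj₁ (set-same hn x it)
    ... | inj₁ i₀ with up j u j<m₂ i₀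
    ...   | u<nv , ou , c = u<nv , trans (own-≢ (0≢ ou)) ou , (case c of λ
              { (inj₁ h) → inj₁ (trans (hn-≢ (0≢ ou)) h)
              ; (inj₂ (1≤j , i′)) → inj₂ (1≤j , In⁺ (<-trans (parent j 1≤j j<m₂) j<m₂) i′) })
    beside : ∀ v → v < nv → E x v → own′ v ≡ 0 → In′ it v
    beside v v<nv e ov with x ≟ v
    ... | yes refl = new
    ... | no ne with near x v it x<nv v<nv e ox
    ...   | inj₁ o = case trans (sym o) (trans (sym (own-≢ ne)) ov) of λ ()
    ...   | inj₂ i = In⁺ it<m₂ i
    covered′ : ∀ u v → u < nv → v < nv → E u v → own′ u ≡ 0 → own′ v ≡ 0 → ∃[ j ] (j < m₂ × In′ j u × In′ j v)
    covered′ u v u<nv v<nv e ou ov with x ≟ u | x ≟ v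
    ... | yes refl | _ = it , it<m₂ , new , beside v v<nv e ov
    ... | no _ | yes refl = it , it<m₂ , beside u u<nv (E-sym u v u<nv v<nv e) ou , new
    ... | no nu | no nv′ =
      let j , j<m₂ , i , i′ = covered u v u<nv v<nv e (trans (sym (own-≢ nu)) ou) (trans (sym (own-≢ nv′)) ov) in j , j<m₂ , In⁺ j<m₂ i , In⁺ j<m₂ i′
    near′ : ∀ u v j → u < nv → v < nv → E u v → own′ u ≡ suc j → own′ v ≡ suc j ⊎ In′ j v
    near′ u v j u<nv v<nv e ou with x ≟ u
    ... | yes refl = case trans (sym own-x) ou of λ ()
    ... | no ne with trans (sym (own-≢ ne)) ou
    ...   | ou₀ with owned u u<nv (λ z → case trans (sym ou₀) z of λ ())
    ...     | j′ , ej , _ , j<m₂ with suc-injective (trans (sym ou₀) ej)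
    ...       | refl with near u v j u<nv v<nv e ou₀
    ...         | inj₂ i = inj₂ (In⁺ j<m₂ i)
    ...         | inj₁ ov with x ≟ v
    ...           | no ne′ = inj₁ (trans (own-≢ ne′) ov)
    ...           | yes refl with suc-injective (trans (sym ox) ov)
    ...             | refl = inj₂ new

  record Children (it m₂ : ℕ) (own len bag par inb lab own′ len′ bag′ par′ : ℕ → ℕ) : Set where
    field
      -- As `own` is shifted by one, label 1 sends a vertex to node `m₂` and label 2 to node
      -- `suc m₂`.
      own-≡ : ∀ u → u < nv → own u ≡ suc it → own′ u ≡ m₂ + lab u
      own-≢ : ∀ u → u < nv → own u ≢ suc it → own′ u ≡ own u
      len-≡ : ∀ j → j < m₂ → len′ j ≡ len j
      bag-≡ : ∀ j a → j < m₂ → a < b → bag′ (b * j + a) ≡ bag (b * j + a)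
      par-≡ : ∀ j → j < m₂ → par′ j ≡ par j
      par-A : par′ m₂ ≡ it
      par-B : par′ (suc m₂) ≡ it
      len-A : len′ m₂ < b
      len-B : len′ (suc m₂) < b
      in-A⁺ : ∀ u → u < nv → inb u ≢ 0 → lab u ≢ 2 → In b len′ bag′ m₂ u
      in-B⁺ : ∀ u → u < nv → inb u ≢ 0 → lab u ≢ 1 → In b len′ bag′ (suc m₂) u
      in-A⁻ : ∀ u → In b len′ bag′ m₂ u → u < nv × inb u ≢ 0
      in-B⁻ : ∀ u → In b len′ bag′ (suc m₂) u → u < nv × inb u ≢ 0

  -- The point is `near` for the children. A neighbour of an owned vertex of label 1 is owned too,
  -- and then not of label 2 and hence in the same child, or it lies in the bag of `it`, and then,
  -- not being of label 2, in the bag of that child. Owned vertices of label 0 have been placed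
  -- before. The new bags are contained in that of `it`, so no home changes.
  split : ∀ {it m₂ own len bag par hn hs inb lab own′ len′ bag′ par′} → Queue b nv E it m₂ (2 + m₂) own len bag par hn hs → it < m₂ →
    (∀ u → u < nv → lab u < 3) → (∀ u v → u < nv → v < nv → E u v → ¬ (lab u ≡ 1 × lab v ≡ 2)) →
    (∀ u → u < nv → own u ≡ suc it → lab u ≢ 0) →
    (∀ u → u < nv → In b len bag it u → inb u ≢ 0) → (∀ u → u < nv → inb u ≢ 0 → In b len bag it u) →
    Children it m₂ own len bag par inb lab own′ len′ bag′ par′ →
    Queue b nv E (suc it) (2 + m₂) (2 + m₂) own′ len′ bag′ par′ hn hs
  split {it} {m₂} {own} {len} {bag} {par} {hn} {hs} {inb} {lab} {own′} {len′} {bag′} {par′} Q it<m₂ lab<3 apart lab≢0 in⇒ ⇒in C = record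
    { m₂≥1 = s≤s z≤n ; parent = parent′ ; fits = fits′ ; homed = homed′ ; owned = owned′ ; up = up′ ; covered = covered′ ; near = near′
    ; count≥ = ≤-trans count≥ (s≤s (*-monoʳ-≤ 2 (∑-mono nv grow))) }
    where
    open Queue Q
    open Children C
    In₀ In′ : ℕ → ℕ → Set
    In₀ = In b len bag
    In′ = In b len′ bag′
    cases : ∀ {j} → j < 2 + m₂ → j < m₂ ⊎ (j ≡ m₂ ⊎ j ≡ suc m₂)
    cases lt with m<1+n⇒m<n∨m≡n lt
    ... | inj₂ e = inj₂ (inj₂ e)
    ... | inj₁ lt′ with m<1+n⇒m<n∨m≡n lt′
    ...   | inj₁ l = inj₁ l
    ...   | inj₂ e = inj₂ (inj₁ e)
    wide : ∀ {j} → j < m₂ → j < 2 + m₂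
    wide lt = m<n⇒m<1+n (m<n⇒m<1+n lt)
    In⁺ : ∀ {j u} → j < m₂ → In₀ j u → In′ j u
    In⁺ {j} lt (a , a<len , e) = a , ≤-trans a<len (≤-reflexive (sym (len-≡ j lt))) , trans (bag-≡ j a lt (<-trans a<len (fits j lt))) e
    In⁻ : ∀ {j u} → j < m₂ → In′ j u → In₀ j u
    In⁻ {j} lt (a , a<len , e) = let a< = ≤-trans a<len (≤-reflexive (len-≡ j lt)) in a , a< , trans (sym (bag-≡ j a lt (<-trans a< (fits j lt)))) e
    0⇒ : ∀ {u} → u < nv → own u ≡ 0 → own′ u ≡ 0
    0⇒ {u} lt e = trans (own-≢ u lt (λ e′ → case trans (sym e) e′ of λ ())) e
    ⇒0 : ∀ {u} → u < nv → own′ u ≡ 0 → own u ≡ 0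
    ⇒0 {u} lt e with own u ≟ suc it
    ... | no ne = trans (sym (own-≢ u lt ne)) e
    ... | yes o = contradiction (m+n≡0⇒m≡0 m₂ (trans (sym (own-≡ u lt o)) e)) (λ z → <⇒≱ m₂≥1 (≤-reflexive z))
    grow : ∀ u → u < nv → when (own u ≡ᵇ 0) 1 ≤ when (own′ u ≡ᵇ 0) 1
    grow u lt with own u ≟ 0
    ... | no ne rewrite ≢⇒≡ᵇ ne = z≤n
    ... | yes e rewrite e | 0⇒ lt e = ≤-refl
    parent′ : ∀ j → 1 ≤ j → j < 2 + m₂ → par′ j < j
    parent′ j 1≤j lt with cases lt
    ... | inj₁ l = ≤-trans (s≤s (≤-reflexive (par-≡ j l))) (parent j 1≤j l)
    ... | inj₂ (inj₁ refl) = ≤-trans (s≤s (≤-reflexive par-A)) it<m₂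
    ... | inj₂ (inj₂ refl) = ≤-trans (s≤s (≤-reflexive par-B)) (m<n⇒m<1+n it<m₂)
    fits′ : ∀ j → j < 2 + m₂ → len′ j < b
    fits′ j lt with cases lt
    ... | inj₁ l = ≤-trans (s≤s (≤-reflexive (len-≡ j l))) (fits j l)
    ... | inj₂ (inj₁ refl) = len-A
    ... | inj₂ (inj₂ refl) = len-B
    homed′ : ∀ u → u < nv → own′ u ≡ 0 → hn u < 2 + m₂ × hs u < len′ (hn u) × bag′ (b * hn u + hs u) ≡ u
    homed′ u lt e = let h , h₁ , h₂ = homed u lt (⇒0 lt e) in
      wide h , ≤-trans h₁ (≤-reflexive (sym (len-≡ (hn u) h))) , trans (bag-≡ (hn u) (hs u) h (<-trans h₁ (fits (hn u) h))) h₂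
    lab12 : ∀ u → u < nv → own u ≡ suc it → lab u ≡ 1 ⊎ lab u ≡ 2
    lab12 u lt o with lab u | lab<3 u lt | lab≢0 u lt o
    ... | zero  | _ | ne = contradiction refl ne
    ... | suc zero | _ | _ = inj₁ refl
    ... | suc (suc zero) | _ | _ = inj₂ refl
    ... | suc (suc (suc _)) | s≤s (s≤s (s≤s ())) | _
    own1 : ∀ u → u < nv → own u ≡ suc it → lab u ≡ 1 → own′ u ≡ suc m₂
    own1 u lt o l = trans (own-≡ u lt o) (trans (cong (m₂ +_) l) (+-comm m₂ 1))
    own2 : ∀ u → u < nv → own u ≡ suc it → lab u ≡ 2 → own′ u ≡ suc (suc m₂)
    own2 u lt o l = trans (own-≡ u lt o) (trans (cong (m₂ +_) l) (+-comm m₂ 2))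
    owned′ : ∀ u → u < nv → own′ u ≢ 0 → ∃[ j ] (own′ u ≡ suc j × suc it ≤ j × j < 2 + m₂)
    owned′ u lt ne with own u ≟ suc it
    ... | yes o with lab12 u lt o
    ...   | inj₁ l = m₂ , own1 u lt o l , it<m₂ , s≤s (n≤1+n m₂)
    ...   | inj₂ l = suc m₂ , own2 u lt o l , m<n⇒m<1+n it<m₂ , ≤-refl
    owned′ u lt ne | no no′ with owned u lt (λ z → ne (0⇒ lt z))
    ... | j , e , it≤j , j<m₂ = j , trans (own-≢ u lt no′) e , ≤∧≢⇒< it≤j (λ { refl → no′ e }) , wide j<m₂
    up-child : ∀ j u → 1 ≤ j → par′ j ≡ it → u < nv × inb u ≢ 0 → u < nv × own′ u ≡ 0 × (hn u ≡ j ⊎ (1 ≤ j × In′ (par′ j) u))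
    up-child j u 1≤j p (lt , i) = let i₀ = ⇒in u lt i in
      lt , 0⇒ lt (proj₁ (proj₂ (up it u it<m₂ i₀))) , inj₂ (1≤j , subst (λ k → In′ k u) (sym p) (In⁺ it<m₂ i₀))
    up′ : ∀ j u → j < 2 + m₂ → In′ j u → u < nv × own′ u ≡ 0 × (hn u ≡ j ⊎ (1 ≤ j × In′ (par′ j) u))
    up′ j u lt i with cases lt
    ... | inj₂ (inj₁ refl) = up-child m₂ u m₂≥1 par-A (in-A⁻ u i)
    ... | inj₂ (inj₂ refl) = up-child (suc m₂) u (s≤s z≤n) par-B (in-B⁻ u i)
    ... | inj₁ l with up j u l (In⁻ l i)
    ...   | u<nv , o , c = u<nv , 0⇒ u<nv o , (case c of λ
              { (inj₁ h) → inj₁ h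
              ; (inj₂ (1≤j , i′)) → inj₂ (1≤j , subst (λ k → In′ k u) (sym (par-≡ j l)) (In⁺ (<-trans (parent j 1≤j l) l) i′)) })
    covered′ : ∀ u v → u < nv → v < nv → E u v → own′ u ≡ 0 → own′ v ≡ 0 → ∃[ j ] (j < 2 + m₂ × In′ j u × In′ j v)
    covered′ u v lu lv e ou ov = let j , l , i , i′ = covered u v lu lv e (⇒0 lu ou) (⇒0 lv ov) in j , wide l , In⁺ l i , In⁺ l i′
    near′ : ∀ u v j → u < nv → v < nv → E u v → own′ u ≡ suc j → own′ v ≡ suc j ⊎ In′ j v
    near′ u v j lu lv e ou with own u ≟ suc it
    ... | no ne with trans (sym (own-≢ u lu ne)) ou
    ...   | ou₀ with owned u lu (λ z → case trans (sym ou₀) z of λ ())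
    ...     | j′ , ej , _ , j<m₂ with suc-injective (trans (sym ou₀) ej)
    ...       | refl with near u v j lu lv e ou₀
    ...         | inj₂ i = inj₂ (In⁺ j<m₂ i)
    ...         | inj₁ ov = inj₁ (trans (own-≢ v lv (λ o → ne (trans ou₀ (trans (sym ov) o)))) ov)
    near′ u v j lu lv e ou | yes o with lab12 u lu o
    ... | inj₁ l with suc-injective (trans (sym ou) (own1 u lu o l))
    ...   | refl with near u v it lu lv e o
    ...     | inj₂ i = inj₂ (in-A⁺ v lv (in⇒ v lv i) (λ l′ → apart u v lu lv e (l , l′)))
    ...     | inj₁ ov with lab12 v lv ov
    ...       | inj₁ l′ = inj₁ (own1 v lv ov l′)
    ...       | inj₂ l′ = contradiction (l , l′) (apart u v lu lv e)
    near′ u v j lu lv e ou | yes o | inj₂ l with suc-injective (trans (sym ou) (own2 u lu o l))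
    ...   | refl with near u v it lu lv e o
    ...     | inj₂ i = inj₂ (in-B⁺ v lv (in⇒ v lv i) (λ l′ → apart v u lv lu (E-sym u v lu lv e) (l′ , l)))
    ...     | inj₁ ov with lab12 v lv ov
    ...       | inj₁ l′ = contradiction (l′ , l) (apart v u lv lu (E-sym u v lu lv e))
    ...       | inj₂ l′ = inj₁ (own2 v lv ov l′)

  skip-node : ∀ {it m₂ μ own len bag par hn hs} → (∀ u → u < nv → own u ≢ suc it) →
    Queue b nv E it m₂ μ own len bag par hn hs → Queue b nv E (suc it) m₂ μ own len bag par hn hs
  skip-node none Q = record
    { m₂≥1 = m₂≥1 ; parent = parent ; fits = fits ; homed = homed ; up = up ; covered = covered ; near = near ; count≥ = count≥
    ; owned = λ u lt ne → let j , e , le , l = owned u lt ne in j , e , ≤∧≢⇒< le (λ e′ → none u lt (trans e (cong suc (sym e′)))) , l }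
    where open Queue Q

  placed≤ : ∀ own → placed nv own ≤ nv
  placed≤ own = ≤-trans (∑-mono nv (λ u _ → when≤ (own u ≡ᵇ 0) 1)) (≤-reflexive (ones nv))
    where
    ones : ∀ k → ∑ k (λ _ → 1) ≡ k
    ones zero    = refl
    ones (suc k) = trans (cong (_+ 1) (ones k)) (+-comm k 1)

  -- The new vertex nv fills the unused slots, hence lies in every bag.
  finish : ∀ {it m₂ own len bag par hn hs bag′ par′ hn′ hs′} (E′ : ℕ → ℕ → Set) → Queue b nv E it m₂ m₂ own len bag par hn hs → 1 + 2 * nv ≤ it →
    (∀ u v → u < nv → v < nv → E′ u v → E u v) →
    (∀ j a → j < m₂ → a < len j → bag′ (b * j + a) ≡ bag (b * j + a)) →
    (∀ j a → j < m₂ → a < b → len j ≤ a → bag′ (b * j + a) ≡ nv) →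
    (∀ j → j < m₂ → par′ j ≡ par j) → (∀ u → u < nv → hn′ u ≡ hn u) → (∀ u → u < nv → hs′ u ≡ hs u) → hn′ nv ≡ 0 → suc (hs′ nv) ≡ b →
    Rooted b E′ (suc nv) m₂ bag′ par′ hn′ hs′
  finish {it} {m₂} {own} {len} {bag} {par} {hn} {hs} {bag′} {par′} {hn′} {hs′} E′ Q it≥ EE bag-in bag-out par≡ hn≡ hs≡ hnv hsv = record
    { m≥1 = m₂≥1 ; par< = λ i p l → ≤-trans (s≤s (≤-reflexive (par≡ i l))) (parent i p l)
    ; bag< = λ i a l a<b → case a <? len i of λ
        { (yes q) → m<n⇒m<1+n (subst (_< nv) (sym (bag-in i a l q)) (proj₁ (up i _ l (a , q , refl))))
        ; (no q) → ≤-reflexive (cong suc (bag-out i a l a<b (≮⇒≥ q))) }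
    ; hn< = hn<′ ; hs< = hs<′ ; home = home′ ; up = up′ ; edge = edge′ }
    where
    open Queue Q
    all-placed : ∀ u → u < nv → own u ≡ 0
    all-placed u lt with own u ≟ 0
    ... | yes e = e
    -- The owner of an unplaced vertex would have a number of at least `1 + 2 * nv`, but no more
    -- nodes than that exist.
    ... | no ne = let j , _ , it≤j , j<m₂ = owned u lt ne in
      contradiction (≤-trans j<m₂ (≤-trans count≥ (≤-trans (s≤s (*-monoʳ-≤ 2 (placed≤ own))) (≤-trans it≥ it≤j)))) (<-irrefl refl)
    split≤ : ∀ {u} → u < suc nv → u < nv ⊎ u ≡ nv
    split≤ = m<1+n⇒m<n∨m≡n
    filler : ∀ j → j < m₂ → bag′ (b * j + hs′ nv) ≡ nv
    filler j l = bag-out j (hs′ nv) l (≤-reflexive hsv) (s≤s⁻¹ (≤-trans (fits j l) (≤-reflexive (sym hsv))))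
    hn<′ : ∀ u → u < suc nv → hn′ u < m₂
    hn<′ u lt with split≤ lt
    ... | inj₁ l = ≤-trans (s≤s (≤-reflexive (hn≡ u l))) (proj₁ (homed u l (all-placed u l)))
    ... | inj₂ refl = ≤-trans (s≤s (≤-reflexive hnv)) m₂≥1
    hs<′ : ∀ u → u < suc nv → hs′ u < b
    hs<′ u lt with split≤ lt
    ... | inj₁ l = let h , h₁ , _ = homed u l (all-placed u l) in ≤-trans (s≤s (≤-reflexive (hs≡ u l))) (<-trans h₁ (fits (hn u) h))
    ... | inj₂ refl = ≤-reflexive hsv
    home′ : ∀ u → u < suc nv → bag′ (b * hn′ u + hs′ u) ≡ u
    home′ u lt with split≤ lt
    ... | inj₁ l = let h , h₁ , h₂ = homed u l (all-placed u l) in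
      trans (cong₂ (λ x y → bag′ (b * x + y)) (hn≡ u l) (hs≡ u l)) (trans (bag-in (hn u) (hs u) h h₁) h₂)
    ... | inj₂ refl = trans (cong (λ x → bag′ (b * x + hs′ nv)) hnv) (filler 0 m₂≥1)
    up′ : ∀ i a → i < m₂ → a < b → hn′ (bag′ (b * i + a)) ≡ i ⊎ (1 ≤ i × ∃[ a′ ] (a′ < b × bag′ (b * par′ i + a′) ≡ bag′ (b * i + a)))
    up′ i a l a<b with a <? len i
    ... | no q with bag-out i a l a<b (≮⇒≥ q) | i ≟ 0
    ...   | e | yes refl = inj₁ (trans (cong hn′ e) hnv)
    ...   | e | no ne = inj₂ (n≢0⇒n>0 ne , hs′ nv , ≤-reflexive hsv ,
            trans (cong (λ k → bag′ (b * k + hs′ nv)) (par≡ i l)) (trans (filler (par i) (<-trans (parent i (n≢0⇒n>0 ne) l) l)) (sym e)))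
    up′ i a l a<b | yes q with up i _ l (a , q , refl)
    ... | lt , _ , inj₁ h = inj₁ (trans (cong hn′ (bag-in i a l q)) (trans (hn≡ _ lt) h))
    ... | lt , _ , inj₂ (1≤i , a′ , a′< , e) =
      let pl = <-trans (parent i 1≤i l) l
      in inj₂ (1≤i , a′ , <-trans a′< (fits (par i) pl) ,
           trans (cong (λ k → bag′ (b * k + a′)) (par≡ i l)) (trans (bag-in (par i) a′ pl a′<) (trans e (sym (bag-in i a l q)))))
    edge′ : ∀ u v → u < suc nv → v < suc nv → E′ u v →
      ∃[ i ] ∃[ a ] ∃[ a′ ] (i < m₂ × a < b × a′ < b × bag′ (b * i + a) ≡ u × bag′ (b * i + a′) ≡ v)
    edge′ u v lu lv e with split≤ lu | split≤ lv
    ... | inj₂ refl | _ = hn′ v , hs′ nv , hs′ v , hn<′ v lv , ≤-reflexive hsv , hs<′ v lv , filler _ (hn<′ v lv) , home′ v lv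
    ... | inj₁ _ | inj₂ refl = hn′ u , hs′ u , hs′ nv , hn<′ u lu , hs<′ u lu , ≤-reflexive hsv , home′ u lu , filler _ (hn<′ u lu)
    ... | inj₁ u<nv | inj₁ v<nv with covered u v u<nv v<nv (EE u v u<nv v<nv e) (all-placed u u<nv) (all-placed v v<nv)
    ...   | j , l , (a , a< , ea) , (a′ , a′< , ea′) =
            j , a , a′ , l , <-trans a< (fits j l) , <-trans a′< (fits j l) , trans (bag-in j a l a<) ea , trans (bag-in j a′ l a′<) ea′

-- Splitting a decomposition: programs

IT QU FND CH : ℕ
IT  = 49
QU  = 50
FND = 51
CH  = 52

in-place⁺ : ∀ {b len bag it x u} → In b len bag it u ⊎ u ≡ x → In b (set len it (suc (len it))) (set bag (b * it + len it) x) it u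
in-place⁺ {b} {len} {bag} {it} {x} (inj₁ (a , a< , e)) = a , ≤-trans (m<n⇒m<1+n a<) (≤-reflexive (sym (set-same len it _))) ,
  trans (set-other bag {b * it + len it} {b * it + a} x (λ e → <⇒≢ a< (sym (+-cancelˡ-≡ (b * it) _ _ e)))) e
in-place⁺ {b} {len} {bag} {it} {x} (inj₂ refl) = len it , ≤-reflexive (sym (set-same len it _)) , set-same bag (b * it + len it) x

in-place⁻ : ∀ {b len bag it x u} → In b (set len it (suc (len it))) (set bag (b * it + len it) x) it u → In b len bag it u ⊎ u ≡ x
in-place⁻ {b} {len} {bag} {it} {x} (a , a< , e) with m<1+n⇒m<n∨m≡n (≤-trans a< (≤-reflexive (set-same len it _)))
... | inj₁ a<len = inj₁ (a , a<len , trans (sym (set-other bag {b * it + len it} {b * it + a} x (λ e → <⇒≢ a<len (sym (+-cancelˡ-≡ (b * it) _ _ e))))) e)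
... | inj₂ refl = inj₂ (trans (sym e) (set-same bag (b * it + len it) x))

∑-set-above : ∀ nv f x → x < nv → ∑ nv (set f x 1) ≤ suc (∑ nv f)
∑-set-above nv f x x<nv = ≤-trans (∑-mono nv le) (≤-reflexive (trans (∑-+ nv f _) (trans (cong (∑ nv f +_) (∑-delta nv x (λ _ → 1) x<nv)) (+-comm _ 1))))
  where
  le : ∀ u → u < nv → set f x 1 u ≤ f u + when (u ≡ᵇ x) 1
  le u _ with x ≟ u
  ... | yes refl rewrite ≡ᵇ-refl x = m≤n+m 1 (f x)
  ... | no ne rewrite ≢⇒≡ᵇ ne | ≢⇒≡ᵇ (ne ∘ sym) = ≤-reflexive (sym (+-identityʳ (f u)))

set-cases : ∀ (P : ℕ → Set) h i x j → (i ≡ j → P x) → (i ≢ j → P (h j)) → P (set h i x j)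
set-cases P h i x j p q with i ≟ j
... | yes refl = subst P (sym (set-same h i x)) (p refl)
... | no ne    = subst P (sym (set-other h {i} {j} x ne)) (q ne)

module StagePrograms (b : ℕ) where

  placeP : Program
  placeP = BAG2 [ times b (V IT) ⊕ LEN [ V IT ] ]≔ V QU ︔ OWN [ V QU ]≔ const 0 ︔ HN2 [ V QU ]≔ V IT ︔
    HS2 [ V QU ]≔ LEN [ V IT ] ︔ LEN [ V IT ]≔ const 1 ⊕ LEN [ V IT ]

  mineE : Expr
  mineE = eqE (OWN [ V QU ]) (const 1 ⊕ V IT)

  -- The separator found later need not contain any vertex owned by the node, and then a split could
  -- hand everything over to one child; the vertex placed here makes the split worthwhile in any
  -- case.
  findP : Program
  findP = FND ≔ const 0 ︔ for QU (V NV) (ifnz mineE ⊖ V FND then (placeP ︔ FND ≔ const 1) else skip)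

  inbP : Program
  inbP = for QU (V NV) (INB [ V QU ]≔ const 0) ︔ for SL (LEN [ V IT ]) (INB [ BAG2 [ times b (V IT) ⊕ V SL ] ]≔ const 1)

  -- Three counters to base `M`: separator vertices in the top digit, whether marked or not, and the
  -- marked vertices of the two sides in the lower digits.
  wtP : ℕ → Program
  wtP M = for QU (V NV) (WT [ times 3 (V QU) ⊕ const 0 ]≔ const (M * M) ︔ WT [ times 3 (V QU) ⊕ const 1 ]≔ times M (INB [ V QU ]) ︔
    WT [ times 3 (V QU) ⊕ const 2 ]≔ INB [ V QU ])

  -- Only owned vertices of the separator join the bag; the others lie outside the part that is
  -- decomposed below this node. The condition is nonzero exactly for owned vertices of label 0.
  separatorP : Program
  separatorP = for QU (V NV) (ifnz mineE ⊖ LAB [ V QU ] then (placeP ︔ INB [ V QU ]≔ const 1) else skip)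

  ownP : Program
  ownP = for QU (V NV) (ifnz mineE then OWN [ V QU ]≔ V M2 ⊕ LAB [ V QU ] else skip)

  childP : ℕ → Program
  childP x = PAR2 [ V CH ]≔ V IT ︔ LEN [ V CH ]≔ const 0 ︔
    for QU (V NV) (ifnz INB [ V QU ] ⊖ eqE (LAB [ V QU ]) (const x) then
      (BAG2 [ times b (V CH) ⊕ LEN [ V CH ] ]≔ V QU ︔ LEN [ V CH ]≔ const 1 ⊕ LEN [ V CH ]) else skip)

  QueueOf : ℕ → (ℕ → ℕ → Set) → ℕ → ℕ → ℕ → Store → Set
  QueueOf nv E it m₂ μ s = Queue b nv E it m₂ μ (s OWN) (s LEN) (s BAG2) (s PAR2) (s HN2) (s HS2)

  record Placed (it x : ℕ) (own len bag own′ len′ bag′ : ℕ → ℕ) : Set where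
    field
      own-x : own′ x ≡ 0
      own-≢ : ∀ u → u ≢ x → own′ u ≡ own u
      len-it : len′ it ≡ suc (len it)
      len-≢ : ∀ j → j ≢ it → len′ j ≡ len j
      in⁺   : ∀ u → In b len bag it u ⊎ u ≡ x → In b len′ bag′ it u
      in⁻   : ∀ u → In b len′ bag′ it u → In b len bag it u ⊎ u ≡ x

  abstract
    place-run : Σ[ K ∈ ℕ ] (∀ nv (E : ℕ → ℕ → Set) (E-sym : ∀ u v → u < nv → v < nv → E u v → E v u) s it m₂ μ x y →
      s IT 0 ≡ it → s QU 0 ≡ x → QueueOf nv E it m₂ μ s → it < m₂ → x < nv → s OWN x ≡ suc it → suc (s LEN it) < b →
      Run placeP s (λ s′ → QueueOf nv E it m₂ (2 + μ) s′ × Placed it x (s OWN) (s LEN) (s BAG2) (s′ OWN) (s′ LEN) (s′ BAG2)) K y)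
    place-run = _ , λ { nv E E-sym s _ m₂ μ _ y refl refl Q it<m₂ x<nv ox lt →
      let it = s IT 0
          x  = s QU 0
          ix : ⟦ times b (V IT) ⟧ s + s LEN it ≡ b * it + s LEN it
          ix = cong (_+ s LEN it) (⟦times⟧ b (V IT) s)
          bag′ = set (s BAG2) (b * it + s LEN it) x
          len′ = set (s LEN) it (suc (s LEN it))
      in run-assign-seq (run-assign-seq (run-assign-seq (run-assign-seq (run-assign
        (subst (λ k → Queue b nv E it m₂ (2 + μ) (set (s OWN) x 0) len′ (set (s BAG2) k x) (s PAR2) (set (s HN2) x it) (set (s HS2) x (s LEN it)) ×
                       Placed it x (s OWN) (s LEN) (s BAG2) (set (s OWN) x 0) len′ (set (s BAG2) k x))
          (sym ix)
          (Queues.place b nv E E-sym x Q it<m₂ x<nv ox lt ,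
           record { own-x = set-same (s OWN) x 0 ; own-≢ = λ u ne → set-other (s OWN) {x} {u} 0 (ne ∘ sym)
                  ; len-it = set-same (s LEN) it _ ; len-≢ = λ j ne → set-other (s LEN) {it} {j} _ (ne ∘ sym)
                  ; in⁺ = λ u → in-place⁺ {b} {s LEN} {s BAG2} {it} ; in⁻ = λ u → in-place⁻ {b} {s LEN} {s BAG2} {it} })))))) }

    find-run : Σ[ K ∈ ℕ ] (∀ nv (E : ℕ → ℕ → Set) (E-sym : ∀ u v → u < nv → v < nv → E u v → E v u) s it m₂ →
      s NV 0 ≡ nv → s IT 0 ≡ it → QueueOf nv E it m₂ m₂ s → (it < m₂ → suc (s LEN it) < b) →
      Run findP s (λ s′ →
        ((s′ FND 0 ≡ 0 × (∀ u → u < nv → s′ OWN u ≢ suc it) × QueueOf nv E it m₂ m₂ s′ × (∀ j → s′ LEN j ≡ s LEN j)) ⊎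
         (s′ FND 0 ≡ 1 × it < m₂ × QueueOf nv E it m₂ (2 + m₂) s′ × s′ LEN it ≡ suc (s LEN it) × (∀ j → j ≢ it → s′ LEN j ≡ s LEN j)))) K (nv ⊛ 0))
    find-run = _ , λ nv E E-sym s it m₂ nv≡ it≡ Q₀ len< →
      let Inv : ℕ → Store → Set
          Inv t s′ = (s′ FND 0 ≡ 0 × (∀ u → u < t → s′ OWN u ≢ suc it) × QueueOf nv E it m₂ m₂ s′ × (∀ j → s′ LEN j ≡ s LEN j)) ⊎
            (s′ FND 0 ≡ 1 × it < m₂ × QueueOf nv E it m₂ (2 + m₂) s′ × s′ LEN it ≡ suc (s LEN it) × (∀ j → j ≢ it → s′ LEN j ≡ s LEN j))
      in run-assign-seq (run-for Inv nv tt tt (λ _ _ _ p → p)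
        (λ t s₁ t<nv t≡ fr inv →
          let mine≡ : δ (s₁ OWN (s₁ QU 0)) (1 + s₁ IT 0) ≡ δ (s₁ OWN t) (suc it)
              mine≡ = cong₂ δ (cong (s₁ OWN) t≡) (cong suc (trans (fr IT 0) it≡))
          in run-if
          (λ nz → case inv of λ
            { (inj₂ (f , _)) → contradiction (trans (cong₂ _∸_ mine≡ f) (m≤n⇒m∸n≡0 (m∸n≤m 1 ((s₁ OWN t ∸ suc it) + (suc it ∸ s₁ OWN t))))) nz
            ; (inj₁ (f , _ , Q , le)) →
                let own≡ : s₁ OWN t ≡ suc it
                    own≡ = δ≢0⇒≡ (λ z → nz (trans (cong₂ _∸_ mine≡ f) z))
                    it<m₂ = let j , e , _ , l = Queue.owned Q t t<nv (λ z → case trans (sym own≡) z of λ ()) in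
                            subst (_< m₂) (suc-injective (trans (sym e) own≡)) l
                in run-seq (proj₂ place-run nv E E-sym s₁ it m₂ m₂ t 0 (trans (fr IT 0) it≡) t≡ Q it<m₂ t<nv own≡
                              (subst (λ k → suc k < b) (sym (le it)) (len< it<m₂)))
                   (λ s₂ (Q₂ , pl) fr₂ → run-assign (inj₂ (refl , it<m₂ , Q₂ , trans (Placed.len-it pl) (cong suc (le it)) ,
                      λ j ne → trans (Placed.len-≢ pl j ne) (le j)))) })
          (λ z → run-skip (case inv of λ
            { (inj₂ r) → inj₂ r
            ; (inj₁ (f , nf , r)) → inj₁ (f , (λ u u<1+t → [ nf u , (λ { refl → δ≡0⇒≢ (trans (sym (cong₂ _∸_ mine≡ f)) z) }) ]′ (m<1+n⇒m<n∨m≡n u<1+t)) , r) })))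
        nv≡ (inj₁ (refl , (λ _ ()) , Q₀ , (λ _ → refl))))

    inb-run : Σ[ K ∈ ℕ ] (∀ nv s it → s NV 0 ≡ nv → s IT 0 ≡ it → s LEN it ≤ b → (∀ u → In b (s LEN) (s BAG2) it u → u < nv) →
      Run inbP s (λ s′ → (∀ u → u < nv → s′ INB u ≢ 0 → In b (s LEN) (s BAG2) it u) × (∀ u → u < nv → In b (s LEN) (s BAG2) it u → s′ INB u ≢ 0) ×
        (∀ u → u < nv → s′ INB u ≤ 1) × ∑ nv (s′ INB) ≤ s LEN it) K (nv ⊛ 0))
    inb-run = _ , λ nv s it nv≡ it≡ len≤ in< → run-seq
      (run-for (λ t s′ → ∀ u → u < t → s′ INB u ≡ 0) nv tt tt (λ _ _ _ p → p)
        (λ t s₁ t<nv t≡ fr inv → run-assign (λ u u<1+t → set-cases (_≡ 0) (s₁ INB) (s₁ QU 0) 0 u (λ _ → refl)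
          (λ ne → [ inv u , (λ { refl → contradiction t≡ ne }) ]′ (m<1+n⇒m<n∨m≡n u<1+t))))
        nv≡ (λ _ ()))
      (λ s₁ zero₁ fr₁ → run-size z≤n (run-post
        (λ s′ (p , q , r , w) _ → p , (λ { u u<nv (a , a< , e) → q a a< e }) , r , w)
        (run-forᶜ (λ a s′ → (∀ u → u < nv → s′ INB u ≢ 0 → In b (s LEN) (s BAG2) it u) ×
                             (∀ a′ {u} → a′ < a → s BAG2 (b * it + a′) ≡ u → s′ INB u ≢ 0) ×
                             (∀ u → u < nv → s′ INB u ≤ 1) × ∑ nv (s′ INB) ≤ a) (s LEN it) tt tt (λ _ _ _ p → p)
          (λ a s₂ a< a≡ fr₂ (p , q , r , w) →
            let x = s BAG2 (b * it + a)
                x≡ : s₂ BAG2 (⟦ times b (V IT) ⟧ s₂ + s₂ SL 0) ≡ x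
                x≡ = trans (fr₂ BAG2 _) (trans (fr₁ BAG2 _) (cong (s BAG2) (cong₂ _+_ (trans (⟦times⟧ b (V IT) s₂) (cong (b *_) (trans (fr₂ IT 0) (trans (fr₁ IT 0) it≡)))) a≡)))
                x<nv = in< x (a , a< , refl)
            in run-assign (subst (λ k → (∀ u → u < nv → set (s₂ INB) k 1 u ≢ 0 → In b (s LEN) (s BAG2) it u) ×
                             (∀ a′ {u} → a′ < suc a → s BAG2 (b * it + a′) ≡ u → set (s₂ INB) k 1 u ≢ 0) ×
                             (∀ u → u < nv → set (s₂ INB) k 1 u ≤ 1) × ∑ nv (set (s₂ INB) k 1) ≤ suc a) (sym x≡)
              ( (λ u u<nv → set-cases (λ v → v ≢ 0 → In b (s LEN) (s BAG2) it u) (s₂ INB) x 1 u (λ { refl _ → a , a< , refl }) (λ _ → p u u<nv))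
              , (λ { a′ {u} a′< refl → set-cases (_≢ 0) (s₂ INB) x 1 u (λ _ ()) (λ ne → [ (λ l → q a′ l refl) , (λ { refl → contradiction refl ne }) ]′ (m<1+n⇒m<n∨m≡n a′<)) })
              , (λ u u<nv → set-cases (_≤ 1) (s₂ INB) x 1 u (λ _ → ≤-refl) (λ _ → r u u<nv))
              , ≤-trans (∑-set-above nv (s₂ INB) x x<nv) (s≤s w) )))
          b len≤ (trans (fr₁ LEN _) (cong (s LEN) (trans (fr₁ IT 0) it≡)))
          ((λ u u<nv ne → contradiction (zero₁ u u<nv) ne) , (λ _ ()) , (λ u u<nv → ≤-trans (≤-reflexive (zero₁ u u<nv)) z≤n) ,
           ≤-reflexive (∑-zero nv zero₁)))))

    wt-run : ∀ M → Σ[ K ∈ ℕ ] (∀ nv s → s NV 0 ≡ nv →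
      Run (wtP M) s (λ s′ → ∀ u → u < nv → s′ WT (3 * u + 0) ≡ M * M × s′ WT (3 * u + 1) ≡ M * s INB u × s′ WT (3 * u + 2) ≡ s INB u) K (nv ⊛ 0))
    wt-run M = _ , λ nv s nv≡ →
      run-for (λ t s′ → ∀ u → u < t → s′ WT (3 * u + 0) ≡ M * M × s′ WT (3 * u + 1) ≡ M * s INB u × s′ WT (3 * u + 2) ≡ s INB u) nv tt tt (λ _ _ _ p → p)
        (λ t s₁ t<nv t≡ fr inv →
          let far : ∀ {u k c d} → u ≢ k → c < 3 → d < 3 → 3 * k + c ≢ 3 * u + d
              far {u} {k} ne c< d< e = ne (sym (proj₁ (index-inj {3} {k} {u} c< d< e)))
              G : ℕ → ℕ → ℕ → ℕ → ℕ
              G k y z = set (set (set (s₁ WT) (3 * k + 0) (M * M)) (3 * k + 1) y) (3 * k + 2) z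
              other : ∀ {k y z u d} → u ≢ k → d < 3 → G k y z (3 * u + d) ≡ s₁ WT (3 * u + d)
              other {k} {y} {z} {u} {d} ne d< =
                trans (set-other (set (set (s₁ WT) (3 * k + 0) (M * M)) (3 * k + 1) y) {3 * k + 2} {3 * u + d} z (far ne (s≤s (s≤s (s≤s z≤n))) d<))
                (trans (set-other (set (s₁ WT) (3 * k + 0) (M * M)) {3 * k + 1} {3 * u + d} y (far ne (s≤s (s≤s z≤n)) d<))
                       (set-other (s₁ WT) {3 * k + 0} {3 * u + d} (M * M) (far ne (s≤s z≤n) d<)))
              differ : ∀ {k c d} → c ≢ d → 3 * k + c ≢ 3 * k + d
              differ {k} ne e = ne (+-cancelˡ-≡ (3 * k) _ _ e)
              inb≡ : s₁ INB (s₁ QU 0) ≡ s INB t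
              inb≡ = trans (fr INB _) (cong (s INB) t≡)
          in run-assign-seq (run-assign-seq (run-assign (λ u u<1+t → subst₂ (λ y z → G (s₁ QU 0) y z (3 * u + 0) ≡ M * M × G (s₁ QU 0) y z (3 * u + 1) ≡ M * s INB u × G (s₁ QU 0) y z (3 * u + 2) ≡ s INB u)
              (sym (trans (⟦times⟧ M (INB [ V QU ]) (update s₁ WT (3 * s₁ QU 0 + 0) (M * M))) (cong (M *_) inb≡))) (sym inb≡)
              (subst (λ k → G k (M * s INB t) (s INB t) (3 * u + 0) ≡ M * M × G k (M * s INB t) (s INB t) (3 * u + 1) ≡ M * s INB u × G k (M * s INB t) (s INB t) (3 * u + 2) ≡ s INB u) (sym t≡)
                (case m<1+n⇒m<n∨m≡n u<1+t of λ
                  { (inj₁ u<t) → let a , b , c = inv u u<t ; ne = <⇒≢ u<t in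
                      trans (other ne (s≤s z≤n)) a , trans (other ne (s≤s (s≤s z≤n))) b , trans (other ne (s≤s (s≤s (s≤s z≤n)))) c
                  ; (inj₂ refl) →
                      trans (set-other (set (set (s₁ WT) (3 * t + 0) (M * M)) (3 * t + 1) (M * s INB t)) {3 * t + 2} {3 * t + 0} (s INB t) (differ {t} (λ ())))
                        (trans (set-other (set (s₁ WT) (3 * t + 0) (M * M)) {3 * t + 1} {3 * t + 0} (M * s INB t) (differ {t} (λ ()))) (set-same (s₁ WT) (3 * t + 0) (M * M)))
                    , trans (set-other (set (set (s₁ WT) (3 * t + 0) (M * M)) (3 * t + 1) (M * s INB t)) {3 * t + 2} {3 * t + 1} (s INB t) (differ {t} (λ ())))
                        (set-same (set (s₁ WT) (3 * t + 0) (M * M)) (3 * t + 1) (M * s INB t))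
                    , set-same (set (set (s₁ WT) (3 * t + 0) (M * M)) (3 * t + 1) (M * s INB t)) (3 * t + 2) (s INB t) }))))))
        nv≡ (λ _ ())

    separator-run : Σ[ K ∈ ℕ ] (∀ nv (E : ℕ → ℕ → Set) (E-sym : ∀ u v → u < nv → v < nv → E u v → E v u) s it m₂ μ →
      s NV 0 ≡ nv → s IT 0 ≡ it → it < m₂ → QueueOf nv E it m₂ μ s →
      (∀ u → u < nv → s INB u ≢ 0 → In b (s LEN) (s BAG2) it u) → (∀ u → u < nv → In b (s LEN) (s BAG2) it u → s INB u ≢ 0) → (∀ u → u < nv → s INB u ≤ 1) →
      suc (s LEN it + ∑ nv (λ u → when (s LAB u ≡ᵇ 0) 1)) ≤ b →
      Run separatorP s (λ s′ → QueueOf nv E it m₂ μ s′ × (∀ u → u < nv → s′ OWN u ≡ suc it → s LAB u ≢ 0) × (∀ j → j ≢ it → s′ LEN j ≡ s LEN j) ×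
        (∀ u → u < nv → s′ INB u ≢ 0 → In b (s′ LEN) (s′ BAG2) it u) × (∀ u → u < nv → In b (s′ LEN) (s′ BAG2) it u → s′ INB u ≢ 0) ×
        (∀ u → u < nv → s′ INB u ≤ 1) × (∀ u → u < nv → s LAB u ≢ 0 → s′ INB u ≡ s INB u) ×
        s′ LEN it ≤ s LEN it + ∑ nv (λ u → when (s LAB u ≡ᵇ 0) 1)) K (nv ⊛ 0))
    separator-run = _ , λ nv E E-sym s it m₂ μ nv≡ it≡ it<m₂ Q₀ in₀ in₀′ inb≤₀ room →
      let S : ℕ → ℕ
          S t = ∑ t (λ u → when (s LAB u ≡ᵇ 0) 1)
          Inv : ℕ → Store → Set
          Inv t s′ = QueueOf nv E it m₂ μ s′ × (∀ u → u < t → s′ OWN u ≡ suc it → s LAB u ≢ 0) × (∀ j → j ≢ it → s′ LEN j ≡ s LEN j) ×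
            (∀ u → u < nv → s′ INB u ≢ 0 → In b (s′ LEN) (s′ BAG2) it u) × (∀ u → u < nv → In b (s′ LEN) (s′ BAG2) it u → s′ INB u ≢ 0) ×
            (∀ u → u < nv → s′ INB u ≤ 1) × (∀ u → u < nv → s LAB u ≢ 0 → s′ INB u ≡ s INB u) × s′ LEN it ≤ s LEN it + S t
      in run-for Inv nv tt tt (λ _ _ _ p → p)
        (λ t s₁ t<nv t≡ fr (Q , none , len≢ , in₁ , in₁′ , inb≤ , same , len≤) →
          let lab≡ : s₁ LAB (s₁ QU 0) ≡ s LAB t
              lab≡ = trans (fr LAB _) (cong (s LAB) t≡)
              cond≡ : δ (s₁ OWN (s₁ QU 0)) (1 + s₁ IT 0) ∸ s₁ LAB (s₁ QU 0) ≡ δ (s₁ OWN t) (suc it) ∸ s LAB t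
              cond≡ = cong₂ _∸_ (cong₂ δ (cong (s₁ OWN) t≡) (cong suc (trans (fr IT 0) it≡))) lab≡
          in run-if
          (λ nz →
            let mine : s₁ OWN t ≡ suc it × s LAB t ≡ 0
                mine = gate (λ z → nz (trans cond≡ z))
                own≡ = proj₁ mine
                lab0 = proj₂ mine
                S≡ : S (suc t) ≡ suc (S t)
                S≡ = trans (cong (λ c → S t + when c 1) (≡ᵇ-true lab0)) (+-comm (S t) 1)
            in run-seq (proj₂ place-run nv E E-sym s₁ it m₂ μ t 0 (trans (fr IT 0) it≡) t≡ Q it<m₂ t<nv own≡
                 (≤-trans (s≤s (≤-trans (s≤s len≤) (≤-trans (≤-reflexive (trans (sym (+-suc (s LEN it) (S t))) (cong (s LEN it +_) (sym S≡)))) (+-monoʳ-≤ (s LEN it) (∑-extend _ t<nv))))) room))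
               (λ s₂ (Q₂ , pl) fr₂ →
                 let inb≡ : ∀ u → s₂ INB u ≡ s₁ INB u
                     inb≡ u = fr₂ INB u
                     q≡ : s₂ QU 0 ≡ t
                     q≡ = trans (fr₂ QU 0) t≡
                     open Placed pl
                 in run-assign
                 -- The credit earned by separator vertices is given up; the vertex from `findP` has
                 -- already paid for the split.
                 ( record { Queue Q₂ ; count≥ = ≤-trans (m≤n+m μ 2) (Queue.count≥ Q₂) }
                 , (λ u u<1+t o → case m<1+n⇒m<n∨m≡n u<1+t of λ
                     { (inj₁ u<t) → none u u<t (trans (sym (own-≢ u (<⇒≢ u<t))) o)
                     ; (inj₂ refl) → case trans (sym own-x) o of λ () })
                 , (λ j ne → trans (len-≢ j ne) (len≢ j ne))
                 , (λ u u<nv → set-cases (λ v → v ≢ 0 → In b (s₂ LEN) (s₂ BAG2) it u) (s₂ INB) (s₂ QU 0) 1 u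
                     (λ e _ → in⁺ u (inj₂ (trans (sym e) q≡))) (λ _ ne → in⁺ u (inj₁ (in₁ u u<nv (λ z → ne (trans (inb≡ u) z))))))
                 , (λ u u<nv i → set-cases (_≢ 0) (s₂ INB) (s₂ QU 0) 1 u (λ _ ()) (λ ne → [ (λ i₀ z → in₁′ u u<nv i₀ (trans (sym (inb≡ u)) z)) , (λ e → contradiction (trans q≡ (sym e)) ne) ]′ (in⁻ u i)))
                 , (λ u u<nv → set-cases (_≤ 1) (s₂ INB) (s₂ QU 0) 1 u (λ _ → ≤-refl) (λ _ → ≤-trans (≤-reflexive (inb≡ u)) (inb≤ u u<nv)))
                 , (λ u u<nv l≢0 → set-cases (_≡ s INB u) (s₂ INB) (s₂ QU 0) 1 u (λ e → contradiction (trans (cong (s LAB) (trans (sym e) q≡)) lab0) l≢0) (λ _ → trans (inb≡ u) (same u u<nv l≢0)))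
                 , ≤-trans (≤-reflexive len-it) (≤-trans (s≤s len≤) (≤-reflexive (trans (sym (+-suc (s LEN it) (S t))) (cong (s LEN it +_) (sym S≡))))) )))
          (λ z → run-skip (Q , (λ u u<1+t o → case m<1+n⇒m<n∨m≡n u<1+t of λ
                     { (inj₁ u<t) → none u u<t o
                     ; (inj₂ refl) → λ l → case trans (sym (cong₂ _∸_ (δ-≡ o) l)) (trans (sym cond≡) z) of λ () })
                 , len≢ , in₁ , in₁′ , inb≤ , same , ≤-trans len≤ (+-monoʳ-≤ (s LEN it) (m≤m+n (S t) _)))))
        nv≡ (Q₀ , (λ _ ()) , (λ _ _ → refl) , in₀ , in₀′ , inb≤₀ , (λ _ _ _ → refl) , ≤-reflexive (sym (+-identityʳ _)))
      where
      gate : ∀ {x y l} → δ x y ∸ l ≢ 0 → x ≡ y × l ≡ 0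
      gate {x} {y} {l} p with x ≟ y | l
      ... | yes e | zero  = e , refl
      ... | yes e | suc k = contradiction (trans (cong (_∸ suc k) (δ-≡ e)) (0∸n≡0 k)) p
      ... | no ne | k     = contradiction (trans (cong (_∸ k) (δ-≢ ne)) (0∸n≡0 k)) p

    own-run : Σ[ K ∈ ℕ ] (∀ nv s it m₂ → s NV 0 ≡ nv → s IT 0 ≡ it → s M2 0 ≡ m₂ →
      Run ownP s (λ s′ → (∀ u → u < nv → s OWN u ≡ suc it → s′ OWN u ≡ m₂ + s LAB u) × (∀ u → u < nv → s OWN u ≢ suc it → s′ OWN u ≡ s OWN u)) K (nv ⊛ 0))
    own-run = _ , λ nv s it m₂ nv≡ it≡ m₂≡ → run-post (λ s′ (p , q , _) _ → p , q)
      (run-for (λ t s′ → (∀ u → u < t → s OWN u ≡ suc it → s′ OWN u ≡ m₂ + s LAB u) × (∀ u → u < t → s OWN u ≢ suc it → s′ OWN u ≡ s OWN u) × (∀ u → t ≤ u → s′ OWN u ≡ s OWN u)) nv tt tt (λ _ _ _ p → p)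
        (λ t s₁ t<nv t≡ fr (p , q , r) →
          let cond≡ : δ (s₁ OWN (s₁ QU 0)) (1 + s₁ IT 0) ≡ δ (s OWN t) (suc it)
              cond≡ = cong₂ δ (trans (cong (s₁ OWN) t≡) (r t ≤-refl)) (cong suc (trans (fr IT 0) it≡))
              v≡ : s₁ M2 0 + s₁ LAB (s₁ QU 0) ≡ m₂ + s LAB t
              v≡ = cong₂ _+_ (trans (fr M2 0) m₂≡) (trans (fr LAB _) (cong (s LAB) t≡))
          in run-if
          (λ nz → let mine = δ≢0⇒≡ {s OWN t} {suc it} (λ z → nz (trans cond≡ z)) in run-assign
            ( (λ u u<1+t o → set-cases (_≡ m₂ + s LAB u) (s₁ OWN) (s₁ QU 0) _ u (λ e → trans v≡ (cong (λ k → m₂ + s LAB k) (trans (sym t≡) e)))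
                 (λ ne → [ (λ l → p u l o) , (λ e → contradiction (trans t≡ (sym e)) ne) ]′ (m<1+n⇒m<n∨m≡n u<1+t)))
            , (λ u u<1+t o → set-cases (_≡ s OWN u) (s₁ OWN) (s₁ QU 0) _ u (λ e → contradiction (trans (cong (s OWN) (trans (sym e) t≡)) mine) o)
                 (λ ne → [ (λ l → q u l o) , (λ e → contradiction (trans t≡ (sym e)) ne) ]′ (m<1+n⇒m<n∨m≡n u<1+t)))
            , (λ u 1+t≤u → trans (set-other (s₁ OWN) {s₁ QU 0} {u} _ (λ e → <⇒≢ 1+t≤u (trans (sym t≡) e))) (r u (<⇒≤ 1+t≤u))) ))
          (λ z → let theirs = δ≡0⇒≢ {s OWN t} {suc it} (trans (sym cond≡) z) in run-skip
            ( (λ u u<1+t o → [ (λ l → p u l o) , (λ { refl → contradiction o theirs }) ]′ (m<1+n⇒m<n∨m≡n u<1+t))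
            , (λ u u<1+t o → [ (λ l → q u l o) , (λ { refl → r u ≤-refl }) ]′ (m<1+n⇒m<n∨m≡n u<1+t))
            , (λ u 1+t≤u → r u (<⇒≤ 1+t≤u)) )))
        nv≡ ((λ _ ()) , (λ _ ()) , (λ _ _ → refl)))

    child-run : ∀ x → Σ[ K ∈ ℕ ] (∀ nv s it ch → s NV 0 ≡ nv → s IT 0 ≡ it → s CH 0 ≡ ch → (∀ u → u < nv → s INB u ≤ 1) →
      (let k = λ u → s INB u ∸ δ (s LAB u) x) → ∑ nv k < b →
      Run (childP x) s (λ s′ → s′ LEN ch ≡ ∑ nv k × s′ PAR2 ch ≡ it × (∀ u → u < nv → k u ≢ 0 → In b (s′ LEN) (s′ BAG2) ch u) ×
        (∀ u → In b (s′ LEN) (s′ BAG2) ch u → u < nv × k u ≢ 0) ×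
        (∀ j → j ≢ ch → s′ LEN j ≡ s LEN j) × (∀ j a → j ≢ ch → a < b → s′ BAG2 (b * j + a) ≡ s BAG2 (b * j + a)) × (∀ j → j ≢ ch → s′ PAR2 j ≡ s PAR2 j)) K (nv ⊛ 0))
    child-run x = _ , λ nv s it ch nv≡ it≡ ch≡ inb≤ room →
      let k : ℕ → ℕ
          k u = s INB u ∸ δ (s LAB u) x
          Inv : ℕ → Store → Set
          Inv t s′ = s′ LEN ch ≡ ∑ t k × (∀ u → u < t → k u ≢ 0 → In b (s′ LEN) (s′ BAG2) ch u) ×
            (∀ u → In b (s′ LEN) (s′ BAG2) ch u → u < t × k u ≢ 0) ×
            (∀ j → j ≢ ch → s′ LEN j ≡ s LEN j) × (∀ j a → j ≢ ch → a < b → s′ BAG2 (b * j + a) ≡ s BAG2 (b * j + a))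
          len0 : set (s LEN) (s CH 0) 0 ch ≡ 0
          len0 = trans (cong (λ c → set (s LEN) c 0 ch) ch≡) (set-same (s LEN) ch 0)
      in run-assign-seq (run-assign-seq (run-post
        (λ s′ (l , i , i′ , l≢ , b≢) fr → l ,
            trans (fr PAR2 ch) (trans (cong₂ (λ c v → set (s PAR2) c v ch) ch≡ it≡) (set-same (s PAR2) ch it)) , i , i′ , l≢ , b≢ ,
            (λ j ne → trans (fr PAR2 j) (set-other (s PAR2) {s CH 0} {j} _ (λ e → ne (trans (sym e) ch≡)))))
        (run-for Inv nv tt tt (λ _ _ _ p → p)
          (λ t s₁ t<nv t≡ fr (l , i , i′ , l≢ , b≢) →
            let ch≡₁ : s₁ CH 0 ≡ ch
                ch≡₁ = trans (fr CH 0) ch≡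
                cond≡ : s₁ INB (s₁ QU 0) ∸ δ (s₁ LAB (s₁ QU 0)) x ≡ k t
                cond≡ = cong₂ (λ y z → y ∸ δ z x) (trans (fr INB _) (cong (s INB) t≡)) (trans (fr LAB _) (cong (s LAB) t≡))
                a = s₁ LEN ch
                a<b : a < b
                a<b = ≤-trans (s≤s (≤-trans (≤-reflexive l) (∑-extend k (<⇒≤ t<nv)))) room
                Next : (ℕ → ℕ) → (ℕ → ℕ) → Set
                Next len bag = len ch ≡ ∑ (suc t) k × (∀ u → u < suc t → k u ≢ 0 → In b len bag ch u) ×
                  (∀ u → In b len bag ch u → u < suc t × k u ≢ 0) ×
                  (∀ j → j ≢ ch → len j ≡ s LEN j) × (∀ j a → j ≢ ch → a < b → bag (b * j + a) ≡ s BAG2 (b * j + a))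
            in run-if
            (λ nz →
              let k≢0 : k t ≢ 0
                  k≢0 z = nz (trans cond≡ z)
                  k≡1 : k t ≡ 1
                  k≡1 = ≤-antisym (≤-trans (m∸n≤m (s INB t) (δ (s LAB t) x)) (inb≤ t t<nv)) (n≢0⇒n>0 k≢0)
                  ix : ⟦ times b (V CH) ⟧ s₁ + s₁ LEN (s₁ CH 0) ≡ b * ch + a
                  ix = cong₂ _+_ (trans (⟦times⟧ b (V CH) s₁) (cong (b *_) ch≡₁)) (cong (s₁ LEN) ch≡₁)
              in run-assign-seq (run-assign (subst₂ (λ c j → Next (set (s₁ LEN) c (suc (s₁ LEN c))) (set (s₁ BAG2) j (s₁ QU 0))) (sym ch≡₁) (sym ix)
                (subst (λ q → Next (set (s₁ LEN) ch (suc a)) (set (s₁ BAG2) (b * ch + a) q)) (sym t≡)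
                  ( trans (set-same (s₁ LEN) ch (suc a)) (trans (cong suc l) (trans (+-comm 1 _) (cong (∑ t k +_) (sym k≡1))))
                  , (λ u u<1+t ne → in-place⁺ {b} {s₁ LEN} {s₁ BAG2} {ch} (case m<1+n⇒m<n∨m≡n u<1+t of λ { (inj₁ lt) → inj₁ (i u lt ne) ; (inj₂ e) → inj₂ e }))
                  , (λ u j → case in-place⁻ {b} {s₁ LEN} {s₁ BAG2} {ch} j of λ { (inj₁ j₀) → let lt , ne = i′ u j₀ in m<n⇒m<1+n lt , ne ; (inj₂ refl) → ≤-refl , k≢0 })
                  , (λ j ne → trans (set-other (s₁ LEN) {ch} {j} _ (ne ∘ sym)) (l≢ j ne))
                  , (λ j a′ ne a′<b → trans (set-other (s₁ BAG2) {b * ch + a} {b * j + a′} _ (λ e → ne (sym (proj₁ (index-inj {b} {ch} {j} a<b a′<b e))))) (b≢ j a′ ne a′<b)) )))))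
            (λ z →
              let k≡0 : k t ≡ 0
                  k≡0 = trans (sym cond≡) z
              in run-skip (trans l (trans (sym (+-identityʳ _)) (cong (∑ t k +_) (sym k≡0)))
                , (λ u u<1+t ne → case m<1+n⇒m<n∨m≡n u<1+t of λ { (inj₁ lt) → i u lt ne ; (inj₂ refl) → contradiction k≡0 ne })
                , (λ u j → let lt , ne = i′ u j in m<n⇒m<1+n lt , ne) , l≢ , b≢)))
          nv≡
          ( len0 , (λ _ ()) , (λ { u (a , a< , _) → contradiction (≤-trans a< (≤-reflexive len0)) (λ ()) })
          , (λ j ne → set-other (s LEN) {s CH 0} {j} 0 (λ e → ne (trans (sym e) ch≡))) , (λ _ _ _ _ → refl) ))))

in-cong : ∀ {b len bag len′ bag′ j u} → len′ j ≡ len j → (∀ a → a < len j → bag′ (b * j + a) ≡ bag (b * j + a)) → In b len bag j u → In b len′ bag′ j u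
in-cong l≡ b≡ (a , a< , e) = a , ≤-trans a< (≤-reflexive (sym l≡)) , trans (b≡ a a<) e

-- Frames yield pointwise equalities of arrays only, so the invariant is transported field by field.
queue-cong : ∀ {b nv E it m₂ μ own len bag par hn hs own′ len′ bag′ par′ hn′ hs′} →
  (∀ u → own′ u ≡ own u) → (∀ u → len′ u ≡ len u) → (∀ u → bag′ u ≡ bag u) → (∀ u → par′ u ≡ par u) → (∀ u → hn′ u ≡ hn u) → (∀ u → hs′ u ≡ hs u) →
  Queue b nv E it m₂ μ own len bag par hn hs → Queue b nv E it m₂ μ own′ len′ bag′ par′ hn′ hs′
queue-cong {b} {nv} {E} {it} {m₂} {μ} {own} {len} {bag} {par} {hn} {hs} {own′} {len′} {bag′} {par′} {hn′} {hs′} o l g p h k Q = record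
  { m₂≥1 = m₂≥1
  ; parent = λ j 1≤j lt → subst (_< j) (sym (p j)) (parent j 1≤j lt)
  ; fits = λ j lt → subst (_< b) (sym (l j)) (fits j lt)
  ; homed = λ u lt e → let x , y , z = homed u lt (trans (sym (o u)) e) in
      subst (_< m₂) (sym (h u)) x ,
      subst₂ _<_ (sym (k u)) (sym (trans (l (hn′ u)) (cong len (h u)))) y ,
      trans (g _) (trans (cong₂ (λ i j → bag (b * i + j)) (h u) (k u)) z)
  ; owned = λ u lt ne → let j , e , r = owned u lt (λ e → ne (trans (o u) e)) in j , trans (o u) e , r
  ; up = λ j u lt i → let x , y , z = up j u lt (In⁻ i) in x , trans (o u) y ,
      (case z of λ { (inj₁ e) → inj₁ (trans (h u) e) ; (inj₂ (1≤j , i′)) → inj₂ (1≤j , subst (λ q → In b len′ bag′ q u) (sym (p j)) (In⁺ i′)) })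
  ; covered = λ u v lu lv e ou ov → let j , lt , i , i′ = covered u v lu lv e (trans (sym (o u)) ou) (trans (sym (o v)) ov) in j , lt , In⁺ i , In⁺ i′
  ; near = λ u v j lu lv e ou → case near u v j lu lv e (trans (sym (o u)) ou) of λ { (inj₁ ov) → inj₁ (trans (o v) ov) ; (inj₂ i) → inj₂ (In⁺ i) }
  ; count≥ = ≤-trans count≥ (≤-reflexive (cong (λ x → suc (2 * x)) (∑-cong nv (λ u _ → cong (λ x → when (x ≡ᵇ 0) 1) (sym (o u)))))) }
  where
  open Queue Q
  In⁺ : ∀ {j u} → In b len bag j u → In b len′ bag′ j u
  In⁺ {j} = in-cong {b} {len} {bag} {len′} {bag′} {j} (l j) (λ a _ → g _)
  In⁻ : ∀ {j u} → In b len′ bag′ j u → In b len bag j u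
  In⁻ {j} = in-cong {b} {len′} {bag′} {len} {bag} {j} (sym (l j)) (λ a _ → sym (g _))

rooted-cong : ∀ {b E E′ nv nv′ m m′ bag par hn hs bag′ par′ hn′ hs′} → (∀ u v → E′ u v → E u v) → nv′ ≡ nv → m′ ≡ m →
  (∀ u → bag′ u ≡ bag u) → (∀ u → par′ u ≡ par u) → (∀ u → hn′ u ≡ hn u) → (∀ u → hs′ u ≡ hs u) →
  Rooted b E nv m bag par hn hs → Rooted b E′ nv′ m′ bag′ par′ hn′ hs′
rooted-cong {b} {E} {E′} {nv} {_} {m} {_} {bag} {par} {hn} {hs} {bag′} {par′} {hn′} {hs′} ee refl refl g p h k R₀ = record
  { m≥1 = m≥1
  ; par< = λ i q l → subst (_< i) (sym (p i)) (par< i q l)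
  ; bag< = λ i a l a<b → subst (_< nv) (sym (g _)) (bag< i a l a<b)
  ; hn< = λ u l → subst (_< m) (sym (h u)) (hn< u l)
  ; hs< = λ u l → subst (_< b) (sym (k u)) (hs< u l)
  ; home = λ u l → trans (g _) (trans (cong₂ (λ i j → bag (b * i + j)) (h u) (k u)) (home u l))
  ; up = λ i a l a<b → case up i a l a<b of λ
      { (inj₁ e) → inj₁ (trans (h _) (trans (cong hn (g _)) e))
      ; (inj₂ (1≤i , a′ , a′<b , e)) → inj₂ (1≤i , a′ , a′<b , trans (g _) (trans (cong (λ q → bag (b * q + a′)) (p i)) (trans e (sym (g _))))) }
  ; edge = λ u v lu lv e → let i , a , a′ , x , y , z , e₁ , e₂ = edge u v lu lv (ee u v e) in i , a , a′ , x , y , z , trans (g _) e₁ , trans (g _) e₂ }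
  where open Rooted R₀

-- Separations as labellings of admissible weight

conf₃ : ℕ → ℕ → ℕ
conf₃ 1 2 = 1
conf₃ 2 1 = 1
conf₃ _ _ = 0

conf₃≢0⇒ : ∀ l l′ → conf₃ l l′ ≢ 0 → (l ≡ 1 × l′ ≡ 2) ⊎ (l ≡ 2 × l′ ≡ 1)
conf₃≢0⇒ 1 2 _ = inj₁ (refl , refl)
conf₃≢0⇒ 2 1 _ = inj₂ (refl , refl)
conf₃≢0⇒ 0 _ p = contradiction refl p
conf₃≢0⇒ 1 0 p = contradiction refl p
conf₃≢0⇒ 1 1 p = contradiction refl p
conf₃≢0⇒ 1 (suc (suc (suc _))) p = contradiction refl p
conf₃≢0⇒ 2 0 p = contradiction refl p
conf₃≢0⇒ 2 (suc (suc _)) p = contradiction refl p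
conf₃≢0⇒ (suc (suc (suc _))) _ p = contradiction refl p

module Weights (s̄ : ℕ) where

  S₃ M N₃ : ℕ
  S₃ = s̄ + s̄ + s̄
  -- At most `3s + 1` vertices are marked, so the two lower digits never overflow; the top digit is
  -- unbounded.
  M  = suc (suc S₃)
  N₃ = M * M * M

  -- For c separator vertices and a, b marked vertices on the two sides: the separator is small, and so are the
  -- boundaries of both parts.  The weight pack b a c cannot carry, because a and b are always below M.
  okF : ℕ → ℕ → ℕ → ℕ
  okF b a c with c ≤? s̄ | a + c ≤? S₃ | b + c ≤? S₃
  ... | yes _ | yes _ | yes _ = 1
  ... | _     | _     | _     = 0

  okF≢0⇒ : ∀ b a c → okF b a c ≢ 0 → c ≤ s̄ × a + c ≤ S₃ × b + c ≤ S₃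
  okF≢0⇒ b a c p with c ≤? s̄ | a + c ≤? S₃ | b + c ≤? S₃
  ... | yes x | yes y | yes z = x , y , z
  ... | yes _ | yes _ | no _  = contradiction refl p
  ... | yes _ | no _  | _     = contradiction refl p
  ... | no _  | _     | _     = contradiction refl p

  ⇒okF≢0 : ∀ b a c → c ≤ s̄ → a + c ≤ S₃ → b + c ≤ S₃ → okF b a c ≢ 0
  ⇒okF≢0 b a c x y z with c ≤? s̄ | a + c ≤? S₃ | b + c ≤? S₃
  ... | yes _ | yes _ | yes _ = λ ()
  ... | yes _ | yes _ | no q  = contradiction z q
  ... | yes _ | no q  | _     = contradiction y q
  ... | no q  | _     | _     = contradiction x q

  alF : ℕ → ℕ
  alF σ = okF (σ % M) ((σ / M) % M) (σ / M / M)

  pack : ℕ → ℕ → ℕ → ℕ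
  pack b a c = b + (a + c * M) * M

  alF-pack : ∀ b a c → b < M → a < M → alF (pack b a c) ≡ okF b a c
  alF-pack b a c b<M a<M = trans (cong₂ (λ x y → okF x (y % M) (y / M))
      (trans ([m+kn]%n≡m%n b (a + c * M) M) (m<n⇒m%n≡m b<M)) ([m+kn]/n≡k b (a + c * M) b<M))
    (cong₂ (okF b) (trans ([m+kn]%n≡m%n a c M) (m<n⇒m%n≡m a<M)) ([m+kn]/n≡k a c a<M))

  pack< : ∀ b a c → b < M → a < M → c < M → pack b a c < N₃
  pack< b a c b<M a<M c<M = digit2 (digit2 c<M a<M) b<M
    where
    digit2 : ∀ {x y X} → x < X → y < M → y + x * M < X * M
    digit2 {x} {y} {X} x<X y<M = ≤-trans (+-monoˡ-< (x * M) y<M) (*-monoˡ-≤ M x<X)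

  Allowed : (ℕ → ℕ) → Set
  Allowed al = (∀ σ → σ < N₃ → al σ ≡ alF σ) × (∀ σ → N₃ ≤ σ → al σ ≡ 0)

  allowed-pack : ∀ {al} → Allowed al → ∀ {b a c} → c ≤ s̄ → a + c ≤ S₃ → b + c ≤ S₃ → al (pack b a c) ≢ 0
  allowed-pack (inside , _) {b} {a} {c} c≤ ac bc e = ⇒okF≢0 b a c c≤ ac bc (trans (sym (trans (inside _ (pack< b a c b<M a<M c<M)) (alF-pack b a c b<M a<M))) e)
    where
    small : ∀ {x} → x ≤ S₃ → x < M
    small le = s≤s (≤-trans le (n≤1+n S₃))
    b<M = small (≤-trans (m≤m+n b c) bc)
    a<M = small (≤-trans (m≤m+n a c) ac)
    c<M = small (≤-trans (m≤n+m c a) ac)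

  module _ (nv : ℕ) (wt w : ℕ → ℕ)
    (wt≡ : ∀ u → u < nv → wt (3 * u + 0) ≡ M * M × wt (3 * u + 1) ≡ M * w u × wt (3 * u + 2) ≡ w u)
    (g : ℕ → ℕ) (g<3 : ∀ u → u < nv → g u < 3) where

    masked : (ℕ → Bool) → ℕ → (ℕ → ℕ) → ℕ
    masked X l f = ∑ nv (λ u → when (X u) (when (g u ≡ᵇ l) (f u)))

    weight-sum : ∀ X → ∑ nv (λ u → when (X u) (wt (3 * u + g u))) ≡ pack (masked X 2 w) (masked X 1 w) (masked X 0 (λ _ → 1))
    weight-sum X = trans (∑-cong nv term) (trans (∑-+ nv _ _) (cong (masked X 2 w +_) (trans (∑-*ʳ nv _ M)
      (cong (_* M) (trans (∑-+ nv _ _) (cong (masked X 1 w +_) (∑-*ʳ nv _ M)))))))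
      where
      term : ∀ u → u < nv → when (X u) (wt (3 * u + g u)) ≡
        when (X u) (when (g u ≡ᵇ 2) (w u)) + (when (X u) (when (g u ≡ᵇ 1) (w u)) + when (X u) (when (g u ≡ᵇ 0) 1) * M) * M
      term u lt with X u | g u | g<3 u lt | wt≡ u lt
      ... | false | _ | _ | _ = refl
      ... | true | zero | _ | e , _ = trans e (cong (_* M) (sym (+-identityʳ M)))
      ... | true | suc zero | _ | _ , e , _ = trans e (trans (*-comm M (w u)) (cong (_* M) (sym (+-identityʳ (w u)))))
      ... | true | suc (suc zero) | _ | _ , _ , e = trans e (sym (+-identityʳ (w u)))
      ... | true | suc (suc (suc _)) | s≤s (s≤s (s≤s ())) | _

    masked≤ : ∀ X l f → masked X l f ≤ count nv g l f
    masked≤ X l f = ∑-mono nv (λ u _ → when≤ (X u) _)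

module Stage (ℓ : ℕ) where

  s̄ b : ℕ
  s̄ = suc ℓ
  -- An inherited boundary of `3s`, the vertex placed before the split, `s` separator vertices, and
  -- the free slot for the next new vertex.
  b = suc (suc (s̄ + s̄ + s̄ + s̄))

  open Weights s̄ public
  open Solver b 3 conf₃ public
  open StagePrograms b public

  splitNodeP : Program
  splitNodeP = inbP ︔ wtP M ︔ solveP ︔ separatorP ︔ ownP ︔ CH ≔ V M2 ︔ childP 2 ︔ CH ≔ const 1 ⊕ V M2 ︔ childP 1 ︔ M2 ≔ const 2 ⊕ V M2

  nodeP : Program
  nodeP = findP ︔ (ifnz V FND then splitNodeP else skip)

  -- The relation `E` stays the same throughout a stage, whereas `Edge s` is a different term for
  -- each store; `E⇒` and `⇒E` connect the two.
  record Context (nv Y : ℕ) (E : ℕ → ℕ → Set) (s : Store) : Set where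
    field
      td     : Rooted b (Edge s) (s NV 0) (s MM 0) (s BAG) (s PAR) (s HN) (s HS)
      nv≡    : s NV 0 ≡ nv
      nn≡    : s NN 0 ≡ N₃
      al     : Allowed (s AL)
      E⇒     : ∀ u v → E u v → Edge s u v
      ⇒E     : ∀ u v → Edge s u v → E u v
      E-sym  : ∀ u v → u < nv → v < nv → E u v → E v u
      exists : ∀ w → (∀ u → u < nv → w u ≤ 1) → ∑ nv w ≤ suc S₃ → Σ[ g ∈ (ℕ → ℕ) ] ((∀ u → g u < 3) × Split s̄ nv E w g)
      size₁  : nv ⊛ 3 ⊛ 0 ≤ Y
      size₂  : s MM 0 ⊛ N₃ ⊛ N₃ ⊛ 0 ≤ Y

  edge-cong : ∀ {s s′} → (∀ i → s′ ADJ i ≡ s ADJ i) → (∀ i → s′ ROW i ≡ s ROW i) → ∀ u v → Edge s′ u v → Edge s u v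
  edge-cong {s} a r u v e z = e (trans (a _) (trans (cong (λ k → s ADJ (k + v)) (r u)) z))

  context-frame : ∀ {nv Y E s s₁} → (∀ i → s₁ ADJ i ≡ s ADJ i) → (∀ i → s₁ ROW i ≡ s ROW i) → (∀ i → s₁ BAG i ≡ s BAG i) → (∀ i → s₁ PAR i ≡ s PAR i) →
    (∀ i → s₁ HN i ≡ s HN i) → (∀ i → s₁ HS i ≡ s HS i) → (∀ i → s₁ MM i ≡ s MM i) → (∀ i → s₁ NV i ≡ s NV i) → (∀ i → s₁ AL i ≡ s AL i) → (∀ i → s₁ NN i ≡ s NN i) →
    Context nv Y E s → Context nv Y E s₁
  context-frame {nv} {Y} {E} {s} {s₁} adjˢ rowˢ bagˢ parˢ hnˢ hsˢ mmˢ nvˢ alˢ nnˢ C = record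
    { td = rooted-cong (edge-cong {s} {s₁} adjˢ rowˢ) (nvˢ 0) (mmˢ 0) bagˢ parˢ hnˢ hsˢ td
    ; nv≡ = trans (nvˢ 0) nv≡ ; nn≡ = trans (nnˢ 0) nn≡
    ; al = (λ σ lt → trans (alˢ σ) (proj₁ al σ lt)) , (λ σ le → trans (alˢ σ) (proj₂ al σ le))
    ; E⇒ = λ u v e → edge-cong {s₁} {s} (sym ∘ adjˢ) (sym ∘ rowˢ) u v (E⇒ u v e) ; ⇒E = λ u v e → ⇒E u v (edge-cong {s} {s₁} adjˢ rowˢ u v e)
    ; E-sym = E-sym ; exists = exists ; size₁ = size₁ ; size₂ = subst (λ m → m ⊛ N₃ ⊛ N₃ ⊛ 0 ≤ Y) (sym (mmˢ 0)) size₂ }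
    where open Context C

  Fresh : Store → Set
  Fresh s = ∀ z → s FP 0 ≤ z → s HEAP z ≡ 0

  fresh-frame : ∀ {s s₁} → (∀ i → s₁ FP i ≡ s FP i) → (∀ i → s₁ HEAP i ≡ s HEAP i) → Fresh s → Fresh s₁
  fresh-frame f h F z le = trans (h z) (F z (≤-trans (≤-reflexive (sym (f 0))) le))

  Weighted : ℕ → (ℕ → ℕ) → (ℕ → ℕ) → Set
  Weighted nv wt w = ∀ u → u < nv → wt (3 * u + 0) ≡ M * M × wt (3 * u + 1) ≡ M * w u × wt (3 * u + 2) ≡ w u

  solver-input : ∀ {nv Y E s} → Context nv Y E s → Fresh s → Input s
  solver-input {s = s} C F = record { td = td ; fresh = F
    ; al< = λ σ ne → ≤-trans (≰⇒> (λ le → ne (proj₂ al σ le))) (≤-reflexive (sym nn≡)) }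
    where open Context C

  separation-target : ∀ {nv Y E s w} (C : Context nv Y E s) (F : Fresh s) → Weighted nv (s WT) w → (∀ u → u < nv → w u ≤ 1) → ∑ nv w ≤ suc S₃ →
    Σ[ g ∈ (ℕ → ℕ) ] Spec.Target s (solver-input C F) g
  separation-target {nv} {Y} {E} {s} {w} C F wt≡ w≤ ∑w≤ = g , record
    { g< = g<3
    ; proper = λ u v lu lv e c → let lu′ = subst (u <_) nv≡ lu ; lv′ = subst (v <_) nv≡ lv in
        case conf₃≢0⇒ (g u) (g v) c of λ
        { (inj₁ p) → apart u v lu′ lv′ (⇒E u v e) p
        ; (inj₂ (p , q)) → apart v u lv′ lu′ (E-sym u v lu′ lv′ (⇒E u v e)) (q , p) }
    ; allowed = λ X → subst (λ k → s AL k ≢ 0) (sym (trans (cong (λ k → ∑ k (λ u → when (X u) (s WT (3 * u + g u)))) nv≡) (weight-sum nv (s WT) w wt≡ g g<3′ X)))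
        (allowed-pack al (≤-trans (bd X 0 (λ _ → 1)) c≤)
          (≤-trans (+-mono-≤ (bd X 1 w) (bd X 0 (λ _ → 1))) a+c≤)
          (≤-trans (+-mono-≤ (bd X 2 w) (bd X 0 (λ _ → 1))) b+c≤)) }
    where
    open Context C
    ex = exists w w≤ ∑w≤
    g = proj₁ ex
    g<3 = proj₁ (proj₂ ex)
    g<3′ : ∀ u → u < nv → g u < 3
    g<3′ u _ = g<3 u
    bd = masked≤ nv (s WT) w wt≡ g g<3′
    open Split (proj₂ (proj₂ ex))

  -- The total weight is admissible, hence below `N₃`, and its digits can be read off: the lower two
  -- are at most the number of marked vertices, which is less than `M`.
  separation-sound : ∀ {nv Y E s w lab} (C : Context nv Y E s) (F : Fresh s) → Weighted nv (s WT) w → ∑ nv w ≤ suc S₃ →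
    Solved s (solver-input C F) lab → (∀ u → u < nv → lab u < 3) × Split s̄ nv E w lab
  separation-sound {nv} {Y} {E} {s} {w} {lab} C F wt≡ ∑w≤ sol = lab<3 , record
    { apart = λ u v lu lv e (p , q) → proper u v (subst (u <_) (sym nv≡) lu) (subst (v <_) (sym nv≡) lv) (E⇒ u v e)
        (subst₂ (λ l l′ → conf₃ l l′ ≢ 0) (sym p) (sym q) (λ ()))
    ; c≤ = proj₁ ok ; a+c≤ = proj₁ (proj₂ ok) ; b+c≤ = proj₂ (proj₂ ok) }
    where
    open Context C
    open Solved sol
    lab<3 : ∀ u → u < nv → lab u < 3
    lab<3 u lt = lab< u (subst (u <_) (sym nv≡) lt)
    small : ∀ l → count nv lab l w < M
    small l = s≤s (≤-trans (∑-mono nv (λ u _ → when≤ (lab u ≡ᵇ l) (w u))) ∑w≤)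
    A = count nv lab 1 w
    B = count nv lab 2 w
    c = count nv lab 0 (λ _ → 1)
    al≢0 : s AL (pack B A c) ≢ 0
    al≢0 = subst (λ k → s AL k ≢ 0) (trans (cong (λ k → ∑ k (λ u → s WT (3 * u + lab u))) nv≡) (weight-sum nv (s WT) w wt≡ lab lab<3 (λ _ → true))) allowed
    ok : c ≤ s̄ × A + c ≤ S₃ × B + c ≤ S₃
    ok = okF≢0⇒ B A c (λ z → al≢0 (trans (proj₁ al _ (≰⇒> (λ le → al≢0 (proj₂ al _ le)))) (trans (alF-pack B A c (small 2) (small 1)) z)))

  abstract
    separation-run : Σ[ K ∈ ℕ ] (∀ nv Y (E : ℕ → ℕ → Set) s w → Context nv Y E s → Fresh s → Weighted nv (s WT) w →
      (∀ u → u < nv → w u ≤ 1) → ∑ nv w ≤ suc S₃ →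
      Run solveP s (λ s′ → (∀ u → u < nv → s′ LAB u < 3) × Split s̄ nv E w (s′ LAB) × Fresh s′) K Y)
    separation-run = _ , λ nv Y E s w C F wt≡ w≤ ∑w≤ →
      let open Context C in
      run-post (λ s′ (sol , F′) _ → let p , q = separation-sound C F wt≡ ∑w≤ sol in p , q , F′)
        (proj₂ solve-run s (solver-input C F) Y (subst (λ k → k ⊛ 3 ⊛ 0 ≤ Y) (sym nv≡) size₁)
          (subst (λ k → s MM 0 ⊛ k ⊛ k ⊛ 0 ≤ Y) (sym nn≡) size₂) (separation-target C F wt≡ w≤ ∑w≤))

  -- Bag vertices of label 0 number at most `c`, whether they were in the bag before or have just
  -- been placed. The others have kept their marks, so the count `w` of the side applies to them.
  child-size : ∀ {nv} {lab inb w : ℕ → ℕ} x l → (∀ u → u < nv → lab u < 3) → (∀ u → u < nv → inb u ≤ 1) → (∀ u → u < nv → lab u ≢ 0 → inb u ≡ w u) →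
    (∀ k → k < 3 → k ≡ 0 ⊎ (k ≡ l ⊎ k ≡ x)) → l ≢ 0 → count nv lab l w + count nv lab 0 (λ _ → 1) ≤ S₃ → ∑ nv (λ u → inb u ∸ δ (lab u) x) ≤ S₃
  child-size {nv} {lab} {inb} {w} x l lab<3 inb≤ same cases l≢0 le = ≤-trans (≤-trans (∑-mono nv term) (≤-reflexive (∑-+ nv _ _))) le
    where
    term : ∀ u → u < nv → inb u ∸ δ (lab u) x ≤ when (lab u ≡ᵇ l) (w u) + when (lab u ≡ᵇ 0) 1
    term u lt with cases (lab u) (lab<3 u lt)
    ... | inj₁ e = ≤-trans (m∸n≤m (inb u) (δ (lab u) x)) (≤-trans (inb≤ u lt) (≤-trans (≤-reflexive (cong (λ t → when t 1) (sym (≡ᵇ-true e)))) (m≤n+m _ _)))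
    ... | inj₂ (inj₁ e) = ≤-trans (m∸n≤m (inb u) (δ (lab u) x)) (≤-trans (≤-reflexive (trans (same u lt (λ z → l≢0 (trans (sym e) z)))
            (cong (λ t → when t (w u)) (sym (≡ᵇ-true e))))) (m≤m+n _ _))
    ... | inj₂ (inj₂ e) = ≤-trans (≤-reflexive (trans (cong (inb u ∸_) (δ-≡ e)) (m≤n⇒m∸n≡0 (inb≤ u lt)))) z≤n

  cases₃ : ∀ k → k < 3 → k ≡ 0 ⊎ (k ≡ 1 ⊎ k ≡ 2)
  cases₃ 0 _ = inj₁ refl
  cases₃ 1 _ = inj₂ (inj₁ refl)
  cases₃ 2 _ = inj₂ (inj₂ refl)
  cases₃ (suc (suc (suc _))) (s≤s (s≤s (s≤s ())))

  -- The bound `3s` is claimed for nodes still to be processed; processing may fill a bag up to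
  -- `4s + 1`.
  Pending : ℕ → (ℕ → ℕ → Set) → ℕ → Store → Set
  Pending nv E it s = QueueOf nv E it (s M2 0) (s M2 0) s × (∀ j → it ≤ j → j < s M2 0 → s LEN j ≤ S₃) × Fresh s

  S₃<b : ∀ {x} → x ≤ S₃ → x < b
  S₃<b le = s≤s (≤-trans le (≤-trans (m≤m+n S₃ s̄) (n≤1+n _)))

  abstract
    splitNode-run : Σ[ K ∈ ℕ ] (∀ nv Y (E : ℕ → ℕ → Set) s it → Context nv Y E s → s IT 0 ≡ it → (let m₂ = s M2 0) → it < m₂ →
      QueueOf nv E it m₂ (2 + m₂) s → s LEN it ≤ suc S₃ → (∀ j → suc it ≤ j → j < m₂ → s LEN j ≤ S₃) → Fresh s →
      Run splitNodeP s (Pending nv E (suc it)) K Y)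
    splitNode-run = _ , λ nv Y E s it C it≡ it<m₂ Q len≤ lens F →
      let open Context C
          m₂ = s M2 0
          small : nv ⊛ 0 ≤ Y
          small = ≤-trans (⊛-mono {nv} ≤-refl z≤n) size₁
      in run-seq (run-size small (proj₂ inb-run nv s it nv≡ it≡ (≤-trans len≤ (s≤s (≤-trans (m≤m+n S₃ s̄) (n≤1+n _)))) (λ u i → proj₁ (Queue.up Q it u it<m₂ i))))
      (λ s₁ (in₁ , in₁′ , inb≤₁ , ∑≤₁) fr₁ → run-seq (run-size small (proj₂ (wt-run M) nv s₁ (trans (fr₁ NV 0) nv≡)))
      (λ s₂ wt₂ fr₂ →
        let e₂ : ∀ a → {_ : T (keeps inbP a)} {_ : T (keeps (wtP M) a)} → ∀ i → s₂ a i ≡ s a i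
            e₂ a {k₁} {k₂} i = trans (fr₂ a {k₂} i) (fr₁ a {k₁} i)
            C₂ = context-frame (e₂ ADJ) (e₂ ROW) (e₂ BAG) (e₂ PAR) (e₂ HN) (e₂ HS) (e₂ MM) (e₂ NV) (e₂ AL) (e₂ NN) C
            w = s₁ INB
        in run-seq (proj₂ separation-run nv Y E s₂ w C₂ (fresh-frame {s} {s₂} (λ i → trans (fr₂ FP i) (fr₁ FP i)) (λ i → trans (fr₂ HEAP i) (fr₁ HEAP i)) F) wt₂ inb≤₁ (≤-trans ∑≤₁ len≤))
      (λ s₃ (lab<3 , sp , F₃) fr₃ →
        let e₃ : ∀ a → {_ : T (keeps inbP a)} {_ : T (keeps (wtP M) a)} {_ : T (keeps solveP a)} → ∀ i → s₃ a i ≡ s a i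
            e₃ a {k₁} {k₂} {k₃} i = trans (fr₃ a {k₃} i) (trans (fr₂ a {k₂} i) (fr₁ a {k₁} i))
            Q₃ : QueueOf nv E it m₂ (2 + m₂) s₃
            Q₃ = queue-cong (e₃ OWN) (e₃ LEN) (e₃ BAG2) (e₃ PAR2) (e₃ HN2) (e₃ HS2) Q
            inb₃ : ∀ u → s₃ INB u ≡ w u
            inb₃ u = trans (fr₃ INB u) (fr₂ INB u)
            in₃ : ∀ {u} → In b (s LEN) (s BAG2) it u → In b (s₃ LEN) (s₃ BAG2) it u
            in₃ = in-cong {b} {s LEN} {s BAG2} {s₃ LEN} {s₃ BAG2} {it} (e₃ LEN it) (λ a _ → e₃ BAG2 _)
            in₃′ : ∀ {u} → In b (s₃ LEN) (s₃ BAG2) it u → In b (s LEN) (s BAG2) it u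
            in₃′ = in-cong {b} {s₃ LEN} {s₃ BAG2} {s LEN} {s BAG2} {it} (sym (e₃ LEN it)) (λ a _ → sym (e₃ BAG2 _))
        in run-seq (run-size small (proj₂ separator-run nv E E-sym s₃ it m₂ (2 + m₂) (trans (e₃ NV 0) nv≡) (trans (e₃ IT 0) it≡) it<m₂ Q₃
             (λ u lt ne → in₃ (in₁ u lt (λ z → ne (trans (inb₃ u) z)))) (λ u lt i z → in₁′ u lt (in₃′ i) (trans (sym (inb₃ u)) z))
             (λ u lt → ≤-trans (≤-reflexive (inb₃ u)) (inb≤₁ u lt))
             (s≤s (+-mono-≤ (≤-trans (≤-reflexive (e₃ LEN it)) len≤) (Split.c≤ sp)))))
      (λ s₄ (Q₄ , lab≢0 , len₄ , in₄ , in₄′ , inb≤₄ , same₄ , _) fr₄ →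
        let e₄ : ∀ a → {_ : T (keeps inbP a)} {_ : T (keeps (wtP M) a)} {_ : T (keeps solveP a)} {_ : T (keeps separatorP a)} → ∀ i → s₄ a i ≡ s a i
            e₄ a {k₁} {k₂} {k₃} {k₄} i = trans (fr₄ a {k₄} i) (e₃ a {k₁} {k₂} {k₃} i)
            lab₄ : ∀ u → s₄ LAB u ≡ s₃ LAB u
            lab₄ u = fr₄ LAB u
        in run-seq (run-size small (proj₂ own-run nv s₄ it m₂ (trans (e₄ NV 0) nv≡) (trans (e₄ IT 0) it≡) (e₄ M2 0)))
      (λ s₅ (own≡ , own≢) fr₅ →
        let e₅ : ∀ a → {_ : T (keeps inbP a)} {_ : T (keeps (wtP M) a)} {_ : T (keeps solveP a)} {_ : T (keeps separatorP a)} {_ : T (keeps ownP a)} → ∀ i → s₅ a i ≡ s a i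
            e₅ a {k₁} {k₂} {k₃} {k₄} {k₅} i = trans (fr₅ a {k₅} i) (e₄ a {k₁} {k₂} {k₃} {k₄} i)
            lab₅ : ∀ u → s₅ LAB u ≡ s₃ LAB u
            lab₅ u = trans (fr₅ LAB u) (lab₄ u)
            lab<₅ : ∀ u → u < nv → s₅ LAB u < 3
            lab<₅ u lt = subst (_< 3) (sym (lab₅ u)) (lab<3 u lt)
            inb≤₅ : ∀ u → u < nv → s₅ INB u ≤ 1
            inb≤₅ u lt = ≤-trans (≤-reflexive (fr₅ INB u)) (inb≤₄ u lt)
            same₅ : ∀ u → u < nv → s₅ LAB u ≢ 0 → s₅ INB u ≡ w u
            same₅ u lt ne = trans (fr₅ INB u) (trans (same₄ u lt (λ z → ne (trans (lab₅ u) z))) (inb₃ u))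
            count≡ : ∀ l f → count nv (s₅ LAB) l f ≡ count nv (s₃ LAB) l f
            count≡ l f = ∑-cong nv (λ u _ → cong (λ k → when (k ≡ᵇ l) (f u)) (lab₅ u))
            sizeA : ∑ nv (λ u → s₅ INB u ∸ δ (s₅ LAB u) 2) ≤ S₃
            sizeA = child-size {nv} {s₅ LAB} {s₅ INB} {w} 2 1 lab<₅ inb≤₅ same₅ cases₃ (λ ()) (≤-trans (≤-reflexive (cong₂ _+_ (count≡ 1 w) (count≡ 0 (λ _ → 1)))) (Split.a+c≤ sp))
            sizeB : ∑ nv (λ u → s₅ INB u ∸ δ (s₅ LAB u) 1) ≤ S₃
            sizeB = child-size {nv} {s₅ LAB} {s₅ INB} {w} 1 2 lab<₅ inb≤₅ same₅ (λ k lt → [ inj₁ , [ (λ e → inj₂ (inj₂ e)) , (λ e → inj₂ (inj₁ e)) ]′ ]′ (cases₃ k lt)) (λ ())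
                      (≤-trans (≤-reflexive (cong₂ _+_ (count≡ 2 w) (count≡ 0 (λ _ → 1)))) (Split.b+c≤ sp))
        in run-assign-seq (run-seq (run-size small (proj₂ (child-run 2) nv (update s₅ CH 0 (s₅ M2 0)) it m₂ (trans (e₅ NV 0) nv≡) (trans (e₅ IT 0) it≡) (e₅ M2 0) inb≤₅ (S₃<b sizeA)))
      (λ s₆ (lenA , parA , inA , inA′ , len₆ , bag₆ , par₆) fr₆ →
        let inb₆ : ∀ u → s₆ INB u ≡ s₅ INB u
            inb₆ u = fr₆ INB u
            k₆ : ∀ u → s₆ INB u ∸ δ (s₆ LAB u) 1 ≡ s₅ INB u ∸ δ (s₅ LAB u) 1
            k₆ u = cong₂ (λ x y → x ∸ δ y 1) (fr₆ INB u) (fr₆ LAB u)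
            sizeB₆ : ∑ nv (λ u → s₆ INB u ∸ δ (s₆ LAB u) 1) ≤ S₃
            sizeB₆ = ≤-trans (≤-reflexive (∑-cong nv (λ u _ → k₆ u))) sizeB
        in run-assign-seq (run-seq (run-size small (proj₂ (child-run 1) nv (update s₆ CH 0 (1 + s₆ M2 0)) it (suc m₂) (trans (fr₆ NV 0) (trans (e₅ NV 0) nv≡))
             (trans (fr₆ IT 0) (trans (e₅ IT 0) it≡)) (cong suc (trans (fr₆ M2 0) (e₅ M2 0))) (λ u lt → ≤-trans (≤-reflexive (inb₆ u)) (inb≤₅ u lt)) (S₃<b sizeB₆)))
      (λ s₇ (lenB , parB , inB , inB′ , len₇ , bag₇ , par₇) fr₇ →
        let mm : 2 + s₇ M2 0 ≡ 2 + m₂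
            mm = cong (2 +_) (trans (fr₇ M2 0) (trans (fr₆ M2 0) (e₅ M2 0)))
            m₂≢ : m₂ ≢ suc m₂
            m₂≢ e = <⇒≢ (n<1+n m₂) e
            lenA₇ : s₇ LEN m₂ ≡ ∑ nv (λ u → s₅ INB u ∸ δ (s₅ LAB u) 2)
            lenA₇ = trans (len₇ m₂ m₂≢) lenA
            old-len : ∀ j → j < m₂ → s₇ LEN j ≡ s₄ LEN j
            old-len j lt = trans (len₇ j (<⇒≢ (m<n⇒m<1+n lt))) (trans (len₆ j (<⇒≢ lt)) (fr₅ LEN j))
            lensC : ∀ j → suc it ≤ j → j < 2 + m₂ → s₇ LEN j ≤ S₃
            lensC j le lt = case m<1+n⇒m<n∨m≡n lt of λ
              { (inj₂ refl) → ≤-trans (≤-reflexive lenB) sizeB₆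
              ; (inj₁ lt′) → case m<1+n⇒m<n∨m≡n lt′ of λ
                  { (inj₂ refl) → ≤-trans (≤-reflexive lenA₇) sizeA
                  ; (inj₁ lt″) → ≤-trans (≤-reflexive (trans (old-len j lt″) (trans (len₄ j (<⇒≢ le ∘ sym)) (e₃ LEN j)))) (lens j le lt″) } }
            children : Queues.Children b nv E E-sym it m₂ (s₄ OWN) (s₄ LEN) (s₄ BAG2) (s₄ PAR2) (s₄ INB) (s₃ LAB) (s₇ OWN) (s₇ LEN) (s₇ BAG2) (s₇ PAR2)
            children = record
              { own-≡ = λ u lt o → trans (fr₇ OWN u) (trans (fr₆ OWN u) (trans (own≡ u lt o) (cong (m₂ +_) (lab₄ u))))
              ; own-≢ = λ u lt o → trans (fr₇ OWN u) (trans (fr₆ OWN u) (own≢ u lt o))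
              ; len-≡ = old-len
              ; bag-≡ = λ j a lt a<b → trans (bag₇ j a (<⇒≢ (m<n⇒m<1+n lt)) a<b) (trans (bag₆ j a (<⇒≢ lt) a<b) (fr₅ BAG2 _))
              ; par-≡ = λ j lt → trans (par₇ j (<⇒≢ (m<n⇒m<1+n lt))) (trans (par₆ j (<⇒≢ lt)) (fr₅ PAR2 j))
              ; par-A = trans (par₇ m₂ m₂≢) parA
              ; par-B = parB
              ; len-A = S₃<b (≤-trans (≤-reflexive lenA₇) sizeA)
              ; len-B = S₃<b (≤-trans (≤-reflexive lenB) sizeB₆)
              ; in-A⁺ = λ u lt i l → in-cong {b} {s₆ LEN} {s₆ BAG2} {s₇ LEN} {s₇ BAG2} {m₂} (len₇ m₂ m₂≢)
                  (λ a a< → bag₇ m₂ a m₂≢ (<-trans a< (S₃<b (≤-trans (≤-reflexive lenA) sizeA))))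
                  (inA u lt (λ z → i (trans (sym (fr₅ INB u)) (trans (sym (cong (s₅ INB u ∸_) (δ-≢ (λ e → l (trans (sym (lab₅ u)) e))))) z))))
              ; in-B⁺ = λ u lt i l → inB u lt (λ z → i (trans (sym (trans (inb₆ u) (fr₅ INB u))) (trans (sym (cong (s₆ INB u ∸_) (δ-≢ (λ e → l (trans (sym (trans (fr₆ LAB u) (lab₅ u))) e))))) z)))
              ; in-A⁻ = λ u i → let lt , ne = inA′ u (in-cong {b} {s₇ LEN} {s₇ BAG2} {s₆ LEN} {s₆ BAG2} {m₂} (sym (len₇ m₂ m₂≢))
                                     (λ a a< → sym (bag₇ m₂ a m₂≢ (<-trans a< (S₃<b (≤-trans (≤-reflexive lenA₇) sizeA))))) i)
                                in lt , λ z → ne (trans (cong (_∸ δ (s₅ LAB u) 2) (trans (fr₅ INB u) z)) (0∸n≡0 (δ (s₅ LAB u) 2)))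
              ; in-B⁻ = λ u i → let lt , ne = inB′ u i in lt , λ z → ne (trans (cong (_∸ δ (s₆ LAB u) 1) (trans (inb₆ u) (trans (fr₅ INB u) z))) (0∸n≡0 (δ (s₆ LAB u) 1))) }
            Q₇ : QueueOf nv E (suc it) (2 + m₂) (2 + m₂) s₇
            Q₇ = queue-cong (λ _ → refl) (λ _ → refl) (λ _ → refl) (λ _ → refl) (λ u → trans (fr₇ HN2 u) (trans (fr₆ HN2 u) (fr₅ HN2 u))) (λ u → trans (fr₇ HS2 u) (trans (fr₆ HS2 u) (fr₅ HS2 u)))
                   (Queues.split b nv E E-sym Q₄ it<m₂ lab<3 (Split.apart sp) lab≢0 (λ u lt i → in₄′ u lt i) in₄ children)
        in run-assign ( subst (λ k → QueueOf nv E (suc it) k k s₇) (sym mm) Q₇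
                      , subst (λ k → ∀ j → suc it ≤ j → j < k → s₇ LEN j ≤ S₃) (sym mm) lensC
                      , fresh-frame {s₃} {s₇} (λ i → trans (fr₇ FP i) (trans (fr₆ FP i) (trans (fr₅ FP i) (fr₄ FP i)))) (λ i → trans (fr₇ HEAP i) (trans (fr₆ HEAP i) (trans (fr₅ HEAP i) (fr₄ HEAP i)))) F₃ ))))))))))

-- Iterative compression

module Stages (ℓ : ℕ) where
  open Stage ℓ public

  copyP : Program
  copyP = for IT (V M2) (PAR [ V IT ]≔ PAR2 [ V IT ] ︔
      for SL (const b) (ifnz LEN [ V IT ] ⊖ V SL then BAG [ times b (V IT) ⊕ V SL ]≔ BAG2 [ times b (V IT) ⊕ V SL ]
                        else (BAG [ times b (V IT) ⊕ V SL ]≔ V NV))) ︔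
    for QU (V NV) (HN [ V QU ]≔ HN2 [ V QU ] ︔ HS [ V QU ]≔ HS2 [ V QU ])

  finishP : Program
  -- The slot `b - 1` is the last one and was free in every bag, so it holds the new vertex
  -- everywhere; the root becomes the home.
  finishP = copyP ︔ HN [ V NV ]≔ const 0 ︔ HS [ V NV ]≔ const (suc (s̄ + s̄ + s̄ + s̄)) ︔ MM ≔ V M2 ︔ NV ≔ const 1 ⊕ V NV

  -- The rebuild begins with an empty root bag that owns all vertices, as `own = 1` means node 0.
  -- The number of rounds bounds the number of nodes that can arise; in rounds beyond the last node
  -- `findP` finds nothing.
  stageP : Program
  stageP = M2 ≔ const 1 ︔ LEN [ const 0 ]≔ const 0 ︔ for QU (V NV) (OWN [ V QU ]≔ const 1) ︔
    for IT (V NV ⊕ V NV ⊕ const 1) nodeP ︔ finishP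

  abstract
    node-run : Σ[ K ∈ ℕ ] (∀ nv Y (E : ℕ → ℕ → Set) s it → Context nv Y E s → s IT 0 ≡ it → Pending nv E it s → Run nodeP s (Pending nv E (suc it)) K Y)
    node-run = _ , λ nv Y E s it C it≡ (Q , lens , F) →
      let open Context C
          m₂ = s M2 0
          small : nv ⊛ 0 ≤ Y
          small = ≤-trans (⊛-mono {nv} ≤-refl z≤n) size₁
      in run-seq (run-size small (proj₂ find-run nv E E-sym s it m₂ nv≡ it≡ Q (λ lt → s≤s (s≤s (≤-trans (lens it ≤-refl lt) (m≤m+n S₃ s̄))))))
      (λ s₁ cases fr →
        let m₂≡ : s₁ M2 0 ≡ m₂
            m₂≡ = fr M2 0
            F₁ : Fresh s₁
            F₁ = fresh-frame {s} {s₁} (fr FP) (fr HEAP) F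
        in run-if
          (λ nz → case cases of λ
            { (inj₁ (f , _)) → contradiction f nz
            ; (inj₂ (_ , it<m₂ , Q₁ , len≡ , len≢)) →
                proj₂ splitNode-run nv Y E s₁ it (context-frame (fr ADJ) (fr ROW) (fr BAG) (fr PAR) (fr HN) (fr HS) (fr MM) (fr NV) (fr AL) (fr NN) C)
                  (trans (fr IT 0) it≡) (subst (it <_) (sym m₂≡) it<m₂) (subst (λ k → QueueOf nv E it k (2 + k) s₁) (sym m₂≡) Q₁)
                  (≤-trans (≤-reflexive len≡) (s≤s (lens it ≤-refl it<m₂)))
                  (λ j le lt → ≤-trans (≤-reflexive (len≢ j (<⇒≢ le ∘ sym))) (lens j (<⇒≤ le) (subst (j <_) m₂≡ lt))) F₁ })
          (λ z → run-skip (case cases of λ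
            { (inj₂ (f , _)) → case trans (sym f) z of λ ()
            ; (inj₁ (_ , none , Q₁ , len≡)) →
                subst (λ k → QueueOf nv E (suc it) k k s₁) (sym m₂≡) (Queues.skip-node b nv E E-sym none Q₁) ,
                (λ j le lt → ≤-trans (≤-reflexive (len≡ j)) (lens j (<⇒≤ le) (subst (j <_) m₂≡ lt))) , F₁ })))

    copy-run : Σ[ K ∈ ℕ ] (∀ s nv m₂ Y → s NV 0 ≡ nv → s M2 0 ≡ m₂ → m₂ ⊛ 0 ≤ Y → nv ⊛ 0 ≤ Y →
      Run copyP s (λ s′ → (∀ j → j < m₂ → s′ PAR j ≡ s PAR2 j) ×
        (∀ j a → j < m₂ → a < b → a < s LEN j → s′ BAG (b * j + a) ≡ s BAG2 (b * j + a)) × (∀ j a → j < m₂ → a < b → s LEN j ≤ a → s′ BAG (b * j + a) ≡ nv) ×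
        (∀ u → u < nv → s′ HN u ≡ s HN2 u) × (∀ u → u < nv → s′ HS u ≡ s HS2 u)) K Y)
    copy-run = _ , λ s nv m₂ Y nv≡ m₂≡ size size′ →
      let Slot : (ℕ → ℕ) → ℕ → ℕ → Set
          Slot bag j a = (a < s LEN j → bag (b * j + a) ≡ s BAG2 (b * j + a)) × (s LEN j ≤ a → bag (b * j + a) ≡ nv)
      in run-seq (run-size size
        (run-for (λ i s′ → (∀ j → j < i → s′ PAR j ≡ s PAR2 j) × (∀ j a → j < i → a < b → Slot (s′ BAG) j a)) m₂ tt tt (λ _ _ _ p → p)
          (λ i s₁ i<m₂ i≡ fr (p , g) → run-assign-seq (run-post
            (λ s′ h fr′ →
              (λ j j<1+i → trans (fr′ PAR j) (set-cases (_≡ s PAR2 j) (s₁ PAR) (s₁ IT 0) _ j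
                  (λ e → trans (fr PAR2 _) (cong (s PAR2) e))
                  (λ ne → [ p j , (λ e → contradiction (trans i≡ (sym e)) ne) ]′ (m<1+n⇒m<n∨m≡n j<1+i)))) ,
              (λ j a j<1+i a<b → h j a a<b ([ inj₁ , (λ e → inj₂ (e , a<b)) ]′ (m<1+n⇒m<n∨m≡n j<1+i))))
            (run-forᶜ (λ c s′ → ∀ j a → a < b → j < i ⊎ (j ≡ i × a < c) → Slot (s′ BAG) j a) b tt tt (λ _ _ _ p → p)
              (λ c s₂ c<b c≡ fr₂ h →
                let i≡₂ : s₂ IT 0 ≡ i
                    i≡₂ = trans (fr₂ IT 0) i≡
                    ix : ⟦ times b (V IT) ⟧ s₂ + s₂ SL 0 ≡ b * i + c
                    ix = cong₂ _+_ (trans (⟦times⟧ b (V IT) s₂) (cong (b *_) i≡₂)) c≡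
                    len≡ : s₂ LEN (s₂ IT 0) ≡ s LEN i
                    len≡ = trans (fr₂ LEN _) (trans (fr LEN _) (cong (s LEN) i≡₂))
                    write : ∀ v → (c < s LEN i → v ≡ s BAG2 (b * i + c)) → (s LEN i ≤ c → v ≡ nv) →
                      ∀ j a → a < b → j < i ⊎ (j ≡ i × a < suc c) → Slot (set (s₂ BAG) (⟦ times b (V IT) ⟧ s₂ + s₂ SL 0) v) j a
                    write v x y j a a<b d = subst (λ k → Slot (set (s₂ BAG) k v) j a) (sym ix)
                      (case (b * i + c) ≟ (b * j + a) of λ
                        { (yes e) → case index-inj {b} {i} {j} c<b a<b e of λ { (refl , refl) →
                            (λ lt → trans (set-same (s₂ BAG) (b * i + c) v) (x lt)) , (λ le → trans (set-same (s₂ BAG) (b * i + c) v) (y le)) }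
                        ; (no ne) →
                            let o , o′ = h j a a<b (case d of λ { (inj₁ lt) → inj₁ lt ; (inj₂ (refl , lt)) → [ (λ l → inj₂ (refl , l)) , (λ { refl → contradiction refl ne }) ]′ (m<1+n⇒m<n∨m≡n lt) })
                            in (λ lt → trans (set-other (s₂ BAG) {b * i + c} {b * j + a} v ne) (o lt)) , (λ le → trans (set-other (s₂ BAG) {b * i + c} {b * j + a} v ne) (o′ le)) })
                in run-if
                  (λ nz → run-assign (write _ (λ _ → trans (fr₂ BAG2 _) (trans (fr BAG2 _) (cong (s BAG2) ix)))
                    (λ le → contradiction (trans (cong₂ _∸_ len≡ c≡) (m≤n⇒m∸n≡0 le)) nz)))
                  (λ z → run-assign (write _ (λ lt → contradiction (m∸n≡0⇒m≤n (trans (sym (cong₂ _∸_ len≡ c≡)) z)) (<⇒≱ lt))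
                    (λ _ → trans (fr₂ NV 0) (trans (fr NV 0) nv≡)))))
              b ≤-refl refl (λ { j a a<b (inj₁ lt) → g j a lt a<b ; j a a<b (inj₂ (_ , ())) }))))
          m₂≡ ((λ _ ()) , (λ _ _ ()))))
      (λ s₁ (p , g) fr₁ → run-size size′ (run-post
        (λ s′ (h , k) fr → (λ j lt → trans (fr PAR j) (p j lt)) , (λ j a lt a<b l → trans (fr BAG _) (proj₁ (g j a lt a<b) l)) ,
            (λ j a lt a<b l → trans (fr BAG _) (proj₂ (g j a lt a<b) l)) , h , k)
        (run-for (λ t s′ → (∀ u → u < t → s′ HN u ≡ s HN2 u) × (∀ u → u < t → s′ HS u ≡ s HS2 u)) nv tt tt (λ _ _ _ p → p)
          (λ t s₂ t<nv t≡ fr₂ (h , k) → run-assign-seq (run-assign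
            ( (λ u u<1+t → set-cases (_≡ s HN2 u) (s₂ HN) (s₂ QU 0) _ u (λ e → trans (fr₂ HN2 _) (trans (fr₁ HN2 _) (cong (s HN2) e)))
                 (λ ne → [ h u , (λ e → contradiction (trans t≡ (sym e)) ne) ]′ (m<1+n⇒m<n∨m≡n u<1+t)))
            , (λ u u<1+t → set-cases (_≡ s HS2 u) (s₂ HS) (s₂ QU 0) _ u (λ e → trans (fr₂ HS2 _) (trans (fr₁ HS2 _) (cong (s HS2) e)))
                 (λ ne → [ k u , (λ e → contradiction (trans t≡ (sym e)) ne) ]′ (m<1+n⇒m<n∨m≡n u<1+t))) )))
          (trans (fr₁ NV 0) nv≡) ((λ _ ()) , (λ _ ())))))

    stage-run : Σ[ K ∈ ℕ ] (∀ nv Y s → Context nv Y (Edge s) s → Fresh s → (1 + 2 * nv) ⊛ 0 ≤ Y →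
      Run stageP s (λ s′ → Rooted b (Edge s) (suc nv) (s′ MM 0) (s′ BAG) (s′ PAR) (s′ HN) (s′ HS) × s′ NV 0 ≡ suc nv × s′ MM 0 ≤ 1 + 2 * nv × Fresh s′)
        K ((1 + 2 * nv) ⊛ Y))
    stage-run = _ , λ nv Y s C F size₃ →
      let open Context C
          E = Edge s
          small : nv ⊛ 0 ≤ Y
          small = ≤-trans (⊛-mono {nv} ≤-refl z≤n) size₁
          big : Y ≤ (1 + 2 * nv) ⊛ Y
          big = ⊛-inner (1 + 2 * nv) Y
      in run-assign-seq (run-assign-seq (run-seq
        (run-size (≤-trans small big) (run-for (λ t s′ → ∀ u → u < t → s′ OWN u ≡ 1) nv tt tt (λ _ _ _ p → p)
          (λ t s₁ t<nv t≡ fr inv → run-assign (λ u u<1+t → set-cases (_≡ 1) (s₁ OWN) (s₁ QU 0) 1 u (λ _ → refl)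
            (λ ne → [ inv u , (λ e → contradiction (trans t≡ (sym e)) ne) ]′ (m<1+n⇒m<n∨m≡n u<1+t))))
          nv≡ (λ _ ())))
      (λ s₁ own₁ fr₁ →
        let C₁ : Context nv Y E s₁
            C₁ = context-frame (fr₁ ADJ) (fr₁ ROW) (fr₁ BAG) (fr₁ PAR) (fr₁ HN) (fr₁ HS) (fr₁ MM) (fr₁ NV) (fr₁ AL) (fr₁ NN) C
            m₁ : s₁ M2 0 ≡ 1
            m₁ = fr₁ M2 0
            len₁ : s₁ LEN 0 ≡ 0
            len₁ = fr₁ LEN 0
            Q₁ : QueueOf nv E 0 1 1 s₁
            Q₁ = record
              { m₂≥1 = ≤-refl ; parent = λ { (suc j) _ (s≤s ()) } ; fits = λ { zero _ → subst (_< b) (sym len₁) z<s ; (suc j) (s≤s ()) }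
              ; homed = λ u lt e → case trans (sym (own₁ u lt)) e of λ ()
              ; owned = λ u lt _ → 0 , own₁ u lt , z≤n , s≤s z≤n
              ; up = λ { zero u _ (a , a< , _) → contradiction (≤-trans a< (≤-reflexive len₁)) (λ ()) ; (suc j) u (s≤s ()) }
              ; covered = λ u v lu lv e ou → case trans (sym (own₁ u lu)) ou of λ ()
              ; near = λ u v j lu lv e ou → inj₁ (trans (own₁ v lv) (trans (sym (own₁ u lu)) ou))
              ; count≥ = s≤s z≤n }
            bound≡ : s₁ NV 0 + s₁ NV 0 + 1 ≡ 1 + 2 * nv
            bound≡ = trans (+-comm _ 1) (cong suc (trans (cong (λ k → k + k) (trans (fr₁ NV 0) nv≡)) (cong (nv +_) (sym (+-identityʳ nv)))))
        in run-seq (run-for (Pending nv E) (1 + 2 * nv) tt tt (λ _ _ _ p → p)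
             (λ it s₂ it< it≡ fr₂ pend → proj₂ node-run nv Y E s₂ it
               (context-frame (fr₂ ADJ) (fr₂ ROW) (fr₂ BAG) (fr₂ PAR) (fr₂ HN) (fr₂ HS) (fr₂ MM) (fr₂ NV) (fr₂ AL) (fr₂ NN) C₁) it≡ pend)
             bound≡ (subst (λ k → QueueOf nv E 0 k k s₁) (sym m₁) Q₁ ,
                     (λ j _ lt → case j ≟ 0 of λ { (yes refl) → ≤-trans (≤-reflexive len₁) z≤n ; (no ne) → contradiction (subst (j <_) m₁ lt) (λ l → ne (n<1⇒n≡0 l)) }) ,
                     fresh-frame {s} {s₁} (fr₁ FP) (fr₁ HEAP) F))
      (λ s₂ (Q₂ , _ , F₂) fr₂ →
        let nv₂ : s₂ NV 0 ≡ nv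
            nv₂ = trans (fr₂ NV 0) (trans (fr₁ NV 0) nv≡)
            m₂ = s₂ M2 0
            m₂≤ : m₂ ≤ 1 + 2 * nv
            m₂≤ = ≤-trans (Queue.count≥ Q₂) (s≤s (*-monoʳ-≤ 2 (Queues.placed≤ b nv E E-sym (s₂ OWN))))
        in run-seq (run-size big (proj₂ copy-run s₂ nv m₂ Y nv₂ refl (≤-trans (⊛-mono {m₂} {1 + 2 * nv} {0} {0} m₂≤ z≤n) size₃) small))
      (λ s₃ (par₃ , in₃ , out₃ , hn₃ , hs₃) fr₃ →
        let nv₃ : s₃ NV 0 ≡ nv
            nv₃ = trans (fr₃ NV 0) nv₂
            m₃ : s₃ M2 0 ≡ m₂
            m₃ = fr₃ M2 0
            top = suc (s̄ + s̄ + s̄ + s̄)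
        in run-assign-seq (run-assign-seq (run-assign-seq (run-assign
          ( subst (λ m → Rooted b E (suc nv) m (s₃ BAG) (s₃ PAR) (set (s₃ HN) (s₃ NV 0) 0) (set (s₃ HS) (s₃ NV 0) top)) (sym m₃)
              (Queues.finish b nv E E-sym E Q₂ ≤-refl (λ _ _ _ _ e → e)
                (λ j a lt a< → in₃ j a lt (<-trans a< (Queue.fits Q₂ j lt)) a<) out₃ par₃
                (λ u lt → trans (set-other (s₃ HN) {s₃ NV 0} {u} 0 (λ e → <⇒≢ lt (trans (sym e) nv₃))) (hn₃ u lt))
                (λ u lt → trans (set-other (s₃ HS) {s₃ NV 0} {u} top (λ e → <⇒≢ lt (trans (sym e) nv₃))) (hs₃ u lt))
                (trans (cong (λ k → set (s₃ HN) k 0 nv) nv₃) (set-same (s₃ HN) nv 0))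
                (cong suc (trans (cong (λ k → set (s₃ HS) k top nv) nv₃) (set-same (s₃ HS) nv top))))
          , cong suc nv₃ , ≤-trans (≤-reflexive m₃) m₂≤ , fresh-frame {s₂} {s₃} (fr₃ FP) (fr₃ HEAP) F₂ )))))))))

-- Labellings, colourings and profits

encode-sum : ∀ B k d → encode B k d ≡ ∑ k (λ j → d j * B ^ j)
encode-sum B zero    d = refl
encode-sum B (suc k) d = sym (trans (∑-shift k _) (cong₂ _+_ (*-identityʳ (d 0)) (trans (∑-cong k (λ j _ → lem j))
  (trans (∑-* k B (λ j → d (suc j) * B ^ j)) (trans (*-comm B _) (cong (_* B) (sym (encode-sum B k (d ∘ suc)))))))))
  where
  lem : ∀ j → d (suc j) * (B * B ^ j) ≡ B * (d (suc j) * B ^ j)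
  lem j = *-swap (d (suc j)) B (B ^ j)

encode-digit : ∀ B .{{_ : NonZero B}} k x → x < B ^ k → encode B k (digit B x) ≡ x
encode-digit B zero    x lt = sym (n<1⇒n≡0 lt)
encode-digit B (suc k) x lt = trans (cong (λ y → x % B + y * B) (encode-digit B k (x / B) (m<n*o⇒m/o<n (≤-trans lt (≤-reflexive (*-comm B (B ^ k)))))))
  (sym (m≡m%n+[m/n]*n x B))

-- Capped at B, since the empty minimum has no value.
minimum : ℕ → ℕ → (ℕ → ℕ) → ℕ
minimum B zero    d = B
minimum B (suc k) d = minimum B k d ⊓ d k

minimum-cong : ∀ B k {d d′} → (∀ j → j < k → d j ≡ d′ j) → minimum B k d ≡ minimum B k d′
minimum-cong B zero    p = refl
minimum-cong B (suc k) p = cong₂ _⊓_ (minimum-cong B k (λ j lt → p j (m<n⇒m<1+n lt))) (p k ≤-refl)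

minimum≤ : ∀ B k d j → j < k → minimum B k d ≤ d j
minimum≤ B (suc k) d j lt with m<1+n⇒m<n∨m≡n lt
... | inj₁ l    = ≤-trans (m⊓n≤m _ _) (minimum≤ B k d j l)
... | inj₂ refl = m⊓n≤n (minimum B k d) (d k)

≤minimum : ∀ B k d x → x ≤ B → (∀ j → j < k → x ≤ d j) → x ≤ minimum B k d
≤minimum B zero    d x le p = le
≤minimum B (suc k) d x le p = ⊓-glb (≤minimum B k d x le (λ j lt → p j (m<n⇒m<1+n lt))) (p k ≤-refl)

∑-flatten : ∀ k n f → ∑ (k * n) f ≡ ∑ k (λ j → ∑ n (λ u → f (n * j + u)))
∑-flatten zero    n f = refl
∑-flatten (suc k) n f = trans (∑-split n (k * n) f) (trans (+-comm _ (∑ n (λ i → f (k * n + i))))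
  (trans (+-comm (∑ n (λ i → f (k * n + i))) (∑ (k * n) f)) (cong₂ _+_ (∑-flatten k n f) (∑-cong n (λ u _ → cong (λ z → f (z + u)) (*-comm k n))))))
  where
  ∑-split : ∀ m k f → ∑ (m + k) f ≡ ∑ k f + ∑ m (λ i → f (k + i))
  ∑-split zero    k f = sym (+-identityʳ _)
  ∑-split (suc m) k f = trans (cong₂ _+_ (∑-split m k f) (cong f (+-comm m k))) (+-assoc (∑ k f) _ _)

value : ℕ → (ℕ → ℕ → ℕ) → (ℕ → Bool) → (ℕ → ℕ) → ℕ → ℕ
value n P X g j = ∑ n (λ u → when (X u) (when (g u ≡ᵇ suc j) (P j u)))

module _ (n k B : ℕ) (P : ℕ → ℕ → ℕ) (wt : ℕ → ℕ)
  (wt₀ : ∀ u → u < n → wt (suc k * u + 0) ≡ 0) (wt₁ : ∀ u j → u < n → j < k → wt (suc k * u + suc j) ≡ P j u * B ^ j)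
  (g : ℕ → ℕ) (g< : ∀ u → u < n → g u < suc k) where

  value-sum : ∀ X → ∑ n (λ u → when (X u) (wt (suc k * u + g u))) ≡ ∑ k (λ j → value n P X g j * B ^ j)
  value-sum X = trans (∑-cong n term) (trans (∑-swap n k (λ u j → when (X u) (when (g u ≡ᵇ suc j) (P j u)) * B ^ j))
    (∑-cong k (λ j _ → ∑-*ʳ n (λ u → when (X u) (when (g u ≡ᵇ suc j) (P j u))) (B ^ j))))
    where
    term : ∀ u → u < n → when (X u) (wt (suc k * u + g u)) ≡ ∑ k (λ j → when (X u) (when (g u ≡ᵇ suc j) (P j u)) * B ^ j)
    term u lt with X u | g u | g< u lt
    ... | false | _ | _ = sym (∑-zero k (λ _ _ → refl))
    ... | true | zero | _ = trans (wt₀ u lt) (sym (∑-zero k (λ _ _ → refl)))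
    ... | true | suc l | s≤s l<k = trans (wt₁ u l lt l<k) (trans (sym (∑-delta k l (λ j → P j u * B ^ j) l<k)) (∑-cong k (λ j _ → eq j)))
      where
      eq : ∀ j → when (j ≡ᵇ l) (P j u * B ^ j) ≡ when (l ≡ᵇ j) (P j u) * B ^ j
      eq j with j ≟ l
      ... | yes refl rewrite ≡ᵇ-refl l = refl
      ... | no ne rewrite ≢⇒≡ᵇ ne | ≢⇒≡ᵇ (ne ∘ sym) = refl

value≤ : ∀ n P X g j → value n P X g j ≤ ∑ n (P j)
value≤ n P X g j = ∑-mono n (λ u _ → ≤-trans (when≤ (X u) _) (when≤ (g u ≡ᵇ suc j) (P j u)))

profit-∑ᶠ : ∀ {n} (f : Fin n → ℕ) X → profit f X ≡ ∑ᶠ n (λ u → when (Vec.lookup X u) (f u))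
profit-∑ᶠ {n} f X = go n (λ u → u)
  where
  go : ∀ m (h : Fin m → Fin n) → sum (map f (filter (_∈? X) (tabulate h))) ≡ ∑ᶠ m (λ i → when (Vec.lookup X (h i)) (f (h i)))
  go zero    h = refl
  go (suc m) h with h zero ∈? X
  ... | yes p rewrite []=⇒lookup p = cong (f (h zero) +_) (go m (h ∘ suc))
  ... | no ¬p with Vec.lookup X (h zero) in eq
  ...   | true  = contradiction (lookup⇒[]= (h zero) X eq) ¬p
  ...   | false = go m (h ∘ suc)

profitTable : ∀ {k n} → Profits k n → ℕ → ℕ → ℕ
profitTable {n = n} p j u = matrix p (n * j + u)

profitTable-at : ∀ {k n} (p : Profits k n) j u → profitTable p (toℕ j) (toℕ u) ≡ p j u
profitTable-at p j u = matrix-at p j u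

always : ℕ → Bool
always _ = true

Represents : ∀ {k n} → (ℕ → ℕ) → (Fin k → Subset n) → Set
Represents {k} {n} g X = ∀ (j : Fin k) (v : Fin n) → Vec.lookup (X j) v ≡ (g (toℕ v) ≡ᵇ suc (toℕ j))

profit-value : ∀ {k n} (p : Profits k n) g X → Represents g X → ∀ j → profit (p j) (X j) ≡ value n (profitTable p) always g (toℕ j)
profit-value {k} {n} p g X r j = trans (profit-∑ᶠ (p j) (X j)) (sym (trans (∑-Fin n _) (go n (λ u → u))))
  where
  go : ∀ m (h : Fin m → Fin n) → ∑ᶠ m (λ i → when (g (toℕ (h i)) ≡ᵇ suc (toℕ j)) (profitTable p (toℕ j) (toℕ (h i)))) ≡ ∑ᶠ m (λ i → when (Vec.lookup (X j) (h i)) (p j (h i)))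
  go zero    h = refl
  go (suc m) h = cong₂ _+_ (cong₂ when (sym (r j (h zero))) (profitTable-at p j (h zero))) (go m (h ∘ suc))

satisfaction≤ : ∀ {k n} (p : Profits (suc k) n) X j → satisfaction p X ≤ profit (p j) (X j)
satisfaction≤ {k} p X zero    = Extrema.min≤v⁺ (profit (p zero) (X zero)) (tabulate (λ j → profit (p (suc j)) (X (suc j)))) (inj₁ ≤-refl)
satisfaction≤ {k} p X (suc j) = Extrema.min≤v⁺ (profit (p zero) (X zero)) (tabulate (λ j → profit (p (suc j)) (X (suc j)))) (inj₂ (Any.tabulate⁺ j ≤-refl))

≤satisfaction : ∀ {k n} (p : Profits (suc k) n) X x → (∀ j → x ≤ profit (p j) (X j)) → x ≤ satisfaction p X
≤satisfaction p X x le = Extrema.v≤min⁺ (le zero) (All.tabulate⁺ (λ j → le (suc j)))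

-- There is at least one player, and the values of the competitor are at most `B`; so the cap in
-- `minimum` does not cut off its satisfaction.
satisfaction-mono : ∀ {k n} (p : Profits (suc k) n) B {g g′ X Y} → (∀ j → j < suc k → value n (profitTable p) always g′ j ≤ B) → Represents g X → Represents g′ Y →
  minimum B (suc k) (value n (profitTable p) always g′) ≤ minimum B (suc k) (value n (profitTable p) always g) → satisfaction p Y ≤ satisfaction p X
satisfaction-mono {k} {n} p B {g} {g′} {X} {Y} ≤B r r′ le = ≤satisfaction p X _ λ j → ≤-trans (≤-trans
  (≤minimum B (suc k) _ _ (≤-trans (sat≤ zero) (≤B 0 z<s)) (λ j lt → subst (λ i → satisfaction p Y ≤ value n (profitTable p) always g′ i) (toℕ-fromℕ< lt) (sat≤ (fromℕ< lt)))) le)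
  (≤-trans (minimum≤ B (suc k) _ (toℕ j) (toℕ<n j)) (≤-reflexive (sym (profit-value p g X r j))))
  where
  sat≤ : ∀ j → satisfaction p Y ≤ value n (profitTable p) always g′ (toℕ j)
  sat≤ j = ≤-trans (satisfaction≤ p Y j) (≤-reflexive (profit-value p g′ Y r′ j))

-- Connects the base, which is built from the sum over all players, with the maximum `Q` of the
-- statement.
total≤ : ∀ {k n} (p : Profits k n) → ∑ (k * n) (matrix p) ≤ k * maxTotalProfit p
total≤ {k} {n} p = ≤-trans (≤-reflexive (trans (∑-flatten k n (matrix p)) (∑-Fin k _)))
  (bound k (λ j → ∑ n (profitTable p (toℕ j))) _ (λ j → ≤-trans (≤-reflexive (row j)) (Extrema.v≤max⁺ 0 (tabulate (λ j → profit (p j) ⊤)) (inj₂ (Any.tabulate⁺ j ≤-refl)))))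
  where
  row : ∀ j → ∑ n (profitTable p (toℕ j)) ≡ profit (p j) ⊤
  row j = sym (trans (profit-∑ᶠ (p j) ⊤) (sym (trans (∑-Fin n _) (go n (λ u → u)))))
    where
    go : ∀ m (h : Fin m → Fin n) → ∑ᶠ m (λ i → profitTable p (toℕ j) (toℕ (h i))) ≡ ∑ᶠ m (λ i → when (Vec.lookup ⊤ (h i)) (p j (h i)))
    go zero    h = refl
    go (suc m) h = cong₂ _+_ (trans (profitTable-at p j (h zero)) (cong (λ c → when c (p j (h zero))) (sym ([]=⇒lookup (∈⊤ {x = h zero}))))) (go m (h ∘ suc))
  bound : ∀ k (f : Fin k → ℕ) M → (∀ j → f j ≤ M) → ∑ᶠ k f ≤ k * M
  bound zero    f M le = z≤n
  bound (suc k) f M le = +-mono-≤ (le zero) (bound k (f ∘ suc) M (λ j → le (suc j)))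

module _ {k n : ℕ} (G : Graph n) (Y : Fin k → Subset n) (col : IsPartialColoring G Y) where
  open IsPartialColoring col

  private
    labᶠ : Fin n → ℕ
    labᶠ v with any? (λ j → v ∈? Y j)
    ... | yes (j , _) = suc (toℕ j)
    ... | no _        = 0

    -- The class found by the search is the given one because the classes are disjoint.
    labᶠ≡ : ∀ v j → v ∈ Y j → labᶠ v ≡ suc (toℕ j)
    labᶠ≡ v j m with any? (λ j → v ∈? Y j)
    ... | no none = contradiction (j , m) none
    ... | yes (i , m′) with i Fin.≟ j
    ...   | yes refl = refl
    ...   | no ne = contradiction (v , x∈p∩q⁺ (m′ , m)) (disjoint i j ne)

    labᶠ∈ : ∀ v j → labᶠ v ≡ suc (toℕ j) → v ∈ Y j
    labᶠ∈ v j e with any? (λ j → v ∈? Y j)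
    ... | yes (i , m) with toℕ-injective (suc-injective e)
    ...   | refl = m

    labᶠ< : ∀ v → labᶠ v < suc k
    labᶠ< v with any? (λ j → v ∈? Y j)
    ... | yes (i , m) = s≤s (toℕ<n i)
    ... | no _        = z<s

  coloring-label : ℕ → ℕ
  coloring-label = array labᶠ

  coloring-label< : ∀ u → coloring-label u < suc k
  coloring-label< u with u <? n
  ... | yes lt = labᶠ< (fromℕ< lt)
  ... | no _   = z<s

  coloring-represents : Represents coloring-label Y
  coloring-represents j v rewrite array-toℕ labᶠ v with Vec.lookup (Y j) v in eq
  ... | true  = sym (≡ᵇ-true (labᶠ≡ v j (lookup⇒[]= v (Y j) eq)))
  ... | false = sym (≢⇒≡ᵇ (λ e → case trans (sym eq) ([]=⇒lookup (labᶠ∈ v j e)) of λ ()))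

  coloring-proper : ∀ u v → Adj G u v → ∀ l → coloring-label (toℕ u) ≡ suc l → coloring-label (toℕ v) ≢ suc l
  coloring-proper u v a l e e′ with any? (λ j → u ∈? Y j) in eq
  ... | yes (j , m) = independent j u v m (labᶠ∈ v j (trans (sym (array-toℕ labᶠ v)) (trans e′ (trans (sym e) (trans (array-toℕ labᶠ u) (labᶠ≡ u j m)))))) a
  ... | no none = contradiction (trans (sym (trans (array-toℕ labᶠ u) (none⇒0 none))) e) (λ ())
    where
    none⇒0 : ¬ (∃[ j ] u ∈ Y j) → labᶠ u ≡ 0
    none⇒0 none with any? (λ j → u ∈? Y j)
    ... | yes x = contradiction x none
    ... | no _  = refl

represented-coloring : ∀ {k n} (G : Graph n) (X : Fin k → Subset n) g → Represents g X →
  (∀ u v → Adj G u v → ∀ l → g (toℕ u) ≡ suc l → g (toℕ v) ≢ suc l) → IsPartialColoring G X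
represented-coloring G X g r proper = record
  { independent = λ j u v mu mv a → proper u v a (toℕ j) (label mu) (label mv)
  ; disjoint = λ i j ne (v , m) → let mi , mj = x∈p∩q⁻ (X i) (X j) m in ne (toℕ-injective (suc-injective (trans (sym (label mi)) (label mj)))) }
  where
  label : ∀ {j v} → v ∈ X j → g (toℕ v) ≡ suc (toℕ j)
  label {j} {v} m = ≡ᵇ-sound _ _ (trans (sym (r j v)) ([]=⇒lookup m))

-- Fair division

JJ KN : ℕ
JJ = 53
KN = 54

-- Label 0 stands for uncoloured vertices and conflicts with nothing. Conflicts of equal colours
-- express independence; disjointness is built into having one label per vertex.
confₖ : ℕ → ℕ → ℕ
confₖ zero    _  = 0
confₖ (suc l) l′ = δ (suc l) l′

module Final (k ℓ : ℕ) where
  open Stages ℓ public using (s̄; b; M; N₃; S₃; alF; Allowed; Context; Fresh; fresh-frame; edge-cong; stageP; stage-run)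
  module Fair = Solver b (suc k) confₖ

  rowP : Program
  -- The offsets serve the `n` rows of the adjacency matrix and the `k` rows of the profit and
  -- output matrices; `n + k` covers both.
  rowP = ROW [ const 0 ]≔ const 0 ︔ for QU (V 0 ⊕ const k) (ROW [ const 1 ⊕ V QU ]≔ ROW [ V QU ] ⊕ V 0)

  alP : Program
  alP = NN ≔ const N₃ ︔ for S1 (const N₃) (AL [ V S1 ]≔ lookupE alF N₃ (V S1))

  stagesP : Program
  -- `BAG`, `PAR`, `HN` and `HS` are still zero everywhere and thus already describe a single bag,
  -- all of whose slots hold vertex 0.
  stagesP = MM ≔ const 1 ︔ NV ≔ const 1 ︔ for JJ (V 0 ⊖ const 1) stageP

  -- A base exceeding the total of all profits excludes carries in every partial sum and needs no
  -- maximum; it is larger than `Q + 1` by a factor of at most `k + 1`.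
  totalP : Program
  totalP = KN ≔ times k (V 0) ︔ BASE ≔ const 1 ︔ for QU (V KN) (BASE ≔+ PROF [ V QU ])

  -- The admissible weights of the separations are erased first, since they may extend beyond `N`.
  -- For profits every weight below `N` is admissible, so nothing is pruned.
  limitsP : Program
  limitsP = for S1 (const N₃) (AL [ V S1 ]≔ const 0) ︔ NN ≔ PWR [ const k ] ︔ for S1 (V NN) (AL [ V S1 ]≔ const 1)

  minP : Program
  minP = ACC ≔ V BASE ︔ for DU (const k) (ifnz V ACC ⊖ LAB [ V DU ] then ACC ≔ LAB [ V DU ] else skip)

  -- Tabulating the ranking of the weights lets the same selection serve both problems; for
  -- separations any admissible labelling will do.
  valP : Program
  valP = for S1 (V NN) (PX ≔ V S1 ︔ digitsP ︔ minP ︔ VAL [ V S1 ]≔ V ACC)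

  -- A product `p * B ^ j` takes `p` additions, and a profit is less than `B`. The resulting O(n *
  -- B) stays within the bound because `k` is positive and hence `B` is at most `B ^ k`.
  weightP : Program
  weightP = for QU (V 0) (WT [ times (suc k) (V QU) ⊕ const 0 ]≔ const 0 ︔
    for DU (const k) (ACC ≔ const 0 ︔ for DD (PROF [ ROW [ V DU ] ⊕ V QU ]) (ACC ≔+ PWR [ V DU ]) ︔ WT [ times (suc k) (V QU) ⊕ (const 1 ⊕ V DU) ]≔ V ACC))

  outP : Program
  outP = for QU (V 0) (ifnz LAB [ V QU ] then OUT [ ROW [ LAB [ V QU ] ⊖ const 1 ] ⊕ V QU ]≔ const 1 else skip)

  abstract
    row-run : Σ[ K ∈ ℕ ] (∀ s n → s 0 0 ≡ n → Run rowP s (λ s′ → ∀ u → u ≤ n + k → s′ ROW u ≡ n * u) K ((n + k) ⊛ 0))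
    row-run = _ , λ s n n≡ → run-assign-seq
      (run-for (λ t s′ → ∀ u → u ≤ t → s′ ROW u ≡ n * u) (n + k) tt tt (λ _ _ _ p → p)
        (λ t s₁ t< t≡ fr inv → run-assign (λ u u≤1+t → set-cases (_≡ n * u) (s₁ ROW) (suc (s₁ QU 0)) _ u
          (λ e → trans (cong₂ _+_ (trans (cong (s₁ ROW) t≡) (inv t ≤-refl)) (trans (fr 0 0) n≡)) (trans (+-comm (n * t) n) (trans (sym (*-suc n t)) (cong (n *_) (trans (cong suc (sym t≡)) e)))))
          (λ ne → inv u (s≤s⁻¹ (≤∧≢⇒< u≤1+t (λ e → ne (trans (cong suc t≡) (sym e))))))))
        (cong (_+ k) n≡) (λ { zero z≤n → sym (*-zeroʳ n) }))

    al-run : Σ[ K ∈ ℕ ] (∀ s y → (∀ σ → s AL σ ≡ 0) → Run alP s (λ s′ → s′ NN 0 ≡ N₃ × Allowed (s′ AL)) K y)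
    al-run = _ , λ s y zero₀ → run-assign-seq (run-post (λ s′ (p , q) fr → fr NN 0 , p , q)
      (run-forᶜ (λ t s′ → (∀ σ → σ < t → s′ AL σ ≡ alF σ) × (∀ σ → t ≤ σ → s′ AL σ ≡ 0)) N₃ tt tt (λ _ _ _ p → p)
        (λ t s₁ t< t≡ fr (p , q) →
          let v≡ : ⟦ lookupE alF N₃ (V S1) ⟧ s₁ ≡ alF t
              v≡ = trans (⟦lookupE⟧ alF N₃ (V S1) s₁ (subst (_< N₃) (sym t≡) t<)) (cong alF t≡)
          in run-assign
            ( (λ σ lt → set-cases (_≡ alF σ) (s₁ AL) (s₁ S1 0) _ σ (λ e → trans v≡ (cong alF (trans (sym t≡) e)))
                 (λ ne → [ p σ , (λ e → contradiction (trans t≡ (sym e)) ne) ]′ (m<1+n⇒m<n∨m≡n lt)))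
            , (λ σ le → trans (set-other (s₁ AL) {s₁ S1 0} {σ} _ (λ e → <⇒≢ le (trans (sym t≡) e))) (q σ (<⇒≤ le))) ))
        N₃ ≤-refl refl ((λ _ ()) , (λ σ _ → zero₀ σ))))

    total-run : Σ[ K ∈ ℕ ] (∀ s n → s 0 0 ≡ n → Run totalP s (λ s′ → s′ BASE 0 ≡ suc (∑ (k * n) (s PROF))) K ((k * n) ⊛ 0))
    total-run = _ , λ s n n≡ → run-assign-seq (run-assign-seq
      (run-for (λ t s′ → s′ BASE 0 ≡ suc (∑ t (s PROF))) (k * n) tt tt (λ _ _ _ p → p)
        (λ t s₁ t< t≡ fr inv → run-assign (cong₂ _+_ inv (trans (fr PROF _) (cong (s PROF) t≡))))
        (trans (⟦times⟧ k (V 0) s) (cong (k *_) n≡)) refl))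

    limits-run : Σ[ K ∈ ℕ ] (∀ s N → (∀ σ → N₃ ≤ σ → s AL σ ≡ 0) → s PWR k ≡ N →
      Run limitsP s (λ s′ → s′ NN 0 ≡ N × (∀ σ → σ < N → s′ AL σ ≡ 1) × (∀ σ → N ≤ σ → s′ AL σ ≡ 0)) K (N ⊛ 0))
    limits-run = _ , λ s N out n≡ → run-seq (run-size z≤n
      (run-forᶜ (λ t s′ → (∀ σ → σ < t → s′ AL σ ≡ 0) × (∀ σ → N₃ ≤ σ → s′ AL σ ≡ 0)) N₃ tt tt (λ _ _ _ p → p)
        (λ t s₁ t< t≡ fr (p , q) → run-assign
          ( (λ σ lt → set-cases (_≡ 0) (s₁ AL) (s₁ S1 0) 0 σ (λ _ → refl) (λ ne → [ p σ , (λ e → contradiction (trans t≡ (sym e)) ne) ]′ (m<1+n⇒m<n∨m≡n lt)))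
          , (λ σ le → set-cases (_≡ 0) (s₁ AL) (s₁ S1 0) 0 σ (λ _ → refl) (λ _ → q σ le)) ))
        N₃ ≤-refl refl ((λ _ ()) , out)))
      (λ s₁ (p , q) fr₁ →
        let zero₁ : ∀ σ → s₁ AL σ ≡ 0
            zero₁ σ = case σ <? N₃ of λ { (yes lt) → p σ lt ; (no ge) → q σ (≮⇒≥ ge) }
            N≡ : s₁ PWR k ≡ N
            N≡ = trans (fr₁ PWR k) n≡
        in run-assign-seq (run-post (λ s′ (x , y) fr → trans (fr NN 0) N≡ , x , y)
          (run-for (λ t s′ → (∀ σ → σ < t → s′ AL σ ≡ 1) × (∀ σ → t ≤ σ → s′ AL σ ≡ 0)) N tt tt (λ _ _ _ p → p)
            (λ t s₂ t< t≡ fr (x , y) → run-assign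
              ( (λ σ lt → set-cases (_≡ 1) (s₂ AL) (s₂ S1 0) 1 σ (λ _ → refl) (λ ne → [ x σ , (λ e → contradiction (trans t≡ (sym e)) ne) ]′ (m<1+n⇒m<n∨m≡n lt)))
              , (λ σ le → trans (set-other (s₂ AL) {s₂ S1 0} {σ} _ (λ e → <⇒≢ le (trans (sym t≡) e))) (y σ (<⇒≤ le))) ))
            N≡ ((λ _ ()) , (λ σ _ → zero₁ σ)))))

    min-run : Σ[ K ∈ ℕ ] (∀ s B → s BASE 0 ≡ B → Run minP s (λ s′ → s′ ACC 0 ≡ minimum B k (s LAB)) K 0)
    min-run = _ , λ s B B≡ → run-assign-seq
      (run-forᶜ (λ t s′ → s′ ACC 0 ≡ minimum B t (s LAB)) k tt tt (λ _ _ _ p → p)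
        (λ t s₁ t< t≡ fr inv →
          let l≡ : s₁ LAB (s₁ DU 0) ≡ s LAB t
              l≡ = trans (fr LAB _) (cong (s LAB) t≡)
          in run-if
            (λ nz → run-assign (trans l≡ (sym (m≥n⇒m⊓n≡n (≮⇒≥ (λ lt → nz (trans (cong₂ _∸_ inv l≡) (m≤n⇒m∸n≡0 (<⇒≤ lt)))))))))
            (λ z → run-skip (trans inv (sym (m≤n⇒m⊓n≡m (m∸n≡0⇒m≤n (trans (sym (cong₂ _∸_ inv l≡)) z)))))))
        k ≤-refl refl B≡)

    val-run : Σ[ K ∈ ℕ ] (∀ s T N → (let B = suc T) → s BASE 0 ≡ B → s CNT 0 ≡ k → (∀ j → j < k → s PWR j ≡ B ^ j) → s NN 0 ≡ N → N ≡ B ^ k →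
      Run valP s (λ s′ → ∀ σ → σ < N → s′ VAL σ ≡ minimum B k (digit B σ)) K (N ⊛ k ⊛ B ⊛ 0))
    val-run = _ , λ s T N B≡ cnt≡ pw≡ nn≡ N≡ →
      let B = suc T in
      run-for (λ t s′ → ∀ σ → σ < t → s′ VAL σ ≡ minimum B k (digit B σ)) N tt tt (λ _ _ _ p → p)
        (λ t s₁ t<N t≡ fr inv → run-assign-seq (run-seq
          (proj₂ digits-run (update s₁ PX 0 (s₁ S1 0)) B k (digit B t) (trans (fr BASE 0) B≡) (trans (fr CNT 0) cnt≡) (λ j lt → trans (fr PWR j) (pw≡ j lt))
            (λ j _ → digit< B t j) (trans t≡ (trans (sym (encode-digit B k t (≤-trans t<N (≤-reflexive N≡)))) (encode-sum B k (digit B t)))))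
          (λ s₂ lab fr₂ → run-seq (run-size z≤n (proj₂ min-run s₂ B (trans (fr₂ BASE 0) (trans (fr BASE 0) B≡))))
          (λ s₃ acc fr₃ →
            let x≡ : s₃ S1 0 ≡ t
                x≡ = trans (fr₃ S1 0) (trans (fr₂ S1 0) t≡)
            in run-assign (λ σ lt → set-cases (_≡ minimum B k (digit B σ)) (s₃ VAL) (s₃ S1 0) _ σ
              (λ e → trans acc (trans (minimum-cong B k lab) (cong (λ z → minimum B k (digit B z)) (trans (sym x≡) e))))
              (λ ne → trans (fr₃ VAL σ) (trans (fr₂ VAL σ) ([ inv σ , (λ e → contradiction (trans x≡ (sym e)) ne) ]′ (m<1+n⇒m<n∨m≡n lt)))))))))
        nn≡ (λ _ ())

    weight-run : Σ[ K ∈ ℕ ] (∀ s n B → s 0 0 ≡ n → (∀ j → j < k → s ROW j ≡ n * j) → (∀ j → j < k → s PWR j ≡ B ^ j) → (∀ j u → j < k → u < n → s PROF (n * j + u) ≤ B) →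
      Run weightP s (λ s′ → ∀ u → u < n → s′ WT (suc k * u + 0) ≡ 0 × (∀ j → j < k → s′ WT (suc k * u + suc j) ≡ s PROF (n * j + u) * B ^ j)) K (n ⊛ B ⊛ 0))
    weight-run = _ , λ s n B n≡ row≡ pw≡ prof≤ →
      let Ok : (ℕ → ℕ) → ℕ → ℕ → Set
          Ok wt u i = wt (suc k * u + 0) ≡ 0 × (∀ j → j < i → wt (suc k * u + suc j) ≡ s PROF (n * j + u) * B ^ j)
      in run-for (λ t s′ → ∀ u → u < t → Ok (s′ WT) u k) n tt tt (λ _ _ _ p → p)
        (λ t s₁ t<n t≡ fr inv →
          let ix : ∀ s′ → s′ QU 0 ≡ t → ∀ c → ⟦ times (suc k) (V QU) ⟧ s′ + c ≡ suc k * t + c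
              ix s′ e c = cong (_+ c) (trans (⟦times⟧ (suc k) (V QU) s′) (cong (suc k *_) e))
              Inv : ℕ → (ℕ → ℕ) → Set
              Inv i wt = (∀ u → u < t → Ok wt u k) × Ok wt t i
              keep : ∀ {wt c v} → c < suc k → (∀ u → u < t → Ok wt u k) → ∀ u → u < t → Ok (set wt (suc k * t + c) v) u k
              keep {wt} {c} {v} c< h u u<t =
                let far : ∀ d → d < suc k → set wt (suc k * t + c) v (suc k * u + d) ≡ wt (suc k * u + d)
                    far d d< = set-other wt {suc k * t + c} {suc k * u + d} v (λ e → <⇒≢ u<t (sym (proj₁ (index-inj {suc k} {t} {u} c< d< e))))
                in trans (far 0 z<s) (proj₁ (h u u<t)) , λ j lt → trans (far (suc j) (s≤s lt)) (proj₂ (h u u<t) j lt)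
          in run-assign-seq (run-post
            (λ s′ (h , h′) _ u u<1+t → [ h u , (λ { refl → h′ }) ]′ (m<1+n⇒m<n∨m≡n u<1+t))
            (run-forᶜ (λ i s′ → Inv i (s′ WT)) k tt tt (λ _ _ _ p → p)
              (λ i s₂ i<k i≡ fr₂ (h , h₀ , h₁) →
                let p = s PROF (n * i + t)
                    q≡ : s₂ QU 0 ≡ t
                    q≡ = trans (fr₂ QU 0) t≡
                    p≡ : s₂ PROF (s₂ ROW (s₂ DU 0) + s₂ QU 0) ≡ p
                    p≡ = trans (fr₂ PROF _) (trans (fr PROF _) (cong (s PROF) (cong₂ _+_ (trans (fr₂ ROW _) (trans (fr ROW _) (trans (cong (s ROW) i≡) (row≡ i i<k)))) q≡)))
                in run-assign-seq (run-seq (run-size (⊛-mono {p} {B} {0} {0} (prof≤ i t i<k t<n) z≤n)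
                  (run-for (λ d s′ → s′ ACC 0 ≡ d * B ^ i) p tt tt (λ _ _ _ p → p)
                    (λ d s₃ d< d≡ fr₃ acc → run-assign (trans (cong₂ _+_ acc (trans (fr₃ PWR _) (trans (fr₂ PWR _) (trans (fr PWR _) (trans (cong (s PWR) (trans (fr₃ DU 0) i≡)) (pw≡ i i<k))))))
                      (+-comm (d * B ^ i) (B ^ i))))
                    p≡ refl))
                  (λ s₃ acc fr₃ → run-size z≤n (run-assign
                    (subst₂ (λ x v → Inv (suc i) (set (s₃ WT) x v)) (sym (trans (ix s₃ (trans (fr₃ QU 0) q≡) (1 + s₃ DU 0)) (cong (λ z → suc k * t + suc z) (trans (fr₃ DU 0) i≡)))) (sym acc)
                      ( (λ u u<t → keep {s₃ WT} {suc i} {p * B ^ i} (s≤s i<k) (λ u u<t → trans (fr₃ WT _) (proj₁ (h u u<t)) , λ j lt → trans (fr₃ WT _) (proj₂ (h u u<t) j lt)) u u<t)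
                      , trans (set-other (s₃ WT) {suc k * t + suc i} {suc k * t + 0} _ (λ e → case +-cancelˡ-≡ (suc k * t) _ _ e of λ ())) (trans (fr₃ WT _) h₀)
                      , (λ j lt → case m<1+n⇒m<n∨m≡n lt of λ
                          { (inj₁ l) → trans (set-other (s₃ WT) {suc k * t + suc i} {suc k * t + suc j} _ (λ e → <⇒≢ l (sym (suc-injective (+-cancelˡ-≡ (suc k * t) _ _ e))))) (trans (fr₃ WT _) (h₁ j l))
                          ; (inj₂ refl) → set-same (s₃ WT) (suc k * t + suc i) _ }) ))))))
              k ≤-refl refl
              (subst (λ x → Inv 0 (set (s₁ WT) x 0)) (sym (ix s₁ t≡ 0))
                ( keep {s₁ WT} {0} {0} z<s inv , set-same (s₁ WT) (suc k * t + 0) 0 , (λ _ ()))))))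
        n≡ (λ _ ())

    out-run : Σ[ K ∈ ℕ ] (∀ s n → s 0 0 ≡ n → (∀ j → j < k → s ROW j ≡ n * j) → (∀ u → u < n → s LAB u < suc k) → (∀ i → s OUT i ≡ 0) →
      Run outP s (λ s′ → ∀ j u → j < k → u < n → (s LAB u ≡ suc j → s′ OUT (n * j + u) ≡ 1) × (s LAB u ≢ suc j → s′ OUT (n * j + u) ≡ 0)) K (n ⊛ 0))
    out-run = _ , λ s n n≡ row≡ lab< out₀ → run-post (λ s′ inv _ j u lt lu → proj₁ (inv j u lt lu) lu , proj₂ (inv j u lt lu) ∘ inj₁)
      (run-for (λ t s′ → ∀ j u → j < k → u < n → (u < t → s LAB u ≡ suc j → s′ OUT (n * j + u) ≡ 1) × (s LAB u ≢ suc j ⊎ t ≤ u → s′ OUT (n * j + u) ≡ 0)) n tt tt (λ _ _ _ p → p)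
        (λ t s₁ t<n t≡ fr inv →
          let l≡ : s₁ LAB (s₁ QU 0) ≡ s LAB t
              l≡ = trans (fr LAB _) (cong (s LAB) t≡)
          in run-if
          (λ nz →
            let i , e = n≢0⇒suc (λ z → nz (trans l≡ z))
                i<k : i < k
                i<k = s≤s⁻¹ (≤-trans (≤-reflexive (cong suc (sym e))) (lab< t t<n))
                ix : s₁ ROW (s₁ LAB (s₁ QU 0) ∸ 1) + s₁ QU 0 ≡ n * i + t
                ix = cong₂ _+_ (trans (fr ROW _) (trans (cong (λ z → s ROW (z ∸ 1)) (trans l≡ e)) (row≡ i i<k))) t≡
            in run-assign (λ j u lt lu → subst (λ x → (u < suc t → s LAB u ≡ suc j → set (s₁ OUT) x 1 (n * j + u) ≡ 1) × (s LAB u ≢ suc j ⊎ suc t ≤ u → set (s₁ OUT) x 1 (n * j + u) ≡ 0)) (sym ix)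
              ( (λ u<1+t l → set-cases (_≡ 1) (s₁ OUT) (n * i + t) 1 (n * j + u) (λ _ → refl)
                   (λ ne → [ (λ u<t → proj₁ (inv j u lt lu) u<t l) , (λ { refl → contradiction (cong (λ z → n * z + t) (suc-injective (trans (sym e) l))) ne }) ]′ (m<1+n⇒m<n∨m≡n u<1+t)))
              , (λ d → set-cases (_≡ 0) (s₁ OUT) (n * i + t) 1 (n * j + u)
                   (λ e′ → case index-inj {n} {i} {j} t<n lu e′ of λ { (refl , refl) → [ (λ ne → contradiction e ne) , (λ le → contradiction le (<-irrefl refl)) ]′ d })
                   (λ _ → proj₂ (inv j u lt lu) ([ inj₁ , (λ le → inj₂ (<⇒≤ le)) ]′ d))) )))
          (λ z → run-skip (λ j u lt lu →
            (λ u<1+t l → [ (λ u<t → proj₁ (inv j u lt lu) u<t l) , (λ { refl → case trans (sym l) (trans (sym l≡) z) of λ () }) ]′ (m<1+n⇒m<n∨m≡n u<1+t)) ,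
            (λ d → proj₂ (inv j u lt lu) ([ inj₁ , (λ le → inj₂ (<⇒≤ le)) ]′ d)))))
        n≡ (λ j u _ _ → (λ ()) , (λ _ → out₀ _)))

    stages-run : Σ[ K ∈ ℕ ] (∀ s n Y → s 0 0 ≡ n → 1 ≤ n → (∀ i → s BAG i ≡ 0) → (∀ i → s PAR i ≡ 0) → (∀ i → s HN i ≡ 0) → (∀ i → s HS i ≡ 0) →
      s NN 0 ≡ N₃ → Allowed (s AL) → Fresh s → (∀ u v → u < n → v < n → Edge s u v → Edge s v u) →
      (∀ nv w → nv ≤ n → (∀ u → u < nv → w u ≤ 1) → ∑ nv w ≤ suc S₃ → Σ[ g ∈ (ℕ → ℕ) ] ((∀ u → g u < 3) × Split s̄ nv (Edge s) w g)) →
      n ⊛ 3 ⊛ 0 ≤ Y → (1 + 2 * n) ⊛ N₃ ⊛ N₃ ⊛ 0 ≤ Y → (1 + 2 * n) ⊛ 0 ≤ Y →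
      Run stagesP s (λ s′ → Rooted b (Edge s) n (s′ MM 0) (s′ BAG) (s′ PAR) (s′ HN) (s′ HS) × s′ NV 0 ≡ n × s′ MM 0 ≤ 1 + 2 * n × Fresh s′) K (n ⊛ (1 + 2 * n) ⊛ Y))
    stages-run = _ , λ s n Y n≡ 1≤n bag₀ par₀ hn₀ hs₀ nn≡ al F E-sym exists size₁ size₂ size₃ →
      let I : ℕ → Store → Set
          I i s′ = Rooted b (Edge s) (suc i) (s′ MM 0) (s′ BAG) (s′ PAR) (s′ HN) (s′ HS) × s′ NV 0 ≡ suc i × s′ MM 0 ≤ 1 + 2 * n × Fresh s′
          1+[n-1] : suc (n ∸ 1) ≡ n
          1+[n-1] = m+[n∸m]≡n 1≤n
      in run-assign-seq (run-assign-seq (run-mono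
        (λ s′ (td , nv , r) _ → subst (λ z → Rooted b (Edge s) z (s′ MM 0) (s′ BAG) (s′ PAR) (s′ HN) (s′ HS)) 1+[n-1] td , trans nv 1+[n-1] , r)
        (⊛-mono {n ∸ 1} {n} (m∸n≤m n 1) ≤-refl)
        (run-for I (n ∸ 1) tt tt (λ _ _ _ p → p)
          (λ i s₁ i< i≡ fr (td , nv≡ , m≤ , F₁) →
            let nv = suc i
                nv≤n : nv ≤ n
                nv≤n = ≤-trans i< (m∸n≤m n 1)
                2nv≤ : 1 + 2 * nv ≤ 1 + 2 * n
                2nv≤ = s≤s (*-monoʳ-≤ 2 nv≤n)
                to : ∀ u v → Edge s₁ u v → Edge s u v
                to = edge-cong {s} {s₁} (fr ADJ) (fr ROW)
                from : ∀ u v → Edge s u v → Edge s₁ u v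
                from = edge-cong {s₁} {s} (λ i → sym (fr ADJ i)) (λ i → sym (fr ROW i))
                C : Context nv Y (Edge s₁) s₁
                C = record
                  { td = rooted-cong to nv≡ refl (λ _ → refl) (λ _ → refl) (λ _ → refl) (λ _ → refl) td
                  ; nv≡ = nv≡ ; nn≡ = trans (fr NN 0) nn≡
                  ; al = (λ σ lt → trans (fr AL σ) (proj₁ al σ lt)) , (λ σ le → trans (fr AL σ) (proj₂ al σ le))
                  ; E⇒ = λ _ _ e → e ; ⇒E = λ _ _ e → e
                  ; E-sym = λ u v lu lv e → from v u (E-sym u v (≤-trans lu nv≤n) (≤-trans lv nv≤n) (to u v e))
                  ; exists = λ w w≤ ∑≤ → let g , g< , sp = exists nv w nv≤n w≤ ∑≤ in
                      g , g< , record { apart = λ u v lu lv e → Split.apart sp u v lu lv (to u v e) ; c≤ = Split.c≤ sp ; a+c≤ = Split.a+c≤ sp ; b+c≤ = Split.b+c≤ sp }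
                  ; size₁ = ≤-trans (⊛-mono nv≤n ≤-refl) size₁
                  ; size₂ = ≤-trans (⊛-mono m≤ ≤-refl) size₂ }
            in run-mono (λ s₂ (td₂ , nv₂ , m₂ , F₂) _ → rooted-cong from refl refl (λ _ → refl) (λ _ → refl) (λ _ → refl) (λ _ → refl) td₂ , nv₂ , ≤-trans m₂ 2nv≤ , F₂)
                 (⊛-mono 2nv≤ ≤-refl)
                 (proj₂ stage-run nv Y s₁ C F₁ (≤-trans (⊛-mono {1 + 2 * nv} {1 + 2 * n} {0} {0} 2nv≤ z≤n) size₃)))
          (cong (_∸ 1) n≡)
          ( record
              { m≥1 = ≤-refl ; par< = λ { (suc i) _ (s≤s ()) } ; bag< = λ i a _ _ → ≤-reflexive (cong suc (bag₀ _))
              ; hn< = λ u _ → ≤-reflexive (cong suc (hn₀ u)) ; hs< = λ u _ → subst (_< b) (sym (hs₀ u)) z<s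
              ; home = λ u lt → trans (bag₀ _) (sym (n<1⇒n≡0 lt))
              ; up = λ { zero a _ _ → inj₁ (hn₀ _) ; (suc i) a (s≤s ()) }
              ; edge = λ u v lu lv _ → 0 , 0 , 0 , ≤-refl , z<s , z<s , trans (bag₀ _) (sym (n<1⇒n≡0 lu)) , trans (bag₀ _) (sym (n<1⇒n≡0 lv)) }
          , refl , s≤s z≤n , F))))

-- The complete algorithm

module Main (k′ ℓ : ℕ) where
  k : ℕ
  k = suc k′

  open Final k ℓ public

  prepareP : Program
  prepareP = rowP ︔ alP ︔ stagesP

  tablesP : Program
  tablesP = totalP ︔ CNT ≔ const k ︔ powersP ︔ limitsP ︔ valP ︔ weightP

  bodyP : Program
  bodyP = prepareP ︔ tablesP ︔ Fair.solveP ︔ outP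

  mainP : Program
  -- The initial bag contains vertex 0, so the graph without vertices is set apart.
  mainP = ifnz V 0 then bodyP else skip

  c₀ : ℕ
  c₀ = N₃ ⊛ N₃ ⊛ 3 ⊛ 0

  stageSize : ℕ → ℕ
  stageSize n = n ⊛ (1 + 2 * n) ⊛ (1 + 2 * n) ⊛ c₀

  f₀ : ℕ
  f₀ = suc k ⊛ 0

  f₁ f₂ f₃ : ℕ → ℕ
  f₁ N = N ⊛ f₀
  f₂ N = k ⊛ f₁ N
  f₃ N = N ⊛ f₂ N

  -- One common size for all phases after the stages. The factors are nested so that the size of
  -- every phase arises by shrinking or dropping some of them. The two factors `N` come from joins,
  -- which run over pairs of cells.
  fairSize : ℕ → ℕ → ℕ
  fairSize n N = (1 + 2 * n) ⊛ f₃ N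

  n≤1+2n : ∀ n → n ≤ 1 + 2 * n
  n≤1+2n n = ≤-trans (m≤m+n n _) (n≤1+n _)

  fair-inner : ∀ n N {x} → x ≤ f₃ N → x ≤ fairSize n N
  fair-inner n N le = ≤-trans le (⊛-inner (1 + 2 * n) (f₃ N))

  fair-outer : ∀ n N {x} → x ≤ f₃ N → n ⊛ x ≤ fairSize n N
  fair-outer n N {x} le = ⊛-mono {n} {1 + 2 * n} {x} {f₃ N} (n≤1+2n n) le

  f₂≤f₃ : ∀ N → f₂ N ≤ f₃ N
  f₂≤f₃ N = ⊛-inner N (f₂ N)

  labels-size : ∀ N → suc k ⊛ 0 ≤ f₃ N
  labels-size N = ≤-trans (⊛-inner N f₀) (≤-trans (⊛-inner k (f₁ N)) (f₂≤f₃ N))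

  fair-pair : ∀ n N → n ⊛ k ⊛ 0 ≤ fairSize n N
  fair-pair n N = fair-outer n N (≤-trans (⊛-mono {k} {k} {0} {f₁ N} ≤-refl z≤n) (f₂≤f₃ N))

  powers-size : ∀ {B N} → B ≤ N → k ⊛ B ⊛ 0 ≤ f₂ N
  powers-size {B} {N} le = ⊛-mono {k} {k} {B ⊛ 0} {f₁ N} ≤-refl (⊛-mono {B} {N} {0} {f₀} le z≤n)

  values-size : ∀ {B N} → B ≤ N → N ⊛ k ⊛ B ⊛ 0 ≤ f₃ N
  values-size {B} {N} le = ⊛-mono {N} {N} {k ⊛ B ⊛ 0} {f₂ N} ≤-refl (powers-size le)

  limits-size : ∀ {B N} → B ≤ N → B ⊛ 0 ≤ f₃ N
  limits-size {B} {N} le = ⊛-mono {B} {N} {0} {f₂ N} le z≤n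

  solve-size : ∀ n N {m} → m ≤ 1 + 2 * n → m ⊛ N ⊛ N ⊛ 0 ≤ fairSize n N
  solve-size n N {m} le = ⊛-mono {m} {1 + 2 * n} {N ⊛ N ⊛ 0} {f₃ N} le (⊛-mono {N} {N} {N ⊛ 0} {f₂ N} ≤-refl
    (≤-trans (⊛-mono {N} {N} {0} {f₀} ≤-refl z≤n) (⊛-inner k (f₁ N))))

  stage-size₁ : ∀ n → n ⊛ 3 ⊛ 0 ≤ (1 + 2 * n) ⊛ c₀
  stage-size₁ n = ⊛-mono {n} {1 + 2 * n} {3 ⊛ 0} {c₀} (n≤1+2n n) (≤-trans (⊛-inner N₃ (3 ⊛ 0)) (⊛-inner N₃ (N₃ ⊛ 3 ⊛ 0)))

  stage-size₂ : ∀ n → (1 + 2 * n) ⊛ N₃ ⊛ N₃ ⊛ 0 ≤ (1 + 2 * n) ⊛ c₀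
  stage-size₂ n = ⊛-mono {1 + 2 * n} {1 + 2 * n} {N₃ ⊛ N₃ ⊛ 0} {c₀} ≤-refl (⊛-mono {N₃} {N₃} {N₃ ⊛ 0} {N₃ ⊛ 3 ⊛ 0} ≤-refl (⊛-mono {N₃} {N₃} {0} {3 ⊛ 0} ≤-refl z≤n))

  +-size : ∀ m n → (m + n) ⊛ 0 ≤ m ⊛ n ⊛ 0
  +-size m n = ≤-trans (≤-reflexive (trans (*-identityʳ (m + n)) (+-comm m n)))
    (+-mono-≤ (≤-reflexive (sym (*-identityʳ n))) (≤-trans (≤-reflexive (sym (*-identityʳ m))) (*-monoʳ-≤ m (s≤s z≤n))))

  *-size : ∀ m n → (n * m) ⊛ 0 ≤ m ⊛ n ⊛ 0
  *-size m n = ≤-trans (≤-reflexive (trans (*-identityʳ (n * m)) (*-comm n m)))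
    (≤-trans (*-monoʳ-≤ m (≤-trans (n≤1+n n) (s≤s (≤-reflexive (sym (*-identityʳ n)))))) (m≤n+m _ (n * 1)))

  Rows : ℕ → Store → Set
  Rows n s = ∀ u → u ≤ n + k → s ROW u ≡ n * u

  adjacency : ∀ {n} → Graph n → ℕ → ℕ
  adjacency G = matrix (λ u v → if adj G u v then 1 else 0)

  Encodes : ∀ {n} → Graph n → Store → Set
  Encodes {n} G s = (∀ i → s ADJ i ≡ adjacency G i) × Rows n s

  adj⇒edge : ∀ {n} (G : Graph n) s → Encodes G s → ∀ u v → Adj G u v → Edge s (toℕ u) (toℕ v)
  adj⇒edge {n} G s (a , r) u v e z with adj G u v | e | trans (sym (matrix-at (λ u v → if adj G u v then 1 else 0) u v))
      (trans (sym (trans (a _) (cong (λ x → adjacency G (x + toℕ v)) (r (toℕ u) (≤-trans (<⇒≤ (toℕ<n u)) (m≤m+n n k)))))) z)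
  ... | true | _ | ()

  edge⇒adj : ∀ {n} (G : Graph n) s → Encodes G s → ∀ u v → u < n → v < n → Edge s u v →
    Σ[ u′ ∈ Fin n ] Σ[ v′ ∈ Fin n ] (toℕ u′ ≡ u × toℕ v′ ≡ v × Adj G u′ v′)
  edge⇒adj {n} G s (a , r) u v lu lv e = u′ , v′ , eu , ev , is (adj G u′ v′) refl
    where
    u′ v′ : Fin n
    u′ = fromℕ< lu
    v′ = fromℕ< lv
    eu : toℕ u′ ≡ u
    eu = toℕ-fromℕ< lu
    ev : toℕ v′ ≡ v
    ev = toℕ-fromℕ< lv
    val : s ADJ (s ROW u + v) ≡ (if adj G u′ v′ then 1 else 0)
    val = trans (a _) (trans (cong (λ x → adjacency G (x + v)) (r u (≤-trans (<⇒≤ lu) (m≤m+n n k))))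
      (trans (sym (cong₂ (λ x y → adjacency G (n * x + y)) eu ev)) (matrix-at (λ u v → if adj G u v then 1 else 0) u′ v′)))
    is : ∀ c → adj G u′ v′ ≡ c → Adj G u′ v′
    is true  q = subst T (sym q) tt
    is false q = contradiction (trans val (cong (λ c → if c then 1 else 0) q)) e

  edge-symmetric : ∀ {n} (G : Graph n) s → Encodes G s → ∀ u v → u < n → v < n → Edge s u v → Edge s v u
  edge-symmetric G s enc u v lu lv e with edge⇒adj G s enc u v lu lv e
  ... | u′ , v′ , refl , refl , a = adj⇒edge G s enc v′ u′ (subst T (Graph.sym G u′ v′) a)

  abstract
    prepare-run : Σ[ K ∈ ℕ ] (∀ n (G : Graph n) (p : Profits k n) N → 1 ≤ n → TreewidthAtMost G ℓ →
      Run prepareP (input G p) (λ s → Rows n s × Rooted b (Edge s) n (s MM 0) (s BAG) (s PAR) (s HN) (s HS) × s NV 0 ≡ n × s MM 0 ≤ 1 + 2 * n × Fresh s ×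
        (∀ σ → N₃ ≤ σ → s AL σ ≡ 0)) K (stageSize n + fairSize n N))
    prepare-run = _ , λ n G p N 1≤n tw →
      let size : n ⊛ k ⊛ 0 ≤ stageSize n + fairSize n N
          size = ≤-trans (fair-pair n N) (m≤n+m _ (stageSize n))
          Y = (1 + 2 * n) ⊛ c₀
      in run-seq (run-size (≤-trans (+-size n k) size) (proj₂ row-run (input G p) n refl))
      (λ s₁ rows fr₁ → run-seq (proj₂ al-run s₁ _ (λ σ → fr₁ AL σ))
      (λ s₂ (nn , al) fr₂ →
        let enc : Encodes G s₂
            enc = (λ i → trans (fr₂ ADJ i) (fr₁ ADJ i)) , (λ u le → trans (fr₂ ROW u) (rows u le))
        in run-mono
          (λ s₃ (td , nv , m≤ , F) fr₃ → (λ u le → trans (fr₃ ROW u) (proj₂ enc u le)) ,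
              rooted-cong (edge-cong {s₂} {s₃} (fr₃ ADJ) (fr₃ ROW)) refl refl (λ _ → refl) (λ _ → refl) (λ _ → refl) (λ _ → refl) td , nv , m≤ , F ,
              λ σ le → trans (fr₃ AL σ) (proj₂ al σ le))
          (m≤m+n (stageSize n) _)
          (proj₂ stages-run s₂ n Y (trans (fr₂ 0 0) (fr₁ 0 0)) 1≤n (λ i → trans (fr₂ BAG i) (fr₁ BAG i)) (λ i → trans (fr₂ PAR i) (fr₁ PAR i))
            (λ i → trans (fr₂ HN i) (fr₁ HN i)) (λ i → trans (fr₂ HS i) (fr₁ HS i)) nn al
            (λ z _ → trans (fr₂ HEAP z) (fr₁ HEAP z)) (edge-symmetric G s₂ enc)
            (λ nv w nv≤n w≤ ∑≤ → split-exists G ℓ tw nv (Edge s₂) w nv≤n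
              (λ u v lu lv e → edge⇒adj G s₂ enc u v (≤-trans lu nv≤n) (≤-trans lv nv≤n) e) w≤ ∑≤)
            (stage-size₁ n) (stage-size₂ n) (⊛-mono {1 + 2 * n} {1 + 2 * n} {0} {c₀} ≤-refl z≤n))))

    tables-run : Σ[ K ∈ ℕ ] (∀ s n → (let B = suc (∑ (k * n) (s PROF))) → (let N = B ^ k) → s 0 0 ≡ n → Rows n s → (∀ σ → N₃ ≤ σ → s AL σ ≡ 0) →
      Run tablesP s (λ s′ → s′ NN 0 ≡ N × (∀ σ → σ < N → s′ AL σ ≡ 1) × (∀ σ → N ≤ σ → s′ AL σ ≡ 0) × (∀ σ → σ < N → s′ VAL σ ≡ minimum B k (digit B σ)) ×
        (∀ u → u < n → s′ WT (suc k * u + 0) ≡ 0 × (∀ j → j < k → s′ WT (suc k * u + suc j) ≡ s PROF (n * j + u) * B ^ j))) K (fairSize n N))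
    tables-run = _ , λ s n n≡ rows out →
      let T = ∑ (k * n) (s PROF)
          B = suc T
          N = B ^ k
          instance _ = m^n≢0 B k′
          B≤N : B ≤ N
          B≤N = m≤m*n B (B ^ k′)
      in run-seq (run-size (≤-trans (*-size n k) (fair-pair n N)) (proj₂ total-run s n n≡))
      (λ s₁ base fr₁ → run-assign-seq (run-seq
        (run-size (fair-inner n N (≤-trans (powers-size B≤N) (f₂≤f₃ N))) (proj₂ powers-run (update s₁ CNT 0 k) B k base refl))
      (λ s₂ pw fr₂ → run-seq (run-size (fair-inner n N (limits-size {N} {N} ≤-refl))
        (proj₂ limits-run s₂ N (λ σ le → trans (fr₂ AL σ) (trans (fr₁ AL σ) (out σ le))) (pw k ≤-refl)))
      (λ s₃ (nn , al₁ , al₀) fr₃ → run-seq (run-size (fair-inner n N (values-size {B} {N} B≤N))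
        (proj₂ val-run s₃ T N (trans (fr₃ BASE 0) (trans (fr₂ BASE 0) base)) (trans (fr₃ CNT 0) (fr₂ CNT 0)) (λ j lt → trans (fr₃ PWR j) (pw j (<⇒≤ lt))) nn refl))
      (λ s₄ val fr₄ →
        let e₄ : ∀ i → s₄ PROF i ≡ s PROF i
            e₄ i = trans (fr₄ PROF i) (trans (fr₃ PROF i) (trans (fr₂ PROF i) (fr₁ PROF i)))
        in run-mono
          (λ s₅ wt fr₅ → trans (fr₅ NN 0) (trans (fr₄ NN 0) nn) , (λ σ lt → trans (fr₅ AL σ) (trans (fr₄ AL σ) (al₁ σ lt))) , (λ σ le → trans (fr₅ AL σ) (trans (fr₄ AL σ) (al₀ σ le))) ,
             (λ σ lt → trans (fr₅ VAL σ) (val σ lt)) , (λ u lt → proj₁ (wt u lt) , λ j jl → trans (proj₂ (wt u lt) j jl) (cong (_* B ^ j) (e₄ _))))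
          (fair-outer n N (limits-size {B} {N} B≤N))
          (proj₂ weight-run s₄ n B (trans (fr₄ 0 0) (trans (fr₃ 0 0) (trans (fr₂ 0 0) (trans (fr₁ 0 0) n≡))))
            (λ j lt → trans (fr₄ ROW j) (trans (fr₃ ROW j) (trans (fr₂ ROW j) (trans (fr₁ ROW j) (rows j (≤-trans (<⇒≤ lt) (m≤n+m k n)))))))
            (λ j lt → trans (fr₄ PWR j) (trans (fr₃ PWR j) (pw j (<⇒≤ lt))))
            (λ j u jl ul → ≤-trans (≤-reflexive (e₄ _)) (≤-trans (∑-member (k * n) (s PROF) (n * j + u) (index< jl ul)) (n≤1+n T)))))))))

  module Optimum {n : ℕ} (G : Graph n) (p : Profits k n) (s : Store) (enc : Encodes G s) (nv≡ : s NV 0 ≡ n) (inp : Fair.Input s) where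

    T₀ B N : ℕ
    T₀ = ∑ (k * n) (matrix p)
    B  = suc T₀
    N  = B ^ k

    module _ (al₁ : ∀ σ → σ < N → s AL σ ≡ 1) (val : ∀ σ → σ < N → s VAL σ ≡ minimum B k (digit B σ))
      (wt : ∀ u → u < n → s WT (suc k * u + 0) ≡ 0 × (∀ j → j < k → s WT (suc k * u + suc j) ≡ profitTable p j u * B ^ j)) where

      value<B : ∀ X g j → j < k → value n (profitTable p) X g j < B
      value<B X g j lt = s≤s (≤-trans (value≤ n (profitTable p) X g j) (≤-trans
        (∑-member k (λ j → ∑ n (profitTable p j)) j lt) (≤-reflexive (sym (∑-flatten k n (matrix p))))))

      weight≡ : ∀ g → (∀ u → u < n → g u < suc k) → ∀ X → ∑ (s NV 0) (λ u → when (X u) (s WT (suc k * u + g u))) ≡ encode B k (value n (profitTable p) X g)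
      weight≡ g g< X = trans (cong (λ m → ∑ m (λ u → when (X u) (s WT (suc k * u + g u)))) nv≡)
        (trans (value-sum n k B (profitTable p) (s WT) (λ u lt → proj₁ (wt u lt)) (λ u j lt jl → proj₂ (wt u lt) j jl) g g< X)
          (sym (encode-sum B k (value n (profitTable p) X g))))

      weight< : ∀ X g → encode B k (value n (profitTable p) X g) < N
      weight< X g = encode< B k _ (λ j lt → value<B X g j lt)

      val≡ : ∀ g → (∀ u → u < n → g u < suc k) → s VAL (∑ (s NV 0) (λ u → s WT (suc k * u + g u))) ≡ minimum B k (value n (profitTable p) always g)
      val≡ g g< = trans (cong (s VAL) (weight≡ g g< always)) (trans (val _ (weight< always g))
        (minimum-cong B k (digit-encode B k (value n (profitTable p) always g) (λ j lt → value<B always g j lt))))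

      Proper : (ℕ → ℕ) → Set
      Proper g = ∀ u v → Adj G u v → ∀ l → g (toℕ u) ≡ suc l → g (toℕ v) ≢ suc l

      target : ∀ g → (∀ u → g u < suc k) → Proper g → Fair.Spec.Target s inp g
      target g g< proper = record
        { g< = g<
        ; proper = λ u v lu lv e → case edge⇒adj G s enc u v (subst (u <_) nv≡ lu) (subst (v <_) nv≡ lv) e of λ
            { (u′ , v′ , refl , refl , a) → clash (g (toℕ u′)) (g (toℕ v′)) (proper u′ v′ a) }
        ; allowed = λ X z → case trans (sym z) (trans (cong (s AL) (weight≡ g (λ u _ → g< u) X)) (al₁ _ (weight< X g))) of λ () }
        where
        clash : ∀ l l′ → (∀ m → l ≡ suc m → l′ ≢ suc m) → ¬ (confₖ l l′ ≢ 0)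
        clash zero    l′ f c = c refl
        clash (suc l) l′ f c = f l refl (sym (δ≢0⇒≡ c))

      solved-proper : ∀ {lab} → Fair.Solved s inp lab → Proper lab
      solved-proper {lab} sol u v a l eu ev = Fair.Solved.proper sol (toℕ u) (toℕ v) (subst (toℕ u <_) (sym nv≡) (toℕ<n u)) (subst (toℕ v <_) (sym nv≡) (toℕ<n v))
        (adj⇒edge G s enc u v a) (λ z → case trans (sym (δ-≡ {suc l} refl)) (trans (sym (cong₂ confₖ eu ev)) z) of λ ())

      optimal : ∀ {lab} → Fair.Solved s inp lab → (X : Fin k → _) → Represents lab X → IsOptimal G p X
      optimal {lab} sol X r = record
        { coloring = represented-coloring G X lab r (solved-proper sol)
        ; maximal = λ Y col → satisfaction-mono p B {lab} {coloring-label G Y col} {X} {Y} (λ j lt → <⇒≤ (value<B always (coloring-label G Y col) j lt)) r (coloring-represents G Y col)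
            (subst₂ _≤_ (val≡ (coloring-label G Y col) (λ u _ → coloring-label< G Y col u)) (val≡ lab lab<)
              (Fair.Solved.optimal sol (coloring-label G Y col) (target _ (coloring-label< G Y col) (coloring-proper G Y col)))) }
        where
        lab< : ∀ u → u < n → lab u < suc k
        lab< u lt = Fair.Solved.lab< sol u (subst (u <_) (sym nv≡) lt)

  output-represents : ∀ {n} s lab → (∀ j u → j < k → u < n → (lab u ≡ suc j → s OUT (n * j + u) ≡ 1) × (lab u ≢ suc j → s OUT (n * j + u) ≡ 0)) → Represents lab (output {k} {n} s)
  output-represents {n} s lab spec j v = trans (lookup∘tabulate _ v) (trans (cong (λ i → 0 <ᵇ s OUT i) (toℕ-combine j v)) cell)
    where
    cell : (0 <ᵇ s OUT (n * toℕ j + toℕ v)) ≡ (lab (toℕ v) ≡ᵇ suc (toℕ j))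
    cell with lab (toℕ v) ≟ suc (toℕ j)
    ... | yes e rewrite proj₁ (spec (toℕ j) (toℕ v) (toℕ<n j) (toℕ<n v)) e | ≡ᵇ-true e = refl
    ... | no ne rewrite proj₂ (spec (toℕ j) (toℕ v) (toℕ<n j) (toℕ<n v)) ne | ≢⇒≡ᵇ ne = refl

  totalBase : ∀ {n} → Profits k n → ℕ
  totalBase {n} p = suc (∑ (k * n) (matrix p))

  abstract
    body-run : Σ[ K ∈ ℕ ] (∀ n (G : Graph n) (p : Profits k n) → 1 ≤ n → TreewidthAtMost G ℓ →
      Run bodyP (input G p) (λ s → IsOptimal G p (output s)) K (stageSize n + fairSize n (totalBase p ^ k)))
    body-run = _ , λ n G p 1≤n tw →
      let B = totalBase p
          N = B ^ k
          fair≤ : fairSize n N ≤ stageSize n + fairSize n N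
          fair≤ = m≤n+m _ (stageSize n)
      in run-seq (proj₂ prepare-run n G p N 1≤n tw)
      (λ s₁ (rows , td , nv , m≤ , F , out) fr₁ →
        let prof≡ : ∑ (k * n) (s₁ PROF) ≡ ∑ (k * n) (matrix p)
            prof≡ = ∑-cong (k * n) (λ i _ → fr₁ PROF i)
        in run-seq (run-size fair≤ (subst (λ T → Run tablesP s₁ (λ s′ → s′ NN 0 ≡ suc T ^ k × (∀ σ → σ < suc T ^ k → s′ AL σ ≡ 1) × (∀ σ → suc T ^ k ≤ σ → s′ AL σ ≡ 0) ×
               (∀ σ → σ < suc T ^ k → s′ VAL σ ≡ minimum (suc T) k (digit (suc T) σ)) ×
               (∀ u → u < n → s′ WT (suc k * u + 0) ≡ 0 × (∀ j → j < k → s′ WT (suc k * u + suc j) ≡ s₁ PROF (n * j + u) * suc T ^ j))) (proj₁ tables-run) (fairSize n (suc T ^ k)))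
             prof≡ (proj₂ tables-run s₁ n (fr₁ 0 0) rows out)))
      (λ s₂ (nn , al₁ , al₀ , val , wt) fr₂ →
        let enc : Encodes G s₂
            enc = (λ i → trans (fr₂ ADJ i) (fr₁ ADJ i)) , (λ u le → trans (fr₂ ROW u) (rows u le))
            nv₂ : s₂ NV 0 ≡ n
            nv₂ = trans (fr₂ NV 0) nv
            inp : Fair.Input s₂
            inp = record
              { td = rooted-cong (edge-cong {s₁} {s₂} (fr₂ ADJ) (fr₂ ROW)) nv₂ (fr₂ MM 0) (fr₂ BAG) (fr₂ PAR) (fr₂ HN) (fr₂ HS) td
              ; al< = λ σ ne → ≤-trans (≰⇒> (λ le → ne (al₀ σ le))) (≤-reflexive (sym nn))
              ; fresh = fresh-frame {s₁} {s₂} (fr₂ FP) (fr₂ HEAP) F }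
            wt₂ : ∀ u → u < n → s₂ WT (suc k * u + 0) ≡ 0 × (∀ j → j < k → s₂ WT (suc k * u + suc j) ≡ profitTable p j u * B ^ j)
            wt₂ u lt = proj₁ (wt u lt) , λ j jl → trans (proj₂ (wt u lt) j jl) (cong (_* B ^ j) (fr₁ PROF _))
            open Optimum G p s₂ enc nv₂ inp using (target; optimal)
        in run-seq (proj₂ Fair.solve-run s₂ inp _
             (≤-trans (≤-reflexive (cong (λ m → m ⊛ suc k ⊛ 0) nv₂)) (≤-trans (fair-outer n N (labels-size N)) fair≤))
             (≤-trans (≤-reflexive (cong (λ m → s₂ MM 0 ⊛ m ⊛ m ⊛ 0) nn)) (≤-trans (solve-size n N (≤-trans (≤-reflexive (fr₂ MM 0)) m≤)) fair≤))
             ((λ _ → 0) , target al₁ val wt₂ (λ _ → 0) (λ _ → z<s) (λ _ _ _ _ ())))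
      (λ s₃ (sol , _) fr₃ → run-mono
        (λ s₄ o _ → optimal al₁ val wt₂ sol (output s₄) (output-represents {n} s₄ (s₃ LAB) o))
        (≤-trans (fair-outer n N {0} z≤n) fair≤)
        (proj₂ out-run s₃ n (trans (fr₃ 0 0) (trans (fr₂ 0 0) (fr₁ 0 0)))
          (λ j lt → trans (fr₃ ROW j) (proj₂ enc j (≤-trans (<⇒≤ lt) (m≤n+m k n))))
          (λ u lt → Fair.Solved.lab< sol u (subst (u <_) (sym nv₂) lt))
          (λ i → trans (fr₃ OUT i) (trans (fr₂ OUT i) (fr₁ OUT i)))))))

-- Running time

2*≥suc : ∀ {n} → 1 ≤ n → suc n ≤ 2 * n
2*≥suc {n} le = +-mono-≤ {1} {n} {n} {1 * n} le (m≤m+n n 0)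

4*≥ : ∀ {n} → 1 ≤ n → suc (1 + 2 * n) ≤ 4 * n
4*≥ {n} le = ≤-trans (+-monoˡ-≤ (2 * n) (*-monoʳ-≤ 2 le)) (≤-reflexive (sym (*-distribʳ-+ n 2 2)))

-- The three factors are at most `2n`, `4n` and `4n`, whence the constant 32. The term `n * (n * 1)`
-- is what `n ^ 2` unfolds to.
stage-bound : ∀ n c → 1 ≤ n → suc n * (suc (1 + 2 * n) * (suc (1 + 2 * n) * c)) ≤ 32 * c * (n * (n * 1) * n)
stage-bound n c le = ≤-trans (*-mono-≤ (2*≥suc le) (*-mono-≤ (4*≥ le) (*-monoˡ-≤ c (4*≥ le)))) (≤-reflexive (eq n c))
  where
  eq : ∀ n c → 2 * n * (4 * n * (4 * n * c)) ≡ 32 * c * (n * (n * 1) * n)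
  eq = solve-∀

-- The fair division is linear in `n`; a factor `n` is given away to fit the common factor `n ^ 2`.
fair-bound : ∀ n N a d → 1 ≤ n → 1 ≤ N → suc (1 + 2 * n) * (suc N * (a * (suc N * d))) ≤ 16 * a * d * (n * (n * 1) * (N * N))
fair-bound n N a d le le′ = ≤-trans (*-mono-≤ (4*≥ le) (*-mono-≤ (2*≥suc le′) (*-monoʳ-≤ a (*-monoˡ-≤ d (2*≥suc le′)))))
  (≤-trans (≤-reflexive (eq n N a d)) (*-monoʳ-≤ (16 * a * d) (*-monoˡ-≤ (N * N) (≤-trans (≤-reflexive (sym (*-identityʳ n))) (*-monoʳ-≤ n (≤-trans le (≤-reflexive (sym (*-identityʳ n)))))))))
  where
  eq : ∀ n N a d → 4 * n * (2 * N * (a * (2 * N * d))) ≡ 16 * a * d * (n * (N * N))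
  eq = solve-∀

[m*n]^o : ∀ m n o → (m * n) ^ o ≡ m ^ o * n ^ o
[m*n]^o m n zero    = refl
[m*n]^o m n (suc o) = trans (cong (m * n *_) ([m*n]^o m n o)) (eq m n (m ^ o) (n ^ o))
  where
  eq : ∀ a b c d → a * b * (c * d) ≡ a * c * (b * d)
  eq = solve-∀

square : ∀ B k → B ^ k * B ^ k ≡ B ^ (2 * k)
square B k = trans (sym (^-distribˡ-+-* B k k)) (cong (λ x → B ^ (k + x)) (sym (+-identityʳ k)))

-- Raised to the power `2 * k`, the factor `suc k` depends on `k` only and goes into the hidden
-- constant.
base-bound : ∀ T k Q → T ≤ k * Q → suc T ≤ suc k * (Q + 1)
base-bound T k Q le = ≤-trans (s≤s le) (≤-trans (+-mono-≤ {1} {Q + 1} {k * Q} {k * (Q + 1)} (m≤n+m 1 Q) (*-monoʳ-≤ k (m≤m+n Q 1))) ≤-refl)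

combine-bounds : ∀ K x y a b c u v w → x ≤ a * (u * v) → y ≤ b * (u * (c * w)) → K * (x + y) ≤ K * (a + b * c) * (u * (v + w))
combine-bounds K x y a b c u v w p q = ≤-trans (*-monoʳ-≤ K (≤-trans (+-mono-≤ p q) (≤-trans
  (+-mono-≤ (*-monoʳ-≤ a (*-monoʳ-≤ u (m≤m+n v w))) (≤-trans (≤-reflexive (eq b u c w)) (*-monoʳ-≤ (b * c) (*-monoʳ-≤ u (m≤n+m w v)))))
  (≤-reflexive (sym (*-distribʳ-+ (u * (v + w)) a (b * c))))))) (≤-reflexive (sym (*-assoc K (a + b * c) (u * (v + w)))))
  where
  eq : ∀ b u c w → b * (u * (c * w)) ≡ b * c * (u * w)
  eq = solve-∀

theorem8 : ∀ (k ℓ : ℕ) .{{_ : NonZero k}} .{{_ : NonZero ℓ}} →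
    Σ[ c ∈ Program ] Σ[ K ∈ ℕ ]
    (∀ (n : ℕ) (G : Graph n) (p : Profits k n) → TreewidthAtMost G ℓ →
    Σ[ s ∈ Store ] Σ[ t ∈ ℕ ]
    ( ⟨ c , input G p ⟩⇓⟨ s , t ⟩
    × IsOptimal G p (output s)
    × (n ≥ 1 → t ≤ K * (n ^ 2 * (n + (maxTotalProfit p + 1) ^ (2 * k))))))
theorem8 (suc k′) ℓ = mainP , K₁ * (A₁ + A₂ * suc k ^ (2 * k)) , solution
  where
  open Main k′ ℓ
  K₁ A₁ A₂ : ℕ
  K₁ = 1 + cost (V 0) + (proj₁ body-run + 1)
  A₁ = 32 * suc c₀
  A₂ = 16 * suc k * (suc (suc k) * 1)
  solution : ∀ n (G : Graph n) (p : Profits k n) → TreewidthAtMost G ℓ → Σ[ s ∈ Store ] Σ[ t ∈ ℕ ]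
    (⟨ mainP , input G p ⟩⇓⟨ s , t ⟩ × IsOptimal G p (output s) ×
     (n ≥ 1 → t ≤ K₁ * (A₁ + A₂ * suc k ^ (2 * k)) * (n ^ 2 * (n + (maxTotalProfit p + 1) ^ (2 * k)))))
  solution zero G p tw = input G p , _ , if-zero refl skip , record
    { coloring = record { independent = λ _ () ; disjoint = λ { _ _ _ (() , _) } }
    ; maximal = λ Y _ → ≤-trans (satisfaction≤ p Y zero) z≤n } , λ ()
  solution n@(suc _) G p tw = final , steps , exec , post , λ _ → ≤-trans bound (≤-trans (*-monoʳ-≤ K₁ (s≤s (+-monoʳ-≤ (stageSize n) (n≤1+n (fairSize n N))))) bounded)
    where
    N : ℕ
    N = totalBase p ^ k
    Q : ℕ
    Q = maxTotalProfit p
    r : Run mainP (input G p) (λ s → IsOptimal G p (output s)) K₁ (stageSize n + fairSize n N)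
    r = run-if (λ _ → proj₂ body-run n G p (s≤s z≤n) tw) (λ ())
    open Run r
    bounded : K₁ * (suc (stageSize n) + suc (fairSize n N)) ≤ K₁ * (A₁ + A₂ * suc k ^ (2 * k)) * (n ^ 2 * (n + (Q + 1) ^ (2 * k)))
    -- The successor of an iterated `⊛` unfolds to a plain product, which is the left side of the
    -- two bounds applied here.
    bounded = combine-bounds K₁ (suc (stageSize n)) (suc (fairSize n N)) A₁ A₂ (suc k ^ (2 * k)) (n ^ 2) n ((Q + 1) ^ (2 * k))
      (stage-bound n (suc c₀) (s≤s z≤n))
      (≤-trans (fair-bound n N (suc k) (suc (suc k) * 1) (s≤s z≤n) (m^n>0 (totalBase p) k))
        (*-monoʳ-≤ A₂ (*-monoʳ-≤ (n ^ 2) (≤-trans (≤-reflexive (square (totalBase p) k))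
          (≤-trans (^-monoˡ-≤ (2 * k) (base-bound _ k Q (total≤ p))) (≤-reflexive ([m*n]^o (suc k) (Q + 1) (2 * k))))))))
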